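{- Let $\mathbf{S}_0$ be the $2$-adic Banach space of $2^{ -1/2}$-overconvergent cuspidal $2$-adic modular forms of weight $0$ and tame level $1$ over $\mathbf{Q}_2$, with its compact operator $U=U_2$. Then the ($2$-adic) Newton polygon of the characteristic power series $\det(1-XU)$ of $U$ on $\mathbf{S}_0$ is the ($2$-adic) Newton polygon of $$1+\sum_{n=1}^{\infty}X^n\prod_{j=1}^{n}\frac{2^{2j}\,(12j+2)!\,(6j)!}{(8j+2)!\,(8j-2)!\,(-12j)}.$$
   Context: Let $\Delta(\tau)=q\prod_{n\ge1}(1-q^n)^{24}$, $q=e^{2\pi i\tau}$, $f(\tau)=\Delta(2\tau)/\Delta(\tau)=q+24q^2+\cdots$ and $g=2^6f$. The space $\mathbf{M}_0$ of $2^{ -1/2}$-overconvergent $2$-adic modular forms of weight $0$ and tame level $1$ is the Banach space (with supremum norm) of rigid analytic functions over $\mathbf{Q}_2$ on the affinoid $X_0(1)_{\ge 2^{ -1/2}}$ of the level one modular curve obtained by removing the open disc of radius $2^{ -1/2}$ (in the sense of a suitable local parameter after adding auxiliary level structure) over the supersingular point. Concretely this affinoid is the region $\{|j|\ge 2^{ -6}\}$ of the $j$-line, and it is identified (preserving $q$-expansions) with the region $\{|g|\le 1\}$ of $X_0(2)$; thus $\mathbf{M}_0$ is the space of series $\sum_{n\ge0}a_ng^n$ with $a_n\in\mathbf{Q}_2$, $a_n\to0$, with norm $\max_n|a_n|$. The subspace $\mathbf{S}_0=\mathbf{S}_0(\mathrm{SL}_2(\mathbf{Z});\mathbf{Q}_2;2^{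 -1/2})$ consists of the elements whose $q$-expansion has zero constant term, i.e. the series $\sum_{n\ge1}a_ng^n$ with $a_n\to 0$. The operator $U$ acts on $q$-expansions by $U(\sum a_nq^n)=\sum a_{2n}q^n$; it is a compact operator on $\mathbf{M}_0$ preserving $\mathbf{S}_0$, and $\det(1-XU)\in\mathbf{Q}_2[[X]]$ denotes its characteristic (Fredholm) power series in the sense of Serre. The Newton polygon of a power series $1+\sum_{n\ge1} c_nX^n$ is the lower convex hull of the points $(0,0)$ and $(n,v_2(c_n))$, where $v_2$ is the $2$-adic valuation with $v_2(2)=1$. -}

module Defs where

open import Algebra.Bundles using (RawRing; CommutativeRing)
open import Algebra.Module.Bundles using (LeftModule)
open import Algebra.Module.Morphism.Structures using (module LeftModuleMorphisms)
import Algebra.Definitions.RawMonoid as RawMonoidOps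
import Algebra.Definitions.RawSemiring as RawSemiringOps
import Algebra.Module.Construct.TensorUnit as TensorUnit
import Algebra.Properties.AbelianGroup as AbelianGroupProperties
import Algebra.Properties.CommutativeSemigroup as CommutativeSemigroupProperties
import Algebra.Properties.Ring as RingProperties
open import Data.Bool.Base using (true; false; if_then_else_)
open import Data.Fin.Base using (Fin; zero; suc; toℕ; fromℕ; inject₁; punchIn)
import Data.Fin.Properties as Fin
open import Data.Integer.Base as ℤ using (ℤ; +_; -[1+_]; 0ℤ; 1ℤ)
import Data.Integer.Properties as ℤ
import Data.Integer.Solver as ℤ-Solver
open import Data.Nat.Base as ℕ using (ℕ; zero; suc; _≤_; _<_; z≤n; s≤s; _∸_; _⊔_; _!)
open import Data.Nat.DivMod using (_/_)
open import Data.Nat.Divisibility using (_∣?_)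
open import Data.Nat.Induction using (<-rec)
import Data.Nat.Properties as ℕ
open import Data.Product.Base using (∃; ∃₂; _×_; _,_; proj₁; proj₂)
open import Data.Rational.Base as ℚ using (ℚ; 0ℚ; 1ℚ; ½)
open import Data.Rational.Literals using (fromℤ)
import Data.Rational.Properties as ℚ
import Data.Rational.Solver as ℚ-Solver
import Data.Rational.Unnormalised.Base as ℚᵘ
import Data.Rational.Unnormalised.Properties as ℚᵘ
open import Data.Sum.Base using (_⊎_; inj₁; inj₂)
open import Data.Vec.Functional using (Vector; _∷_)
open import Function.Base using (_∘_)
open import Function.Bundles using (_⇔_)
open import Level using (0ℓ)
open import Relation.Binary.PropositionalEquality as ≡ using (_≡_; _≢_)
open import Relation.Binary.Structures using (IsEquivalence)
open import Relation.Nullary.Decidable.Core using (does)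
open import Relation.Nullary.Decidable using (dec-true; dec-false)
open import Relation.Nullary.Negation.Core using (¬_; contradiction)

-- Only the relation k ≤ v(x) is recorded: v(x) itself cannot be computed,
-- since vanishing is undecidable in the completions formed below.
record ValuedRing : Set₁ where
  field
    commutativeRing : CommutativeRing 0ℓ 0ℓ

  open CommutativeRing commutativeRing public
  infix 4 _≤v_

  field
    _≤v_    : ℤ → Carrier → Set
    v-resp  : ∀ {k x y} → x ≈ y → k ≤v x → k ≤v y
    v-0     : ∀ k → k ≤v 0#
    v-1     : 0ℤ ≤v 1#
    v-+     : ∀ {k x y} → k ≤v x → k ≤v y → k ≤v x + y
    v-neg   : ∀ {k x} → k ≤v x → k ≤v - x
    v-*     : ∀ {k l x y} → k ≤v x → l ≤v y → k ℤ.+ l ≤v x * y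
    v-mono  : ∀ {k l x} → k ℤ.≤ l → l ≤v x → k ≤v x
    v-bound : ∀ x → ∃ λ B → ℤ.- + B ≤v x

  open RawMonoidOps +-rawMonoid public using (sum)
  private
    open module G = AbelianGroupProperties +-abelianGroup using (⁻¹-∙-comm; ⁻¹-involutive)
    open module R = RingProperties ring using (-‿distribˡ-*; -‿distribʳ-*)
    open module S = CommutativeSemigroupProperties +-commutativeSemigroup using (interchange)

  -- x ≡ y mod 2ᵏ
  Close : ℤ → Carrier → Carrier → Set
  Close k x y = k ≤v x - y

  Close-≈ : ∀ {k x y} → x ≈ y → Close k x y
  Close-≈ {k} {x} {y} e = v-resp (trans (sym (-‿inverseʳ y)) (+-congʳ (sym e))) (v-0 k)

  Close-refl : ∀ {k} x → Close k x x
  Close-refl x = Close-≈ refl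

  Close-sym : ∀ {k x y} → Close k x y → Close k y x
  Close-sym {k} {x} {y} c = v-resp (trans (sym (⁻¹-∙-comm x (- y)))
    (trans (+-congˡ (⁻¹-involutive y)) (+-comm (- x) y))) (v-neg c)

  telescope : ∀ x y z → (x - y) + (y - z) ≈ x - z
  telescope x y z = trans (+-assoc x (- y) (y - z)) (+-congˡ
    (trans (sym (+-assoc (- y) y (- z))) (trans (+-congʳ (-‿inverseˡ y)) (+-identityˡ (- z)))))

  Close-trans : ∀ {k x y z} → Close k x y → Close k y z → Close k x z
  Close-trans {k} {x} {y} {z} c d = v-resp (telescope x y z) (v-+ c d)

  Close-+ : ∀ {k x x′ y y′} → Close k x x′ → Close k y y′ → Close k (x + y) (x′ + y′)
  Close-+ {k} {x} {x′} {y} {y′} c d = v-resp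
    (trans (interchange x (- x′) y (- y′)) (+-congˡ (⁻¹-∙-comm x′ y′))) (v-+ c d)

  Close-neg : ∀ {k x x′} → Close k x x′ → Close k (- x) (- x′)
  Close-neg {k} {x} {x′} c = v-resp (sym (⁻¹-∙-comm x (- x′))) (v-neg c)

  Close-* : ∀ {k i j i′ j′ x x′ y y′} → Close i x x′ → j ≤v y → i ℤ.+ j ≡ k →
            i′ ≤v x′ → Close j′ y y′ → i′ ℤ.+ j′ ≡ k → Close k (x * y) (x′ * y′)
  Close-* {x = x} {x′} {y} {y′} c w ≡.refl w′ d eq = v-resp
    (trans (+-cong
      (trans (distribʳ y x (- x′)) (+-congˡ (sym (-‿distribˡ-* x′ y))))
      (trans (distribˡ x′ y (- y′)) (+-congˡ (sym (-‿distribʳ-* x′ y′)))))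
      (telescope (x * y) (x′ * y) (x′ * y′)))
    (v-+ (v-* c w) (≡.subst (_≤v x′ * (y - y′)) eq (v-* w′ d)))

  Close-0 : ∀ {k x} → k ≤v x → Close k x 0#
  Close-0 {k} {x} = v-resp (trans (sym (+-identityʳ x)) (+-congˡ (sym (trans (sym (+-identityˡ (- 0#))) (-‿inverseʳ 0#)))))

  v-close : ∀ {k x y} → Close k x y → k ≤v y → k ≤v x
  v-close {k} {x} {y} c w = v-resp
    (trans (+-assoc x (- y) y) (trans (+-congˡ (-‿inverseˡ y)) (+-identityʳ x))) (v-+ c w)

  Close-mono : ∀ {k l x y} → k ℤ.≤ l → Close l x y → Close k x y
  Close-mono = v-mono

  IsCauchy : (ℕ → Carrier) → Set
  IsCauchy z = ∀ k → ∃ λ N → ∀ m → N ≤ m → Close (+ k) (z m) (z N)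

  infix 4 _⟶_

  _⟶_ : (ℕ → Carrier) → Carrier → Set
  z ⟶ x = ∀ k → ∃ λ N → ∀ m → N ≤ m → Close (+ k) (z m) x

  IsComplete : Set
  IsComplete = ∀ z → IsCauchy z → ∃ λ x → z ⟶ x

-B≤0 : ∀ B → ℤ.- + B ℤ.≤ 0ℤ
-B≤0 B = ℤ.neg-mono-≤ {0ℤ} {+ B} (ℤ.+≤+ z≤n)

i≤+∣i∣ : ∀ i → i ℤ.≤ + ℤ.∣ i ∣
i≤+∣i∣ (+ n)    = ℤ.≤-refl
i≤+∣i∣ -[1+ n ] = ℤ.-≤+

shiftʳ : ∀ k B → + (k ℕ.+ B) ℤ.+ ℤ.- + B ≡ + k
shiftʳ k B = ≡.trans (ℤ.+-assoc (+ k) (+ B) (ℤ.- + B))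
  (≡.trans (≡.cong (λ z → + k ℤ.+ z) (ℤ.+-inverseʳ (+ B))) (ℤ.+-identityʳ (+ k)))

shiftˡ : ∀ k B → ℤ.- + B ℤ.+ + (k ℕ.+ B) ≡ + k
shiftˡ k B = ≡.trans (ℤ.+-comm (ℤ.- + B) (+ (k ℕ.+ B))) (shiftʳ k B)

≤⊔ˡ : ∀ {m} N N′ → N ⊔ N′ ≤ m → N ≤ m
≤⊔ˡ N N′ = ℕ.≤-trans (ℕ.m≤m⊔n N N′)

≤⊔ʳ : ∀ {m} N N′ → N ⊔ N′ ≤ m → N′ ≤ m
≤⊔ʳ N N′ = ℕ.≤-trans (ℕ.m≤n⊔m N N′)

module Completion (R : ValuedRing) where

  open ValuedRing R

  record Completed : Set where
    no-eta-equality
    constructor mkCompleted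
    field
      seq    : ℕ → Carrier
      cauchy : IsCauchy seq

  open Completed public

  cauchy₂ : ∀ x k → ∃ λ N → ∀ m n → N ≤ m → N ≤ n → Close (+ k) (seq x m) (seq x n)
  cauchy₂ x k = let N , c = cauchy x k in
    N , λ m n N≤m N≤n → Close-trans (c m N≤m) (Close-sym (c n N≤n))

  infix 4 _≤v^_ _≈^_

  _≤v^_ : ℤ → Completed → Set
  k ≤v^ x = ∃ λ N → ∀ m → N ≤ m → k ≤v seq x m

  record _≈^_ (x y : Completed) : Set where
    constructor mk≈
    field
      close : ∀ k → ∃ λ N → ∀ m → N ≤ m → Close (+ k) (seq x m) (seq y m)

  open _≈^_ public

  v-bound^ : ∀ x → ∃ λ B → ℤ.- + B ≤v^ x
  v-bound^ x = let N , c = cauchy x 0 ; B , b = v-bound (seq x N) in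
    B , N , λ m N≤m → v-close (v-mono (-B≤0 B) (c m N≤m)) b

  infixl 6 _+^_
  infixl 7 _*^_
  infix  8 -^_

  const : Carrier → Completed
  seq    (const x) _ = x
  cauchy (const x) k = 0 , λ _ _ → Close-refl x

  _+^_ : Completed → Completed → Completed
  seq    (x +^ y) n = seq x n + seq y n
  cauchy (x +^ y) k = let N , c = cauchy₂ x k ; N′ , c′ = cauchy₂ y k ; M = N ⊔ N′ in
    M , λ m M≤m → Close-+ (c m M (≤⊔ˡ N N′ M≤m) (ℕ.m≤m⊔n N N′))
                          (c′ m M (≤⊔ʳ N N′ M≤m) (ℕ.m≤n⊔m N N′))

  -^_ : Completed → Completed
  seq    (-^ x) n = - seq x n
  cauchy (-^ x) k = let N , c = cauchy x k in N , λ m N≤m → Close-neg (c m N≤m)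

  _*^_ : Completed → Completed → Completed
  seq    (x *^ y) n = seq x n * seq y n
  cauchy (x *^ y) k =
    let B  , N₁ , b  = v-bound^ x
        B′ , N₂ , b′ = v-bound^ y
        N₃ , c  = cauchy₂ x (k ℕ.+ B′)
        N₄ , c′ = cauchy₂ y (k ℕ.+ B)
        N = (N₁ ⊔ N₂) ⊔ (N₃ ⊔ N₄)
        below : ∀ {m} → N ≤ m → (N₁ ≤ m × N₂ ≤ m) × (N₃ ≤ m × N₄ ≤ m)
        below N≤m = let l = ≤⊔ˡ (N₁ ⊔ N₂) (N₃ ⊔ N₄) N≤m ; r = ≤⊔ʳ (N₁ ⊔ N₂) (N₃ ⊔ N₄) N≤m in
          (≤⊔ˡ N₁ N₂ l , ≤⊔ʳ N₁ N₂ l) , (≤⊔ˡ N₃ N₄ r , ≤⊔ʳ N₃ N₄ r)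
        (N₁≤N , _) , (N₃≤N , N₄≤N) = below ℕ.≤-refl
    in N , λ m N≤m → let (_ , N₂≤m) , (N₃≤m , N₄≤m) = below N≤m in
      Close-* (c m N N₃≤m N₃≤N) (b′ m N₂≤m) (shiftʳ k B′)
              (b N N₁≤N) (c′ m N N₄≤m N₄≤N) (shiftˡ k B)

  ≈⇒≈^ : ∀ {x y} → (∀ n → seq x n ≈ seq y n) → x ≈^ y
  ≈⇒≈^ e = mk≈ λ k → 0 , λ m _ → Close-≈ (e m)

  ≈^-isEquivalence : IsEquivalence _≈^_
  ≈^-isEquivalence = record
    { refl  = ≈⇒≈^ λ _ → refl
    ; sym   = λ e → mk≈ λ k → let N , c = close e k in N , λ m N≤m → Close-sym (c m N≤m)
    ; trans = λ e e′ → mk≈ λ k → let N , c = close e k ; N′ , c′ = close e′ k in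
        N ⊔ N′ , λ m M≤m → Close-trans (c m (≤⊔ˡ N N′ M≤m)) (c′ m (≤⊔ʳ N N′ M≤m))
    }

  +^-cong : ∀ {x x′ y y′} → x ≈^ x′ → y ≈^ y′ → x +^ y ≈^ x′ +^ y′
  +^-cong e e′ = mk≈ λ k → let N , c = close e k ; N′ , c′ = close e′ k in
    N ⊔ N′ , λ m M≤m → Close-+ (c m (≤⊔ˡ N N′ M≤m)) (c′ m (≤⊔ʳ N N′ M≤m))

  -^-cong : ∀ {x x′} → x ≈^ x′ → -^ x ≈^ -^ x′
  -^-cong e = mk≈ λ k → let N , c = close e k in N , λ m N≤m → Close-neg (c m N≤m)

  *^-cong : ∀ {x x′ y y′} → x ≈^ x′ → y ≈^ y′ → x *^ y ≈^ x′ *^ y′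
  *^-cong {x} {x′} {y} {y′} e e′ = mk≈ λ k →
    let B  , N₁ , b  = v-bound^ x′
        B′ , N₂ , b′ = v-bound^ y
        N₃ , c  = close e (k ℕ.+ B′)
        N₄ , c′ = close e′ (k ℕ.+ B)
    in (N₁ ⊔ N₂) ⊔ (N₃ ⊔ N₄) , λ m M≤m →
      let l = ≤⊔ˡ (N₁ ⊔ N₂) (N₃ ⊔ N₄) M≤m ; r = ≤⊔ʳ (N₁ ⊔ N₂) (N₃ ⊔ N₄) M≤m in
      Close-* (c m (≤⊔ˡ N₃ N₄ r)) (b′ m (≤⊔ʳ N₁ N₂ l)) (shiftʳ k B′)
              (b m (≤⊔ˡ N₁ N₂ l)) (c′ m (≤⊔ʳ N₃ N₄ r)) (shiftˡ k B)

  completion-commutativeRing : CommutativeRing 0ℓ 0ℓ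
  completion-commutativeRing = record
    { Carrier = Completed ; _≈_ = _≈^_ ; _+_ = _+^_ ; _*_ = _*^_ ; -_ = -^_
    ; 0# = const 0# ; 1# = const 1#
    ; isCommutativeRing = record
      { isRing = record
        { +-isAbelianGroup = record
          { isGroup = record
            { isMonoid = record
              { isSemigroup = record
                { isMagma = record { isEquivalence = ≈^-isEquivalence ; ∙-cong = +^-cong }
                ; assoc   = λ x y z → ≈⇒≈^ λ n → +-assoc (seq x n) (seq y n) (seq z n)
                }
              ; identity = (λ x → ≈⇒≈^ λ n → +-identityˡ (seq x n))
                         , (λ x → ≈⇒≈^ λ n → +-identityʳ (seq x n))
              }
            ; inverse = (λ x → ≈⇒≈^ λ n → -‿inverseˡ (seq x n))
                      , (λ x → ≈⇒≈^ λ n → -‿inverseʳ (seq x n))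
            ; ⁻¹-cong = -^-cong
            }
          ; comm = λ x y → ≈⇒≈^ λ n → +-comm (seq x n) (seq y n)
          }
        ; *-cong     = *^-cong
        ; *-assoc    = λ x y z → ≈⇒≈^ λ n → *-assoc (seq x n) (seq y n) (seq z n)
        ; *-identity = (λ x → ≈⇒≈^ λ n → *-identityˡ (seq x n))
                     , (λ x → ≈⇒≈^ λ n → *-identityʳ (seq x n))
        ; distrib    = (λ x y z → ≈⇒≈^ λ n → distribˡ (seq x n) (seq y n) (seq z n))
                     , (λ x y z → ≈⇒≈^ λ n → distribʳ (seq x n) (seq y n) (seq z n))
        }
      ; *-comm = λ x y → ≈⇒≈^ λ n → *-comm (seq x n) (seq y n)
      }
    }

  completion : ValuedRing
  completion = record
    { commutativeRing = completion-commutativeRing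
    ; _≤v_    = _≤v^_
    ; v-resp  = λ {k} e (N , w) → let N′ , c = close e ℤ.∣ k ∣ in
        N ⊔ N′ , λ m M≤m → v-close (v-mono (i≤+∣i∣ k) (Close-sym (c m (≤⊔ʳ N N′ M≤m)))) (w m (≤⊔ˡ N N′ M≤m))
    ; v-0     = λ k → 0 , λ _ _ → v-0 k
    ; v-1     = 0 , λ _ _ → v-1
    ; v-+     = λ (N , w) (N′ , w′) → N ⊔ N′ , λ m M≤m → v-+ (w m (≤⊔ˡ N N′ M≤m)) (w′ m (≤⊔ʳ N N′ M≤m))
    ; v-neg   = λ (N , w) → N , λ m N≤m → v-neg (w m N≤m)
    ; v-*     = λ (N , w) (N′ , w′) → N ⊔ N′ , λ m M≤m → v-* (w m (≤⊔ˡ N N′ M≤m)) (w′ m (≤⊔ʳ N N′ M≤m))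
    ; v-mono  = λ k≤l (N , w) → N , λ m N≤m → v-mono k≤l (w m N≤m)
    ; v-bound = v-bound^
    }

  module C = ValuedRing completion

  completion-complete : C.IsComplete
  completion-complete z z-cauchy = lim , λ k → idx k , λ m k≤m →
    C.Close-trans {+ k} {z m} {const (approx k)} {lim}
      (C.Close-trans {+ k} {z m} {z (idx k)} {const (approx k)} (proj₂ (z-cauchy k) m k≤m) (approx-close k))
      (C.Close-sym {+ k} {lim} {const (approx k)} (k , λ m k≤m → approx-cauchy k m k≤m))
    where
    idx : ℕ → ℕ
    idx k = proj₁ (z-cauchy k)

    approx : ℕ → Carrier
    approx k = seq (z (idx k)) (proj₁ (cauchy (z (idx k)) k))

    approx-close : ∀ k → C.Close (+ k) (z (idx k)) (const (approx k))
    approx-close k = let N , c = cauchy (z (idx k)) k in N , c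

    approx-cauchy : ∀ k l → k ≤ l → Close (+ k) (approx l) (approx k)
    approx-cauchy k l k≤l = let
        M = idx l ⊔ idx k
        N , c = C.Close-trans {+ k} {const (approx l)} {z M} {const (approx k)}
          (C.Close-mono {+ k} {+ l} {const (approx l)} {z M} (ℤ.+≤+ k≤l)
            (C.Close-sym {+ l} {z M} {const (approx l)}
              (C.Close-trans {+ l} {z M} {z (idx l)} {const (approx l)}
                (proj₂ (z-cauchy l) M (ℕ.m≤m⊔n (idx l) (idx k))) (approx-close l))))
          (C.Close-trans {+ k} {z M} {z (idx k)} {const (approx k)}
            (proj₂ (z-cauchy k) M (ℕ.m≤n⊔m (idx l) (idx k))) (approx-close k))
      in c N ℕ.≤-refl

    lim : Completed
    seq    lim = approx
    cauchy lim k = k , λ l k≤l → approx-cauchy k l k≤l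

module ℚ-Valuation where

  open ≡ using (refl; sym; trans; cong; cong₂; subst; subst₂; module ≡-Reasoning)
  open ℚ-Solver.+-*-Solver using (solve; _:+_; _:*_; :-_; _:=_; con)

  module ℚ^ = RawSemiringOps ℚ.+-*-rawSemiring

  2^ : ℤ → ℚ
  2^ (+ n)    = fromℤ (+ 2) ℚ^.^ n
  2^ -[1+ n ] = ½ ℚ^.^ suc n

  odd : ℤ → ℤ
  odd c = 1ℤ ℤ.+ + 2 ℤ.* c

  infix 4 _≤vℚ_

  -- k ≤ v₂(q), that is, q ∈ 2ᵏ ℤ₍₂₎.
  record _≤vℚ_ (k : ℤ) (q : ℚ) : Set where
    constructor mk≤vℚ
    field
      a c : ℤ
      eq  : q ℚ.* fromℤ (odd c) ≡ 2^ k ℚ.* fromℤ a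

  fromℤ-/1 : ∀ z → z ℚ./ 1 ≡ fromℤ z
  fromℤ-/1 z = ℚ.↥p/↧p≡p (fromℤ z)

  fromℤ-+ : ∀ a b → fromℤ (a ℤ.+ b) ≡ fromℤ a ℚ.+ fromℤ b
  fromℤ-+ a b = trans (sym (fromℤ-/1 (a ℤ.+ b)))
    (cong (ℚ._/ 1) (sym (cong₂ ℤ._+_ (ℤ.*-identityʳ a) (ℤ.*-identityʳ b))))

  fromℤ-* : ∀ a b → fromℤ (a ℤ.* b) ≡ fromℤ a ℚ.* fromℤ b
  fromℤ-* a b = sym (fromℤ-/1 (a ℤ.* b))

  2^-suc : ∀ k → 2^ (ℤ.suc k) ≡ fromℤ (+ 2) ℚ.* 2^ k
  2^-suc (+ n)        = refl
  2^-suc -[1+ zero ]  = refl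
  2^-suc -[1+ suc n ] = begin
    x                                  ≡⟨ ℚ.*-identityˡ x ⟨
    1ℚ ℚ.* x                           ≡⟨⟩
    (fromℤ (+ 2) ℚ.* ½) ℚ.* x          ≡⟨ ℚ.*-assoc (fromℤ (+ 2)) ½ x ⟩
    fromℤ (+ 2) ℚ.* (½ ℚ.* x)          ∎
    where
    open ≡-Reasoning
    x = ½ ℚ^.^ suc n

  fromℤ-2^ : ∀ n → 2^ (+ n) ≡ fromℤ ((+ 2) ℤ.^ n)
  fromℤ-2^ zero    = refl
  fromℤ-2^ (suc n) = trans (cong (fromℤ (+ 2) ℚ.*_) (fromℤ-2^ n)) (sym (fromℤ-* (+ 2) ((+ 2) ℤ.^ n)))

  ℤ-cancel : ∀ i j → i ℤ.- j ℤ.+ j ≡ i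
  ℤ-cancel = solveℤ 2 (λ i j → i ⊖ j ⊕ j ⊜ i) refl
    where
    open ℤ-Solver.+-*-Solver renaming (solve to solveℤ; _:+_ to _⊕_; _:-_ to _⊖_; _:=_ to _⊜_)

  2^-pred : ∀ k → 2^ (ℤ.pred k) ≡ ½ ℚ.* 2^ k
  2^-pred k = begin
    2^ (ℤ.pred k)                              ≡⟨ ℚ.*-identityˡ _ ⟨
    1ℚ ℚ.* 2^ (ℤ.pred k)                       ≡⟨ ℚ.*-assoc ½ (fromℤ (+ 2)) (2^ (ℤ.pred k)) ⟩
    ½ ℚ.* (fromℤ (+ 2) ℚ.* 2^ (ℤ.pred k))      ≡⟨ cong (½ ℚ.*_) (2^-suc (ℤ.pred k)) ⟨
    ½ ℚ.* 2^ (ℤ.suc (ℤ.pred k))                ≡⟨ cong (λ z → ½ ℚ.* 2^ z) (ℤ.suc-pred k) ⟩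
    ½ ℚ.* 2^ k                                 ∎
    where open ≡-Reasoning

  2^-+ : ∀ i j → 2^ (i ℤ.+ j) ≡ 2^ i ℚ.* 2^ j
  2^-+ (+ zero)        j = trans (cong 2^ (ℤ.+-identityˡ j)) (sym (ℚ.*-identityˡ (2^ j)))
  2^-+ (+ suc n)       j = begin
    2^ (+ suc n ℤ.+ j)                       ≡⟨ cong 2^ (ℤ.+-assoc 1ℤ (+ n) j) ⟩
    2^ (ℤ.suc (+ n ℤ.+ j))                   ≡⟨ 2^-suc (+ n ℤ.+ j) ⟩
    fromℤ (+ 2) ℚ.* 2^ (+ n ℤ.+ j)           ≡⟨ cong (fromℤ (+ 2) ℚ.*_) (2^-+ (+ n) j) ⟩
    fromℤ (+ 2) ℚ.* (2^ (+ n) ℚ.* 2^ j)      ≡⟨ ℚ.*-assoc (fromℤ (+ 2)) (2^ (+ n)) (2^ j) ⟨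
    2^ (+ suc n) ℚ.* 2^ j                    ∎
    where open ≡-Reasoning
  2^-+ -[1+ zero ]     j = 2^-pred j
  2^-+ -[1+ suc n ]    j = begin
    2^ (-[1+ suc n ] ℤ.+ j)                  ≡⟨ cong 2^ (ℤ.+-assoc ℤ.-1ℤ -[1+ n ] j) ⟩
    2^ (ℤ.pred (-[1+ n ] ℤ.+ j))             ≡⟨ 2^-pred (-[1+ n ] ℤ.+ j) ⟩
    ½ ℚ.* 2^ (-[1+ n ] ℤ.+ j)                ≡⟨ cong (½ ℚ.*_) (2^-+ -[1+ n ] j) ⟩
    ½ ℚ.* (2^ -[1+ n ] ℚ.* 2^ j)             ≡⟨ ℚ.*-assoc ½ (2^ -[1+ n ]) (2^ j) ⟨
    2^ -[1+ suc n ] ℚ.* 2^ j                 ∎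
    where open ≡-Reasoning

  vℚ-0 : ∀ k → k ≤vℚ 0ℚ
  vℚ-0 k = mk≤vℚ 0ℤ 0ℤ (trans (ℚ.*-zeroˡ (fromℤ 1ℤ)) (sym (ℚ.*-zeroʳ (2^ k))))

  vℚ-fromℤ : ∀ z → 0ℤ ≤vℚ fromℤ z
  vℚ-fromℤ z = mk≤vℚ z 0ℤ (ℚ.*-comm (fromℤ z) 1ℚ)

  odd-* : ∀ c d → odd (c ℤ.+ d ℤ.+ + 2 ℤ.* (c ℤ.* d)) ≡ odd c ℤ.* odd d
  odd-* = solveℤ 2 (λ c d → κ 1ℤ ⊕ κ (+ 2) ⊗ (c ⊕ d ⊕ κ (+ 2) ⊗ (c ⊗ d))
                          ⊜ (κ 1ℤ ⊕ κ (+ 2) ⊗ c) ⊗ (κ 1ℤ ⊕ κ (+ 2) ⊗ d)) refl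
    where
    open ℤ-Solver.+-*-Solver renaming
      (solve to solveℤ; _:+_ to _⊕_; _:*_ to _⊗_; _:=_ to _⊜_; con to κ)

  fromℤ-odd-* : ∀ c d → fromℤ (odd (c ℤ.+ d ℤ.+ + 2 ℤ.* (c ℤ.* d))) ≡ fromℤ (odd c) ℚ.* fromℤ (odd d)
  fromℤ-odd-* c d = trans (cong fromℤ (odd-* c d)) (fromℤ-* (odd c) (odd d))

  vℚ-+ : ∀ {k p q} → k ≤vℚ p → k ≤vℚ q → k ≤vℚ p ℚ.+ q
  vℚ-+ {k} {p} {q} (mk≤vℚ a c eq) (mk≤vℚ b d eq′) =
    mk≤vℚ (a ℤ.* odd d ℤ.+ b ℤ.* odd c) (c ℤ.+ d ℤ.+ + 2 ℤ.* (c ℤ.* d)) (begin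
    (p ℚ.+ q) ℚ.* fromℤ (odd (c ℤ.+ d ℤ.+ + 2 ℤ.* (c ℤ.* d)))
      ≡⟨ cong ((p ℚ.+ q) ℚ.*_) (fromℤ-odd-* c d) ⟩
    (p ℚ.+ q) ℚ.* (u ℚ.* w)
      ≡⟨ solve 4 (λ p q u w → (p :+ q) :* (u :* w) := (p :* u) :* w :+ (q :* w) :* u) refl p q u w ⟩
    (p ℚ.* u) ℚ.* w ℚ.+ (q ℚ.* w) ℚ.* u
      ≡⟨ cong₂ (λ x y → x ℚ.* w ℚ.+ y ℚ.* u) eq eq′ ⟩
    (2^ k ℚ.* fromℤ a) ℚ.* w ℚ.+ (2^ k ℚ.* fromℤ b) ℚ.* u
      ≡⟨ solve 5 (λ t a b u w → (t :* a) :* w :+ (t :* b) :* u := t :* (a :* w :+ b :* u)) refl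
           (2^ k) (fromℤ a) (fromℤ b) u w ⟩
    2^ k ℚ.* (fromℤ a ℚ.* w ℚ.+ fromℤ b ℚ.* u)
      ≡⟨ cong (2^ k ℚ.*_) (trans (fromℤ-+ (a ℤ.* odd d) (b ℤ.* odd c))
           (cong₂ ℚ._+_ (fromℤ-* a (odd d)) (fromℤ-* b (odd c)))) ⟨
    2^ k ℚ.* fromℤ (a ℤ.* odd d ℤ.+ b ℤ.* odd c) ∎)
    where
    open ≡-Reasoning
    u = fromℤ (odd c)
    w = fromℤ (odd d)

  vℚ-* : ∀ {k l p q} → k ≤vℚ p → l ≤vℚ q → k ℤ.+ l ≤vℚ p ℚ.* q
  vℚ-* {k} {l} {p} {q} (mk≤vℚ a c eq) (mk≤vℚ b d eq′) =
    mk≤vℚ (a ℤ.* b) (c ℤ.+ d ℤ.+ + 2 ℤ.* (c ℤ.* d)) (begin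
    (p ℚ.* q) ℚ.* fromℤ (odd (c ℤ.+ d ℤ.+ + 2 ℤ.* (c ℤ.* d)))
      ≡⟨ cong ((p ℚ.* q) ℚ.*_) (fromℤ-odd-* c d) ⟩
    (p ℚ.* q) ℚ.* (u ℚ.* w)
      ≡⟨ solve 4 (λ p q u w → (p :* q) :* (u :* w) := (p :* u) :* (q :* w)) refl p q u w ⟩
    (p ℚ.* u) ℚ.* (q ℚ.* w)
      ≡⟨ cong₂ ℚ._*_ eq eq′ ⟩
    (2^ k ℚ.* fromℤ a) ℚ.* (2^ l ℚ.* fromℤ b)
      ≡⟨ solve 4 (λ s t a b → (s :* a) :* (t :* b) := (s :* t) :* (a :* b)) refl
           (2^ k) (2^ l) (fromℤ a) (fromℤ b) ⟩
    (2^ k ℚ.* 2^ l) ℚ.* (fromℤ a ℚ.* fromℤ b)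
      ≡⟨ cong₂ ℚ._*_ (2^-+ k l) (fromℤ-* a b) ⟨
    2^ (k ℤ.+ l) ℚ.* fromℤ (a ℤ.* b) ∎)
    where
    open ≡-Reasoning
    u = fromℤ (odd c)
    w = fromℤ (odd d)

  vℚ-neg : ∀ {k p} → k ≤vℚ p → k ≤vℚ ℚ.- p
  vℚ-neg {k} {p} v = subst₂ _≤vℚ_ (ℤ.+-identityˡ k)
    (trans (ℚ.*-comm (ℚ.- 1ℚ) p) (solve 1 (λ x → x :* con (ℚ.- 1ℚ) := :- x) refl p))
    (vℚ-* {0ℤ} {k} (vℚ-fromℤ ℤ.-1ℤ) v)

  vℚ-mono : ∀ {k l p} → k ℤ.≤ l → l ≤vℚ p → k ≤vℚ p
  vℚ-mono {k} {l} {p} k≤l (mk≤vℚ a c eq) = go (l ℤ.- k) (ℤ.i≤j⇒0≤j-i k≤l) refl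
    where
    go : ∀ m → 0ℤ ℤ.≤ m → l ℤ.- k ≡ m → k ≤vℚ p
    go (+ n) _ l-k = mk≤vℚ ((+ 2) ℤ.^ n ℤ.* a) c (begin
      p ℚ.* fromℤ (odd c)                                ≡⟨ eq ⟩
      2^ l ℚ.* fromℤ a                                   ≡⟨ cong (λ z → 2^ z ℚ.* fromℤ a) l≡ ⟩
      2^ (k ℤ.+ + n) ℚ.* fromℤ a                         ≡⟨ cong (ℚ._* fromℤ a) (2^-+ k (+ n)) ⟩
      (2^ k ℚ.* 2^ (+ n)) ℚ.* fromℤ a                    ≡⟨ ℚ.*-assoc (2^ k) (2^ (+ n)) (fromℤ a) ⟩
      2^ k ℚ.* (2^ (+ n) ℚ.* fromℤ a)                    ≡⟨ cong (λ z → 2^ k ℚ.* (z ℚ.* fromℤ a)) (fromℤ-2^ n) ⟩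
      2^ k ℚ.* (fromℤ ((+ 2) ℤ.^ n) ℚ.* fromℤ a)          ≡⟨ cong (2^ k ℚ.*_) (fromℤ-* ((+ 2) ℤ.^ n) a) ⟨
      2^ k ℚ.* fromℤ ((+ 2) ℤ.^ n ℤ.* a)                  ∎)
      where
      open ≡-Reasoning
      l≡ : l ≡ k ℤ.+ + n
      l≡ = trans (sym (trans (ℤ.+-comm k (l ℤ.- k)) (ℤ-cancel l k))) (cong (λ z → k ℤ.+ z) l-k)

  halve : ∀ n → ∃ λ m → n ≡ 2 ℕ.* m ⊎ n ≡ suc (2 ℕ.* m)
  halve zero    = 0 , inj₁ refl
  halve (suc n) with halve n
  ... | m , inj₁ eq = m , inj₂ (cong suc eq)
  ... | m , inj₂ eq = suc m , inj₁ (cong suc (trans eq (sym (ℕ.+-suc m (m ℕ.+ 0)))))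

  OddPart : ℕ → Set
  OddPart d = 0 < d → ∃₂ λ e c → fromℤ (+ d) ≡ 2^ (+ e) ℚ.* fromℤ (odd c)

  oddPart : ∀ d → OddPart d
  oddPart = <-rec OddPart step
    where
    step : ∀ d → (∀ {d′} → d′ < d → OddPart d′) → OddPart d
    step d rec d>0 with halve d
    ... | m , inj₂ refl = 0 , + m ,
      trans (cong (λ z → fromℤ (1ℤ ℤ.+ z)) (ℤ.pos-* 2 m)) (sym (ℚ.*-identityˡ (fromℤ (odd (+ m)))))
    ... | zero , inj₁ refl = contradiction d>0 λ ()
    ... | suc m , inj₁ refl with rec (ℕ.m<m+n (suc m) (s≤s z≤n)) (s≤s z≤n)
    ...   | e , c , eq = suc e , c , (begin
      fromℤ (+ (2 ℕ.* suc m))                             ≡⟨ cong fromℤ (ℤ.pos-* 2 (suc m)) ⟩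
      fromℤ (+ 2 ℤ.* + suc m)                             ≡⟨ fromℤ-* (+ 2) (+ suc m) ⟩
      fromℤ (+ 2) ℚ.* fromℤ (+ suc m)                     ≡⟨ cong (fromℤ (+ 2) ℚ.*_) eq ⟩
      fromℤ (+ 2) ℚ.* (2^ (+ e) ℚ.* fromℤ (odd c))        ≡⟨ ℚ.*-assoc (fromℤ (+ 2)) (2^ (+ e)) (fromℤ (odd c)) ⟨
      2^ (+ suc e) ℚ.* fromℤ (odd c)                      ∎)
      where open ≡-Reasoning

  *↧≡↥ : ∀ q → q ℚ.* fromℤ (+ ℚ.↧ₙ q) ≡ fromℤ (ℚ.↥ q)
  *↧≡↥ q@record{} = ℚ.toℚᵘ-injective (ℚᵘ.≃-trans (ℚ.toℚᵘ-homo-* q (fromℤ (+ ℚ.↧ₙ q)))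
    (ℚᵘ.*≡* (trans (ℤ.*-identityʳ (ℚ.↥ q ℤ.* ℚ.↧ q))
                   (cong (λ n → ℚ.↥ q ℤ.* + n) (sym (ℕ.*-identityʳ (ℚ.↧ₙ q)))))))

  vℚ-bound : ∀ q → ∃ λ B → ℤ.- + B ≤vℚ q
  vℚ-bound q with oddPart (ℚ.↧ₙ q) (s≤s z≤n)
  ... | e , c , eq = e , mk≤vℚ (ℚ.↥ q) c (begin
    q ℚ.* o                               ≡⟨ ℚ.*-identityˡ (q ℚ.* o) ⟨
    1ℚ ℚ.* (q ℚ.* o)                      ≡⟨ cong (λ z → 2^ z ℚ.* (q ℚ.* o)) (ℤ.+-inverseˡ (+ e)) ⟨
    2^ (ℤ.- + e ℤ.+ + e) ℚ.* (q ℚ.* o)    ≡⟨ cong (ℚ._* (q ℚ.* o)) (2^-+ (ℤ.- + e) (+ e)) ⟩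
    (s ℚ.* t) ℚ.* (q ℚ.* o)               ≡⟨ solve 4 (λ s t q o → (s :* t) :* (q :* o) := s :* (q :* (t :* o))) refl s t q o ⟩
    s ℚ.* (q ℚ.* (t ℚ.* o))               ≡⟨ cong (λ z → s ℚ.* (q ℚ.* z)) eq ⟨
    s ℚ.* (q ℚ.* fromℤ (+ ℚ.↧ₙ q))        ≡⟨ cong (s ℚ.*_) (*↧≡↥ q) ⟩
    s ℚ.* fromℤ (ℚ.↥ q)                   ∎)
    where
    open ≡-Reasoning
    o = fromℤ (odd c)
    s = 2^ (ℤ.- + e)
    t = 2^ (+ e)

open ℚ-Valuation using (_≤vℚ_)

ℚ-valued : ValuedRing
ℚ-valued = record
  { commutativeRing = ℚ.+-*-commutativeRing
  ; _≤v_    = _≤vℚ_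
  ; v-resp  = λ {k} → ≡.subst (k ≤vℚ_)
  ; v-0     = ℚ-Valuation.vℚ-0
  ; v-1     = ℚ-Valuation.vℚ-fromℤ 1ℤ
  ; v-+     = ℚ-Valuation.vℚ-+
  ; v-neg   = ℚ-Valuation.vℚ-neg
  ; v-*     = ℚ-Valuation.vℚ-*
  ; v-mono  = ℚ-Valuation.vℚ-mono
  ; v-bound = ℚ-Valuation.vℚ-bound
  }

open Completion ℚ-valued using () renaming (Completed to ℚ₂; const to ℚ⇒ℚ₂; completion to ℚ₂-valued; completion-complete to ℚ₂-complete) public

Series : RawRing 0ℓ 0ℓ → Set
Series R = ℕ → RawRing.Carrier R

seriesRing : RawRing 0ℓ 0ℓ → RawRing 0ℓ 0ℓ
seriesRing R = record
  { Carrier = Series R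
  ; _≈_ = λ a b → ∀ n → a n ≈ b n
  ; _+_ = λ a b n → a n + b n
  ; _*_ = λ a b n → sum {suc n} λ i → a (n ∸ toℕ i) * b (toℕ i)
  ; -_  = λ a n → - a n
  ; 0#  = λ _ → 0#
  ; 1#  = λ { zero → 1# ; (suc _) → 0# }
  }
  where
  open RawRing R
  open RawMonoidOps +-rawMonoid using (sum)

module _ (R : RawRing 0ℓ 0ℓ) where
  open RawRing R
  open RawMonoidOps +-rawMonoid using (sum)

  constant : Carrier → Series R
  constant x zero    = x
  constant x (suc _) = 0#

  var : Series R
  var zero          = 0#
  var (suc zero)    = 1#
  var (suc (suc _)) = 0#

  -- (-1)ᵏ x
  signed : ℕ → Carrier → Carrier
  signed zero          x = x
  signed (suc zero)    x = - x
  signed (suc (suc k)) x = signed k x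

  -- Laplace expansion along the last row.
  det : ∀ {n} → (Fin n → Fin n → Carrier) → Carrier
  det {zero}  A = 1#
  det {suc n} A = sum λ j → signed (n ℕ.+ toℕ j)
    (det (λ i k → A (inject₁ i) (punchIn j k)) * A (fromℕ n) j)

module Banach (K : ValuedRing) (complete : ValuedRing.IsComplete K) where

  open ValuedRing K hiding (zero)

  -- Null sequences, with ‖ s ‖ = max |coef s n|.
  record c₀ : Set where
    no-eta-equality
    constructor mkc₀
    field
      coef : ℕ → Carrier
      null : ∀ k → ∃ λ N → ∀ n → N ≤ n → + k ≤v coef n

  open c₀ public

  infix 4 _≤‖_ _≈ᶜ_

  -- ‖ s ‖ ≤ 2⁻ᵏ
  _≤‖_ : ℤ → c₀ → Set
  k ≤‖ s = ∀ n → k ≤v coef s n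

  record _≈ᶜ_ (s t : c₀) : Set where
    constructor mk≈ᶜ
    field
      coef-≈ : ∀ n → coef s n ≈ coef t n

  open _≈ᶜ_ public

  infixl 6 _+ᶜ_
  infixr 7 _·ᶜ_
  infix  8 -ᶜ_

  _+ᶜ_ : c₀ → c₀ → c₀
  coef (s +ᶜ t) n = coef s n + coef t n
  null (s +ᶜ t) k = let N , v = null s k ; N′ , v′ = null t k in
    N ⊔ N′ , λ n M≤n → v-+ (v n (≤⊔ˡ N N′ M≤n)) (v′ n (≤⊔ʳ N N′ M≤n))

  -ᶜ_ : c₀ → c₀
  coef (-ᶜ s) n = - coef s n
  null (-ᶜ s) k = let N , v = null s k in N , λ n N≤n → v-neg (v n N≤n)

  0ᶜ : c₀
  coef 0ᶜ _ = 0#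
  null 0ᶜ k = 0 , λ _ _ → v-0 (+ k)

  _·ᶜ_ : Carrier → c₀ → c₀
  coef (x ·ᶜ s) n = x * coef s n
  null (x ·ᶜ s) k = let B , b = v-bound x ; N , v = null s (k ℕ.+ B) in
    N , λ n N≤n → ≡.subst (_≤v x * coef s n) (shiftˡ k B) (v-* b (v n N≤n))

  basis : ℕ → c₀
  coef (basis j) n = if does (n ℕ.≟ j) then 1# else 0#
  null (basis j) k = suc j , λ n j<n →
    ≡.subst (λ b → + k ≤v (if b then 1# else 0#)) (≡.sym (dec-false (n ℕ.≟ j) (ℕ.>⇒≢ j<n))) (v-0 (+ k))

  c₀-leftModule : LeftModule ring 0ℓ 0ℓ
  c₀-leftModule = record
    { Carrierᴹ = c₀ ; _≈ᴹ_ = _≈ᶜ_ ; _+ᴹ_ = _+ᶜ_ ; _*ₗ_ = _·ᶜ_ ; 0ᴹ = 0ᶜ ; -ᴹ_ = -ᶜ_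
    ; isLeftModule = record
      { isLeftSemimodule = record
        { +ᴹ-isCommutativeMonoid = record
          { isMonoid = record
            { isSemigroup = record
              { isMagma = record
                { isEquivalence = record
                  { refl  = mk≈ᶜ λ _ → refl
                  ; sym   = λ e → mk≈ᶜ λ n → sym (coef-≈ e n)
                  ; trans = λ e e′ → mk≈ᶜ λ n → trans (coef-≈ e n) (coef-≈ e′ n)
                  }
                ; ∙-cong = λ e e′ → mk≈ᶜ λ n → +-cong (coef-≈ e n) (coef-≈ e′ n)
                }
              ; assoc = λ s t u → mk≈ᶜ λ n → +-assoc (coef s n) (coef t n) (coef u n)
              }
            ; identity = (λ s → mk≈ᶜ λ n → +-identityˡ (coef s n))
                       , (λ s → mk≈ᶜ λ n → +-identityʳ (coef s n))
            }
          ; comm = λ s t → mk≈ᶜ λ n → +-comm (coef s n) (coef t n)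
          }
        ; isPreleftSemimodule = record
          { *ₗ-cong      = λ e e′ → mk≈ᶜ λ n → *-cong e (coef-≈ e′ n)
          ; *ₗ-zeroˡ     = λ s → mk≈ᶜ λ n → zeroˡ (coef s n)
          ; *ₗ-distribʳ  = λ s x y → mk≈ᶜ λ n → distribʳ (coef s n) x y
          ; *ₗ-identityˡ = λ s → mk≈ᶜ λ n → *-identityˡ (coef s n)
          ; *ₗ-assoc     = λ x y s → mk≈ᶜ λ n → *-assoc x y (coef s n)
          ; *ₗ-zeroʳ     = λ x → mk≈ᶜ λ n → zeroʳ x
          ; *ₗ-distribˡ  = λ x s t → mk≈ᶜ λ n → distribˡ x (coef s n) (coef t n)
          }
        }
      ; -ᴹ‿cong    = λ e → mk≈ᶜ λ n → -‿cong (coef-≈ e n)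
      ; -ᴹ‿inverse = (λ s → mk≈ᶜ λ n → -‿inverseˡ (coef s n))
                   , (λ s → mk≈ᶜ λ n → -‿inverseʳ (coef s n))
      }
    }

  private
    module V = LeftModule c₀-leftModule
    module LinearForms = LeftModuleMorphisms V.rawLeftModule (TensorUnit.rawLeftModule {R = rawRing})
    module Endomorphisms = LeftModuleMorphisms V.rawLeftModule V.rawLeftModule

  record Functional : Set where
    field
      form       : c₀ → Carrier
      isLinear   : LinearForms.IsLeftModuleHomomorphism form
      continuous : ∃ λ B → ∀ k s → k ≤‖ s → k ℤ.- + B ≤v form s

  record FiniteRank : Set where
    field
      {rank} : ℕ
      form   : Fin rank → Functional
      vector : Fin rank → c₀

    apply : c₀ → c₀
    apply s = RawMonoidOps.sum V.+ᴹ-rawMonoid λ r → Functional.form (form r) s ·ᶜ vector r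

  -- A compact (completely continuous) operator is a limit, in operator norm,
  -- of continuous operators of finite rank.
  record CompactOperator : Set where
    field
      apply      : c₀ → c₀
      isLinear   : Endomorphisms.IsLeftModuleHomomorphism apply
      continuous : ∃ λ B → ∀ k s → k ≤‖ s → k ℤ.- + B ≤‖ apply s
      compact    : ∀ k → ∃ λ (F : FiniteRank) → ∀ s → 0ℤ ≤‖ s → + k ≤‖ apply s +ᶜ -ᶜ FiniteRank.apply F s

    matrix : ℕ → ℕ → Carrier
    matrix i j = coef (apply (basis j)) i

  basis-unit : ∀ j → 0ℤ ≤‖ basis j
  basis-unit j n with does (n ℕ.≟ j)
  ... | true  = v-1
  ... | false = v-0 0ℤ

  K[[X]] : RawRing 0ℓ 0ℓ
  K[[X]] = seriesRing rawRing

  module P = RawRing K[[X]]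

  -- The entries of 1 - X u, for an infinite matrix u.
  1-X_ : (ℕ → ℕ → Carrier) → ℕ → ℕ → P.Carrier
  (1-X u) i j = (if does (i ℕ.≟ j) then P.1# else P.0#) P.+ P.- (var rawRing P.* constant rawRing (u i j))

  -- det (1 - X u) for the upper left M × M block of u.
  truncated : (ℕ → ℕ → Carrier) → ℕ → P.Carrier
  truncated u M = det K[[X]] {M} λ i j → (1-X u) (toℕ i) (toℕ j)

  finiteRank-rows : ∀ n (φ : Fin n → Functional) (w : Fin n → c₀) k → ∃ λ N → ∀ i → N ≤ i → ∀ s → 0ℤ ≤‖ s →
    + k ≤v coef (RawMonoidOps.sum V.+ᴹ-rawMonoid λ r → Functional.form (φ r) s ·ᶜ w r) i
  finiteRank-rows zero    φ w k = 0 , λ _ _ _ _ → v-0 (+ k)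
  finiteRank-rows (suc n) φ w k =
    let N  , v  = finiteRank-rows n (φ ∘ suc) (w ∘ suc) k
        B  , b  = Functional.continuous (φ zero)
        N′ , v′ = null (w zero) (k ℕ.+ B)
    in N ⊔ N′ , λ i M≤i s s≤1 → v-+
      (≡.subst (_≤v Functional.form (φ zero) s * coef (w zero) i) (shiftˡ k B)
        (v-* (≡.subst (_≤v Functional.form (φ zero) s) (ℤ.+-identityˡ (ℤ.- + B)) (b 0ℤ s s≤1))
             (v′ i (≤⊔ʳ N N′ M≤i))))
      (v i (≤⊔ˡ N N′ M≤i) s s≤1)

  module _ (U : CompactOperator) where
    open CompactOperator U

    matrix-rows : ∀ k → ∃ λ N → ∀ i → N ≤ i → ∀ j → + k ≤v matrix i j
    matrix-rows k =
      let F , c = compact k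
          N , v = finiteRank-rows (FiniteRank.rank F) (FiniteRank.form F) (FiniteRank.vector F) k
      in N , λ i N≤i j → v-close (c (basis j) (basis-unit j) i) (v i N≤i (basis j) (basis-unit j))

    B : ℕ
    B = proj₁ continuous

    matrix-bound : ∀ i j → ℤ.- + B ≤v matrix i j
    matrix-bound i j = ≡.subst (_≤v matrix i j) (ℤ.+-identityˡ (ℤ.- + B))
      (proj₂ continuous 0ℤ (basis j) (basis-unit j) i)

    -- The Gauss norm for |X| = 2^(-B) makes 1 - X U integral.
    level : ℤ → ℕ → ℤ
    level k n = k ℤ.- + (n ℕ.* B)

    infix 4 _≤G_

    _≤G_ : ℤ → P.Carrier → Set
    k ≤G a = ∀ n → level k n ≤v a n

    CloseG : ℤ → P.Carrier → P.Carrier → Set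
    CloseG k a b = ∀ n → Close (level k n) (a n) (b n)

    level-split : ∀ k l {n i} → i ≤ n → level k (n ∸ i) ℤ.+ level l i ≡ level (k ℤ.+ l) n
    level-split k l {n} {i} i≤n = ≡.trans
      (reorder k l (+ ((n ∸ i) ℕ.* B)) (+ (i ℕ.* B)))
      (≡.cong (λ m → k ℤ.+ l ℤ.- + m)
        (≡.trans (≡.sym (ℕ.*-distribʳ-+ B (n ∸ i) i)) (≡.cong (ℕ._* B) (ℕ.m∸n+n≡m i≤n))))
      where
      open ℤ-Solver.+-*-Solver
      reorder : ∀ k l x y → k ℤ.- x ℤ.+ (l ℤ.- y) ≡ k ℤ.+ l ℤ.- (x ℤ.+ y)
      reorder = solve 4 (λ k l x y → k :- x :+ (l :- y) := k :+ l :- (x :+ y)) ≡.refl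

    v-sum : ∀ {k n} (f : Fin n → Carrier) → (∀ i → k ≤v f i) → k ≤v sum f
    v-sum {k} {zero}  f v = v-0 k
    v-sum {k} {suc n} f v = v-+ (v zero) (v-sum (f ∘ suc) (v ∘ suc))

    Close-sum : ∀ {k n} (f g : Fin n → Carrier) → (∀ i → Close k (f i) (g i)) → Close k (sum f) (sum g)
    Close-sum {n = zero}  f g c = Close-refl 0#
    Close-sum {n = suc n} f g c = Close-+ (c zero) (Close-sum (f ∘ suc) (g ∘ suc) (c ∘ suc))

    toℕ≤ : ∀ {n} (i : Fin (suc n)) → toℕ i ≤ n
    toℕ≤ i = ℕ.≤-pred (Fin.toℕ<n i)

    G-* : ∀ {k l a b} → k ≤G a → l ≤G b → k ℤ.+ l ≤G a P.* b
    G-* {k} {l} {a} {b} v w n = v-sum (λ i → a (n ∸ toℕ i) * b (toℕ i)) λ i →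
      ≡.subst (_≤v a (n ∸ toℕ i) * b (toℕ i)) (level-split k l (toℕ≤ i)) (v-* (v (n ∸ toℕ i)) (w (toℕ i)))

    CloseG-refl : ∀ {k} a → CloseG k a a
    CloseG-refl a n = Close-refl (a n)

    CloseG-trans : ∀ {k a b c} → CloseG k a b → CloseG k b c → CloseG k a c
    CloseG-trans p q n = Close-trans (p n) (q n)

    CloseG-+ : ∀ {k a a′ b b′} → CloseG k a a′ → CloseG k b b′ → CloseG k (a P.+ b) (a′ P.+ b′)
    CloseG-+ p q n = Close-+ (p n) (q n)

    CloseG-* : ∀ {k a a′ b b′} → CloseG k a a′ → 0ℤ ≤G b → 0ℤ ≤G a′ → CloseG k b b′ → CloseG k (a P.* b) (a′ P.* b′)
    CloseG-* {k} {a} {a′} {b} {b′} p w v q n =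
      Close-sum (λ i → a (n ∸ toℕ i) * b (toℕ i)) (λ i → a′ (n ∸ toℕ i) * b′ (toℕ i)) λ i →
      Close-* (p (n ∸ toℕ i)) (w (toℕ i))
        (≡.trans (level-split k 0ℤ (toℕ≤ i)) (≡.cong (λ z → level z n) (ℤ.+-identityʳ k)))
        (v (n ∸ toℕ i)) (q (toℕ i))
        (≡.trans (level-split 0ℤ k (toℕ≤ i)) (≡.cong (λ z → level z n) (ℤ.+-identityˡ k)))

    CloseG-*-1 : ∀ {k} a → CloseG k (a P.* P.1#) a
    CloseG-*-1 {k} a n = Close-trans
      (Close-+ (Close-≈ (*-identityʳ (a n)))
        (Close-0 (v-sum (λ (i : Fin n) → a (n ∸ suc (toℕ i)) * 0#)
          λ i → v-resp (sym (zeroʳ (a (n ∸ suc (toℕ i))))) (v-0 (level k n)))))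
      (Close-≈ (+-identityʳ (a n)))

    level-neg : ∀ n → level 0ℤ n ℤ.≤ 0ℤ
    level-neg n = ≡.subst (ℤ._≤ 0ℤ) (≡.sym (ℤ.+-identityˡ (ℤ.- + (n ℕ.* B)))) (-B≤0 (n ℕ.* B))

    G-0 : ∀ k → k ≤G P.0#
    G-0 k n = v-0 (level k n)

    G-1 : 0ℤ ≤G P.1#
    G-1 zero    = v-1
    G-1 (suc n) = v-0 (level 0ℤ (suc n))

    G-constant : ∀ {k x} → k ≤v x → k ≤G constant rawRing x
    G-constant {k} {x} v zero    = ≡.subst (_≤v x) (≡.sym (ℤ.+-identityʳ k)) v
    G-constant {k}     v (suc n) = v-0 (level k (suc n))

    G-var : + B ≤G var rawRing
    G-var zero          = v-0 (level (+ B) 0)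
    G-var (suc zero)    = ≡.subst (_≤v 1#)
      (≡.sym (≡.trans (≡.cong (λ m → + B ℤ.- + m) (ℕ.+-identityʳ B)) (ℤ.+-inverseʳ (+ B)))) v-1
    G-var (suc (suc n)) = v-0 (level (+ B) (suc (suc n)))

    X·entry : ∀ {k x} → k ℤ.- + B ≤v x → k ≤G var rawRing P.* constant rawRing x
    X·entry {k} {x} v = ≡.subst (_≤G var rawRing P.* constant rawRing x) cancel
      (G-* {+ B} {k ℤ.- + B} {var rawRing} {constant rawRing x} G-var (G-constant v))
      where
      cancel : + B ℤ.+ (k ℤ.- + B) ≡ k
      cancel = solve 2 (λ b k → b :+ (k :- b) := k) ≡.refl (+ B) k
        where open ℤ-Solver.+-*-Solver

    E : ℕ → ℕ → P.Carrier
    E = 1-X matrix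

    E-integral : ∀ i j → 0ℤ ≤G E i j
    E-integral i j n = v-+ (δ n) (v-neg (X·entry {0ℤ}
      (≡.subst (_≤v matrix i j) (≡.sym (ℤ.+-identityˡ (ℤ.- + B))) (matrix-bound i j)) n))
      where
      δ : 0ℤ ≤G (if does (i ℕ.≟ j) then P.1# else P.0#)
      δ with does (i ℕ.≟ j)
      ... | true  = G-1
      ... | false = G-0 0ℤ

    G-sum : ∀ {k n} (f : Fin n → P.Carrier) → (∀ i → k ≤G f i) → k ≤G RawMonoidOps.sum P.+-rawMonoid f
    G-sum {k} {zero}  f v = G-0 k
    G-sum {k} {suc n} f v m = v-+ (v zero m) (G-sum {k} (f ∘ suc) (v ∘ suc) m)

    CloseG-sum : ∀ {k n} (f g : Fin n → P.Carrier) → (∀ i → CloseG k (f i) (g i)) →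
                 CloseG k (RawMonoidOps.sum P.+-rawMonoid f) (RawMonoidOps.sum P.+-rawMonoid g)
    CloseG-sum {k} {zero}  f g c = CloseG-refl {k} P.0#
    CloseG-sum {k} {suc n} f g c m = Close-+ (c zero m) (CloseG-sum {k} (f ∘ suc) (g ∘ suc) (c ∘ suc) m)

    CloseG-sum-last : ∀ {k n} (f : Fin (suc n) → P.Carrier) {a} → (∀ i → k ≤G f (inject₁ i)) →
                      CloseG k (f (fromℕ n)) a → CloseG k (RawMonoidOps.sum P.+-rawMonoid f) a
    CloseG-sum-last {k} {zero}  f {a} v c m = Close-trans (Close-≈ (+-identityʳ (f zero m))) (c m)
    CloseG-sum-last {k} {suc n} f {a} v c m = Close-trans
      (Close-+ (Close-0 (v zero m)) (CloseG-sum-last {k} (f ∘ suc) {a} (v ∘ suc) c m))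
      (Close-≈ (+-identityˡ (a m)))

    G-signed : ∀ {k} m {a} → k ≤G a → k ≤G signed K[[X]] m a
    G-signed     zero          v = v
    G-signed     (suc zero)    v n = v-neg (v n)
    G-signed {k} (suc (suc m)) v = G-signed {k} m v

    CloseG-signed : ∀ {k} m {a b} → CloseG k a b → CloseG k (signed K[[X]] m a) (signed K[[X]] m b)
    CloseG-signed     zero          c = c
    CloseG-signed     (suc zero)    c n = Close-neg (c n)
    CloseG-signed {k} (suc (suc m)) c = CloseG-signed {k} m c

    signed-double : ∀ m a → signed K[[X]] (m ℕ.+ m) a ≡ a
    signed-double zero    a = ≡.refl
    signed-double (suc m) a = ≡.trans (≡.cong (λ l → signed K[[X]] (suc l) a) (ℕ.+-suc m m)) (signed-double m a)

    G-det : ∀ n (A : Fin n → Fin n → P.Carrier) → (∀ i j → 0ℤ ≤G A i j) → 0ℤ ≤G det K[[X]] A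
    G-det zero    A v = G-1
    G-det (suc n) A v = G-sum {0ℤ} _ λ j → G-signed {0ℤ} (n ℕ.+ toℕ j)
      (G-* {0ℤ} {0ℤ} {det K[[X]] (λ i k → A (inject₁ i) (punchIn j k))} {A (fromℕ n) j}
        (G-det n _ λ i k → v (inject₁ i) (punchIn j k)) (v (fromℕ n) j))

    CloseG-det : ∀ {k} n (A A′ : Fin n → Fin n → P.Carrier) → (∀ i j → 0ℤ ≤G A i j) → (∀ i j → 0ℤ ≤G A′ i j) →
                 (∀ i j → CloseG k (A i j) (A′ i j)) → CloseG k (det K[[X]] A) (det K[[X]] A′)
    CloseG-det {k} zero    A A′ v v′ c = CloseG-refl {k} P.1#
    CloseG-det {k} (suc n) A A′ v v′ c = CloseG-sum {k} _ _ λ j → CloseG-signed {k} (n ℕ.+ toℕ j)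
      (CloseG-* {k} {det K[[X]] (minor A j)} {det K[[X]] (minor A′ j)} {A (fromℕ n) j} {A′ (fromℕ n) j}
        (CloseG-det {k} n (minor A j) (minor A′ j) (λ i l → v (inject₁ i) (punchIn j l))
          (λ i l → v′ (inject₁ i) (punchIn j l)) (λ i l → c (inject₁ i) (punchIn j l)))
        (v (fromℕ n) j) (G-det n (minor A′ j) λ i l → v′ (inject₁ i) (punchIn j l)) (c (fromℕ n) j))
      where
      minor : (Fin (suc n) → Fin (suc n) → P.Carrier) → Fin (suc n) → Fin n → Fin n → P.Carrier
      minor A j i l = A (inject₁ i) (punchIn j l)

    toℕ-punchIn-last : ∀ {n} (l : Fin n) → toℕ (punchIn (fromℕ n) l) ≡ toℕ l
    toℕ-punchIn-last zero    = ≡.refl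
    toℕ-punchIn-last (suc l) = ≡.cong suc (toℕ-punchIn-last l)

    -- If row M of U is small then so is the difference of successive truncations.
    truncated-step : ∀ {k} M → (∀ j → k ≤v matrix M j) → CloseG k (truncated matrix (suc M)) (truncated matrix M)
    truncated-step {k} M small = CloseG-sum-last {k} term {truncated matrix M} off-diagonal diagonal
      where
      A : Fin (suc M) → Fin (suc M) → P.Carrier
      A i j = E (toℕ i) (toℕ j)

      minor : Fin (suc M) → P.Carrier
      minor j = det K[[X]] (λ i l → A (inject₁ i) (punchIn j l))

      term : Fin (suc M) → P.Carrier
      term j = signed K[[X]] (M ℕ.+ toℕ j) (minor j P.* A (fromℕ M) j)

      minor-integral : ∀ j → 0ℤ ≤G minor j
      minor-integral j = G-det M _ λ i l → E-integral (toℕ (inject₁ i)) (toℕ (punchIn j l))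

      X·small : ∀ j → k ≤G var rawRing P.* constant rawRing (matrix M j)
      X·small j = X·entry {k} (v-mono (ℤ.≤-trans (ℤ.+-monoʳ-≤ k (-B≤0 B)) (ℤ.≤-reflexive (ℤ.+-identityʳ k))) (small j))

      E-row : ∀ i → M ≡ i → ∀ j → i ≢ j → k ≤G E i j
      E-row i ≡.refl j i≢j n = v-+
        (≡.subst (λ b → level k n ≤v (if b then P.1# else P.0#) n) (≡.sym (dec-false (M ℕ.≟ j) i≢j)) (v-0 (level k n)))
        (v-neg (X·small j n))

      off-diagonal : ∀ i → k ≤G term (inject₁ i)
      off-diagonal i = G-signed {k} (M ℕ.+ toℕ (inject₁ i))
        (≡.subst (_≤G minor (inject₁ i) P.* A (fromℕ M) (inject₁ i)) (ℤ.+-identityˡ k)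
          (G-* {0ℤ} {k} {minor (inject₁ i)} {A (fromℕ M) (inject₁ i)} (minor-integral (inject₁ i))
            (E-row (toℕ (fromℕ M)) (≡.sym (Fin.toℕ-fromℕ M)) (toℕ (inject₁ i))
              λ eq → ℕ.<⇒≢ (Fin.toℕ<n i) (≡.trans (≡.sym (Fin.toℕ-inject₁ i)) (≡.trans (≡.sym eq) (Fin.toℕ-fromℕ M))))))

      E-corner : ∀ i → M ≡ i → CloseG k (E i i) P.1#
      E-corner i ≡.refl n = Close-trans
        (Close-+ (≡.subst (λ b → Close (level k n) ((if b then P.1# else P.0#) n) (P.1# n))
                   (≡.sym (dec-true (M ℕ.≟ M) ≡.refl)) (Close-refl (P.1# n)))
                 (Close-0 (v-neg (X·small M n))))
        (Close-≈ (+-identityʳ (P.1# n)))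

      minor-last : CloseG k (minor (fromℕ M)) (truncated matrix M)
      minor-last = CloseG-det {k} M _ _
        (λ i l → E-integral (toℕ (inject₁ i)) (toℕ (punchIn (fromℕ M) l)))
        (λ i l → E-integral (toℕ i) (toℕ l))
        (λ i l → ≡.subst₂ (λ x y → CloseG k (E x y) (E (toℕ i) (toℕ l)))
          (≡.sym (Fin.toℕ-inject₁ i)) (≡.sym (toℕ-punchIn-last l)) (CloseG-refl {k} (E (toℕ i) (toℕ l))))

      diagonal : CloseG k (term (fromℕ M)) (truncated matrix M)
      diagonal = ≡.subst (λ x → CloseG k x (truncated matrix M))
        (≡.sym (≡.trans (≡.cong (λ l → signed K[[X]] (M ℕ.+ l) (minor (fromℕ M) P.* A (fromℕ M) (fromℕ M))) (Fin.toℕ-fromℕ M))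
                        (signed-double M _)))
        (CloseG-trans {k} {minor (fromℕ M) P.* A (fromℕ M) (fromℕ M)} {truncated matrix M P.* P.1#}
          (CloseG-* {k} {minor (fromℕ M)} {truncated matrix M} {A (fromℕ M) (fromℕ M)} {P.1#} minor-last
            (E-integral (toℕ (fromℕ M)) (toℕ (fromℕ M)))
            (G-det M _ λ i l → E-integral (toℕ i) (toℕ l))
            (E-corner (toℕ (fromℕ M)) (≡.sym (Fin.toℕ-fromℕ M))))
          (CloseG-*-1 {k} (truncated matrix M)))

    truncated-cauchy : ∀ n → IsCauchy (λ M → truncated matrix M n)
    truncated-cauchy n k = let N , small = matrix-rows (k ℕ.+ n ℕ.* B) in
      N , λ m N≤m → ≡.subst (λ m → Close (+ k) (z m) (z N)) (ℕ.m∸n+n≡m N≤m) (steps N small (m ∸ N))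
      where
      z : ℕ → Carrier
      z M = truncated matrix M n

      steps : ∀ N → (∀ i → N ≤ i → ∀ j → + (k ℕ.+ n ℕ.* B) ≤v matrix i j) → ∀ d → Close (+ k) (z (d ℕ.+ N)) (z N)
      steps N small zero    = Close-refl (z N)
      steps N small (suc d) = Close-trans
        (≡.subst (λ l → Close l (z (suc d ℕ.+ N)) (z (d ℕ.+ N))) (shiftʳ k (n ℕ.* B))
          (truncated-step {+ (k ℕ.+ n ℕ.* B)} (d ℕ.+ N) (small (d ℕ.+ N) (ℕ.m≤n+m N d)) n))
        (steps N small d)

    -- Serre's det (1 - X U): the coefficientwise limit of the determinants of
    -- the truncations of 1 - X U.
    fredholm : Series rawRing
    fredholm n = proj₁ (complete (λ M → truncated matrix M n) (truncated-cauchy n))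

    fredholm-limit : ∀ n → (λ M → truncated matrix M n) ⟶ fredholm n
    fredholm-limit n = proj₂ (complete (λ M → truncated matrix M n) (truncated-cauchy n))

module NewtonPolygon (K : ValuedRing) where

  open ValuedRing K

  HasValuation : Carrier → ℤ → Set
  HasValuation x k = k ≤v x × ¬ (ℤ.suc k ≤v x)

  -- The points on or above the Newton polygon of c, that is, the convex hull
  -- of the vertical rays above the points (n , v (c n)) with c n ≠ 0.  The
  -- polygon is the lower boundary of this region.
  data OnOrAbove (c : ℕ → Carrier) : ℚ → ℚ → Set where
    ray    : ∀ {n k y} → HasValuation (c n) k → fromℤ k ℚ.≤ y → OnOrAbove c (fromℤ (+ n)) y
    convex : ∀ {x y x′ y′ t} → 0ℚ ℚ.≤ t → t ℚ.≤ 1ℚ → OnOrAbove c x y → OnOrAbove c x′ y′ →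
             OnOrAbove c (t ℚ.* x ℚ.+ (1ℚ ℚ.- t) ℚ.* x′) (t ℚ.* y ℚ.+ (1ℚ ℚ.- t) ℚ.* y′)

  SameNewtonPolygon : (ℕ → Carrier) → (ℕ → Carrier) → Set
  SameNewtonPolygon c d = ∀ x y → OnOrAbove c x y ⇔ OnOrAbove d x y

module ℤ[[q]] where

  open RawRing (seriesRing ℤ.+-*-rawRing) public
  open RawSemiringOps rawSemiring public using (_^_; product)
  open RawMonoidOps (RawRing.+-rawMonoid ℤ.+-*-rawRing) public using (sum)

  q : Carrier
  q = var ℤ.+-*-rawRing

  tail : Carrier → Carrier
  tail a n = a (suc n)

  -- a(q²)
  dilate : Carrier → Carrier
  dilate a n = if does (2 ∣? n) then a (n / 2) else 0ℤ

  module _ (a b : Carrier) where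

    -- The coefficients n-1, …, 0 of the series c with c b = a, given b₀ = 1.
    quotients : ∀ n → Vector ℤ n
    quotients zero    = λ ()
    quotients (suc n) = (a n ℤ.- sum λ i → quotients n i ℤ.* b (suc (toℕ i))) ∷ quotients n

    quotient : Carrier
    quotient n = quotients (suc n) zero

    quotients-quotient : ∀ n (i : Fin n) → quotients n i ≡ quotient (n ∸ suc (toℕ i))
    quotients-quotient (suc n) zero    = ≡.refl
    quotients-quotient (suc n) (suc i) = quotients-quotient n i

    quotient-* : b 0 ≡ 1ℤ → ∀ n → (quotient * b) n ≡ a n
    quotient-* b₀ n = begin
      quotient n ℤ.* b 0 ℤ.+ tails     ≡⟨ ≡.cong (λ z → quotient n ℤ.* z ℤ.+ tails) b₀ ⟩
      quotient n ℤ.* 1ℤ ℤ.+ tails      ≡⟨ ≡.cong (ℤ._+ tails) (ℤ.*-identityʳ (quotient n)) ⟩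
      a n ℤ.- tails′ ℤ.+ tails         ≡⟨ ≡.cong (λ z → a n ℤ.- z ℤ.+ tails) tails≡ ⟩
      a n ℤ.- tails ℤ.+ tails          ≡⟨ ℤ-cancel (a n) tails ⟩
      a n                              ∎
      where
      open ≡.≡-Reasoning
      open ℚ-Valuation using (ℤ-cancel)

      sum-cong : ∀ {n} (f g : Fin n → ℤ) → (∀ i → f i ≡ g i) → sum f ≡ sum g
      sum-cong {zero}  f g e = ≡.refl
      sum-cong {suc n} f g e = ≡.cong₂ ℤ._+_ (e zero) (sum-cong (f ∘ suc) (g ∘ suc) (e ∘ suc))

      tails  = sum {n} λ i → quotient (n ∸ suc (toℕ i)) ℤ.* b (suc (toℕ i))
      tails′ = sum {n} λ i → quotients n i ℤ.* b (suc (toℕ i))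

      tails≡ : tails′ ≡ tails
      tails≡ = sum-cong {n} _ _ λ i → ≡.cong (ℤ._* b (suc (toℕ i))) (quotients-quotient n i)

  -- ∏ₙ (1 - qⁿ)²⁴; only the factors with n ≤ m affect the coefficient of qᵐ.
  euler : Carrier
  euler m = product {m} (λ i → (1# + - (q ^ suc (toℕ i))) ^ 24) m

  Δ : Carrier
  Δ zero    = 0ℤ
  Δ (suc n) = euler n

  -- Δ(2τ) / Δ(τ); see f-correct.
  f : Carrier
  f = quotient (tail (dilate Δ)) (tail Δ)

  f-correct : f * Δ ≈ dilate Δ
  f-correct zero    = ≡.cong (ℤ._+ 0ℤ) (ℤ.*-zeroʳ (f 0))
  f-correct (suc n) = ≡.trans (≡.cong (ℤ._+ (f * tail Δ) n) (ℤ.*-zeroʳ (f (suc n))))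
    (≡.trans (ℤ.+-identityˡ ((f * tail Δ) n)) (quotient-* (tail (dilate Δ)) (tail Δ) ≡.refl n))

  g : Carrier
  g n = + 64 ℤ.* f n

open module ℚ₂-Banach = Banach ℚ₂-valued ℚ₂-complete public
  using (c₀; coef; CompactOperator; fredholm)
open module ℚ₂ᵛ = ValuedRing ℚ₂-valued public using () renaming (_≈_ to _≈₂_; _+_ to _+₂_; _*_ to _*₂_)
open NewtonPolygon ℚ₂-valued public

-- The element s stands for ∑ᵢ sᵢ g^(i+1), so that the monomials gⁿ (n ≥ 1)
-- form the standard orthonormal basis.
S₀ : Set
S₀ = c₀

-- As g starts in degree 1, only g, …, gᵐ affect the coefficient of qᵐ.
qExpansion : S₀ → ℕ → ℚ₂
qExpansion s m = ℚ₂ᵛ.sum {m} λ i → coef s (toℕ i) *₂ ℚ⇒ℚ₂ (fromℤ ((g ^ suc (toℕ i)) m))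
  where open ℤ[[q]]

U₂ : (ℕ → ℚ₂) → (ℕ → ℚ₂)
U₂ a n = a (2 ℕ.* n)

IsU : CompactOperator → Set
IsU U = ∀ s n → qExpansion (CompactOperator.apply U s) n ≈₂ U₂ (qExpansion s) n

-- The sign of -12j is carried by the numerator.
factor : (j : ℕ) → .{{ℕ.NonZero j}} → ℚ
factor j = (ℤ.- + (2 ℕ.^ (2 ℕ.* j) ℕ.* (12 ℕ.* j ℕ.+ 2) ! ℕ.* (6 ℕ.* j) !))
  ℚ./ ((8 ℕ.* j ℕ.+ 2) ! ℕ.* (8 ℕ.* j ∸ 2) ! ℕ.* (12 ℕ.* j))
  where instance
  nonZero : ℕ.NonZero ((8 ℕ.* j ℕ.+ 2) ! ℕ.* (8 ℕ.* j ∸ 2) ! ℕ.* (12 ℕ.* j))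
  nonZero = ℕ.m*n≢0 _ _ {{ℕ.m*n≢0 _ _ {{(8 ℕ.* j ℕ.+ 2) ℕ.!≢0}} {{(8 ℕ.* j ∸ 2) ℕ.!≢0}}}} {{ℕ.m*n≢0 12 j}}

explicitSeries : ℕ → ℚ
explicitSeries zero    = 1ℚ
explicitSeries (suc n) = explicitSeries n ℚ.* factor (suc n)

{-# OPTIONS --safe #-}
module Submission where

-- Put f = Δ(2τ)/Δ(τ) and w = f(2τ).  Gauss's product formulas for the theta functions ∑ (-1)ⁿ q^(n²)
-- and ∑ q^(n(n+1)/2) yield the modular equation f² = w + (48 w + 4096 w²) f, whose second root is
-- f(τ + 1/2).  Hence U f = 24 f + 2048 f², and U gʲ satisfies a three-term recurrence in j, which is
-- solved by U gʲ = ∑ᵢ m(i,j) gⁱ with m(i,j) = 3j 2^(2i+2j-1) (i+j-1)! / ((2i-j)! (2j-i)!).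
--
-- A WZ pair factors the matrix m as A D B, where A is lower and B upper unitriangular, both congruent
-- to 1 mod 2, and D is diagonal with v(D_k) = s_k = 1 + 2 v((3k)!/k!).  Row operations turn 1 - X m into
-- A⁻¹ - X D B.  Since s increases by at least 2 at every step, there is a Gauss norm with s_n < v(1/X)
-- < s_(n+1) for which each row of A⁻¹ - X D B is dominated by its diagonal entry: by - X D_k if k ≤ n
-- and by 1 if k > n.  So the coefficient of Xⁿ in det (1 - X U) has valuation s_1 + ⋯ + s_n, and so
-- does the explicit product, whose j-th factor has valuation s_j.

-- Apart from the factor j the matrix m is symmetric, so elimination yields a lower triangular
-- factor and, weighted by j/k, its transpose. That weight is the delicate point: B is congruent to
-- 1 mod 2 only because the entry of A at (i, k) below the diagonal is divisible by 2k in ℤ₍₂₎ and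
-- not merely by 2. Since A is lower triangular and stands on the left, the leading M × M block of 1
-- - X m involves only the leading block of A. The reduction is therefore exact on every truncation,
-- and only the resulting estimate has to pass to the limit.
--
-- Valuations in a completion cannot be computed. Whatever enters the estimate is therefore a
-- rational constant whose valuation is certified by clearing odd denominators: x · odd = 2ᵏ · odd.
-- The operator is known only through q-expansions; its matrix is recovered from them because gⁿ
-- starts with 64ⁿ qⁿ, and 64 is invertible in ℚ₂.
--
-- Most of the algebra is done over an abstract commutative ring, where numerals and factorials stay
-- symbolic.

open import Algebra.Bundles using (CommutativeRing; RawRing)
open import Level using (0ℓ)

-- A ring solver with integer coefficients over any commutative ring.

module IntegerCoefficients (R : CommutativeRing 0ℓ 0ℓ) where
  open import Algebra.Definitions.RawMonoid (CommutativeRing.+-rawMonoid R) using () renaming (_×′_ to _×_)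
  open import Algebra.Properties.AbelianGroup (CommutativeRing.+-abelianGroup R) using (⁻¹-∙-comm; ⁻¹-involutive; ε⁻¹≈ε)
  open import Algebra.Properties.Monoid.Mult.TCOptimised (CommutativeRing.+-monoid R) using (1+×; ×-homo-+)
  open import Algebra.Properties.Ring (CommutativeRing.ring R) using (-‿distribˡ-*; -‿distribʳ-*)
  open import Algebra.Properties.Semiring.Mult.TCOptimised (CommutativeRing.semiring R) using (×1-homo-*)
  open import Algebra.Solver.Ring.AlmostCommutativeRing using (fromCommutativeRing; _-Raw-AlmostCommutative⟶_)
  open import Data.Integer.Base as ℤ using (ℤ; +_; -[1+_]; _⊖_)
  open import Data.Integer.Properties as ℤ using ()
  open import Data.Nat.Base as ℕ using (ℕ; zero; suc)
  open import Data.Maybe.Base using (Maybe; map)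
  open import Relation.Binary.PropositionalEquality as ≡ using ()
  open import Relation.Nullary.Decidable using (dec⇒maybe)
  open CommutativeRing R
  open import Relation.Binary.Reasoning.Setoid setoid

  -- This multiple operation has no trailing zero: `ι` sends 0 and 1 definitionally to `0#` and
  -- `1#`, so the numerals of the solver match the constants of the ring by `refl`.
  ι : ℤ → Carrier
  ι (+ n)    = n × 1#
  ι -[1+ n ] = - (suc n × 1#)

  ι-neg : ∀ i → ι (ℤ.- i) ≈ - ι i
  ι-neg (+ zero)  = sym ε⁻¹≈ε
  ι-neg (+ suc n) = refl
  ι-neg -[1+ n ]  = sym (⁻¹-involutive _)

  cancel-1 : ∀ x y → (1# + x) - (1# + y) ≈ x - y
  cancel-1 x y = begin
    (1# + x) - (1# + y)      ≈⟨ +-cong (+-comm 1# x) (sym (⁻¹-∙-comm 1# y)) ⟩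
    (x + 1#) + (- 1# - y)    ≈⟨ +-assoc x 1# _ ⟩
    x + (1# + (- 1# - y))    ≈⟨ +-congˡ (sym (+-assoc 1# (- 1#) (- y))) ⟩
    x + ((1# - 1#) - y)      ≈⟨ +-congˡ (trans (+-congʳ (-‿inverseʳ 1#)) (+-identityˡ (- y))) ⟩
    x - y                    ∎

  ι-⊖ : ∀ m n → ι (m ⊖ n) ≈ m × 1# - n × 1#
  ι-⊖ zero    zero    = sym (-‿inverseʳ 0#)
  ι-⊖ zero    (suc n) = sym (+-identityˡ _)
  ι-⊖ (suc m) zero    = sym (trans (+-congˡ ε⁻¹≈ε) (+-identityʳ _))
  ι-⊖ (suc m) (suc n) = begin
    ι (suc m ⊖ suc n)              ≡⟨ ≡.cong ι (ℤ.[1+m]⊖[1+n]≡m⊖n m n) ⟩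
    ι (m ⊖ n)                      ≈⟨ ι-⊖ m n ⟩
    m × 1# - n × 1#                ≈⟨ cancel-1 _ _ ⟨
    (1# + m × 1#) - (1# + n × 1#)  ≈⟨ +-cong (1+× m 1#) (-‿cong (1+× n 1#)) ⟨
    suc m × 1# - suc n × 1#        ∎

  ι-+ : ∀ i j → ι (i ℤ.+ j) ≈ ι i + ι j
  ι-+ (+ m)    (+ n)    = ×-homo-+ 1# m n
  ι-+ (+ m)    -[1+ n ] = ι-⊖ m (suc n)
  ι-+ -[1+ m ] (+ n)    = trans (ι-⊖ n (suc m)) (+-comm _ _)
  ι-+ -[1+ m ] -[1+ n ] = begin
    - (suc (suc (m ℕ.+ n)) × 1#)       ≡⟨ ≡.cong (λ k → - (suc k × 1#)) (≡.sym (ℕ-+-suc m n)) ⟩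
    - ((suc m ℕ.+ suc n) × 1#)         ≈⟨ -‿cong (×-homo-+ 1# (suc m) (suc n)) ⟩
    - (suc m × 1# + suc n × 1#)        ≈⟨ ⁻¹-∙-comm _ _ ⟨
    - (suc m × 1#) - (suc n × 1#)      ∎
    where open import Data.Nat.Properties using () renaming (+-suc to ℕ-+-suc)

  ι-*⁺ : ∀ m j → ι (+ m ℤ.* j) ≈ ι (+ m) * ι j
  ι-*⁺ m (+ n)    = trans (reflexive (≡.cong ι (≡.sym (ℤ.pos-* m n)))) (×1-homo-* m n)
  ι-*⁺ m -[1+ n ] = begin
    ι (+ m ℤ.* -[1+ n ])       ≡⟨ ≡.cong ι (ℤ.neg-distribʳ-* (+ m) (+ suc n)) ⟨
    ι (ℤ.- (+ m ℤ.* + suc n))  ≈⟨ ι-neg (+ m ℤ.* + suc n) ⟩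
    - ι (+ m ℤ.* + suc n)      ≈⟨ -‿cong (ι-*⁺ m (+ suc n)) ⟩
    - (ι (+ m) * ι (+ suc n))  ≈⟨ -‿distribʳ-* _ _ ⟩
    ι (+ m) * ι -[1+ n ]       ∎

  ι-* : ∀ i j → ι (i ℤ.* j) ≈ ι i * ι j
  ι-* (+ m)    j = ι-*⁺ m j
  ι-* -[1+ m ] j = begin
    ι (-[1+ m ] ℤ.* j)         ≡⟨ ≡.cong ι (ℤ.neg-distribˡ-* (+ suc m) j) ⟨
    ι (ℤ.- (+ suc m ℤ.* j))    ≈⟨ ι-neg (+ suc m ℤ.* j) ⟩
    - ι (+ suc m ℤ.* j)        ≈⟨ -‿cong (ι-*⁺ (suc m) j) ⟩
    - (ι (+ suc m) * ι j)      ≈⟨ -‿distribˡ-* _ _ ⟩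
    ι -[1+ m ] * ι j           ∎

  ι-morphism : ℤ.+-*-rawRing -Raw-AlmostCommutative⟶ fromCommutativeRing R
  ι-morphism = record
    { ⟦_⟧    = ι
    ; +-homo = ι-+
    ; *-homo = ι-*
    ; -‿homo = ι-neg
    ; 0-homo = refl
    ; 1-homo = refl
    }

  _ι≟_ : ∀ i j → Maybe (ι i ≈ ι j)
  i ι≟ j = map (λ i≡j → reflexive (≡.cong ι i≡j)) (dec⇒maybe (i ℤ.≟ j))

  open import Algebra.Solver.Ring ℤ.+-*-rawRing (fromCommutativeRing R) ι-morphism _ι≟_ public
    using (solve; Polynomial; con; _:+_; _:*_; _:-_; :-_; _:^_; _:=_)

  infix 10 #_
  #_ : ∀ {n} → ℕ → Polynomial n
  # k = con (+ k)

-- The ring of formal power series.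

module PowerSeries (R : CommutativeRing 0ℓ 0ℓ) where
  open import Data.Integer.Base using (+_)
  open import Data.Nat.Base using (zero; suc)
  open import Data.Product.Base using (_,_)
  open import Function.Base using (_∘_)
  open import Defs using (seriesRing)
  open CommutativeRing R
  open import Relation.Binary.Reasoning.Setoid setoid
  module S = RawRing (seriesRing rawRing)
  open IntegerCoefficients R using (solve; #_; _:+_; _:*_; _:=_)

  infixr 7 _·_
  _·_ : Carrier → S.Carrier → S.Carrier
  (x · a) n = x * a n

  tail : S.Carrier → S.Carrier
  tail a n = a (suc n)

  *-head : ∀ a b → (a S.* b) 0 ≈ a 0 * b 0
  *-head a b = +-identityʳ (a 0 * b 0)

  -- The convolution unfolds definitionally along its second factor, to
  -- `a (suc n) * b 0 + (a * tail b) n`. This is the companion recursion along the first factor;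
  -- with both at hand the ring laws become inductions on the coefficient.
  *-tail : ∀ a b n → (a S.* b) (suc n) ≈ (tail a S.* b) n + a 0 * b (suc n)
  *-tail a b zero    = solve 2 (λ x y → x :+ (y :+ # 0) := (x :+ # 0) :+ y) refl _ _
  *-tail a b (suc n) = begin
    a (suc (suc n)) * b 0 + (a S.* tail b) (suc n)                     ≈⟨ +-congˡ (*-tail a (tail b) n) ⟩
    a (suc (suc n)) * b 0 + ((tail a S.* tail b) n + a 0 * b (suc (suc n)))  ≈⟨ +-assoc _ _ _ ⟨
    (tail a S.* b) (suc n) + a 0 * b (suc (suc n))                     ∎

  S-cong : ∀ {a a′ b b′} → a S.≈ a′ → b S.≈ b′ → a S.* b S.≈ a′ S.* b′
  S-cong e e′ zero    = +-congʳ (*-cong (e 0) (e′ 0))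
  S-cong e e′ (suc n) = +-cong (*-cong (e (suc n)) (e′ 0)) (S-cong e (e′ ∘ suc) n)

  S-comm : ∀ a b → a S.* b S.≈ b S.* a
  S-comm a b zero    = +-congʳ (*-comm _ _)
  S-comm a b (suc n) = begin
    a (suc n) * b 0 + (a S.* tail b) n   ≈⟨ +-cong (*-comm _ _) (S-comm a (tail b) n) ⟩
    b 0 * a (suc n) + (tail b S.* a) n   ≈⟨ +-comm _ _ ⟩
    (tail b S.* a) n + b 0 * a (suc n)   ≈⟨ *-tail b a n ⟨
    (b S.* a) (suc n)                    ∎

  S-distribˡ : ∀ a b c → a S.* (b S.+ c) S.≈ a S.* b S.+ a S.* c
  S-distribˡ a b c zero    = solve 3 (λ x y z → x :* (y :+ z) :+ # 0 := (x :* y :+ # 0) :+ (x :* z :+ # 0)) refl _ _ _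
  S-distribˡ a b c (suc n) = begin
    a (suc n) * (b 0 + c 0) + (a S.* (tail b S.+ tail c)) n             ≈⟨ +-congˡ (S-distribˡ a (tail b) (tail c) n) ⟩
    a (suc n) * (b 0 + c 0) + ((a S.* tail b) n + (a S.* tail c) n)     ≈⟨ solve 5 (λ x y z u v → x :* (y :+ z) :+ (u :+ v) := (x :* y :+ u) :+ (x :* z :+ v)) refl _ _ _ _ _ ⟩
    (a S.* b) (suc n) + (a S.* c) (suc n)                               ∎

  S-distribʳ : ∀ a b c → (b S.+ c) S.* a S.≈ b S.* a S.+ c S.* a
  S-distribʳ a b c n = trans (S-comm (b S.+ c) a n) (trans (S-distribˡ a b c n) (+-cong (S-comm a b n) (S-comm a c n)))

  ·-* : ∀ x a b → a S.* (x · b) S.≈ x · (a S.* b)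
  ·-* x a b zero    = solve 3 (λ x y z → y :* (x :* z) :+ # 0 := x :* (y :* z :+ # 0)) refl _ _ _
  ·-* x a b (suc n) = begin
    a (suc n) * (x * b 0) + (a S.* (x · tail b)) n       ≈⟨ +-congˡ (·-* x a (tail b) n) ⟩
    a (suc n) * (x * b 0) + x * (a S.* tail b) n         ≈⟨ solve 4 (λ x y z u → y :* (x :* z) :+ x :* u := x :* (y :* z :+ u)) refl _ _ _ _ ⟩
    x * (a S.* b) (suc n)                                ∎

  S-assoc : ∀ a b c → (a S.* b) S.* c S.≈ a S.* (b S.* c)
  S-assoc a b c zero    = solve 3 (λ x y z → (x :* y :+ # 0) :* z :+ # 0 := x :* (y :* z :+ # 0) :+ # 0) refl _ _ _
  S-assoc a b c (suc n) = begin
    (a (suc n) * b 0 + (a S.* tail b) n) * c 0 + ((a S.* b) S.* tail c) n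
      ≈⟨ +-congˡ (S-assoc a b (tail c) n) ⟩
    (a (suc n) * b 0 + (a S.* tail b) n) * c 0 + (a S.* (b S.* tail c)) n
      ≈⟨ solve 5 (λ x y z u v → (x :* y :+ u) :* z :+ v := x :* (y :* z :+ # 0) :+ (z :* u :+ v)) refl _ _ _ _ _ ⟩
    a (suc n) * (b S.* c) 0 + (c 0 * (a S.* tail b) n + (a S.* (b S.* tail c)) n)
      ≈⟨ +-congˡ (+-congʳ (·-* (c 0) a (tail b) n)) ⟨
    a (suc n) * (b S.* c) 0 + ((a S.* (c 0 · tail b)) n + (a S.* (b S.* tail c)) n)
      ≈⟨ +-congˡ (S-distribˡ a (c 0 · tail b) (b S.* tail c) n) ⟨
    a (suc n) * (b S.* c) 0 + (a S.* ((c 0 · tail b) S.+ (b S.* tail c))) n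
      -- `c 0 · tail b + b * tail c` is the tail of `b * c`, which restores a convolution with `a`.
      ≈⟨ +-congˡ (S-cong {a} {a} {_} {tail (b S.* c)} (λ _ → refl) (λ m → +-congʳ (*-comm (c 0) (b (suc m)))) n) ⟩
    (a S.* (b S.* c)) (suc n) ∎

  S-zero : ∀ a → a S.* S.0# S.≈ S.0#
  S-zero a zero    = trans (+-identityʳ _) (zeroʳ _)
  S-zero a (suc n) = trans (+-cong (zeroʳ _) (S-zero a n)) (+-identityʳ 0#)

  S-identityʳ : ∀ a → a S.* S.1# S.≈ a
  S-identityʳ a zero    = trans (+-identityʳ _) (*-identityʳ _)
  S-identityʳ a (suc n) = trans (+-cong (*-identityʳ _) (S-zero a n)) (+-identityʳ _)

  series : CommutativeRing 0ℓ 0ℓ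
  series = record
    { Carrier = S.Carrier ; _≈_ = S._≈_ ; _+_ = S._+_ ; _*_ = S._*_ ; -_ = S.-_ ; 0# = S.0# ; 1# = S.1#
    ; isCommutativeRing = record
      { isRing = record
        { +-isAbelianGroup = record
          { isGroup = record
            { isMonoid = record
              { isSemigroup = record
                { isMagma = record
                  { isEquivalence = record
                    { refl = λ _ → refl ; sym = λ e n → sym (e n) ; trans = λ e e′ n → trans (e n) (e′ n) }
                  ; ∙-cong = λ e e′ n → +-cong (e n) (e′ n)
                  }
                ; assoc = λ a b c n → +-assoc (a n) (b n) (c n)
                }
              ; identity = (λ a n → +-identityˡ (a n)) , (λ a n → +-identityʳ (a n))
              }
            ; inverse = (λ a n → -‿inverseˡ (a n)) , (λ a n → -‿inverseʳ (a n))
            ; ⁻¹-cong = λ e n → -‿cong (e n)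
            }
          ; comm = λ a b n → +-comm (a n) (b n)
          }
        ; *-cong = λ {a} {a′} {b} {b′} → S-cong {a} {a′} {b} {b′}
        ; *-assoc = S-assoc
        ; *-identity = (λ a n → trans (S-comm S.1# a n) (S-identityʳ a n)) , S-identityʳ
        ; distrib = S-distribˡ , S-distribʳ
        }
      ; *-comm = S-comm
      }
    }

-- Finite sums and products indexed by natural numbers.

module FiniteSums (R : CommutativeRing 0ℓ 0ℓ) where
  open import Algebra.Properties.CommutativeSemigroup (CommutativeRing.+-commutativeSemigroup R) using (interchange)
  open import Algebra.Properties.AbelianGroup (CommutativeRing.+-abelianGroup R) using (ε⁻¹≈ε; ⁻¹-∙-comm)
  open import Data.Fin.Base using (toℕ; zero; suc)
  open import Data.Nat.Base as ℕ using (ℕ; zero; suc; _<_)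
  open import Data.Nat.Properties as ℕ using ()
  open import Function.Base using (_∘_)
  open CommutativeRing R
  open import Algebra.Definitions.RawMonoid +-rawMonoid using (sum)
  open import Algebra.Definitions.RawMonoid *-rawMonoid using () renaming (sum to product)
  open import Algebra.Properties.Semiring.Exp semiring using (_^_)
  open import Algebra.Properties.CommutativeSemiring.Exp commutativeSemiring using (^-distrib-*)

  -- The recursion splits off the last term, so that extending a partial sum or product is
  -- definitional; sums over `Fin` split off the first.
  ∑ ∏ : ℕ → (ℕ → Carrier) → Carrier
  ∑ zero    t = 0#
  ∑ (suc n) t = ∑ n t + t n
  ∏ zero    t = 1#
  ∏ (suc n) t = ∏ n t * t n

  ∑-cong : ∀ n {s t} → (∀ i → i < n → s i ≈ t i) → ∑ n s ≈ ∑ n t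
  ∑-cong zero    e = refl
  ∑-cong (suc n) e = +-cong (∑-cong n λ i i<n → e i (ℕ.m<n⇒m<1+n i<n)) (e n ℕ.≤-refl)

  ∏-cong : ∀ n {s t} → (∀ i → i < n → s i ≈ t i) → ∏ n s ≈ ∏ n t
  ∏-cong zero    e = refl
  ∏-cong (suc n) e = *-cong (∏-cong n λ i i<n → e i (ℕ.m<n⇒m<1+n i<n)) (e n ℕ.≤-refl)

  ∑-+ : ∀ n s t → ∑ n (λ i → s i + t i) ≈ ∑ n s + ∑ n t
  ∑-+ zero    s t = sym (+-identityʳ 0#)
  ∑-+ (suc n) s t = trans (+-congʳ (∑-+ n s t)) (interchange _ _ _ _)

  ∑-neg : ∀ n s → ∑ n (λ i → - s i) ≈ - ∑ n s
  ∑-neg zero    s = sym ε⁻¹≈ε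
  ∑-neg (suc n) s = trans (+-congʳ (∑-neg n s)) (⁻¹-∙-comm _ _)

  ∑-*ˡ : ∀ n x s → x * ∑ n s ≈ ∑ n (λ i → x * s i)
  ∑-*ˡ zero    x s = zeroʳ x
  ∑-*ˡ (suc n) x s = trans (distribˡ x _ _) (+-congʳ (∑-*ˡ n x s))

  ∑-0 : ∀ n {s} → (∀ i → i < n → s i ≈ 0#) → ∑ n s ≈ 0#
  ∑-0 zero    e = refl
  ∑-0 (suc n) e = trans (+-cong (∑-0 n λ i i<n → e i (ℕ.m<n⇒m<1+n i<n)) (e n ℕ.≤-refl)) (+-identityʳ 0#)

  ∏-* : ∀ n s t → ∏ n (λ i → s i * t i) ≈ ∏ n s * ∏ n t
  ∏-* zero    s t = sym (*-identityʳ 1#)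
  ∏-* (suc n) s t = trans (*-congʳ (∏-* n s t)) (*-interchange _ _ _ _)
    where open import Algebra.Properties.CommutativeSemigroup *-commutativeSemigroup using () renaming (interchange to *-interchange)

  ∑-head : ∀ n t → ∑ (suc n) t ≈ t 0 + ∑ n (t ∘ suc)
  ∑-head zero    t = +-comm _ _
  ∑-head (suc n) t = trans (+-congʳ (∑-head n t)) (+-assoc _ _ _)

  sum-∑ : ∀ n (t : ℕ → Carrier) → sum {n} (t ∘ toℕ) ≈ ∑ n t
  sum-∑ zero    t = refl
  sum-∑ (suc n) t = trans (+-congˡ (sum-∑ n (t ∘ suc))) (sym (∑-head n t))

  ∏-head : ∀ n t → ∏ (suc n) t ≈ t 0 * ∏ n (t ∘ suc)
  ∏-head zero    t = *-comm _ _
  ∏-head (suc n) t = trans (*-congʳ (∏-head n t)) (*-assoc _ _ _)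

  product-∏ : ∀ n (t : ℕ → Carrier) → product {n} (t ∘ toℕ) ≈ ∏ n t
  product-∏ zero    t = refl
  product-∏ (suc n) t = trans (*-congˡ (product-∏ n (t ∘ suc))) (sym (∏-head n t))

  ∏-^ : ∀ n t k → ∏ n (λ i → t i ^ k) ≈ ∏ n t ^ k
  ∏-^ zero    t k = sym (1^ k)
    where
    1^ : ∀ k → 1# ^ k ≈ 1#
    1^ zero    = refl
    1^ (suc k) = trans (*-identityˡ _) (1^ k)
  ∏-^ (suc n) t k = trans (*-congʳ (∏-^ n t k)) (sym (^-distrib-* (∏ n t) (t n) k))

  ∑-swap : ∀ m n (t : ℕ → ℕ → Carrier) → ∑ m (λ i → ∑ n (t i)) ≈ ∑ n (λ j → ∑ m (λ i → t i j))
  ∑-swap zero    n t = sym (∑-0 n λ _ _ → refl)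
  ∑-swap (suc m) n t = trans (+-congʳ (∑-swap m n t)) (sym (∑-+ n _ _))

-- Finite forms of Gauss's product formulas for two theta functions.

module GaussIdentities (R : CommutativeRing 0ℓ 0ℓ) (x : CommutativeRing.Carrier R) where
  open import Algebra.Properties.Semiring.Exp (CommutativeRing.semiring R) using (_^_; ^-homo-*; ^-congʳ)
  open import Data.Integer.Base using (+_)
  open import Data.Nat.Base as ℕ using (ℕ; zero; suc)
  open import Data.Nat.Properties as ℕ using ()
  open CommutativeRing R
  open IntegerCoefficients R
  open FiniteSums R
  open import Relation.Binary.Reasoning.Setoid setoid

  ^-*-+ : ∀ m k n → x ^ (m ℕ.* (k ℕ.+ n)) ≈ x ^ (m ℕ.* k) * x ^ (m ℕ.* n)
  ^-*-+ m k n = trans (^-congʳ x (ℕ.*-distribˡ-+ m k n)) (^-homo-* x (m ℕ.* k) (m ℕ.* n))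

  alternating : ℕ → Carrier
  alternating zero    = 1#
  alternating (suc n) = - alternating n

  -- Partial sums of ∑ (-1)ˢ x^(s²) over |s| ≤ n and of ∑ x^(t(t+1)/2) over t < 2n: the exponents
  -- s(2s+1) and (s+1)(2s+1) belong to t = 2s and t = 2s + 1.
  square-theta triangular-theta : ℕ → Carrier
  square-theta n = 1# + ∑ n λ s → ι (+ 2) * (alternating (suc s) * x ^ (suc s ℕ.* suc s))
  triangular-theta n = ∑ n λ s → x ^ (s ℕ.* suc (s ℕ.* 2)) + x ^ (suc s ℕ.* suc (s ℕ.* 2))

  ∏₊ ∏₋ odd∏₋ even∏₋ : ℕ → Carrier
  ∏₊ n = ∏ n λ s → 1# + x ^ suc s
  ∏₋ n = ∏ n λ s → 1# - x ^ suc s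
  odd∏₋ n = ∏ n λ s → 1# - x ^ suc (s ℕ.* 2)
  even∏₋ n = ∏ n λ s → 1# - x ^ (suc s ℕ.* 2)

  -- Here z s is (-1)ˢ times the product of 1 + xᵏ over k < s divided by the product of 1 - xᵏ over
  -- 1 ≤ k ≤ s. It is given by its recurrence because `R` has no division.
  module Square (z : ℕ → Carrier) (z₀ : z 0 ≈ 1#)
    (z-step : ∀ s → z (suc s) * (1# - x ^ suc s) ≈ - (z s * (1# + x ^ s))) where

    partial : ℕ → ℕ → Carrier
    partial m c = ∑ m λ s → z s * x ^ (s ℕ.* c)

    -- The full series F(c) = ∑ z s x^(sc) is a q-binomial series with (1 - xᶜ) F(c+1) = (1 + xᶜ)
    -- F(c). Cutting it off after m terms leaves the boundary term on the right.
    telescope : ∀ c m → (1# - x ^ c) * partial m (suc c) - (1# + x ^ c) * partial m c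
                          ≈ z m * x ^ (m ℕ.* c) * (1# - x ^ m)
    telescope c zero = solve 2 (λ z a → (# 1 :- a) :* # 0 :- (# 1 :+ a) :* # 0
      := z :* # 1 :* (# 1 :- # 1)) refl (z 0) (x ^ c)
    telescope c (suc m) = begin
      (1# - a) * (P + z m * x ^ (m ℕ.* suc c)) - (1# + a) * (Q + z m * u)
        ≈⟨ +-congʳ (*-congˡ (+-congˡ (*-congˡ (trans (^-*-+ m 1 c) (*-congʳ (^-congʳ x (ℕ.*-identityʳ m))))))) ⟩
      (1# - a) * (P + z m * (b * u)) - (1# + a) * (Q + z m * u)
        ≈⟨ solve 6 (λ a b u z P Q → (# 1 :- a) :* (P :+ z :* (b :* u)) :- (# 1 :+ a) :* (Q :+ z :* u)
             := ((# 1 :- a) :* P :- (# 1 :+ a) :* Q) :+ z :* ((# 1 :- a) :* b :- (# 1 :+ a)) :* u) refl a b u (z m) P Q ⟩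
      ((1# - a) * P - (1# + a) * Q) + z m * ((1# - a) * b - (1# + a)) * u
        ≈⟨ +-congʳ (telescope c m) ⟩
      z m * u * (1# - b) + z m * ((1# - a) * b - (1# + a)) * u
        ≈⟨ solve 4 (λ a b u z → z :* u :* (# 1 :- b) :+ z :* ((# 1 :- a) :* b :- (# 1 :+ a)) :* u
             := (:- (z :* (# 1 :+ b))) :* (a :* u)) refl a b u (z m) ⟩
      - (z m * (1# + b)) * (a * u)
        ≈⟨ *-cong (sym (z-step m)) (sym (^-homo-* x c (m ℕ.* c))) ⟩
      z (suc m) * (1# - x ^ suc m) * x ^ (suc m ℕ.* c)
        ≈⟨ solve 3 (λ z d u → z :* d :* u := z :* u :* d) refl _ _ _ ⟩
      z (suc m) * x ^ (suc m ℕ.* c) * (1# - x ^ suc m) ∎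
      where
      a = x ^ c
      b = x ^ m
      u = x ^ (m ℕ.* c)
      P = partial m (suc c)
      Q = partial m c

    -- The denominators of `z (suc n)` are cleared; the 2 is the factor 1 + x⁰ of its numerator.
    z-closed : ∀ n → z (suc n) * (1# - x ^ suc n) * ∏₋ n ≈ ι (+ 2) * alternating (suc n) * ∏₊ n
    z-closed zero = trans (*-congʳ (trans (z-step 0) (-‿cong (*-congʳ z₀))))
      (solve 0 ((:- (# 1 :* (# 1 :+ # 1))) :* # 1 := # 2 :* (:- # 1) :* # 1) refl)
    z-closed (suc n) = begin
      z (suc (suc n)) * (1# - x ^ suc (suc n)) * (∏₋ n * (1# - b))
        ≈⟨ *-congʳ (z-step (suc n)) ⟩
      - (z (suc n) * (1# + b)) * (∏₋ n * (1# - b))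
        ≈⟨ solve 3 (λ z b e → (:- (z :* (# 1 :+ b))) :* (e :* (# 1 :- b)) := (:- (z :* (# 1 :- b) :* e)) :* (# 1 :+ b)) refl (z (suc n)) b (∏₋ n) ⟩
      - (z (suc n) * (1# - b) * ∏₋ n) * (1# + b)
        ≈⟨ *-congʳ (-‿cong (z-closed n)) ⟩
      - (ι (+ 2) * alternating (suc n) * ∏₊ n) * (1# + b)
        ≈⟨ solve 3 (λ s d b → (:- (# 2 :* s :* d)) :* b := # 2 :* (:- s) :* (d :* b)) refl (alternating (suc n)) (∏₊ n) (1# + b) ⟩
      ι (+ 2) * - alternating (suc n) * (∏₊ n * (1# + b)) ∎
      where b = x ^ suc n

    -- A finite form of Gauss's formula in the manner of Shanks. The exponent c = n + 1 grows
    -- together with n: `telescope` trades `S` for `L`, and its boundary term combines with the new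
    -- summand, through `z-closed`, to the next term of the theta series. As n grows the sum on the
    -- left tends to 1.
    identity : ∀ n → ∏₋ n * partial (suc n) (suc n) ≈ ∏₊ n * square-theta n
    identity zero = trans (*-congˡ (+-congˡ (*-congʳ z₀)))
      (solve 0 (# 1 :* (# 0 :+ # 1 :* # 1) := # 1 :* (# 1 :+ # 0)) refl)
    identity (suc n) = begin
      ∏₋ n * (1# - a) * (S + z (suc n) * x ^ (suc n ℕ.* suc (suc n)))
        ≈⟨ *-congˡ (+-congˡ (*-congˡ (trans (^-*-+ (suc n) 1 (suc n)) (*-congʳ (^-congʳ x (ℕ.*-identityʳ (suc n))))))) ⟩
      ∏₋ n * (1# - a) * (S + z (suc n) * (a * v))
        ≈⟨ solve 6 (λ e a S z v L → e :* (# 1 :- a) :* (S :+ z :* (a :* v)) := e :* (((# 1 :- a) :* S :- (# 1 :+ a) :* L)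
             :+ (# 1 :+ a) :* L :+ (# 1 :- a) :* z :* (a :* v))) refl (∏₋ n) a S (z (suc n)) v L ⟩
      ∏₋ n * (((1# - a) * S - (1# + a) * L) + (1# + a) * L + (1# - a) * z (suc n) * (a * v))
        ≈⟨ *-congˡ (+-congʳ (+-congʳ (telescope (suc n) (suc n)))) ⟩
      ∏₋ n * (z (suc n) * v * (1# - a) + (1# + a) * L + (1# - a) * z (suc n) * (a * v))
        ≈⟨ solve 5 (λ e a z v L → e :* (z :* v :* (# 1 :- a) :+ (# 1 :+ a) :* L :+ (# 1 :- a) :* z :* (a :* v))
             := (# 1 :+ a) :* (e :* L :+ (z :* (# 1 :- a) :* e) :* v)) refl (∏₋ n) a (z (suc n)) v L ⟩
      (1# + a) * (∏₋ n * L + (z (suc n) * (1# - a) * ∏₋ n) * v)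
        ≈⟨ *-congˡ (+-cong (identity n) (*-congʳ (z-closed n))) ⟩
      (1# + a) * (∏₊ n * (1# + Y) + (ι (+ 2) * alternating (suc n) * ∏₊ n) * v)
        ≈⟨ solve 5 (λ a d Y s v → (# 1 :+ a) :* (d :* (# 1 :+ Y) :+ (# 2 :* s :* d) :* v)
             := d :* (# 1 :+ a) :* (# 1 :+ (Y :+ # 2 :* (s :* v)))) refl a (∏₊ n) Y (alternating (suc n)) v ⟩
      ∏₊ n * (1# + a) * (1# + (Y + ι (+ 2) * (alternating (suc n) * v)))
        ≈⟨ refl ⟩
      ∏₊ (suc n) * square-theta (suc n) ∎
      where
      a = x ^ suc n
      v = x ^ (suc n ℕ.* suc n)
      S = partial (suc n) (suc (suc n))
      L = partial (suc n) (suc n)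
      Y = ∑ n λ s → ι (+ 2) * (alternating (suc s) * x ^ (suc s ℕ.* suc s))

  -- Here y s is the product of (1 - x^(2k-1)) / (1 - x^(2k)) over 1 ≤ k ≤ s, again given without
  -- division.
  module Triangular (y : ℕ → Carrier) (y₀ : y 0 ≈ 1#)
    (y-step : ∀ s → y (suc s) * (1# - x ^ (suc s ℕ.* 2)) ≈ y s * (1# - x ^ suc (s ℕ.* 2))) where

    partial : ℕ → ℕ → Carrier
    partial m c = ∑ m λ s → y s * x ^ (s ℕ.* c)

    -- The same functional equation for base x², whence the exponent c moves by 2.
    telescope : ∀ c m → (1# - x ^ suc c) * partial m (suc (suc c)) - (1# - x ^ c) * partial m c
                          ≈ y m * x ^ (m ℕ.* c) * (1# - x ^ (m ℕ.* 2))
    telescope c zero = solve 3 (λ y a b → (# 1 :- a) :* # 0 :- (# 1 :- b) :* # 0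
      := y :* # 1 :* (# 1 :- # 1)) refl (y 0) (x ^ suc c) (x ^ c)
    telescope c (suc m) = begin
      (1# - x * a) * (P + y m * x ^ (m ℕ.* suc (suc c))) - (1# - a) * (Q + y m * u)
        ≈⟨ +-congʳ (*-congˡ (+-congˡ (*-congˡ (^-*-+ m 2 c)))) ⟩
      (1# - x * a) * (P + y m * (b * u)) - (1# - a) * (Q + y m * u)
        ≈⟨ solve 7 (λ x a b u y P Q → (# 1 :- x :* a) :* (P :+ y :* (b :* u)) :- (# 1 :- a) :* (Q :+ y :* u)
             := ((# 1 :- x :* a) :* P :- (# 1 :- a) :* Q) :+ y :* ((# 1 :- x :* a) :* b :- (# 1 :- a)) :* u) refl x a b u (y m) P Q ⟩
      ((1# - x * a) * P - (1# - a) * Q) + y m * ((1# - x * a) * b - (1# - a)) * u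
        ≈⟨ +-congʳ (telescope c m) ⟩
      y m * u * (1# - b) + y m * ((1# - x * a) * b - (1# - a)) * u
        ≈⟨ solve 5 (λ x a b u y → y :* u :* (# 1 :- b) :+ y :* ((# 1 :- x :* a) :* b :- (# 1 :- a)) :* u
             := y :* (# 1 :- x :* b) :* (a :* u)) refl x a b u (y m) ⟩
      y m * (1# - x * b) * (a * u)
        ≈⟨ *-cong (sym (y-step m)) (sym (^-homo-* x c (m ℕ.* c))) ⟩
      y (suc m) * (1# - x ^ (suc m ℕ.* 2)) * x ^ (suc m ℕ.* c)
        ≈⟨ solve 3 (λ z d u → z :* d :* u := z :* u :* d) refl _ _ _ ⟩
      y (suc m) * x ^ (suc m ℕ.* c) * (1# - x ^ (suc m ℕ.* 2)) ∎
      where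
      a = x ^ c
      b = x ^ (m ℕ.* 2)
      u = x ^ (m ℕ.* c)
      P = partial m (suc (suc c))
      Q = partial m c

    y-closed : ∀ n → y n * even∏₋ n ≈ odd∏₋ n
    y-closed zero    = trans (*-identityʳ _) y₀
    y-closed (suc n) = begin
      y (suc n) * (even∏₋ n * (1# - b))     ≈⟨ solve 3 (λ y e b → y :* (e :* b) := (y :* b) :* e) refl _ _ _ ⟩
      y (suc n) * (1# - b) * even∏₋ n       ≈⟨ *-congʳ (y-step n) ⟩
      y n * (1# - x ^ suc (n ℕ.* 2)) * even∏₋ n ≈⟨ solve 3 (λ y b e → (y :* b) :* e := y :* e :* b) refl _ _ _ ⟩
      y n * even∏₋ n * (1# - x ^ suc (n ℕ.* 2)) ≈⟨ *-congʳ (y-closed n) ⟩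
      odd∏₋ n * (1# - x ^ suc (n ℕ.* 2))    ∎
      where b = x ^ (suc n ℕ.* 2)

    -- Shanks's finite identity. In the step, the boundary term and the new summand produce `u` and
    -- `x ^ c * u`, the triangular powers of index 2n and 2n + 1.
    identity : ∀ n → even∏₋ n * partial n (suc (n ℕ.* 2)) ≈ odd∏₋ n * triangular-theta n
    identity zero = refl
    identity (suc n) = begin
      even∏₋ n * (1# - x * (x * b)) * (S + y n * x ^ (n ℕ.* suc (suc (suc (n ℕ.* 2)))))
        ≈⟨ *-congˡ (+-congˡ (*-congˡ (^-*-+ n 2 c))) ⟩
      even∏₋ n * (1# - x * (x * b)) * (S + y n * (b * u))
        ≈⟨ solve 7 (λ e x b S y u L → e :* (# 1 :- x :* (x :* b)) :* (S :+ y :* (b :* u))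
             := e :* (((# 1 :- x :* (x :* b)) :* S :- (# 1 :- x :* b) :* L) :+ (# 1 :- x :* b) :* L :+ (# 1 :- x :* (x :* b)) :* (y :* (b :* u))))
             refl (even∏₋ n) x b S (y n) u L ⟩
      even∏₋ n * (((1# - x * (x * b)) * S - (1# - x * b) * L) + (1# - x * b) * L + (1# - x * (x * b)) * (y n * (b * u)))
        ≈⟨ *-congˡ (+-congʳ (+-congʳ (telescope c n))) ⟩
      even∏₋ n * (y n * u * (1# - b) + (1# - x * b) * L + (1# - x * (x * b)) * (y n * (b * u)))
        ≈⟨ solve 6 (λ e x b y u L → e :* (y :* u :* (# 1 :- b) :+ (# 1 :- x :* b) :* L :+ (# 1 :- x :* (x :* b)) :* (y :* (b :* u)))
             := (# 1 :- x :* b) :* (e :* L :+ (y :* e) :* (u :+ x :* b :* u))) refl (even∏₋ n) x b (y n) u L ⟩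
      (1# - x * b) * (even∏₋ n * L + (y n * even∏₋ n) * (u + x * b * u))
        ≈⟨ *-congˡ (+-cong (identity n) (*-cong (y-closed n) (+-congˡ (sym (^-homo-* x c (n ℕ.* c)))))) ⟩
      (1# - x * b) * (odd∏₋ n * triangular-theta n + odd∏₋ n * (u + x ^ (suc n ℕ.* c)))
        ≈⟨ solve 4 (λ b o t u → b :* (o :* t :+ o :* u) := o :* b :* (t :+ u)) refl _ _ _ _ ⟩
      odd∏₋ n * (1# - x * b) * (triangular-theta n + (u + x ^ (suc n ℕ.* c))) ∎
      where
      c = suc (n ℕ.* 2)
      b = x ^ (n ℕ.* 2)
      u = x ^ (n ℕ.* c)
      S = partial n (suc (suc c))
      L = partial n c

-- Ring endomorphisms, to be used for q ↦ q² and q ↦ - q.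

module Endomorphisms (R : CommutativeRing 0ℓ 0ℓ) where
  open import Data.Integer.Base as ℤ using (ℤ; +_)
  open import Data.Nat.Base using (zero; suc)
  open CommutativeRing R
  open IntegerCoefficients R using (ι)
  open FiniteSums R
  open import Algebra.Properties.Semiring.Exp semiring using (_^_)

  record Endomorphism : Set where
    field
      ⟦_⟧      : Carrier → Carrier
      cong     : ∀ {a b} → a ≈ b → ⟦ a ⟧ ≈ ⟦ b ⟧
      homo-+   : ∀ a b → ⟦ a + b ⟧ ≈ ⟦ a ⟧ + ⟦ b ⟧
      homo-*   : ∀ a b → ⟦ a * b ⟧ ≈ ⟦ a ⟧ * ⟦ b ⟧
      homo-neg : ∀ a → ⟦ - a ⟧ ≈ - ⟦ a ⟧
      homo-1   : ⟦ 1# ⟧ ≈ 1#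
      homo-0   : ⟦ 0# ⟧ ≈ 0#

    homo-^ : ∀ a n → ⟦ a ^ n ⟧ ≈ ⟦ a ⟧ ^ n
    homo-^ a zero    = homo-1
    homo-^ a (suc n) = trans (homo-* a (a ^ n)) (*-congˡ (homo-^ a n))

    homo-∏ : ∀ n t → ⟦ ∏ n t ⟧ ≈ ∏ n (λ s → ⟦ t s ⟧)
    homo-∏ zero    t = homo-1
    homo-∏ (suc n) t = trans (homo-* _ _) (*-congʳ (homo-∏ n t))

    homo-∑ : ∀ n t → ⟦ ∑ n t ⟧ ≈ ∑ n (λ s → ⟦ t s ⟧)
    homo-∑ zero    t = homo-0
    homo-∑ (suc n) t = trans (homo-+ _ _) (+-congʳ (homo-∑ n t))

    homo-ι⁺ : ∀ n → ⟦ ι (+ n) ⟧ ≈ ι (+ n)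
    homo-ι⁺ zero          = homo-0
    homo-ι⁺ (suc zero)    = homo-1
    homo-ι⁺ (suc (suc n)) = trans (homo-+ _ _) (+-cong (homo-ι⁺ (suc n)) homo-1)

    homo-ι : ∀ k → ⟦ ι k ⟧ ≈ ι k
    homo-ι (+ n)          = homo-ι⁺ n
    homo-ι (ℤ.-[1+_] n)   = trans (homo-neg _) (-‿cong (homo-ι⁺ (suc n)))

    homo-ι* : ∀ k a → ⟦ ι k * a ⟧ ≈ ι k * ⟦ a ⟧
    homo-ι* k a = trans (homo-* (ι k) a) (*-congʳ (homo-ι k))

    homo-1- : ∀ a → ⟦ 1# - a ⟧ ≈ 1# - ⟦ a ⟧
    homo-1- a = trans (homo-+ 1# (- a)) (+-cong homo-1 (homo-neg a))

  cancel-unit : ∀ {u a b c} → u * a ≈ 1# → a * b ≈ a * c → b ≈ c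
  cancel-unit {u} {a} {b} {c} inv e = trans (sym (undo b)) (trans (*-congˡ e) (undo c))
    where
    undo : ∀ b → u * (a * b) ≈ b
    undo b = trans (sym (*-assoc u a b)) (trans (*-congʳ inv) (*-identityˡ b))

-- Integral q-series: congruences mod qᴺ, limits, dilation, reflection and U.

module IntegralSeries where
  open import Data.Integer.Base as ℤ using (ℤ; +_; 0ℤ; 1ℤ)
  open import Data.Integer.Properties as ℤ using ()
  open import Data.Nat.Base as ℕ using (ℕ; zero; suc; _<_; _≤_; z≤n; s≤s)
  open import Data.Nat.Properties as ℕ using ()
  open import Data.Sum.Base using (inj₁; inj₂)
  open import Function.Base using (_∘_)
  open import Relation.Binary.PropositionalEquality as ≡ using (_≡_)
  open import Defs using (module ℤ[[q]])
  open ℤ[[q]] using (q; quotient; quotient-*) public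
  open import Algebra.Structures using (IsCommutativeRing)
  private
    module PS = PowerSeries ℤ.+-*-commutativeRing
    module S = CommutativeRing PS.series
  open PS public using (tail; _·_)

  -- Opaque, as unification would otherwise unfold the convolution sums.
  opaque
    _⊛_ : S.Carrier → S.Carrier → S.Carrier
    a ⊛ b = a S.* b

    ⊛-isCommutativeRing : IsCommutativeRing S._≈_ S._+_ _⊛_ (S.-_) S.0# S.1#
    ⊛-isCommutativeRing = S.isCommutativeRing

    ⊛≡* : ∀ a b → a ⊛ b ≡ a ℤ[[q]].* b
    ⊛≡* a b = ≡.refl

  series : CommutativeRing 0ℓ 0ℓ
  series = record { isCommutativeRing = ⊛-isCommutativeRing }

  open CommutativeRing series public hiding (zero)
  open IntegerCoefficients series public
  open FiniteSums series public
  open Endomorphisms series public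
  open import Algebra.Properties.Semiring.Exp semiring public using (_^_; ^-homo-*; ^-congʳ; ^-congˡ; ^-assocʳ)
  open import Algebra.Properties.CommutativeSemiring.Exp commutativeSemiring public using (^-distrib-*)
  opaque
    unfolding _⊛_

    *-head : ∀ a b → (a * b) 0 ≡ a 0 ℤ.* b 0
    *-head = PS.*-head

    *-tail : ∀ a b n → (a * b) (suc n) ≡ (tail a * b) n ℤ.+ a 0 ℤ.* b (suc n)
    *-tail = PS.*-tail

    *-suc : ∀ a b n → (a * b) (suc n) ≡ a (suc n) ℤ.* b 0 ℤ.+ (a * tail b) n
    *-suc a b n = ≡.refl

    ^≡^ : ∀ a n → a ^ n ≡ a ℤ[[q]].^ n
    ^≡^ a n = ≡.refl

    inverseˡ : ∀ a → a 0 ≡ 1ℤ → quotient 1# a * a ≈ 1#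
    inverseˡ a = quotient-* 1# a

  open import Algebra.Properties.Ring ring public using (-‿distribˡ-*)
  module ℤ-Sums = FiniteSums ℤ.+-*-commutativeRing
  open import Relation.Binary.Reasoning.Setoid setoid

  private
    module Z = IntegerCoefficients ℤ.+-*-commutativeRing

  infix 4 _≡[_]_
  -- Congruence mod qᴺ. A record rather than a function type, so that the two series can be
  -- recovered from the type of a proof.
  record _≡[_]_ (a : Carrier) (N : ℕ) (b : Carrier) : Set where
    constructor agree
    field
      below : ∀ n → n < N → a n ≡ b n
  open _≡[_]_ public

  module _ {N : ℕ} where
    ≈⇒≡[] : ∀ {a b} → a ≈ b → a ≡[ N ] b
    ≈⇒≡[] e = agree λ n _ → e n

    ≡[]-refl : ∀ a → a ≡[ N ] a
    ≡[]-refl a = agree λ _ _ → ≡.refl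

    ≡[]-trans : ∀ {a b c} → a ≡[ N ] b → b ≡[ N ] c → a ≡[ N ] c
    ≡[]-trans e e′ = agree λ n n<N → ≡.trans (below e n n<N) (below e′ n n<N)

    ≡[]-sym : ∀ {a b} → a ≡[ N ] b → b ≡[ N ] a
    ≡[]-sym e = agree λ n n<N → ≡.sym (below e n n<N)

    +-≡[] : ∀ {a a′ b b′} → a ≡[ N ] a′ → b ≡[ N ] b′ → a + b ≡[ N ] a′ + b′
    +-≡[] e e′ = agree λ n n<N → ≡.cong₂ ℤ._+_ (below e n n<N) (below e′ n n<N)

    *-≡[] : ∀ {a a′ b b′} → a ≡[ N ] a′ → b ≡[ N ] b′ → a * b ≡[ N ] a′ * b′
    *-≡[] {a} {a′} e e′ = agree λ n n<N → go n _ _ n<N λ m m≤n → below e′ m (ℕ.≤-<-trans m≤n n<N)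
      where
      -- Only the second factor varies: `*-suc` recurses into the tail of `b` and keeps `a`.
      go : ∀ n b b′ → n < N → (∀ m → m ≤ n → b m ≡ b′ m) → (a * b) n ≡ (a′ * b′) n
      go zero    b b′ n<N h = ≡.trans (*-head a b) (≡.trans (≡.cong₂ ℤ._*_ (below e 0 n<N) (h 0 z≤n)) (≡.sym (*-head a′ b′)))
      go (suc n) b b′ n<N h = ≡.trans (*-suc a b n) (≡.trans (≡.cong₂ ℤ._+_ (≡.cong₂ ℤ._*_ (below e (suc n) n<N) (h 0 z≤n))
        (go n (tail b) (tail b′) (ℕ.<-trans (ℕ.n<1+n n) n<N) λ m m≤n → h (suc m) (s≤s m≤n))) (≡.sym (*-suc a′ b′ n)))

    ≡[]-mono : ∀ {M a b} → N ≤ M → a ≡[ M ] b → a ≡[ N ] b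
    ≡[]-mono N≤M e = agree λ n n<N → below e n (ℕ.≤-trans n<N N≤M)

    ∑-≡[]-0 : ∀ n {t} → (∀ i → t i ≡[ N ] 0#) → ∑ n t ≡[ N ] 0#
    ∑-≡[]-0 zero    h = ≡[]-refl 0#
    ∑-≡[]-0 (suc n) h = ≡[]-trans (+-≡[] (∑-≡[]-0 n h) (h n)) (≈⇒≡[] (+-identityʳ 0#))

  q*-head : ∀ a → (q * a) 0 ≡ 0ℤ
  q*-head a = *-head q a

  q*-tail : ∀ a n → (q * a) (suc n) ≡ a n
  q*-tail a n = ≡.trans (*-tail q a n) (≡.trans (ℤ.+-identityʳ _) (≡.trans (q′ n) (*-identityˡ a n)))
    where
    q′ : tail q * a ≈ 1# * a
    q′ = *-congʳ {a} {tail q} {1#} λ { zero → ≡.refl ; (suc _) → ≡.refl }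

  q*-cancel : ∀ {a b} → q * a ≈ q * b → a ≈ b
  q*-cancel {a} {b} e n = ≡.trans (≡.sym (q*-tail a n)) (≡.trans (e (suc n)) (q*-tail b n))

  q^-≡[] : ∀ n a → a * q ^ n ≡[ n ] 0#
  q^-≡[] zero    a = agree λ _ ()
  q^-≡[] (suc n) a = ≡[]-trans (≈⇒≡[] (solve 3 (λ a x y → a :* (x :* y) := x :* (a :* y)) refl a q (q ^ n)))
    (agree λ { zero _ → q*-head (a * q ^ n) ; (suc m) (s≤s m<n) → ≡.trans (q*-tail _ m) (below (q^-≡[] n a) m m<n) })

  q^≥-≡[] : ∀ {N n} a → N ≤ n → a * q ^ n ≡[ N ] 0#
  q^≥-≡[] a N≤n = ≡[]-mono N≤n (q^-≡[] _ a)

  ι⁺-head : ∀ n → ι (+ n) 0 ≡ + n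
  ι⁺-head zero          = ≡.refl
  ι⁺-head (suc zero)    = ≡.refl
  ι⁺-head (suc (suc n)) = ≡.trans (≡.cong (ℤ._+ 1ℤ) (ι⁺-head (suc n))) (≡.cong +_ (ℕ.+-comm (suc n) 1))

  ι⁺-tail : ∀ m n → ι (+ m) (suc n) ≡ 0ℤ
  ι⁺-tail zero          n = ≡.refl
  ι⁺-tail (suc zero)    n = ≡.refl
  ι⁺-tail (suc (suc m)) n = ≡.trans (ℤ.+-identityʳ _) (ι⁺-tail (suc m) n)

  ι-head : ∀ k → ι k 0 ≡ k
  ι-head (+ n)        = ι⁺-head n
  ι-head (ℤ.-[1+_] n) = ≡.cong (ℤ.-_) (ι⁺-head (suc n))

  ι-tail : ∀ k n → ι k (suc n) ≡ 0ℤ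
  ι-tail (+ m)        n = ι⁺-tail m n
  ι-tail (ℤ.-[1+_] m) n = ≡.cong (ℤ.-_) (ι⁺-tail (suc m) n)

  ι*-coeff : ∀ k a n → (ι k * a) n ≡ k ℤ.* a n
  ι*-coeff k a zero    = ≡.trans (*-head (ι k) a) (≡.cong (ℤ._* a 0) (ι-head k))
  ι*-coeff k a (suc n) = ≡.trans (*-tail (ι k) a n)
    (≡.trans (≡.cong₂ ℤ._+_ zero-tail (≡.cong (ℤ._* a (suc n)) (ι-head k))) (ℤ.+-identityˡ _))
    where
    zero-tail : (tail (ι k) * a) n ≡ 0ℤ
    zero-tail = ≡.trans (*-congʳ {a} {tail (ι k)} {0#} (ι-tail k) n) (zeroˡ a n)

  inverse : Carrier → Carrier
  inverse = quotient 1#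

  -- The limit of a sequence x with x (N + 1) ≡ x N mod q^(N+1).
  lim : (ℕ → Carrier) → Carrier
  lim x m = x m m

  Coherent : (ℕ → Carrier) → Set
  Coherent x = ∀ N → x (suc N) ≡[ suc N ] x N

  lim-≡[] : ∀ {x} → Coherent x → ∀ N → lim x ≡[ suc N ] x N
  lim-≡[] {x} coh N = agree λ { m (s≤s m≤N) → go N m m≤N }
    where
    go : ∀ N m → m ≤ N → x m m ≡ x N m
    go N m m≤N with ℕ.m≤n⇒m<n∨m≡n m≤N
    ... | inj₂ ≡.refl = ≡.refl
    go (suc N) m m≤N | inj₁ (s≤s m≤N′) = ≡.trans (go N m m≤N′) (≡.sym (below (coh N) m (s≤s m≤N′)))

  coherent-∏ : ∀ {t} → (∀ s → t s ≡[ suc s ] 1#) → Coherent (λ n → ∏ n t)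
  coherent-∏ {t} h N = ≡[]-trans {b = ∏ N t * 1#} (*-≡[] {b = t N} (≡[]-refl (∏ N t)) (h N)) (≈⇒≡[] (*-identityʳ (∏ N t)))

  coherent-+ : ∀ (x : ℕ → Carrier) {e : ℕ → Carrier} → (∀ N → x (suc N) ≈ x N + e N) → (∀ N → e N ≡[ suc N ] 0#) → Coherent x
  coherent-+ x {e} s h N = ≡[]-trans {b = x N + e N} (≈⇒≡[] (s N)) (≡[]-trans {b = x N + 0#} (+-≡[] {a = x N} {x N} {e N} {0#} (≡[]-refl (x N)) (h N)) (≈⇒≡[] (+-identityʳ (x N))))

  -- Recursion by two coefficients at a time in place of the parity test of `dilate`, so that the
  -- homomorphism laws are inductions; `dilate≈dil` compares the two.
  dil : Carrier → Carrier
  dil a zero          = a 0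
  dil a (suc zero)    = 0ℤ
  dil a (suc (suc n)) = dil (tail a) n

  -- The substitution q ↦ - q.
  flip : Carrier → Carrier
  flip a zero    = a 0
  flip a (suc n) = ℤ.- flip (tail a) n

  dil-cong : ∀ {a b} → a ≈ b → dil a ≈ dil b
  dil-cong e zero          = e 0
  dil-cong e (suc zero)    = ≡.refl
  dil-cong e (suc (suc n)) = dil-cong (λ m → e (suc m)) n

  dil-+ : ∀ a b → dil (a + b) ≈ dil a + dil b
  dil-+ a b zero          = ≡.refl
  dil-+ a b (suc zero)    = ≡.refl
  dil-+ a b (suc (suc n)) = dil-+ (tail a) (tail b) n

  dil-neg : ∀ a → dil (- a) ≈ - dil a
  dil-neg a zero          = ≡.refl
  dil-neg a (suc zero)    = ≡.refl
  dil-neg a (suc (suc n)) = dil-neg (tail a) n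

  dil-· : ∀ k a → dil (k · a) ≈ k · dil a
  dil-· k a zero          = ≡.refl
  dil-· k a (suc zero)    = ≡.sym (ℤ.*-zeroʳ k)
  dil-· k a (suc (suc n)) = dil-· k (tail a) n

  dil-* : ∀ a b → dil (a * b) ≈ dil a * dil b
  dil-* a b zero       = ≡.trans (*-head a b) (≡.sym (*-head (dil a) (dil b)))
  dil-* a b (suc zero) = ≡.sym (≡.trans (*-tail (dil a) (dil b) 0)
    (≡.cong₂ ℤ._+_ (*-head (tail (dil a)) (dil b)) (ℤ.*-zeroʳ (a 0))))
  dil-* a b (suc (suc n)) = ≡R.begin
    dil (tail (a * b)) n
      ≡R.≡⟨ dil-cong (*-tail a b) n ⟩
    dil (tail a * b + a 0 · tail b) n
      ≡R.≡⟨ dil-+ (tail a * b) (a 0 · tail b) n ⟩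
    dil (tail a * b) n ℤ.+ dil (a 0 · tail b) n
      ≡R.≡⟨ ≡.cong₂ ℤ._+_ (dil-* (tail a) b n) (dil-· (a 0) (tail b) n) ⟩
    (dil (tail a) * dil b) n ℤ.+ a 0 ℤ.* dil (tail b) n
      ≡R.≡⟨ ≡.cong (ℤ._+ a 0 ℤ.* dil (tail b) n) (≡.trans (*-tail (tail (dil a)) (dil b) n)
              (≡.trans (≡.cong (λ z → (dil (tail a) * dil b) n ℤ.+ z) (ℤ.*-zeroˡ (dil b (suc n)))) (ℤ.+-identityʳ ((dil (tail a) * dil b) n)))) ⟨
    (tail (dil a) * dil b) (suc n) ℤ.+ a 0 ℤ.* dil b (suc (suc n))
      ≡R.≡⟨ *-tail (dil a) (dil b) (suc n) ⟨
    (dil a * dil b) (suc (suc n)) ≡R.∎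
    where module ≡R = ≡.≡-Reasoning

  flip-cong : ∀ {a b} → a ≈ b → flip a ≈ flip b
  flip-cong e zero    = e 0
  flip-cong e (suc n) = ≡.cong ℤ.-_ (flip-cong (λ m → e (suc m)) n)

  flip-+ : ∀ a b → flip (a + b) ≈ flip a + flip b
  flip-+ a b zero    = ≡.refl
  flip-+ a b (suc n) = ≡.trans (≡.cong ℤ.-_ (flip-+ (tail a) (tail b) n)) (ℤ.neg-distrib-+ (flip (tail a) n) _)

  flip-· : ∀ k a → flip (k · a) ≈ k · flip a
  flip-· k a zero    = ≡.refl
  flip-· k a (suc n) = ≡.trans (≡.cong ℤ.-_ (flip-· k (tail a) n)) (ℤ.neg-distribʳ-* k _)

  flip-neg : ∀ a → flip (- a) ≈ - flip a
  flip-neg a zero    = ≡.refl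
  flip-neg a (suc n) = ≡.cong ℤ.-_ (flip-neg (tail a) n)

  flip-* : ∀ a b → flip (a * b) ≈ flip a * flip b
  flip-* a b zero    = ≡.trans (*-head a b) (≡.sym (*-head (flip a) (flip b)))
  flip-* a b (suc n) = ≡R.begin
    ℤ.- flip (tail (a * b)) n
      ≡R.≡⟨ ≡.cong ℤ.-_ (≡.trans (flip-cong (*-tail a b) n) (flip-+ (tail a * b) (a 0 · tail b) n)) ⟩
    ℤ.- (flip (tail a * b) n ℤ.+ flip (a 0 · tail b) n)
      ≡R.≡⟨ ≡.cong ℤ.-_ (≡.cong₂ ℤ._+_ (flip-* (tail a) b n) (flip-· (a 0) (tail b) n)) ⟩
    ℤ.- ((flip (tail a) * flip b) n ℤ.+ a 0 ℤ.* flip (tail b) n)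
      ≡R.≡⟨ ≡.trans (ℤ.neg-distrib-+ ((flip (tail a) * flip b) n) _) (≡.cong₂ ℤ._+_ (-‿distribˡ-* (flip (tail a)) (flip b) n) (ℤ.neg-distribʳ-* (a 0) _)) ⟩
    (- flip (tail a) * flip b) n ℤ.+ a 0 ℤ.* flip b (suc n)
      ≡R.≡⟨ *-tail (flip a) (flip b) n ⟨
    (flip a * flip b) (suc n) ≡R.∎
    where module ≡R = ≡.≡-Reasoning

  dilation : Endomorphism
  dilation = record
    { ⟦_⟧ = dil ; cong = dil-cong ; homo-+ = dil-+ ; homo-* = dil-* ; homo-neg = dil-neg
    ; homo-1 = λ { zero → ≡.refl ; (suc zero) → ≡.refl ; (suc (suc n)) → dil-0 n }
    ; homo-0 = dil-0
    }
    where
    dil-0 : dil 0# ≈ 0#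
    dil-0 zero          = ≡.refl
    dil-0 (suc zero)    = ≡.refl
    dil-0 (suc (suc n)) = dil-0 n

  dil-≡[] : ∀ {N a b} → a ≡[ N ] b → dil a ≡[ N ] dil b
  dil-≡[] e = agree λ n n<N → go n _ _ λ m m≤n → below e m (ℕ.≤-<-trans m≤n n<N)
    where
    go : ∀ n a b → (∀ m → m ≤ n → a m ≡ b m) → dil a n ≡ dil b n
    go zero          a b h = h 0 z≤n
    go (suc zero)    a b h = ≡.refl
    go (suc (suc n)) a b h = go n (tail a) (tail b) λ m m≤n → h (suc m) (s≤s (ℕ.m≤n⇒m≤1+n m≤n))

  reflection : Endomorphism
  reflection = record
    { ⟦_⟧ = flip ; cong = flip-cong ; homo-+ = flip-+ ; homo-* = flip-* ; homo-neg = flip-neg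
    ; homo-1 = λ { zero → ≡.refl ; (suc n) → ≡.cong ℤ.-_ (flip-0 n) }
    ; homo-0 = flip-0
    }
    where
    flip-0 : flip 0# ≈ 0#
    flip-0 zero    = ≡.refl
    flip-0 (suc n) = ≡.cong ℤ.-_ (flip-0 n)

  flip-≡[] : ∀ {N a b} → a ≡[ N ] b → flip a ≡[ N ] flip b
  flip-≡[] e = agree λ n n<N → go n _ _ λ m m≤n → below e m (ℕ.≤-<-trans m≤n n<N)
    where
    go : ∀ n a b → (∀ m → m ≤ n → a m ≡ b m) → flip a n ≡ flip b n
    go zero    a b h = h 0 z≤n
    go (suc n) a b h = ≡.cong ℤ.-_ (go n (tail a) (tail b) λ m m≤n → h (suc m) (s≤s m≤n))

  module Dil = Endomorphism dilation
  module Flip = Endomorphism reflection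

  dil-q : dil q ≈ q * q
  dil-q zero       = ≡.sym (q*-head q)
  dil-q (suc zero) = ≡.sym (q*-tail q 0)
  dil-q (suc (suc n)) = ≡.trans (go n) (≡.sym (q*-tail q (suc n)))
    where
    go : ∀ n → dil (tail q) n ≡ tail q n
    go zero          = ≡.refl
    go (suc zero)    = ≡.refl
    go (suc (suc n)) = Dil.homo-0 n

  dil-q^ : ∀ n → dil (q ^ n) ≈ q ^ (n ℕ.* 2)
  dil-q^ zero    = Dil.homo-1
  dil-q^ (suc n) = trans (Dil.homo-* q (q ^ n)) (trans (*-cong {dil q} {q * q} {dil (q ^ n)} {q ^ (n ℕ.* 2)} dil-q (dil-q^ n)) (*-assoc q q (q ^ (n ℕ.* 2))))

  flip-q : flip q ≈ - q
  flip-q zero          = ≡.refl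
  flip-q (suc zero)    = ≡.refl
  flip-q (suc (suc n)) = ≡.trans (≡.cong (λ z → ℤ.- (ℤ.- z)) (Flip.homo-0 n)) ≡.refl

  flip-dil : ∀ a → flip (dil a) ≈ dil a
  flip-dil a zero          = ≡.refl
  flip-dil a (suc zero)    = ≡.refl
  flip-dil a (suc (suc n)) = ≡.trans (ℤ.neg-involutive _) (flip-dil (tail a) n)

  -- U on q-expansions.
  even-part : Carrier → Carrier
  even-part a zero    = a 0
  even-part a (suc n) = even-part (tail (tail a)) n

  even-part-2* : ∀ a n → even-part a n ≡ a (2 ℕ.* n)
  even-part-2* a zero    = ≡.refl
  even-part-2* a (suc n) = ≡.trans (even-part-2* (tail (tail a)) n) (≡.cong (a ∘ suc) (≡.sym (ℕ.+-suc n (n ℕ.+ 0))))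

  even-part-cong : ∀ {a b} → a ≈ b → even-part a ≈ even-part b
  even-part-cong e zero    = e 0
  even-part-cong e (suc n) = even-part-cong (λ m → e (suc (suc m))) n

  even-part-+ : ∀ a b → even-part (a + b) ≈ even-part a + even-part b
  even-part-+ a b zero    = ≡.refl
  even-part-+ a b (suc n) = even-part-+ (tail (tail a)) (tail (tail b)) n

  even-part-· : ∀ k a → even-part (k · a) ≈ k · even-part a
  even-part-· k a zero    = ≡.refl
  even-part-· k a (suc n) = even-part-· k (tail (tail a)) n

  -- The projection formula: series in q² are scalars for U. It converts the modular equation, whose
  -- coefficients are series in q², into a recurrence for U gʲ.
  even-part-dil* : ∀ a b → even-part (dil a * b) ≈ a * even-part b
  even-part-dil* a b zero    = ≡.trans (*-head (dil a) b) (≡.sym (*-head a (even-part b)))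
  even-part-dil* a b (suc n) = ≡R.begin
    even-part (tail (tail (dil a * b))) n
      ≡R.≡⟨ even-part-cong step n ⟩
    even-part (dil (tail a) * b + a 0 · tail (tail b)) n
      ≡R.≡⟨ even-part-+ (dil (tail a) * b) (a 0 · tail (tail b)) n ⟩
    even-part (dil (tail a) * b) n ℤ.+ even-part (a 0 · tail (tail b)) n
      ≡R.≡⟨ ≡.cong₂ ℤ._+_ (even-part-dil* (tail a) b n) (even-part-· (a 0) (tail (tail b)) n) ⟩
    (tail a * even-part b) n ℤ.+ a 0 ℤ.* even-part b (suc n)
      ≡R.≡⟨ *-tail a (even-part b) n ⟨
    (a * even-part b) (suc n) ≡R.∎
    where
    module ≡R = ≡.≡-Reasoning
    step : tail (tail (dil a * b)) ≈ dil (tail a) * b + a 0 · tail (tail b)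
    step m = ≡.trans (*-tail (dil a) b (suc m)) (≡.cong (ℤ._+ a 0 ℤ.* b (suc (suc m)))
      (≡.trans (*-tail (tail (dil a)) b m)
        (≡.trans (≡.cong (λ z → (dil (tail a) * b) m ℤ.+ z) (ℤ.*-zeroˡ (b (suc m)))) (ℤ.+-identityʳ ((dil (tail a) * b) m)))))

-- From theta identities to the modular equation of degree two.

module ModularEquation (R : CommutativeRing 0ℓ 0ℓ) where
  open import Data.Integer.Base using (+_)
  open CommutativeRing R
  open IntegerCoefficients R
  open Endomorphisms R
  open import Algebra.Properties.Semiring.Exp semiring using (_^_; ^-congˡ)
  open import Algebra.Properties.CommutativeSemiring.Exp commutativeSemiring using (^-distrib-*)
  open import Relation.Binary.Reasoning.Setoid setoid

  module _ (dilation reflection : Endomorphism) where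
    open Endomorphism dilation renaming (⟦_⟧ to δ)
    open Endomorphism reflection using () renaming (⟦_⟧ to σ; cong to σ-cong; homo-* to σ-*; homo-^ to σ-^)

    -- D = ∏ (1 + qⁿ), E = ∏ (1 - qⁿ), T = ∏ (1 - q²ⁿ⁻¹), y = ∑ (-1)ⁿ q^(n²) over all integers n, and
    -- ψ = ∑ q^(n(n+1)/2) over n ≥ 0.
    record ThetaFunctions : Set where
      field
        q D E T y ψ E⁻¹ : Carrier
        δ-q      : δ q ≈ q * q
        σ-q      : σ q ≈ - q
        σ-δ      : ∀ a → σ (δ a) ≈ δ a
        q-cancel : ∀ {a b} → q * a ≈ q * b → a ≈ b
        E⁻¹*E    : E⁻¹ * E ≈ 1#
        D*E      : D * E ≈ δ E
        E-split  : E ≈ T * δ E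
        T*σT     : T * σ T ≈ δ T
        gauss-y  : E ≈ D * y
        gauss-ψ  : δ E ≈ T * ψ
        x-split  : σ y ≈ δ (δ (σ y)) + ι (+ 2) * q * δ (δ (δ ψ))
        y-split  : y ≈ δ (δ (σ y)) - ι (+ 2) * q * δ (δ (δ ψ))

      x = σ y

      -- Euler's identity behind the equal numbers of partitions into distinct and into odd parts;
      -- `T` thus serves as the inverse of `D`.
      D*T : D * T ≈ 1#
      D*T = cancel-unit E⁻¹*E (begin
        E * (D * T)   ≈⟨ solve 3 (λ E D T → E :* (D :* T) := T :* (D :* E)) refl E D T ⟩
        T * (D * E)   ≈⟨ *-congˡ D*E ⟩
        T * δ E       ≈⟨ E-split ⟨
        E             ≈⟨ *-identityʳ E ⟨
        E * 1#        ∎)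

      undo-D : ∀ a → D * (T * a) ≈ a
      undo-D a = trans (sym (*-assoc D T a)) (trans (*-congʳ D*T) (*-identityˡ a))

      δD*δT : δ D * δ T ≈ 1#
      δD*δT = trans (sym (homo-* D T)) (trans (cong D*T) homo-1)

      ψ≈ : ψ ≈ D * δ E
      ψ≈ = sym (trans (*-congˡ gauss-ψ) (undo-D ψ))

      y≈ : y ≈ T * E
      y≈ = sym (trans (*-congˡ gauss-y) (trans (solve 3 (λ T D y → T :* (D :* y) := D :* (T :* y)) refl T D y) (undo-D y)))

      σT≈ : σ T ≈ D * δ T
      σT≈ = sym (trans (*-congˡ (sym T*σT)) (undo-D (σ T)))

      x≈ : x ≈ (D * δ T) * ((D * δ T) * δ E)
      x≈ = begin
        σ y                   ≈⟨ trans (σ-cong y≈) (σ-* T E) ⟩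
        σ T * σ E             ≈⟨ *-congˡ (trans (σ-cong E-split) (σ-* T (δ E))) ⟩
        σ T * (σ T * σ (δ E)) ≈⟨ *-cong σT≈ (*-cong σT≈ (σ-δ E)) ⟩
        (D * δ T) * ((D * δ T) * δ E) ∎

      δδE≈ : δ (δ E) ≈ δ D * δ E
      δδE≈ = trans (sym (cong D*E)) (homo-* D E)

      δψ≈ : δ ψ ≈ δ D * (δ D * δ E)
      δψ≈ = trans (cong ψ≈) (trans (homo-* D (δ E)) (*-congˡ δδE≈))

      -- φ(q) ψ(q²) = ψ(q)² in Ramanujan's notation, with x = φ(q) = ∑ q^(n²). All theta functions
      -- are products of `D`, `T`, `E` and their dilations, and the factors `δ D * δ T` are 1.
      x*δψ : x * δ ψ ≈ ψ * ψ
      x*δψ = begin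
        x * δ ψ
          ≈⟨ *-cong x≈ δψ≈ ⟩
        ((D * δ T) * ((D * δ T) * δ E)) * (δ D * (δ D * δ E))
          ≈⟨ solve 4 (λ D t e d → ((D :* t) :* ((D :* t) :* e)) :* (d :* (d :* e)) := (d :* t) :* ((d :* t) :* ((D :* e) :* (D :* e)))) refl D (δ T) (δ E) (δ D) ⟩
        (δ D * δ T) * ((δ D * δ T) * ((D * δ E) * (D * δ E)))
          ≈⟨ *-cong δD*δT (*-congʳ δD*δT) ⟩
        1# * (1# * ((D * δ E) * (D * δ E)))
          ≈⟨ trans (*-identityˡ _) (*-identityˡ _) ⟩
        (D * δ E) * (D * δ E)
          ≈⟨ *-cong ψ≈ ψ≈ ⟨
        ψ * ψ ∎

      -- φ(q) φ(-q) = φ(-q²)², by the same reduction to products.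
      x*y : x * y ≈ δ y * δ y
      x*y = begin
        x * y
          ≈⟨ *-cong x≈ (trans y≈ (*-congˡ E-split)) ⟩
        ((D * δ T) * ((D * δ T) * δ E)) * (T * (T * δ E))
          ≈⟨ solve 4 (λ D t e T → ((D :* t) :* ((D :* t) :* e)) :* (T :* (T :* e)) := D :* (T :* (D :* (T :* ((t :* e) :* (t :* e)))))) refl D (δ T) (δ E) T ⟩
        D * (T * (D * (T * ((δ T * δ E) * (δ T * δ E)))))
          ≈⟨ trans (undo-D _) (undo-D _) ⟩
        (δ T * δ E) * (δ T * δ E)
          ≈⟨ *-cong δy≈ δy≈ ⟨
        δ y * δ y ∎
        where
        δy≈ : δ y ≈ δ T * δ E
        δy≈ = trans (cong y≈) (homo-* T E)

      a b c : Carrier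
      a = δ (δ x)
      b = δ (δ (δ ψ))
      c = δ (δ ψ)

      δ-product : ∀ {s t u v} → s * t ≈ u * v → δ s * δ t ≈ δ u * δ v
      δ-product {s} {t} {u} {v} e = trans (sym (homo-* s t)) (trans (cong e) (homo-* u v))

      δ2q : ∀ t → δ (ι (+ 2) * q * t) ≈ ι (+ 2) * (q * q) * δ t
      δ2q t = trans (homo-* _ t) (*-congʳ (trans (homo-ι* (+ 2) q) (*-congˡ δ-q)))

      δx≈ : δ x ≈ δ a + ι (+ 2) * (q * q) * δ b
      δx≈ = trans (cong x-split) (trans (homo-+ _ _) (+-congˡ (δ2q b)))

      δy≈ : δ y ≈ δ a - ι (+ 2) * (q * q) * δ b
      δy≈ = trans (cong y-split) (trans (homo-+ _ _) (+-congˡ (trans (homo-neg _) (-‿cong (δ2q b)))))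

      -- φ(q²)² = φ(q⁴)² + 4 q² ψ(q⁸)². The splittings of `δ x` and `δ y` show that their squares
      -- differ by 8 q² `δ a * δ b`, which is 8 q² b²; and the square of `δ y` is x y, split once
      -- more.
      δx² : δ x * δ x ≈ a * a + ι (+ 4) * (q * q) * (b * b)
      δx² = begin
        δ x * δ x
          ≈⟨ *-cong δx≈ δx≈ ⟩
        (δ a + ι (+ 2) * (q * q) * δ b) * (δ a + ι (+ 2) * (q * q) * δ b)
          ≈⟨ solve 3 (λ a b q → (a :+ # 2 :* (q :* q) :* b) :* (a :+ # 2 :* (q :* q) :* b)
               := (a :- # 2 :* (q :* q) :* b) :* (a :- # 2 :* (q :* q) :* b) :+ # 8 :* (q :* q) :* (a :* b)) refl (δ a) (δ b) q ⟩
        (δ a - ι (+ 2) * (q * q) * δ b) * (δ a - ι (+ 2) * (q * q) * δ b) + ι (+ 8) * (q * q) * (δ a * δ b)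
          ≈⟨ +-cong (*-cong (sym δy≈) (sym δy≈)) (*-congˡ (δ-product (δ-product (δ-product x*δψ)))) ⟩
        δ y * δ y + ι (+ 8) * (q * q) * (b * b)
          ≈⟨ +-congʳ (trans (sym x*y) (*-cong x-split y-split)) ⟩
        (a + ι (+ 2) * q * b) * (a - ι (+ 2) * q * b) + ι (+ 8) * (q * q) * (b * b)
          ≈⟨ solve 3 (λ a b q → (a :+ # 2 :* q :* b) :* (a :- # 2 :* q :* b) :+ # 8 :* (q :* q) :* (b :* b)
               := a :* a :+ # 4 :* (q :* q) :* (b :* b)) refl a b q ⟩
        a * a + ι (+ 4) * (q * q) * (b * b) ∎

      -- Jacobi's identity θ₃⁴ = θ₄⁴ + θ₂⁴. The difference of the fourth powers of a ± 2 q b is 16 q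
      -- · a b · (a² + 4 q² b²), where a b = c² and the last factor is the square of `δ x`.
      quartic : x ^ 4 ≈ y ^ 4 + ι (+ 16) * q * δ ψ ^ 4
      quartic = begin
        x ^ 4
          ≈⟨ ^-congˡ 4 x-split ⟩
        (a + ι (+ 2) * q * b) ^ 4
          ≈⟨ solve 3 (λ a b q → (a :+ # 2 :* q :* b) :^ 4
               := (a :- # 2 :* q :* b) :^ 4 :+ # 16 :* q :* ((a :* b) :* (a :* a :+ # 4 :* (q :* q) :* (b :* b)))) refl a b q ⟩
        (a - ι (+ 2) * q * b) ^ 4 + ι (+ 16) * q * ((a * b) * (a * a + ι (+ 4) * (q * q) * (b * b)))
          ≈⟨ +-cong (^-congˡ 4 (sym y-split)) (*-congˡ (*-cong (δ-product (δ-product x*δψ)) (sym δx²))) ⟩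
        y ^ 4 + ι (+ 16) * q * ((c * c) * (δ x * δ x))
          ≈⟨ +-congˡ (*-congˡ (solve 2 (λ c x → (c :* c) :* (x :* x) := (x :* c) :^ 2) refl c (δ x))) ⟩
        y ^ 4 + ι (+ 16) * q * (δ x * c) ^ 2
          ≈⟨ +-congˡ (*-congˡ (^-congˡ 2 (δ-product x*δψ))) ⟩
        y ^ 4 + ι (+ 16) * q * (δ ψ * δ ψ) ^ 2
          ≈⟨ +-congˡ (*-congˡ (solve 1 (λ p → (p :* p) :^ 2 := p :^ 4) refl (δ ψ))) ⟩
        y ^ 4 + ι (+ 16) * q * δ ψ ^ 4 ∎

      D⁸ δD⁸ : Carrier
      D⁸  = D ^ 8
      δD⁸ = δ D ^ 8

      D²*y : (D * D) * y ≈ δ E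
      D²*y = trans (*-congˡ (trans y≈ (*-congˡ E-split)))
        (trans (solve 3 (λ D T e → (D :* D) :* (T :* (T :* e)) := D :* (T :* (D :* (T :* e)))) refl D T (δ E)) (trans (undo-D _) (undo-D _)))

      -- Jacobi's quartic identity rewritten in `D` and its dilation; the common unit `δ E ^ 4` is
      -- cancelled.
      degree-two : D⁸ * D⁸ ≈ δD⁸ * (1# + ι (+ 16) * q * (D⁸ * δD⁸))
      degree-two = cancel-unit E⁴-unit (begin
        δ E ^ 4 * (D⁸ * D⁸)
          ≈⟨ *-identityˡ _ ⟨
        1# * (δ E ^ 4 * (D⁸ * D⁸))
          ≈⟨ *-congʳ (trans (^-congˡ 8 δD*δT) (solve 0 (# 1 :^ 8 := # 1) refl)) ⟨
        (δ D * δ T) ^ 8 * (δ E ^ 4 * (D⁸ * D⁸))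
          ≈⟨ *-congʳ (^-distrib-* (δ D) (δ T) 8) ⟩
        (δD⁸ * δ T ^ 8) * (δ E ^ 4 * (D⁸ * D⁸))
          ≈⟨ solve 4 (λ d t e D → (d :* t :^ 8) :* (e :^ 4 :* (D :^ 8 :* D :^ 8)) := (d :* D :^ 8) :* ((D :* t) :* ((D :* t) :* e)) :^ 4) refl δD⁸ (δ T) (δ E) D ⟩
        (δD⁸ * D⁸) * ((D * δ T) * ((D * δ T) * δ E)) ^ 4
          ≈⟨ *-congˡ (trans (^-congˡ 4 (sym x≈)) quartic) ⟩
        (δD⁸ * D⁸) * (y ^ 4 + ι (+ 16) * q * δ ψ ^ 4)
          ≈⟨ *-congˡ (+-congˡ (*-congˡ (^-congˡ 4 δψ≈))) ⟩
        (δD⁸ * D⁸) * (y ^ 4 + ι (+ 16) * q * (δ D * (δ D * δ E)) ^ 4)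
          ≈⟨ solve 6 (λ q d D y b e → (b :* D :^ 8) :* (y :^ 4 :+ # 16 :* q :* (d :* (d :* e)) :^ 4)
               := b :* (((D :* D) :* y) :^ 4 :+ # 16 :* q :* (D :^ 8 :* d :^ 8) :* e :^ 4)) refl q (δ D) D y δD⁸ (δ E) ⟩
        δD⁸ * (((D * D) * y) ^ 4 + ι (+ 16) * q * (D⁸ * δD⁸) * δ E ^ 4)
          ≈⟨ *-congˡ (+-congʳ (^-congˡ 4 D²*y)) ⟩
        δD⁸ * (δ E ^ 4 + ι (+ 16) * q * (D⁸ * δD⁸) * δ E ^ 4)
          ≈⟨ solve 3 (λ d h e → d :* (e :+ h :* e) := e :* (d :* (# 1 :+ h))) refl δD⁸ (ι (+ 16) * q * (D⁸ * δD⁸)) (δ E ^ 4) ⟩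
        δ E ^ 4 * (δD⁸ * (1# + ι (+ 16) * q * (D⁸ * δD⁸))) ∎)
        where
        E⁴-unit : δ E⁻¹ ^ 4 * δ E ^ 4 ≈ 1#
        E⁴-unit = trans (sym (^-distrib-* (δ E⁻¹) (δ E) 4)) (trans (^-congˡ 4 (trans (sym (homo-* E⁻¹ E)) (trans (cong E⁻¹*E) homo-1)))
          (solve 0 (# 1 :^ 4 := # 1) refl))

      -- h is (η(4τ)/η(τ))⁸, a Hauptmodul for Γ₀(4). Both f(τ) and f(2τ) are rational in it: f = h
      -- (1 + 16 h) and w = h² / (1 + 16 h). The modular equation is the elimination of h.
      f w h : Carrier
      f = q * D ^ 24
      w = δ f
      h = q * (D⁸ * δD⁸)

      D²⁴ : ∀ z → z ^ 24 ≈ z ^ 8 * (z ^ 8 * z ^ 8)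
      D²⁴ = solve 1 (λ z → z :^ 24 := z :^ 8 :* (z :^ 8 :* z :^ 8)) refl

      w≈ : w ≈ (q * q) * (δD⁸ * (δD⁸ * δD⁸))
      w≈ = trans (homo-* q _) (*-cong δ-q (trans (homo-^ D 24) (D²⁴ (δ D))))

      f≈h : f ≈ h * (1# + ι (+ 16) * h)
      f≈h = begin
        q * D ^ 24                  ≈⟨ *-congˡ (trans (D²⁴ D) (*-congˡ degree-two)) ⟩
        q * (D⁸ * (δD⁸ * (1# + ι (+ 16) * q * (D⁸ * δD⁸))))
          ≈⟨ solve 3 (λ q d e → q :* (d :* (e :* (# 1 :+ # 16 :* q :* (d :* e)))) := (q :* (d :* e)) :* (# 1 :+ # 16 :* (q :* (d :* e)))) refl q D⁸ δD⁸ ⟩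
        h * (1# + ι (+ 16) * h) ∎

      h²≈ : w * (1# + ι (+ 16) * h) ≈ h * h
      h²≈ = begin
        w * (1# + ι (+ 16) * h)
          ≈⟨ *-congʳ w≈ ⟩
        (q * q) * (δD⁸ * (δD⁸ * δD⁸)) * (1# + ι (+ 16) * h)
          ≈⟨ solve 3 (λ q d e → (q :* q) :* (e :* (e :* e)) :* (# 1 :+ # 16 :* (q :* (d :* e)))
               := (q :* q) :* (e :* e) :* (e :* (# 1 :+ # 16 :* q :* (d :* e)))) refl q D⁸ δD⁸ ⟩
        (q * q) * (δD⁸ * δD⁸) * (δD⁸ * (1# + ι (+ 16) * q * (D⁸ * δD⁸)))
          ≈⟨ *-congˡ degree-two ⟨
        (q * q) * (δD⁸ * δD⁸) * (D⁸ * D⁸)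
          ≈⟨ solve 3 (λ q d e → (q :* q) :* (e :* e) :* (d :* d) := (q :* (d :* e)) :* (q :* (d :* e))) refl q D⁸ δD⁸ ⟩
        h * h ∎

      modular-equation : f * f ≈ w + (ι (+ 48) * w + ι (+ 4096) * (w * w)) * f
      modular-equation = begin
        f * f
          ≈⟨ *-cong f≈h f≈h ⟩
        (h * (1# + ι (+ 16) * h)) * (h * (1# + ι (+ 16) * h))
          ≈⟨ solve 1 (λ h → (h :* (# 1 :+ # 16 :* h)) :* (h :* (# 1 :+ # 16 :* h))
               := (h :* h) :* ((# 1 :+ # 16 :* h) :* (# 1 :+ # 16 :* h))) refl h ⟩
        (h * h) * ((1# + ι (+ 16) * h) * (1# + ι (+ 16) * h))
          ≈⟨ *-congʳ h²≈ ⟨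
        (w * (1# + ι (+ 16) * h)) * ((1# + ι (+ 16) * h) * (1# + ι (+ 16) * h))
          -- The cube of 1 + 16 h is 1 + 48 h (1 + 16 h) + 4096 h³. The middle term is 48 f, and
          -- `h²≈` turns w h³ into w² f.
          ≈⟨ solve 2 (λ w h → (w :* (# 1 :+ # 16 :* h)) :* ((# 1 :+ # 16 :* h) :* (# 1 :+ # 16 :* h))
               := w :+ # 48 :* w :* (h :* (# 1 :+ # 16 :* h)) :+ # 4096 :* w :* ((h :* h) :* h)) refl w h ⟩
        w + ι (+ 48) * w * (h * (1# + ι (+ 16) * h)) + ι (+ 4096) * w * ((h * h) * h)
          ≈⟨ +-congˡ (*-congˡ (*-congʳ h²≈)) ⟨
        w + ι (+ 48) * w * (h * (1# + ι (+ 16) * h)) + ι (+ 4096) * w * ((w * (1# + ι (+ 16) * h)) * h)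
          ≈⟨ solve 3 (λ w h k → w :+ # 48 :* w :* (h :* k) :+ # 4096 :* w :* ((w :* k) :* h)
               := w :+ (# 48 :* w :+ # 4096 :* (w :* w)) :* (h :* k)) refl w h (1# + ι (+ 16) * h) ⟩
        w + (ι (+ 48) * w + ι (+ 4096) * (w * w)) * (h * (1# + ι (+ 16) * h))
          ≈⟨ +-congˡ (*-congˡ f≈h) ⟨
        w + (ι (+ 48) * w + ι (+ 4096) * (w * w)) * f ∎

      D*σD : D * σ D ≈ δ D
      D*σD = begin
        D * σ D                             ≈⟨ *-identityˡ _ ⟨
        1# * (D * σ D)                      ≈⟨ *-congʳ δD*δT ⟨
        (δ D * δ T) * (D * σ D)             ≈⟨ *-congʳ (*-congˡ T*σT) ⟨
        (δ D * (T * σ T)) * (D * σ D)       ≈⟨ solve 5 (λ d T t D s → (d :* (T :* t)) :* (D :* s) := D :* (T :* ((s :* t) :* d))) refl (δ D) T (σ T) D (σ D) ⟩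
        D * (T * ((σ D * σ T) * δ D))       ≈⟨ undo-D _ ⟩
        (σ D * σ T) * δ D                   ≈⟨ *-congʳ (trans (sym (σ-* D T)) (trans (σ-cong D*T) (Endomorphism.homo-1 reflection))) ⟩
        1# * δ D                            ≈⟨ *-identityˡ _ ⟩
        δ D                                 ∎

      f*σf : f * σ f ≈ - w
      f*σf = begin
        (q * D ^ 24) * σ (q * D ^ 24)       ≈⟨ *-congˡ (trans (σ-* q _) (*-cong σ-q (σ-^ D 24))) ⟩
        (q * D ^ 24) * (- q * σ D ^ 24)     ≈⟨ solve 3 (λ q d e → (q :* d) :* ((:- q) :* e) := :- ((q :* q) :* (d :* e))) refl q (D ^ 24) (σ D ^ 24) ⟩
        - ((q * q) * (D ^ 24 * σ D ^ 24))   ≈⟨ -‿cong (*-cong (sym δ-q) (trans (sym (^-distrib-* D (σ D) 24)) (trans (^-congˡ 24 D*σD) (sym (homo-^ D 24))))) ⟩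
        - (δ q * δ (D ^ 24))                ≈⟨ -‿cong (homo-* q (D ^ 24)) ⟨
        - w                                 ∎

      f-cancel : ∀ {s t} → f * s ≈ f * t → s ≈ t
      f-cancel {s} {t} e = cancel-unit {T ^ 24} {D ^ 24} unit
        (q-cancel (trans (sym (*-assoc q (D ^ 24) s)) (trans e (*-assoc q (D ^ 24) t))))
        where
        unit : T ^ 24 * D ^ 24 ≈ 1#
        unit = trans (sym (^-distrib-* T D 24)) (trans (^-congˡ 24 (trans (*-comm T D) D*T)) (solve 0 (# 1 :^ 24 := # 1) refl))

      -- f and its reflection are the two roots of the modular equation.
      f+σf : f + σ f ≈ ι (+ 48) * w + ι (+ 4096) * (w * w)
      f+σf = f-cancel (begin
        f * (f + σ f)       ≈⟨ distribˡ f f (σ f) ⟩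
        f * f + f * σ f     ≈⟨ +-cong modular-equation f*σf ⟩
        w + s * f + - w     ≈⟨ solve 3 (λ w s f → w :+ s :* f :+ (:- w) := f :* s) refl w s f ⟩
        f * s               ∎)
        where s = ι (+ 48) * w + ι (+ 4096) * (w * w)

  -- Kept apart from q-series, where numerals are series that the type checker would expand.
  double-identity : ∀ f → ι (+ 48) * f + ι (+ 4096) * (f * f) ≈ ι (+ 2) * (ι (+ 24) * f + ι (+ 2048) * (f * f))
  double-identity = solve 1 (λ f → # 48 :* f :+ # 4096 :* (f :* f) := # 2 :* (# 24 :* f :+ # 2048 :* (f :* f))) refl

  rescale-identity : ∀ f → ι (+ 64) * (ι (+ 24) * f + ι (+ 2048) * (f * f)) ≈ ι (+ 24) * (ι (+ 64) * f) + ι (+ 32) * ((ι (+ 64) * f) * (ι (+ 64) * f))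
  rescale-identity = solve 1 (λ f → # 64 :* (# 24 :* f :+ # 2048 :* (f :* f))
    := # 24 :* (# 64 :* f) :+ # 32 :* ((# 64 :* f) :* (# 64 :* f))) refl

  -- With g = 64 f and v = 64 w the equation reads g² = 64 v + (48 v + 64 v²) g; it is multiplied by
  -- p, later a power of g.
  rescale-modular-equation : ∀ {f w} p → f * f ≈ w + (ι (+ 48) * w + ι (+ 4096) * (w * w)) * f →
    (ι (+ 64) * f) * ((ι (+ 64) * f) * p) ≈ (ι (+ 64) * (ι (+ 64) * w)) * p
      + (ι (+ 48) * (ι (+ 64) * w) + ι (+ 64) * ((ι (+ 64) * w) * (ι (+ 64) * w))) * ((ι (+ 64) * f) * p)
  rescale-modular-equation {f} {w} p e = trans
    (solve 2 (λ f p → (# 64 :* f) :* ((# 64 :* f) :* p) := # 4096 :* ((f :* f) :* p)) refl f p)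
    (trans (*-congˡ (*-congʳ e))
      (solve 3 (λ f w p → # 4096 :* ((w :+ (# 48 :* w :+ # 4096 :* (w :* w)) :* f) :* p)
         := (# 64 :* (# 64 :* w)) :* p
            :+ (# 48 :* (# 64 :* w) :+ # 64 :* ((# 64 :* w) :* (# 64 :* w))) :* ((# 64 :* f) :* p)) refl f w p))

  regroup : ∀ g a b → ι (+ 64) * g * a + (ι (+ 48) * g + ι (+ 64) * (g * g)) * b
              ≈ ι (+ 64) * (g * a) + (ι (+ 48) * (g * b) + ι (+ 64) * (g * (g * b)))
  regroup = solve 3 (λ g a b → # 64 :* g :* a :+ (# 48 :* g :+ # 64 :* (g :* g)) :* b
         := # 64 :* (g :* a) :+ (# 48 :* (g :* b) :+ # 64 :* (g :* (g :* b)))) refl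

  factor-identity : ∀ q d → ι (+ 64) * (q * d) ≈ q * (ι (+ 64) * d)
  factor-identity = solve 2 (λ q d → # 64 :* (q :* d) := q :* (# 64 :* d)) refl

-- The theta functions and their products as q-series.

module ThetaProducts where
  open import Data.Integer.Base as ℤ using (ℤ; +_; 1ℤ)
  open import Data.Integer.Properties as ℤ using ()
  open import Data.Nat.Base as ℕ using (ℕ; zero; suc; _≤_; s≤s)
  open import Data.Nat.Properties as ℕ using ()
  open import Data.Nat.Tactic.RingSolver using (solve-∀)
  open import Relation.Binary.PropositionalEquality as ≡ using (_≡_)
  open IntegralSeries
  open GaussIdentities series q
  open import Relation.Binary.Reasoning.Setoid setoid

  infixr 4 _⨾_
  _⨾_ : ∀ {N a b c} → a ≡[ N ] b → b ≡[ N ] c → a ≡[ N ] c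
  _⨾_ = ≡[]-trans

  q^-≡[]-0 : ∀ {N n} → N ≤ n → q ^ n ≡[ N ] 0#
  q^-≡[]-0 {N} {n} N≤n = ≈⇒≡[] (sym (*-identityˡ (q ^ n))) ⨾ q^≥-≡[] 1# N≤n

  1+-≡[] : ∀ {N a} → a ≡[ N ] 0# → 1# + a ≡[ N ] 1#
  1+-≡[] e = +-≡[] (≡[]-refl 1#) e ⨾ ≈⇒≡[] (+-identityʳ 1#)

  neg-≡[] : ∀ {N a} → a ≡[ N ] 0# → - a ≡[ N ] 0#
  neg-≡[] e = agree λ n n<N → ≡.cong ℤ.-_ (below e n n<N)

  ^-≡[] : ∀ {N a b} n → a ≡[ N ] b → a ^ n ≡[ N ] b ^ n
  ^-≡[] zero    e = ≡[]-refl 1#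
  ^-≡[] (suc n) e = *-≡[] e (^-≡[] n e)

  -- Approximant N must be correct mod q^(N+1). For ψ this forces the shift by one, as
  -- `triangular-theta 0` is the empty sum and misses the constant term 1.
  D E T y ψ : Carrier
  D = lim ∏₊
  E = lim ∏₋
  T = lim odd∏₋
  y = lim square-theta
  ψ = lim λ n → triangular-theta (suc n)

  D≡ : ∀ N → D ≡[ suc N ] ∏₊ N
  D≡ = lim-≡[] {∏₊} (coherent-∏ λ s → 1+-≡[] (q^-≡[]-0 ℕ.≤-refl))

  E≡ : ∀ N → E ≡[ suc N ] ∏₋ N
  E≡ = lim-≡[] {∏₋} (coherent-∏ λ s → 1+-≡[] (neg-≡[] (q^-≡[]-0 ℕ.≤-refl)))

  T≡ : ∀ N → T ≡[ suc N ] odd∏₋ N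
  T≡ = lim-≡[] {odd∏₋} (coherent-∏ λ s → 1+-≡[] (neg-≡[] (q^-≡[]-0 (s≤s (ℕ.m≤m*n s 2)))))

  y≡ : ∀ N → y ≡[ suc N ] square-theta N
  y≡ = lim-≡[] {square-theta} (coherent-+ square-theta (λ N → sym (+-assoc 1# _ _))
    λ N → ≈⇒≡[] (sym (*-assoc (ι (+ 2)) (alternating (suc N)) (q ^ (suc N ℕ.* suc N)))) ⨾ q^≥-≡[] (ι (+ 2) * alternating (suc N)) (ℕ.m≤m*n (suc N) (suc N)))

  ψ≡ : ∀ N → ψ ≡[ suc N ] triangular-theta (suc N)
  ψ≡ = lim-≡[] {λ n → triangular-theta (suc n)} (coherent-+ (λ n → triangular-theta (suc n)) (λ N → refl)
    λ N → +-≡[] (q^-≡[]-0 (ℕ.m≤m*n (suc N) (suc (suc N ℕ.* 2)))) (q^-≡[]-0 (ℕ.≤-trans (ℕ.n≤1+n (suc N)) (ℕ.m≤m*n (suc (suc N)) (suc (suc N ℕ.* 2)))))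
      ⨾ ≈⇒≡[] (+-identityʳ 0#))

  ≈-from : ∀ {a b} → (∀ N → a ≡[ suc N ] b) → a ≈ b
  ≈-from h n = below (h n) n ℕ.≤-refl

  square : ∀ n → q ^ n * q ^ n ≈ q ^ (n ℕ.* 2)
  square n = trans (*-congˡ (sym (*-identityʳ (q ^ n)))) (^-assocʳ q n 2)

  dil-1-q^ : ∀ n → dil (1# - q ^ n) ≈ 1# - q ^ (n ℕ.* 2)
  dil-1-q^ n = trans (Dil.homo-1- (q ^ n)) (+-congˡ {1#} (-‿cong (dil-q^ n)))

  dil-∏₋ : ∀ N → dil (∏₋ N) ≈ even∏₋ N
  dil-∏₋ N = trans (Dil.homo-∏ N _) (∏-cong N λ s _ → dil-1-q^ (suc s))

  D*E : D * E ≈ dil E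
  D*E = ≈-from λ N → *-≡[] (D≡ N) (E≡ N) ⨾ ≈⇒≡[] (finite N) ⨾ ≡[]-sym (dil-≡[] (E≡ N))
    where
    finite : ∀ N → ∏₊ N * ∏₋ N ≈ dil (∏₋ N)
    finite N = begin
      ∏₊ N * ∏₋ N
        ≈⟨ ∏-* N _ _ ⟨
      ∏ N (λ s → (1# + q ^ suc s) * (1# - q ^ suc s))
        ≈⟨ ∏-cong N (λ s _ → trans (solve 1 (λ z → (# 1 :+ z) :* (# 1 :- z) := # 1 :- z :* z) refl (q ^ suc s)) (+-congˡ {1#} (-‿cong (square (suc s))))) ⟩
      even∏₋ N
        ≈⟨ dil-∏₋ N ⟨
      dil (∏₋ N) ∎

  E-split : E ≈ T * dil E
  E-split = ≈-from λ N → ≡[]-mono (s≤s (ℕ.m≤m*n N 2)) (E≡ (N ℕ.* 2)) ⨾ ≈⇒≡[] (finite N)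
    ⨾ *-≡[] (≡[]-sym (T≡ N)) (≈⇒≡[] (sym (dil-∏₋ N)) ⨾ ≡[]-sym (dil-≡[] (E≡ N)))
    where
    finite : ∀ N → ∏₋ (N ℕ.* 2) ≈ odd∏₋ N * even∏₋ N
    finite zero    = sym (*-identityˡ 1#)
    finite (suc N) = trans (*-congʳ (*-congʳ (finite N)))
      (solve 4 (λ a b u v → a :* b :* u :* v := (a :* u) :* (b :* v)) refl (odd∏₋ N) (even∏₋ N) (1# - q ^ suc (N ℕ.* 2)) (1# - q ^ (suc N ℕ.* 2)))

  flip-q^odd : ∀ s → flip (q ^ suc (s ℕ.* 2)) ≈ - q ^ suc (s ℕ.* 2)
  flip-q^odd s = trans (Flip.homo-^ q (suc (s ℕ.* 2))) (trans (^-congˡ (suc (s ℕ.* 2)) flip-q) (neg^odd s))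
    where
    neg^odd : ∀ s → (- q) ^ suc (s ℕ.* 2) ≈ - q ^ suc (s ℕ.* 2)
    neg^odd zero    = sym (-‿distribˡ-* q 1#)
    neg^odd (suc s) = trans (*-congˡ (*-congˡ (neg^odd s)))
      (solve 2 (λ x z → (:- x) :* ((:- x) :* (:- z)) := :- (x :* (x :* z))) refl q (q ^ suc (s ℕ.* 2)))

  T*flipT : T * flip T ≈ dil T
  T*flipT = ≈-from λ N → *-≡[] (T≡ N) (flip-≡[] (T≡ N)) ⨾ ≈⇒≡[] (finite N) ⨾ ≡[]-sym (dil-≡[] (T≡ N))
    where
    finite : ∀ N → odd∏₋ N * flip (odd∏₋ N) ≈ dil (odd∏₋ N)
    finite N = begin
      odd∏₋ N * flip (odd∏₋ N)
        ≈⟨ *-congˡ (trans (Flip.homo-∏ N _) (∏-cong N λ s _ → trans (Flip.homo-1- _) (+-congˡ {1#} (-‿cong (flip-q^odd s))))) ⟩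
      odd∏₋ N * ∏ N (λ s → 1# - - q ^ suc (s ℕ.* 2))
        ≈⟨ ∏-* N _ _ ⟨
      ∏ N (λ s → (1# - q ^ suc (s ℕ.* 2)) * (1# - - q ^ suc (s ℕ.* 2)))
        ≈⟨ ∏-cong N (λ s _ → trans (solve 1 (λ z → (# 1 :- z) :* (# 1 :- (:- z)) := # 1 :- z :* z) refl (q ^ suc (s ℕ.* 2)))
             (trans (+-congˡ {1#} (-‿cong (square (suc (s ℕ.* 2))))) (sym (dil-1-q^ (suc (s ℕ.* 2)))))) ⟩
      ∏ N (λ s → dil (1# - q ^ suc (s ℕ.* 2)))
        ≈⟨ Dil.homo-∏ N _ ⟨
      dil (odd∏₋ N) ∎

  1-q^-head : ∀ n → (1# - q ^ suc n) 0 ≡ 1ℤ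
  1-q^-head n = ≡.cong (λ z → 1ℤ ℤ.- z) (q*-head (q ^ n))

  /1-q^ : ∀ a n → a * inverse (1# - q ^ suc n) * (1# - q ^ suc n) ≈ a
  /1-q^ a n = trans (*-assoc a _ _) (trans (*-congˡ (inverseˡ (1# - q ^ suc n) (1-q^-head n))) (*-identityʳ a))

  -- Each term with s ≥ 1 is divisible by qᶜ. As c grows with n in the finite Gauss identities,
  -- their left-hand sums become 1 and the infinite product formulas remain.
  partial-≡[]-1 : ∀ (z : ℕ → Carrier) m c → z 0 ≈ 1# → ∑ (suc m) (λ s → z s * q ^ (s ℕ.* c)) ≡[ c ] 1#
  partial-≡[]-1 z m c z₀ = ≈⇒≡[] (trans (∑-head m _) (+-congʳ {∑ m (λ s → z (suc s) * q ^ (suc s ℕ.* c))} (trans (*-identityʳ (z 0)) z₀)))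
    ⨾ 1+-≡[] (∑-≡[]-0 m λ s → q^≥-≡[] (z (suc s)) (ℕ.m≤m+n c (s ℕ.* c)))

  gauss-y : E ≈ D * y
  gauss-y = ≈-from λ N → E≡ N ⨾ ≈⇒≡[] (sym (*-identityʳ (∏₋ N)))
    ⨾ *-≡[] (≡[]-refl (∏₋ N)) (≡[]-sym (partial-≡[]-1 z N (suc N) refl))
    ⨾ ≈⇒≡[] (Square.identity z refl (λ s → /1-q^ _ s) N) ⨾ ≡[]-sym (*-≡[] (D≡ N) (y≡ N))
    where
    z : ℕ → Carrier
    z zero    = 1#
    z (suc s) = - (z s * (1# + q ^ s)) * inverse (1# - q ^ suc s)

  gauss-ψ : dil E ≈ T * ψ
  -- The finite identity is taken at N + 1, where `triangular-theta` approximates ψ; the surplus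
  -- precision of the products is discarded.
  gauss-ψ = ≈-from λ N → ≡[]-mono (ℕ.n≤1+n (suc N)) (dil-≡[] (E≡ (suc N)) ⨾ ≈⇒≡[] (dil-∏₋ (suc N)))
    ⨾ ≈⇒≡[] (sym (*-identityʳ (even∏₋ (suc N))))
    ⨾ *-≡[] (≡[]-refl (even∏₋ (suc N))) (≡[]-sym (≡[]-mono (ℕ.m≤n⇒m≤1+n (ℕ.m≤m*n (suc N) 2)) (partial-≡[]-1 z N (suc (suc N ℕ.* 2)) refl)))
    ⨾ ≈⇒≡[] (Triangular.identity z refl (λ s → /1-q^ _ (suc (s ℕ.* 2))) (suc N))
    ⨾ ≡[]-sym (*-≡[] (≡[]-mono (ℕ.n≤1+n (suc N)) (T≡ (suc N))) (ψ≡ N))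
    where
    z : ℕ → Carrier
    z zero    = 1#
    z (suc s) = z s * (1# - q ^ suc (s ℕ.* 2)) * inverse (1# - q ^ (suc s ℕ.* 2))

  flip-flip : ∀ a → flip (flip a) ≈ a
  flip-flip a zero    = ≡.refl
  flip-flip a (suc n) = ≡.trans (≡.cong ℤ.-_ (flip-neg (flip (tail a)) n)) (≡.trans (ℤ.neg-involutive _) (flip-flip (tail a) n))

  positive-theta : ℕ → Carrier
  positive-theta n = 1# + ∑ n λ s → ι (+ 2) * q ^ (suc s ℕ.* suc s)

  -- s² has the parity of s, so q ↦ - q cancels the alternating sign.
  flip-theta : ∀ n → flip (square-theta n) ≈ positive-theta n
  flip-theta n = trans (Flip.homo-+ 1# _) (+-cong Flip.homo-1 (trans (Flip.homo-∑ n _) (∑-cong n λ s _ →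
    trans (Flip.homo-ι* (+ 2) _) (*-congˡ (term (suc s))))))
    where
    sign : ∀ m → Carrier
    sign = alternating

    flip-sign : ∀ m → flip (sign m) ≈ sign m
    flip-sign zero    = Flip.homo-1
    flip-sign (suc m) = trans (Flip.homo-neg _) (-‿cong (flip-sign m))

    sign-+ : ∀ m n → sign (m ℕ.+ n) ≈ sign m * sign n
    sign-+ zero    n = sym (*-identityˡ (sign n))
    sign-+ (suc m) n = trans (-‿cong (sign-+ m n)) (-‿distribˡ-* (sign m) (sign n))

    sign² : ∀ m → sign m * sign m ≈ 1#
    sign² zero    = *-identityˡ 1#
    sign² (suc m) = trans (solve 1 (λ s → (:- s) :* (:- s) := s :* s) refl (sign m)) (sign² m)

    flip-q^ : ∀ m → flip (q ^ m) ≈ sign m * q ^ m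
    flip-q^ zero    = trans Flip.homo-1 (sym (*-identityˡ 1#))
    flip-q^ (suc m) = trans (Flip.homo-* q (q ^ m)) (trans (*-cong flip-q (flip-q^ m))
      (solve 3 (λ x s z → (:- x) :* (s :* z) := (:- s) :* (x :* z)) refl q (sign m) (q ^ m)))

    sign-square : ∀ m → sign (m ℕ.* m) ≈ sign m
    sign-square zero    = refl
    sign-square (suc m) = -‿cong (begin
      sign (m ℕ.+ m ℕ.* suc m)           ≡⟨ ≡.cong (λ k → sign (m ℕ.+ k)) (ℕ.*-suc m m) ⟩
      sign (m ℕ.+ (m ℕ.+ m ℕ.* m))       ≈⟨ trans (sign-+ m _) (*-congˡ (sign-+ m (m ℕ.* m))) ⟩
      sign m * (sign m * sign (m ℕ.* m)) ≈⟨ *-assoc _ _ _ ⟨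
      sign m * sign m * sign (m ℕ.* m)   ≈⟨ *-cong (sign² m) (sign-square m) ⟩
      1# * sign m                        ≈⟨ *-identityˡ _ ⟩
      sign m                             ∎)

    term : ∀ m → flip (sign m * q ^ (m ℕ.* m)) ≈ q ^ (m ℕ.* m)
    term m = begin
      flip (sign m * q ^ (m ℕ.* m))               ≈⟨ trans (Flip.homo-* _ _) (*-cong (flip-sign m) (flip-q^ (m ℕ.* m))) ⟩
      sign m * (sign (m ℕ.* m) * q ^ (m ℕ.* m))   ≈⟨ *-congˡ (*-congʳ (sign-square m)) ⟩
      sign m * (sign m * q ^ (m ℕ.* m))           ≈⟨ *-assoc _ _ _ ⟨
      sign m * sign m * q ^ (m ℕ.* m)             ≈⟨ *-congʳ (sign² m) ⟩
      1# * q ^ (m ℕ.* m)                          ≈⟨ *-identityˡ _ ⟩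
      q ^ (m ℕ.* m)                               ∎

  flip-y≡ : ∀ N → flip y ≡[ suc N ] positive-theta N
  flip-y≡ N = flip-≡[] (y≡ N) ⨾ ≈⇒≡[] (flip-theta N)

  -- φ(q) = φ(q⁴) + 2 q ψ(q⁸): even n contribute n² = 4 m², odd n contribute n² = 1 + 8 · m(m+1)/2.
  -- At finite level the induction adds the four squares of 4N + 1, ..., 4N + 4, two of each kind.
  x-split : flip y ≈ dil (dil (flip y)) + ι (+ 2) * q * dil (dil (dil ψ))
  x-split = ≈-from λ N → ≡[]-mono (s≤s (ℕ.m≤n⇒m≤1+n (ℕ.m≤n⇒m≤1+n (ℕ.m≤n⇒m≤1+n (ℕ.m≤n⇒m≤1+n (ℕ.m≤m*n N 4))))))
      (flip-y≡ (suc N ℕ.* 4))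
    ⨾ ≈⇒≡[] (finite (suc N))
    ⨾ ≡[]-sym (+-≡[] (≡[]-mono (s≤s (ℕ.m≤n⇒m≤1+n (ℕ.m≤n⇒m≤1+n (ℕ.m≤m*n N 2)))) (dil-≡[] (dil-≡[] (flip-y≡ (suc N ℕ.* 2)))))
        (*-≡[] (≡[]-refl (ι (+ 2) * q)) (dil-≡[] (dil-≡[] (dil-≡[] (ψ≡ N))))))
    where
    dil²-q^ : ∀ n → dil (dil (q ^ n)) ≈ q ^ (n ℕ.* 2 ℕ.* 2)
    dil²-q^ n = trans (dil-cong (dil-q^ n)) (dil-q^ (n ℕ.* 2))

    dil³-q^ : ∀ n → dil (dil (dil (q ^ n))) ≈ q ^ (n ℕ.* 2 ℕ.* 2 ℕ.* 2)
    dil³-q^ n = trans (dil-cong (dil²-q^ n)) (dil-q^ (n ℕ.* 2 ℕ.* 2))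

    squares : ∀ n → dil (dil (positive-theta n)) ≈ 1# + ∑ n (λ s → ι (+ 2) * q ^ (suc s ℕ.* suc s ℕ.* 2 ℕ.* 2))
    squares n = trans (dil-cong (Dil.homo-+ 1# _)) (trans (Dil.homo-+ _ _) (+-cong (trans (dil-cong Dil.homo-1) Dil.homo-1)
      (trans (dil-cong (Dil.homo-∑ n _)) (trans (Dil.homo-∑ n _) (∑-cong n λ s _ →
        trans (dil-cong (Dil.homo-ι* (+ 2) _)) (trans (Dil.homo-ι* (+ 2) _) (*-congˡ (dil²-q^ (suc s ℕ.* suc s)))))))))

    triangles : ∀ n → dil (dil (dil (triangular-theta n)))
                        ≈ ∑ n (λ s → q ^ (s ℕ.* suc (s ℕ.* 2) ℕ.* 2 ℕ.* 2 ℕ.* 2) + q ^ (suc s ℕ.* suc (s ℕ.* 2) ℕ.* 2 ℕ.* 2 ℕ.* 2))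
    triangles zero    = trans (dil-cong (trans (dil-cong Dil.homo-0) Dil.homo-0)) Dil.homo-0
    triangles (suc n) = trans (dil-cong (trans (dil-cong (Dil.homo-+ _ _)) (Dil.homo-+ _ _))) (trans (Dil.homo-+ _ _) (+-cong (triangles n)
      (trans (dil-cong (trans (dil-cong (Dil.homo-+ _ _)) (Dil.homo-+ _ _))) (trans (Dil.homo-+ _ _)
        (+-cong (dil³-q^ (n ℕ.* suc (n ℕ.* 2))) (dil³-q^ (suc n ℕ.* suc (n ℕ.* 2))))))))

    e₁ : ∀ N → suc (N ℕ.* 4) ℕ.* suc (N ℕ.* 4) ≡ suc (N ℕ.* suc (N ℕ.* 2) ℕ.* 2 ℕ.* 2 ℕ.* 2)
    e₁ = solve-∀
    e₂ : ∀ N → suc (suc (N ℕ.* 4)) ℕ.* suc (suc (N ℕ.* 4)) ≡ suc (N ℕ.* 2) ℕ.* suc (N ℕ.* 2) ℕ.* 2 ℕ.* 2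
    e₂ = solve-∀
    e₃ : ∀ N → suc (suc (suc (N ℕ.* 4))) ℕ.* suc (suc (suc (N ℕ.* 4))) ≡ suc (suc N ℕ.* suc (N ℕ.* 2) ℕ.* 2 ℕ.* 2 ℕ.* 2)
    e₃ = solve-∀
    e₄ : ∀ N → suc (suc (suc (suc (N ℕ.* 4)))) ℕ.* suc (suc (suc (suc (N ℕ.* 4)))) ≡ suc (suc (N ℕ.* 2)) ℕ.* suc (suc (N ℕ.* 2)) ℕ.* 2 ℕ.* 2
    e₄ = solve-∀

    term : ∀ {m n} → m ≡ n → ι (+ 2) * q ^ m ≈ ι (+ 2) * q ^ n
    term e = reflexive (≡.cong (λ k → ι (+ 2) * q ^ k) e)

    sums : ∀ N → 1# + ∑ (N ℕ.* 4) (λ s → ι (+ 2) * q ^ (suc s ℕ.* suc s))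
                  ≈ (1# + ∑ (N ℕ.* 2) (λ s → ι (+ 2) * q ^ (suc s ℕ.* suc s ℕ.* 2 ℕ.* 2)))
                    + ι (+ 2) * q * ∑ N (λ s → q ^ (s ℕ.* suc (s ℕ.* 2) ℕ.* 2 ℕ.* 2 ℕ.* 2) + q ^ (suc s ℕ.* suc (s ℕ.* 2) ℕ.* 2 ℕ.* 2 ℕ.* 2))
    sums zero    = solve 1 (λ x → # 1 :+ # 0 := (# 1 :+ # 0) :+ # 2 :* x :* # 0) refl q
    sums (suc N) = begin
      1# + ∑ (suc N ℕ.* 4) (λ s → ι (+ 2) * q ^ (suc s ℕ.* suc s))
        ≈⟨ +-congˡ {1#} (+-cong (+-cong (+-cong (+-congˡ {S} (term (e₁ N))) (term (e₂ N))) (term (e₃ N))) (term (e₄ N))) ⟩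
      1# + ((((S + ι (+ 2) * (q * c₁)) + ι (+ 2) * c₂) + ι (+ 2) * (q * c₃)) + ι (+ 2) * c₄)
        ≈⟨ solve 6 (λ S q a b c d → # 1 :+ ((((S :+ # 2 :* (q :* a)) :+ # 2 :* b) :+ # 2 :* (q :* c)) :+ # 2 :* d)
             := (# 1 :+ S) :+ (# 2 :* (q :* a) :+ # 2 :* b :+ # 2 :* (q :* c) :+ # 2 :* d)) refl S q c₁ c₂ c₃ c₄ ⟩
      (1# + S) + (ι (+ 2) * (q * c₁) + ι (+ 2) * c₂ + ι (+ 2) * (q * c₃) + ι (+ 2) * c₄)
        ≈⟨ +-congʳ (sums N) ⟩
      ((1# + B) + ι (+ 2) * q * C) + (ι (+ 2) * (q * c₁) + ι (+ 2) * c₂ + ι (+ 2) * (q * c₃) + ι (+ 2) * c₄)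
        ≈⟨ solve 7 (λ B C q a b c d → ((# 1 :+ B) :+ # 2 :* q :* C) :+ (# 2 :* (q :* a) :+ # 2 :* b :+ # 2 :* (q :* c) :+ # 2 :* d)
             := (# 1 :+ ((B :+ # 2 :* b) :+ # 2 :* d)) :+ # 2 :* q :* (C :+ (a :+ c))) refl B C q c₁ c₂ c₃ c₄ ⟩
      (1# + ((B + ι (+ 2) * c₂) + ι (+ 2) * c₄)) + ι (+ 2) * q * (C + (c₁ + c₃)) ∎
      where
      S = ∑ (N ℕ.* 4) λ s → ι (+ 2) * q ^ (suc s ℕ.* suc s)
      B = ∑ (N ℕ.* 2) λ s → ι (+ 2) * q ^ (suc s ℕ.* suc s ℕ.* 2 ℕ.* 2)
      C = ∑ N λ s → q ^ (s ℕ.* suc (s ℕ.* 2) ℕ.* 2 ℕ.* 2 ℕ.* 2) + q ^ (suc s ℕ.* suc (s ℕ.* 2) ℕ.* 2 ℕ.* 2 ℕ.* 2)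
      c₁ = q ^ (N ℕ.* suc (N ℕ.* 2) ℕ.* 2 ℕ.* 2 ℕ.* 2)
      c₂ = q ^ (suc (N ℕ.* 2) ℕ.* suc (N ℕ.* 2) ℕ.* 2 ℕ.* 2)
      c₃ = q ^ (suc N ℕ.* suc (N ℕ.* 2) ℕ.* 2 ℕ.* 2 ℕ.* 2)
      c₄ = q ^ (suc (suc (N ℕ.* 2)) ℕ.* suc (suc (N ℕ.* 2)) ℕ.* 2 ℕ.* 2)

    finite : ∀ N → positive-theta (N ℕ.* 4) ≈ dil (dil (positive-theta (N ℕ.* 2))) + ι (+ 2) * q * dil (dil (dil (triangular-theta N)))
    finite N = trans (sums N) (sym (+-cong (squares (N ℕ.* 2)) (*-congˡ (triangles N))))

  y-split : y ≈ dil (dil (flip y)) - ι (+ 2) * q * dil (dil (dil ψ))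
  y-split = begin
    y                                                                ≈⟨ flip-flip y ⟨
    flip (flip y)                                                    ≈⟨ trans (flip-cong x-split) (Flip.homo-+ _ _) ⟩
    flip (dil (dil (flip y))) + flip (ι (+ 2) * q * dil (dil (dil ψ)))
      ≈⟨ +-cong (flip-dil (dil (flip y))) (trans (Flip.homo-* _ _) (*-cong (trans (Flip.homo-ι* (+ 2) q) (*-congˡ flip-q)) (flip-dil (dil (dil ψ))))) ⟩
    dil (dil (flip y)) + ι (+ 2) * - q * dil (dil (dil ψ))
      ≈⟨ solve 3 (λ a q b → a :+ # 2 :* (:- q) :* b := a :- # 2 :* q :* b) refl (dil (dil (flip y))) q (dil (dil (dil ψ))) ⟩
    dil (dil (flip y)) - ι (+ 2) * q * dil (dil (dil ψ))             ∎

  thetaFunctions : ModularEquation.ThetaFunctions series dilation reflection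
  thetaFunctions = record
    { q = q ; D = D ; E = E ; T = T ; y = y ; ψ = ψ ; E⁻¹ = inverse E
    ; δ-q = dil-q ; σ-q = flip-q ; σ-δ = flip-dil ; q-cancel = q*-cancel ; E⁻¹*E = inverseˡ E ≡.refl
    ; D*E = D*E ; E-split = E-split ; T*σT = T*flipT ; gauss-y = gauss-y ; gauss-ψ = gauss-ψ
    ; x-split = x-split ; y-split = y-split
    }

  module Theta = ModularEquation.ThetaFunctions

  f w : Carrier
  f = q * D ^ 24
  w = dil f

  modular-equation : f * f ≈ w + (ι (+ 48) * w + ι (+ 4096) * (w * w)) * f
  modular-equation = Theta.modular-equation thetaFunctions

  f+flip-f : f + flip f ≈ ι (+ 48) * w + ι (+ 4096) * (w * w)
  f+flip-f = Theta.f+σf thetaFunctions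

-- The action of U on powers of g.

module HauptmodulU where
  open import Data.Bool.Base using (if_then_else_)
  open import Data.Fin.Base using (Fin; toℕ; zero; suc)
  open import Data.Integer.Base as ℤ using (ℤ; +_; 0ℤ; 1ℤ)
  open import Data.Integer.Properties as ℤ using ()
  open import Data.Nat.Base as ℕ using (ℕ; zero; suc; _<_; z≤n; s≤s)
  open import Data.Nat.DivMod using (m/n≡1+[m∸n]/n)
  open import Data.Nat.Divisibility using (_∣?_)
  open import Data.Nat.Properties as ℕ using ()
  open import Function.Base using (_∘_)
  open import Relation.Nullary.Decidable.Core using (does)
  open import Relation.Binary.PropositionalEquality as ≡ using (_≡_)
  open import Defs using (module ℤ[[q]])
  open IntegralSeries
  open ThetaProducts using (_⨾_; ^-≡[]; D; E; E≡; D*E; f; w; modular-equation; f+flip-f)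
  open GaussIdentities series q using (∏₋)
  private module M = ModularEquation series
  open ℤ-Sums using () renaming (∑ to ∑ℤ; ∑-head to ∑ℤ-head)
  open import Relation.Binary.Reasoning.Setoid setoid

  dilate≈dil : ∀ a → ℤ[[q]].dilate a ≈ dil a
  dilate≈dil a zero          = ≡.refl
  dilate≈dil a (suc zero)    = ≡.refl
  dilate≈dil a (suc (suc n)) = ≡.trans
    (≡.cong (λ k → if does (2 ∣? n) then a k else 0ℤ) (m/n≡1+[m∸n]/n {suc (suc n)} {2} (s≤s (s≤s z≤n))))
    (dilate≈dil (tail a) n)

  *≈* : ∀ a b → a * b ≈ a ℤ[[q]].* b
  *≈* a b n = ≡.cong (λ c → c n) (⊛≡* a b)

  product≈∏ : ∀ n (s : ℕ → Carrier) (t : Fin n → Carrier) → (∀ i → t i ≈ s (toℕ i)) → ℤ[[q]].product t ≈ ∏ n s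
  product≈∏ zero    s t e = λ _ → ≡.refl
  product≈∏ (suc n) s t e = trans (sym (*≈* (t zero) (ℤ[[q]].product (t ∘ suc))))
    (trans (*-cong (e zero) (product≈∏ n (s ∘ suc) (t ∘ suc) (λ i → e (suc i)))) (sym (∏-head n s)))

  -- With a literal exponent in place of e the type checker would unfold the power.
  euler-^ : ℕ → ℕ → Carrier
  euler-^ e m = ℤ[[q]].product {m} (λ i → (ℤ[[q]].1# ℤ[[q]].+ ℤ[[q]].- (q ℤ[[q]].^ suc (toℕ i))) ℤ[[q]].^ e)

  euler-^≈ : ∀ e m → euler-^ e m ≈ ∏₋ m ^ e
  euler-^≈ e m = trans
    (product≈∏ m (λ s → (1# - q ^ suc s) ^ e) _ λ i k → ≡.trans (≡.cong (λ a → ((1# - a) ℤ[[q]].^ e) k) (≡.sym (^≡^ q (suc (toℕ i)))))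
      (≡.cong (λ a → a k) (≡.sym (^≡^ (1# - q ^ suc (toℕ i)) e))))
    (∏-^ m (λ s → 1# - q ^ suc s) e)

  euler≡ : ∀ m → ℤ[[q]].euler m ≡ (∏₋ m ^ 24) m
  euler≡ m = ≡.trans unfold (euler-^≈ 24 m m)
    where
    unfold : ℤ[[q]].euler m ≡ euler-^ 24 m m
    unfold = ≡.refl

  f*Δ : ℤ[[q]].f * ℤ[[q]].Δ ≈ ℤ[[q]].dilate ℤ[[q]].Δ
  f*Δ = trans (*≈* ℤ[[q]].f ℤ[[q]].Δ) ℤ[[q]].f-correct

  Δ≈ : ℤ[[q]].Δ ≈ q * E ^ 24
  Δ≈ zero    = ≡.sym (q*-head (E ^ 24))
  Δ≈ (suc m) = ≡.trans (euler≡ m) (≡.trans (≡.sym (below (^-≡[] 24 (E≡ m)) m ℕ.≤-refl)) (≡.sym (q*-tail (E ^ 24) m)))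

  -- Δ is q E²⁴ and `D * E` is the dilation of E, so q D²⁴ solves the equation f Δ = Δ(q²)
  -- characterising f; then q and the unit E²⁴ are cancelled.
  f≈ : ℤ[[q]].f ≈ f
  f≈ = cancel-unit {inverse E ^ 24} {E ^ 24} unit (q*-cancel (begin
    q * (E ^ 24 * ℤ[[q]].f)    ≈⟨ solve 3 (λ q e f → q :* (e :* f) := f :* (q :* e)) refl q (E ^ 24) ℤ[[q]].f ⟩
    ℤ[[q]].f * (q * E ^ 24)    ≈⟨ *-congˡ {ℤ[[q]].f} Δ≈ ⟨
    ℤ[[q]].f * ℤ[[q]].Δ        ≈⟨ f*Δ ⟩
    ℤ[[q]].dilate ℤ[[q]].Δ     ≈⟨ trans (dilate≈dil ℤ[[q]].Δ) (dil-cong Δ≈) ⟩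
    dil (q * E ^ 24)           ≈⟨ trans (dil-* q (E ^ 24)) (*-cong dil-q (Dil.homo-^ E 24)) ⟩
    q * q * dil E ^ 24         ≈⟨ *-congˡ (trans (^-congˡ 24 (sym D*E)) (^-distrib-* D E 24)) ⟩
    q * q * (D ^ 24 * E ^ 24)  ≈⟨ solve 3 (λ q d e → q :* q :* (d :* e) := q :* (e :* (q :* d))) refl q (D ^ 24) (E ^ 24) ⟩
    q * (E ^ 24 * (q * D ^ 24)) ∎))
    where
    unit : inverse E ^ 24 * E ^ 24 ≈ 1#
    unit = trans (sym (^-distrib-* (inverse E) E 24)) (trans (^-congˡ 24 (inverseˡ E ≡.refl)) (solve 0 (# 1 :^ 24 := # 1) refl))

  even-part-dil : ∀ a → even-part (dil a) ≈ a
  even-part-dil a zero    = ≡.refl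
  even-part-dil a (suc n) = even-part-dil (tail a) n

  a+flip-a : ∀ a → a + flip a ≈ ι (+ 2) * dil (even-part a)
  a+flip-a a n = ≡.trans (go a n) (≡.sym (ι*-coeff (+ 2) (dil (even-part a)) n))
    where
    go : ∀ a n → (a + flip a) n ≡ + 2 ℤ.* dil (even-part a) n
    go a zero          = twice (a 0)
      where
      twice : ∀ z → z ℤ.+ z ≡ + 2 ℤ.* z
      twice z = ≡.trans (≡.sym (≡.cong₂ ℤ._+_ (ℤ.*-identityˡ z) (ℤ.*-identityˡ z))) (≡.sym (ℤ.*-distribʳ-+ z 1ℤ 1ℤ))
    go a (suc zero)    = ℤ.+-inverseʳ (a 1)
    go a (suc (suc n)) = ≡.trans (≡.cong (λ z → a (suc (suc n)) ℤ.+ z) (ℤ.neg-involutive _)) (go (tail (tail a)) n)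

  -- f + f(τ + 1/2) is twice the dilation of U f, and the modular equation makes it the dilation of
  -- 48 f + 4096 f². U undoes the dilation, and ℤ permits division by 2.
  even-part-f : even-part f ≈ ι (+ 24) * f + ι (+ 2048) * (f * f)
  even-part-f n = ℤ.*-cancelˡ-≡ (+ 2) _ _ (≡.trans (≡.sym (ι*-coeff (+ 2) (even-part f) n)) (≡.trans (double n) (ι*-coeff (+ 2) (ι (+ 24) * f + ι (+ 2048) * (f * f)) n)))
    where
    double : ι (+ 2) * even-part f ≈ ι (+ 2) * (ι (+ 24) * f + ι (+ 2048) * (f * f))
    double = begin
      ι (+ 2) * even-part f                        ≈⟨ even-part-dil _ ⟨
      even-part (dil (ι (+ 2) * even-part f))      ≈⟨ even-part-cong (trans (Dil.homo-ι* (+ 2) _) (sym (a+flip-a f))) ⟩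
      even-part (f + flip f)                       ≈⟨ even-part-cong f+flip-f ⟩
      even-part (ι (+ 48) * w + ι (+ 4096) * (w * w))
        ≈⟨ even-part-cong (trans (Dil.homo-+ _ _) (+-cong (Dil.homo-ι* (+ 48) f) (trans (Dil.homo-ι* (+ 4096) (f * f)) (*-congˡ (dil-* f f))))) ⟨
      even-part (dil (ι (+ 48) * f + ι (+ 4096) * (f * f))) ≈⟨ even-part-dil _ ⟩
      ι (+ 48) * f + ι (+ 4096) * (f * f)
        ≈⟨ M.double-identity f ⟩
      ι (+ 2) * (ι (+ 24) * f + ι (+ 2048) * (f * f)) ∎

  g : Carrier
  g = ι (+ 64) * f

  g≈ : ℤ[[q]].g ≈ g
  g≈ n = ≡.trans (≡.cong (+ 64 ℤ.*_) (f≈ n)) (≡.sym (ι*-coeff (+ 64) f n))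

  U-g⁰ : even-part (g ^ 0) ≈ 1#
  U-g⁰ = trans (even-part-cong (sym Dil.homo-1)) (even-part-dil 1#)

  U-g¹ : even-part (g ^ 1) ≈ ι (+ 24) * g + ι (+ 32) * (g * g)
  U-g¹ = begin
    even-part (g * 1#)           ≈⟨ even-part-cong (trans (*-identityʳ g) (*-congʳ (sym (Dil.homo-ι (+ 64))))) ⟩
    even-part (dil (ι (+ 64)) * f) ≈⟨ even-part-dil* (ι (+ 64)) f ⟩
    ι (+ 64) * even-part f       ≈⟨ *-congˡ even-part-f ⟩
    ι (+ 64) * (ι (+ 24) * f + ι (+ 2048) * (f * f))
      ≈⟨ M.rescale-identity f ⟩
    ι (+ 24) * g + ι (+ 32) * (g * g) ∎

  -- U is applied to gʲ times the modular equation; its coefficients are dilations and come out by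
  -- the projection formula.
  U-g-step : ∀ j → even-part (g ^ suc (suc j)) ≈
    ι (+ 64) * g * even-part (g ^ j) + (ι (+ 48) * g + ι (+ 64) * (g * g)) * even-part (g ^ suc j)
  U-g-step j = begin
    even-part (g * (g * g ^ j))
      ≈⟨ even-part-cong (begin
           g * (g * g ^ j)
             ≈⟨ M.rescale-modular-equation (g ^ j) modular-equation ⟩
           (ι (+ 64) * v) * g ^ j + (ι (+ 48) * v + ι (+ 64) * (v * v)) * g ^ suc j
             ≈⟨ +-cong (*-congʳ dil₁) (*-congʳ dil₂) ⟨
           dil (ι (+ 64) * g) * g ^ j + dil (ι (+ 48) * g + ι (+ 64) * (g * g)) * g ^ suc j ∎) ⟩
    even-part (dil (ι (+ 64) * g) * g ^ j + dil (ι (+ 48) * g + ι (+ 64) * (g * g)) * g ^ suc j)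
      ≈⟨ even-part-+ _ _ ⟩
    even-part (dil (ι (+ 64) * g) * g ^ j) + even-part (dil (ι (+ 48) * g + ι (+ 64) * (g * g)) * g ^ suc j)
      ≈⟨ +-cong (even-part-dil* (ι (+ 64) * g) (g ^ j)) (even-part-dil* (ι (+ 48) * g + ι (+ 64) * (g * g)) (g ^ suc j)) ⟩
    ι (+ 64) * g * even-part (g ^ j) + (ι (+ 48) * g + ι (+ 64) * (g * g)) * even-part (g ^ suc j) ∎
    where
    v = ι (+ 64) * w
    dil-g : dil g ≈ v
    dil-g = Dil.homo-ι* (+ 64) f
    dil₁ : dil (ι (+ 64) * g) ≈ ι (+ 64) * v
    dil₁ = trans (Dil.homo-ι* (+ 64) g) (*-congˡ dil-g)
    dil₂ : dil (ι (+ 48) * g + ι (+ 64) * (g * g)) ≈ ι (+ 48) * v + ι (+ 64) * (v * v)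
    dil₂ = trans (Dil.homo-+ _ _) (+-cong (trans (Dil.homo-ι* (+ 48) g) (*-congˡ dil-g))
      (trans (Dil.homo-ι* (+ 64) (g * g)) (*-congˡ (trans (dil-* g g) (*-cong dil-g dil-g)))))

  shift : (ℕ → ℤ) → ℕ → ℤ
  shift a zero    = 0ℤ
  shift a (suc i) = a i

  -- U gʲ = ∑ᵢ column j i gⁱ
  column : ℕ → ℕ → ℤ
  column zero          zero    = 1ℤ
  column zero          (suc i) = 0ℤ
  column (suc zero)    i = + 24 ℤ.* shift (column 0) i ℤ.+ + 32 ℤ.* shift (shift (column 0)) i
  column (suc (suc j)) i = + 64 ℤ.* shift (column j) i ℤ.+
    (+ 48 ℤ.* shift (column (suc j)) i ℤ.+ + 64 ℤ.* shift (shift (column (suc j))) i)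

  -- Since gⁱ is divisible by qⁱ, the first K terms determine the value mod qᴷ, and no infinite sums
  -- of powers of g are required.
  eval : ℕ → (ℕ → ℤ) → Carrier
  eval K a = ∑ K λ i → ι (a i) * g ^ i

  eval-+ : ∀ K a b → eval K (λ i → a i ℤ.+ b i) ≈ eval K a + eval K b
  eval-+ K a b = trans (∑-cong K λ i _ → trans (*-congʳ (ι-+ (a i) (b i))) (distribʳ (g ^ i) (ι (a i)) (ι (b i)))) (∑-+ K _ _)

  eval-* : ∀ K k a → eval K (λ i → k ℤ.* a i) ≈ ι k * eval K a
  eval-* K k a = trans (∑-cong K λ i _ → trans (*-congʳ (ι-* k (a i))) (*-assoc (ι k) (ι (a i)) (g ^ i))) (sym (∑-*ˡ K (ι k) _))

  g-factor : g ≈ q * (ι (+ 64) * D ^ 24)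
  g-factor = M.factor-identity q (D ^ 24)

  g^-factor : ∀ n → g ^ n ≈ (ι (+ 64) * D ^ 24) ^ n * q ^ n
  g^-factor n = trans (^-congˡ n g-factor) (trans (^-distrib-* q _ n) (*-comm _ _))

  g^-≡[] : ∀ n a → a * g ^ n ≡[ n ] 0#
  g^-≡[] n a = ≈⇒≡[] (trans (*-congˡ (g^-factor n)) (sym (*-assoc a _ (q ^ n)))) ⨾ q^-≡[] n _

  eval-suc : ∀ K a → eval (suc K) a ≡[ K ] eval K a
  eval-suc K a = +-≡[] (≡[]-refl (eval K a)) (g^-≡[] K (ι (a K))) ⨾ ≈⇒≡[] (+-identityʳ (eval K a))

  -- Only a congruence: the shift pushes the last coefficient out of range, and the lost term is a
  -- multiple of gᴷ.
  eval-shift : ∀ K a → eval K (shift a) ≡[ K ] g * eval K a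
  eval-shift K a = ≡[]-sym (eval-suc K (shift a)) ⨾ ≈⇒≡[] (trans (∑-head K _)
    (trans (+-cong (zeroˡ (g ^ 0)) (trans (∑-cong K λ i _ → solve 3 (λ a g p → a :* (g :* p) := g :* (a :* p)) refl (ι (a i)) g (g ^ i)) (sym (∑-*ˡ K g _))))
      (+-identityˡ _)))

  column-1 : ∀ K → eval K (column 0) ≡[ K ] 1#
  column-1 zero    = agree λ _ ()
  column-1 (suc K) = ≈⇒≡[] (trans (∑-head K _) (trans (+-cong (*-identityˡ 1#) (∑-0 K λ i _ → zeroˡ (g ^ suc i))) (+-identityʳ 1#)))

  U-g^ : ∀ j K → even-part (g ^ j) ≡[ K ] eval K (column j)
  U-g^ zero K = ≈⇒≡[] U-g⁰ ⨾ ≡[]-sym (column-1 K)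
  U-g^ (suc zero) K = ≈⇒≡[] (trans U-g¹ (+-cong (*-congˡ (sym (*-identityʳ g))) (*-congˡ (*-congˡ (sym (*-identityʳ g))))))
    ⨾ +-≡[] (*-≡[] (≡[]-refl _) e₁) (*-≡[] (≡[]-refl _) (*-≡[] (≡[]-refl g) e₁ ⨾ ≡[]-sym (eval-shift K (shift (column 0)))))
    ⨾ ≈⇒≡[] (sym (trans (eval-+ K (λ i → + 24 ℤ.* shift (column 0) i) (λ i → + 32 ℤ.* shift (shift (column 0)) i)) (+-cong (eval-* K (+ 24) (shift (column 0))) (eval-* K (+ 32) (shift (shift (column 0)))))))
    where
    e₁ : g * 1# ≡[ K ] eval K (shift (column 0))
    e₁ = *-≡[] (≡[]-refl g) (≡[]-sym (column-1 K)) ⨾ ≡[]-sym (eval-shift K (column 0))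
  U-g^ (suc (suc j)) K = ≈⇒≡[] (trans (U-g-step j)
      (M.regroup g (even-part (g ^ j)) (even-part (g ^ suc j))))
    ⨾ +-≡[] (*-≡[] (≡[]-refl _) (up j (U-g^ j K))) (+-≡[] (*-≡[] (≡[]-refl _) (up (suc j) (U-g^ (suc j) K)))
        (*-≡[] (≡[]-refl _) (*-≡[] (≡[]-refl g) (up (suc j) (U-g^ (suc j) K)) ⨾ ≡[]-sym (eval-shift K (shift (column (suc j)))))))
    ⨾ ≈⇒≡[] (sym (trans (eval-+ K (λ i → + 64 ℤ.* shift (column j) i) (λ i → + 48 ℤ.* shift (column (suc j)) i ℤ.+ + 64 ℤ.* shift (shift (column (suc j))) i))
        (+-cong (eval-* K (+ 64) (shift (column j))) (trans (eval-+ K (λ i → + 48 ℤ.* shift (column (suc j)) i) (λ i → + 64 ℤ.* shift (shift (column (suc j))) i))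
        (+-cong (eval-* K (+ 48) (shift (column (suc j)))) (eval-* K (+ 64) (shift (shift (column (suc j))))))))))
    where
    up : ∀ j → even-part (g ^ j) ≡[ K ] eval K (column j) → g * even-part (g ^ j) ≡[ K ] eval K (shift (column j))
    up j e = *-≡[] (≡[]-refl g) e ⨾ ≡[]-sym (eval-shift K (column j))

  -- U preserves the vanishing of the constant term, which is why indices from 1 on suffice in
  -- `U-column`.
  column-head : ∀ j → column (suc j) 0 ≡ 0ℤ
  column-head zero    = ≡.refl
  column-head (suc j) = ≡.refl

  ∑-coeff : ∀ K (t : ℕ → Carrier) n → ∑ K t n ≡ ∑ℤ K (λ i → t i n)
  ∑-coeff zero    t n = ≡.refl
  ∑-coeff (suc K) t n = ≡.cong (ℤ._+ t K n) (∑-coeff K t n)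

  Defs-g^ : ∀ n → g ^ n ≈ ℤ[[q]].g ℤ[[q]].^ n
  Defs-g^ n k = ≡.trans (^-congˡ n (sym g≈) k) (≡.cong (λ a → a k) (^≡^ ℤ[[q]].g n))

  U-column : ∀ j n → (ℤ[[q]].g ℤ[[q]].^ suc j) (2 ℕ.* n) ≡
    ∑ℤ n (λ i → column (suc j) (suc i) ℤ.* (ℤ[[q]].g ℤ[[q]].^ suc i) n)
  U-column j n = ≡R.begin
    (ℤ[[q]].g ℤ[[q]].^ suc j) (2 ℕ.* n)
      ≡R.≡⟨ Defs-g^ (suc j) (2 ℕ.* n) ⟨
    (g ^ suc j) (2 ℕ.* n)
      ≡R.≡⟨ even-part-2* (g ^ suc j) n ⟨
    even-part (g ^ suc j) n
      ≡R.≡⟨ below (U-g^ (suc j) (suc n)) n ℕ.≤-refl ⟩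
    eval (suc n) (column (suc j)) n
      ≡R.≡⟨ ∑-coeff (suc n) (λ i → ι (column (suc j) i) * g ^ i) n ⟩
    ∑ℤ (suc n) (λ i → (ι (column (suc j) i) * g ^ i) n)
      ≡R.≡⟨ ℤ-Sums.∑-cong (suc n) (λ i _ → ≡.trans (ι*-coeff (column (suc j) i) (g ^ i) n) (≡.cong (column (suc j) i ℤ.*_) (Defs-g^ i n))) ⟩
    ∑ℤ (suc n) (λ i → column (suc j) i ℤ.* (ℤ[[q]].g ℤ[[q]].^ i) n)
      ≡R.≡⟨ ∑ℤ-head n _ ⟩
    column (suc j) 0 ℤ.* (ℤ[[q]].g ℤ[[q]].^ 0) n ℤ.+ ∑ℤ n (λ i → column (suc j) (suc i) ℤ.* (ℤ[[q]].g ℤ[[q]].^ suc i) n)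
      ≡R.≡⟨ drop _ (column-head j) ⟩
    ∑ℤ n (λ i → column (suc j) (suc i) ℤ.* (ℤ[[q]].g ℤ[[q]].^ suc i) n) ≡R.∎
    where
    module ≡R = ≡.≡-Reasoning
    drop : ∀ {c} x {y} → c ≡ 0ℤ → c ℤ.* x ℤ.+ y ≡ y
    drop x {y} ≡.refl = ≡.trans (≡.cong (ℤ._+ y) (ℤ.*-zeroˡ x)) (ℤ.+-identityˡ y)

  ^-head : ∀ a n → (a ^ n) 0 ≡ a 0 ℤ.^ n
  ^-head a zero    = ≡.refl
  ^-head a (suc n) = ≡.trans (*-head a (a ^ n)) (≡.cong (a 0 ℤ.*_) (^-head a n))

  -- Together with `g^-vanishing` this makes the passage from powers of g to powers of q triangular,
  -- with diagonal entries 64ⁿ.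
  g^-leading : ∀ n → (ℤ[[q]].g ℤ[[q]].^ n) n ≡ (+ 64) ℤ.^ n
  g^-leading n = ≡.trans (≡.sym (Defs-g^ n n)) (≡.trans (g^-factor n n) (≡.trans (go n _) (≡.trans (^-head _ n) (≡.cong (ℤ._^ n) unit))))
    where
    unit : (ι (+ 64) * D ^ 24) 0 ≡ + 64
    unit = ≡.trans (ι*-coeff (+ 64) (D ^ 24) 0) (≡.cong (+ 64 ℤ.*_) (^-head D 24))

    go : ∀ n a → (a * q ^ n) n ≡ a 0
    go zero    a = *-identityʳ a 0
    go (suc n) a = ≡.trans (solve 3 (λ a x y → a :* (x :* y) := x :* (a :* y)) refl a q (q ^ n) (suc n)) (≡.trans (q*-tail (a * q ^ n) n) (go n a))

  g^-vanishing : ∀ {m n} → m < n → (ℤ[[q]].g ℤ[[q]].^ n) m ≡ 0ℤ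
  g^-vanishing {m} {n} m<n = ≡.trans (≡.sym (Defs-g^ n m)) (≡.trans (sym (*-identityˡ (g ^ n)) m) (below (g^-≡[] n 1#) m m<n))

-- Inverse factorials over the rationals, and the WZ pair.

module RationalAlgebra (R : CommutativeRing 0ℓ 0ℓ) where
  open import Data.Integer.Base using (+_)
  open import Data.Nat.Base using (ℕ; suc)
  open CommutativeRing R
  open IntegerCoefficients R using (ι)

  -- All that is used of a ℚ-algebra. The ring stays abstract, so that concrete fractions are never
  -- normalised in the identities below.
  record Reciprocals : Set where
    field
      inv   : ℕ → Carrier
      ι*inv : ∀ n → ι (+ suc n) * inv n ≈ 1#

module Hypergeometric (R : CommutativeRing 0ℓ 0ℓ) (reciprocals : RationalAlgebra.Reciprocals R) where
  open import Data.Integer.Base as ℤ using (ℤ; +_; -[1+_]; 1ℤ)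
  open import Data.Integer.Properties as ℤ using ()
  open import Data.Integer.Solver using () renaming (module +-*-Solver to ℤ-Solver)
  open import Data.Nat.Base as ℕ using (ℕ; zero; suc; _<_; s≤s; _!)
  open import Data.Nat.Properties as ℕ using ()
  open import Relation.Binary.PropositionalEquality as ≡ using (_≡_)
  open CommutativeRing R hiding (zero)
  open IntegerCoefficients R
  open FiniteSums R
  open Endomorphisms R using (cancel-unit)
  open RationalAlgebra.Reciprocals reciprocals
  open import Relation.Binary.Reasoning.Setoid setoid
  open ℤ-Solver using () renaming (solve to solveℤ; con to conℤ; _:+_ to _⊞_; _:*_ to _⊠_; _:-_ to _⊟_; _:=_ to _⊜_)

  cancel-suc : ∀ n {x y} → ι (+ suc n) * x ≈ ι (+ suc n) * y → x ≈ y
  cancel-suc n = cancel-unit {inv n} {ι (+ suc n)} (trans (*-comm _ _) (ι*inv n))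

  φ : ℕ → Carrier
  φ n = ι (+ (n !))

  -- 1 / z!, read as 0 for negative z.
  ρ : ℤ → Carrier
  ρ (+ zero)  = 1#
  ρ (+ suc n) = inv n * ρ (+ n)
  ρ -[1+ n ]  = 0#

  ι-ℕ* : ∀ m n → ι (+ (m ℕ.* n)) ≈ ι (+ m) * ι (+ n)
  ι-ℕ* m n = trans (reflexive (≡.cong ι (ℤ.pos-* m n))) (ι-* (+ m) (+ n))

  φ-suc : ∀ n → φ (suc n) ≈ ι (+ suc n) * φ n
  φ-suc n = ι-ℕ* (suc n) (n !)

  φ*ρ : ∀ n → φ n * ρ (+ n) ≈ 1#
  φ*ρ zero    = *-identityˡ 1#
  φ*ρ (suc n) = begin
    φ (suc n) * (inv n * ρ (+ n))           ≈⟨ *-congʳ (φ-suc n) ⟩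
    (ι (+ suc n) * φ n) * (inv n * ρ (+ n)) ≈⟨ solve 4 (λ s f i r → (s :* f) :* (i :* r) := (s :* i) :* (f :* r)) refl _ _ _ _ ⟩
    (ι (+ suc n) * inv n) * (φ n * ρ (+ n)) ≈⟨ *-cong (ι*inv n) (φ*ρ n) ⟩
    1# * 1#                                 ≈⟨ *-identityˡ 1# ⟩
    1#                                      ∎

  -- At z = 0 both sides vanish, so the rule z · 1/z! = 1/(z-1)! holds for all integers and shifts
  -- of `ρ` require no case distinction.
  ρ-step : ∀ z → ι z * ρ z ≈ ρ (ℤ.pred z)
  ρ-step (+ zero)  = zeroˡ 1#
  ρ-step (+ suc n) = trans (sym (*-assoc _ _ _)) (trans (*-congʳ (ι*inv n)) (*-identityˡ _))
  ρ-step -[1+ n ]  = zeroʳ _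

  ρ-pred : ∀ z z′ {c} → ℤ.suc z′ ≡ z → ι z ≈ c → ρ z′ ≈ c * ρ z
  ρ-pred _ z′ ≡.refl e = trans (reflexive (≡.cong ρ (≡.sym (ℤ.pred-suc z′)))) (trans (sym (ρ-step (ℤ.suc z′))) (*-congʳ e))

  ρ-≡ : ∀ {z z′} → z ≡ z′ → ρ z ≈ ρ z′
  ρ-≡ e = reflexive (≡.cong ρ e)

  ρ-negative : ∀ {m n} → m < n → ρ (+ m ℤ.- + n) ≈ 0#
  ρ-negative {m} {suc n} (s≤s m≤n) = ρ-≡ (≡.trans (ℤ.⊖-< (s≤s m≤n)) (≡.cong (λ d → ℤ.- + d) (ℕ.+-∸-assoc 1 m≤n)))

  ι-+′ : ∀ i j {x y} → ι i ≈ x → ι j ≈ y → ι (i ℤ.+ j) ≈ x + y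
  ι-+′ i j p q = trans (ι-+ i j) (+-cong p q)

  ι-−′ : ∀ i j {x y} → ι i ≈ x → ι j ≈ y → ι (i ℤ.- j) ≈ x - y
  ι-−′ i j p q = trans (ι-+ i (ℤ.- j)) (+-cong p (trans (ι-neg j) (-‿cong q)))

  twice : ∀ i → ι (+ 2 ℤ.* i) ≈ ι (+ 2) * ι i
  twice = ι-* (+ 2)

  ι-suc : ∀ n → ι (+ suc n) ≈ 1# + ι (+ n)
  ι-suc n = ι-+ 1ℤ (+ n)

  ρ-2k-1 : ∀ i k → ρ (+ 2 ℤ.* k ℤ.- 1ℤ ℤ.- i) ≈ (ι (+ 2) * ι k - ι i) * ρ (+ 2 ℤ.* k ℤ.- i)
  ρ-2k-1 i k = ρ-pred (+ 2 ℤ.* k ℤ.- i) (+ 2 ℤ.* k ℤ.- 1ℤ ℤ.- i) (solveℤ 2 (λ i k → conℤ 1ℤ ⊞ (conℤ (+ 2) ⊠ k ⊟ conℤ 1ℤ ⊟ i) ⊜ conℤ (+ 2) ⊠ k ⊟ i) ≡.refl i k)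
    (ι-−′ (+ 2 ℤ.* k) i (twice k) refl)

  ρ-2k-2 : ∀ i k → ρ (+ 2 ℤ.* k ℤ.- + 2 ℤ.- i) ≈ ((ι (+ 2) * ι k - 1# - ι i) * (ι (+ 2) * ι k - ι i)) * ρ (+ 2 ℤ.* k ℤ.- i)
  ρ-2k-2 i k = trans (ρ-pred (+ 2 ℤ.* k ℤ.- 1ℤ ℤ.- i) (+ 2 ℤ.* k ℤ.- + 2 ℤ.- i)
    (solveℤ 2 (λ i k → conℤ 1ℤ ⊞ (conℤ (+ 2) ⊠ k ⊟ conℤ (+ 2) ⊟ i) ⊜ conℤ (+ 2) ⊠ k ⊟ conℤ 1ℤ ⊟ i) ≡.refl i k)
    (ι-−′ (+ 2 ℤ.* k ℤ.- 1ℤ) i (ι-−′ (+ 2 ℤ.* k) 1ℤ (twice k) refl) refl)) (trans (*-congˡ (ρ-2k-1 i k)) (sym (*-assoc _ _ _)))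

  ρ-i-k : ∀ i k → ρ (i ℤ.- k) ≈ (ι i + 1# - ι k) * ρ (i ℤ.+ 1ℤ ℤ.- k)
  ρ-i-k i k = ρ-pred _ (i ℤ.- k) (solveℤ 2 (λ i k → conℤ 1ℤ ⊞ (i ⊟ k) ⊜ i ⊞ conℤ 1ℤ ⊟ k) ≡.refl i k)
    (ι-−′ (i ℤ.+ 1ℤ) k (ι-+ i 1ℤ) refl)

  ρ-i+k : ∀ i k → ρ (i ℤ.+ k) ≈ (ι i + 1# + ι k) * ρ (i ℤ.+ 1ℤ ℤ.+ k)
  ρ-i+k i k = ρ-pred _ (i ℤ.+ k) (solveℤ 2 (λ i k → conℤ 1ℤ ⊞ (i ⊞ k) ⊜ i ⊞ conℤ 1ℤ ⊞ k) ≡.refl i k)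
    (ι-+′ (i ℤ.+ 1ℤ) k (ι-+ i 1ℤ) refl)

  ρ-i+k-1 : ∀ i k → ρ (i ℤ.+ k ℤ.- 1ℤ) ≈ (ι i + ι k) * ρ (i ℤ.+ k)
  ρ-i+k-1 i k = ρ-pred (i ℤ.+ k) (i ℤ.+ k ℤ.- 1ℤ) (solveℤ 2 (λ i k → conℤ 1ℤ ⊞ (i ⊞ k ⊟ conℤ 1ℤ) ⊜ i ⊞ k) ≡.refl i k) (ι-+ i k)

  ρ-i-k-1 : ∀ i k → ρ (i ℤ.- (1ℤ ℤ.+ k)) ≈ (ι i - ι k) * ρ (i ℤ.- k)
  ρ-i-k-1 i k = ρ-pred (i ℤ.- k) (i ℤ.- (1ℤ ℤ.+ k)) (solveℤ 2 (λ i k → conℤ 1ℤ ⊞ (i ⊟ (conℤ 1ℤ ⊞ k)) ⊜ i ⊟ k) ≡.refl i k) (ι-−′ i k refl refl)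

  β̂ : ℕ → ℤ → ℤ → Carrier
  β̂ n i k = φ n * (ρ (+ 2 ℤ.* k ℤ.- i) * (ρ (i ℤ.- k) * ρ (i ℤ.+ k)))

  -- (2k + i - 1)! / ((2k - i)! (i - k)! (i + k)!) for i = i′ + 1
  β : ℕ → ℕ → Carrier
  β i′ k = β̂ (2 ℕ.* k ℕ.+ i′) (+ suc i′) (+ k)

  module WZ (i′ j′ : ℕ) where
    i j : ℤ
    i = + suc i′
    j = + suc j′

    I J : Carrier
    I = ι i
    J = ι j

    -- Coefficients of a first-order recurrence in j: Q / P is the ratio H(i, j+1) / H(i, j) of the
    -- closed form `H` below, and the sum over k satisfies the same recurrence.
    P Q : Carrier
    P = (J + 1#) * ((ι (+ 2) * J + ι (+ 2) - I) * (ι (+ 2) * J + 1# - I))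
    Q = ι (+ 2) * (ι (+ 2) * J + 1#) * ((I + J) * (ι (+ 2) * I - J))

    -- The companion of Zeilberger's algorithm.
    certificate : ℕ → Carrier
    certificate k = (ι (+ 3) * J + ι (+ 2))
      * ((φ (2 ℕ.* k ℕ.+ i′) * (ρ (+ 2 ℤ.* + k ℤ.- + 2 ℤ.- i) * (ρ (i ℤ.- + k) * ρ (i ℤ.+ + k ℤ.- 1ℤ))))
       * (φ (2 ℕ.* k ℕ.+ j′) * (ρ (+ 2 ℤ.* + k ℤ.- + 2 ℤ.- j) * (ρ (j ℤ.+ 1ℤ ℤ.- + k) * ρ (j ℤ.+ + k)))))

    term : ℕ → ℕ → Carrier
    term j″ k = ι (+ k) * (β i′ k * β j″ k)

    module _ (k : ℕ) where
      κ : ℤ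
      κ = + k
      -- The arguments of `ρ` are the largest and those of `φ` the smallest that occur, so all four
      -- terms of `telescoping` are polynomial multiples of `M`. Hence b′ and c′ are taken at j + 1.
      K F a b c F′ a′ b′ c′ M : Carrier
      K = ι κ
      F = φ (2 ℕ.* k ℕ.+ i′)
      a = ρ (+ 2 ℤ.* κ ℤ.- i)
      b = ρ (i ℤ.- κ)
      c = ρ (i ℤ.+ κ)
      F′ = φ (2 ℕ.* k ℕ.+ j′)
      a′ = ρ (+ 2 ℤ.* κ ℤ.- j)
      b′ = ρ (j ℤ.+ 1ℤ ℤ.- κ)
      c′ = ρ (j ℤ.+ 1ℤ ℤ.+ κ)
      M = (F * (a * (b * c))) * (F′ * (a′ * (b′ * c′)))

      collect : ∀ x₀ x₁ x₂ x₃ y₀ y₁ y₂ y₃ →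
        ((x₀ * F) * ((x₁ * a) * ((x₂ * b) * (x₃ * c)))) * ((y₀ * F′) * ((y₁ * a′) * ((y₂ * b′) * (y₃ * c′))))
          ≈ M * ((x₀ * (x₁ * (x₂ * x₃))) * (y₀ * (y₁ * (y₂ * y₃))))
      collect x₀ x₁ x₂ x₃ y₀ y₁ y₂ y₃ = trans (*-cong (half x₀ x₁ x₂ x₃ F a b c) (half y₀ y₁ y₂ y₃ F′ a′ b′ c′))
        (solve 4 (λ p q r s → (p :* q) :* (r :* s) := (q :* s) :* (p :* r)) refl _ _ _ _)
        where
        half : ∀ x₀ x₁ x₂ x₃ F a b c → (x₀ * F) * ((x₁ * a) * ((x₂ * b) * (x₃ * c))) ≈ (x₀ * (x₁ * (x₂ * x₃))) * (F * (a * (b * c)))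
        half = solve 8 (λ x y z w F a b c → (x :* F) :* ((y :* a) :* ((z :* b) :* (w :* c))) := (x :* (y :* (z :* w))) :* (F :* (a :* (b :* c)))) refl

      1* : ∀ x → x ≈ 1# * x
      1* x = sym (*-identityˡ x)

      2k+ : ∀ n → ι (+ (2 ℕ.* k ℕ.+ n)) ≈ ι (+ 2) * K + ι (+ n)
      2k+ n = trans (ι-+ (+ (2 ℕ.* k)) (+ n)) (+-congʳ (ι-ℕ* 2 k))

      φ-2k+ : ∀ n → φ (2 ℕ.* k ℕ.+ suc n) ≈ (ι (+ 2) * K + ι (+ suc n)) * φ (2 ℕ.* k ℕ.+ n)
      φ-2k+ n = trans (reflexive (≡.cong φ (ℕ.+-suc (2 ℕ.* k) n))) (trans (φ-suc (2 ℕ.* k ℕ.+ n))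
        (*-congʳ (trans (reflexive (≡.cong (λ z → ι (+ z)) (≡.sym (ℕ.+-suc (2 ℕ.* k) n)))) (2k+ (suc n)))))

      φ-2k+2 : ∀ n → φ (2 ℕ.* suc k ℕ.+ n) ≈ ((ι (+ 2) * K + ι (+ suc n) + 1#) * (ι (+ 2) * K + ι (+ suc n))) * φ (2 ℕ.* k ℕ.+ n)
      φ-2k+2 n = trans (reflexive (≡.cong φ index)) (trans (φ-2k+ (suc n)) (trans (*-cong (trans (+-congˡ (ι-suc (suc n)))
        (solve 2 (λ x y → x :+ (# 1 :+ y) := x :+ y :+ # 1) refl _ _)) (φ-2k+ n)) (sym (*-assoc _ _ _))))
        where
        index : 2 ℕ.* suc k ℕ.+ n ≡ 2 ℕ.* k ℕ.+ suc (suc n)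
        index = ≡.trans (≡.cong (ℕ._+ n) (ℕ.*-suc 2 k)) (≡.trans (≡.sym (≡.trans (ℕ.+-suc (2 ℕ.* k) (suc n)) (≡.cong suc (ℕ.+-suc (2 ℕ.* k) n)))) ≡.refl)

      term-j : term j′ k ≈ K * (M * ((J + 1# - K) * (J + 1# + K)))
      term-j = *-congˡ (trans (*-cong (*-cong (1* F) (*-cong (1* a) (*-cong (1* b) (1* c)))) (*-cong (1* F′) (*-cong (1* a′) (*-cong (ρ-i-k j κ) (ρ-i+k j κ)))))
        (trans (collect _ _ _ _ _ _ _ _) (*-congˡ (solve 2 (λ x y → (# 1 :* (# 1 :* (# 1 :* # 1))) :* (# 1 :* (# 1 :* (x :* y))) := x :* y) refl _ _))))

      term-j+1 : term (suc j′) k ≈ K * (M * ((ι (+ 2) * K + J) * (ι (+ 2) * K - J)))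
      term-j+1 = *-congˡ (trans (*-cong (*-cong (1* F) (*-cong (1* a) (*-cong (1* b) (1* c))))
          (*-cong (φ-2k+ j′) (*-cong (trans (ρ-≡ e₁) (ρ-2k-1 j κ)) (*-cong (trans (ρ-≡ e₂) (1* b′)) (trans (ρ-≡ e₃) (1* c′))))))
        (trans (collect _ _ _ _ _ _ _ _) (*-congˡ (solve 2 (λ x y → (# 1 :* (# 1 :* (# 1 :* # 1))) :* (x :* (y :* (# 1 :* # 1))) := x :* y) refl _ _))))
        where
        e₁ : + 2 ℤ.* κ ℤ.- + suc (suc j′) ≡ + 2 ℤ.* κ ℤ.- 1ℤ ℤ.- j
        e₁ = solveℤ 2 (λ j k → conℤ (+ 2) ⊠ k ⊟ (conℤ 1ℤ ⊞ j) ⊜ conℤ (+ 2) ⊠ k ⊟ conℤ 1ℤ ⊟ j) ≡.refl j κ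
        e₂ : + suc (suc j′) ℤ.- κ ≡ j ℤ.+ 1ℤ ℤ.- κ
        e₂ = ≡.cong (ℤ._- κ) (ℤ.+-comm 1ℤ j)
        e₃ : + suc (suc j′) ℤ.+ κ ≡ j ℤ.+ 1ℤ ℤ.+ κ
        e₃ = ≡.cong (ℤ._+ κ) (ℤ.+-comm 1ℤ j)

      certificate-k : certificate k ≈ (ι (+ 3) * J + ι (+ 2)) * (M * ((((ι (+ 2) * K - 1# - I) * (ι (+ 2) * K - I)) * (I + K))
        * (((ι (+ 2) * K - 1# - J) * (ι (+ 2) * K - J)) * (J + 1# + K))))
      certificate-k = *-congˡ (trans (*-cong (*-cong (1* F) (*-cong (ρ-2k-2 i κ) (*-cong (1* b)
          (ρ-i+k-1 i κ))))
          (*-cong (1* F′) (*-cong (ρ-2k-2 j κ) (*-cong (1* b′) (ρ-i+k j κ)))))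
        (trans (collect _ _ _ _ _ _ _ _) (*-congˡ (solve 4 (λ x y z w → (# 1 :* (x :* (# 1 :* y))) :* (# 1 :* (z :* (# 1 :* w))) := (x :* y) :* (z :* w)) refl _ _ _ _))))

      certificate-k+1 : certificate (suc k) ≈ (ι (+ 3) * J + ι (+ 2)) * (M * ((((ι (+ 2) * K + I + 1#) * (ι (+ 2) * K + I)) * (I - K))
        * (((ι (+ 2) * K + J + 1#) * (ι (+ 2) * K + J)) * (J + 1# - K))))
      certificate-k+1 = *-congˡ (trans (*-cong (*-cong (φ-2k+2 i′) (*-cong (trans (ρ-≡ (e₁ i)) (1* a)) (*-cong
            (ρ-i-k-1 i κ)
            (trans (ρ-≡ (solveℤ 2 (λ i k → i ⊞ (conℤ 1ℤ ⊞ k) ⊟ conℤ 1ℤ ⊜ i ⊞ k) ≡.refl i κ)) (1* c)))))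
          (*-cong (φ-2k+2 j′) (*-cong (trans (ρ-≡ (e₁ j)) (1* a′))
            (*-cong (trans (ρ-≡ (solveℤ 2 (λ j k → j ⊞ conℤ 1ℤ ⊟ (conℤ 1ℤ ⊞ k) ⊜ j ⊟ k) ≡.refl j κ)) (ρ-i-k j κ))
              (trans (ρ-≡ (solveℤ 2 (λ j k → j ⊞ (conℤ 1ℤ ⊞ k) ⊜ j ⊞ conℤ 1ℤ ⊞ k) ≡.refl j κ)) (1* c′))))))
        (trans (collect _ _ _ _ _ _ _ _) (*-congˡ (solve 4 (λ x y z w → (x :* (# 1 :* (y :* # 1))) :* (z :* (# 1 :* (w :* # 1))) := (x :* y) :* (z :* w)) refl _ _ _ _))))
        where
        e₁ : ∀ i → + 2 ℤ.* (1ℤ ℤ.+ κ) ℤ.- + 2 ℤ.- i ≡ + 2 ℤ.* κ ℤ.- i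
        e₁ i = solveℤ 2 (λ i k → conℤ (+ 2) ⊠ (conℤ 1ℤ ⊞ k) ⊟ conℤ (+ 2) ⊟ i ⊜ conℤ (+ 2) ⊠ k ⊟ i) ≡.refl i κ

      -- After extraction of `M` a polynomial identity in I, J, K remains. The factor 2 (I + J + 1)
      -- clears the denominator of the rational certificate.
      telescoping : ι (+ 2) * (I + J + 1#) * (P * term (suc j′) k - Q * term j′ k) ≈ certificate k - certificate (suc k)
      telescoping = trans (*-congˡ (+-cong (*-congˡ term-j+1) (-‿cong (*-congˡ term-j))))
        (trans (polynomial I J K M) (sym (+-cong certificate-k (-‿cong certificate-k+1))))
        where
        polynomial : ∀ I J K M → ι (+ 2) * (I + J + 1#)
            * ((J + 1#) * ((ι (+ 2) * J + ι (+ 2) - I) * (ι (+ 2) * J + 1# - I)) * (K * (M * ((ι (+ 2) * K + J) * (ι (+ 2) * K - J))))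
             - ι (+ 2) * (ι (+ 2) * J + 1#) * ((I + J) * (ι (+ 2) * I - J)) * (K * (M * ((J + 1# - K) * (J + 1# + K)))))
          ≈ (ι (+ 3) * J + ι (+ 2)) * (M * ((((ι (+ 2) * K - 1# - I) * (ι (+ 2) * K - I)) * (I + K)) * (((ι (+ 2) * K - 1# - J) * (ι (+ 2) * K - J)) * (J + 1# + K))))
            - (ι (+ 3) * J + ι (+ 2)) * (M * ((((ι (+ 2) * K + I + 1#) * (ι (+ 2) * K + I)) * (I - K)) * (((ι (+ 2) * K + J + 1#) * (ι (+ 2) * K + J)) * (J + 1# - K))))
        polynomial = solve 4 (λ I J K M → # 2 :* (I :+ J :+ # 1)
            :* ((J :+ # 1) :* ((# 2 :* J :+ # 2 :- I) :* (# 2 :* J :+ # 1 :- I)) :* (K :* (M :* ((# 2 :* K :+ J) :* (# 2 :* K :- J))))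
             :- # 2 :* (# 2 :* J :+ # 1) :* ((I :+ J) :* (# 2 :* I :- J)) :* (K :* (M :* ((J :+ # 1 :- K) :* (J :+ # 1 :+ K)))))
          := (# 3 :* J :+ # 2) :* (M :* ((((# 2 :* K :- # 1 :- I) :* (# 2 :* K :- I)) :* (I :+ K)) :* (((# 2 :* K :- # 1 :- J) :* (# 2 :* K :- J)) :* (J :+ # 1 :+ K))))
            :- (# 3 :* J :+ # 2) :* (M :* ((((# 2 :* K :+ I :+ # 1) :* (# 2 :* K :+ I)) :* (I :- K)) :* (((# 2 :* K :+ J :+ # 1) :* (# 2 :* K :+ J)) :* (J :+ # 1 :- K))))) refl

-- The sum in closed form, and the recurrence for the entries of m.

module ClosedForm (R : CommutativeRing 0ℓ 0ℓ) (reciprocals : RationalAlgebra.Reciprocals R) where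
  open import Data.Integer.Base as ℤ using (ℤ; +_; 1ℤ)
  open import Data.Integer.Properties as ℤ using ()
  open import Data.Integer.Solver using () renaming (module +-*-Solver to ℤ-Solver)
  open import Data.Nat.Base as ℕ using (ℕ; zero; suc; _<_; _≤_; z≤n; s≤s)
  open import Data.Nat.Properties as ℕ using ()
  open import Data.Product.Base using (_,_)
  open import Data.Sum.Base using (inj₁; inj₂)
  open import Relation.Binary.PropositionalEquality as ≡ using (_≡_)
  open CommutativeRing R hiding (zero)
  open IntegerCoefficients R
  open FiniteSums R
  open Hypergeometric R reciprocals
  open import Algebra.Properties.Semiring.Exp semiring using (_^_)
  open import Relation.Binary.Reasoning.Setoid setoid
  open ℤ-Solver using () renaming (solve to solveℤ; con to conℤ; _:+_ to _⊞_; _:*_ to _⊠_; _:-_ to _⊟_; _:=_ to _⊜_)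

  ∑-telescope : ∀ n (c : ℕ → Carrier) → ∑ n (λ k → c k - c (suc k)) ≈ c 0 - c n
  ∑-telescope zero    c = sym (-‿inverseʳ (c 0))
  ∑-telescope (suc n) c = trans (+-congʳ (∑-telescope n c)) (solve 3 (λ x y z → (x :- y) :+ (y :- z) := x :- z) refl _ _ _)

  S : ℕ → ℕ → ℕ → Carrier
  S n i′ j′ = ∑ n λ k → ι (+ k) * (β i′ k * β j′ k)

  S-sym : ∀ n i′ j′ → S n i′ j′ ≈ S n j′ i′
  S-sym n i′ j′ = ∑-cong n λ k _ → *-congˡ (*-comm _ _)

  -- Summation over k leaves the certificate at both ends. It vanishes at 0 because of 1/(-2-i)! and
  -- at n > i because of 1/(i-n)!.
  S-recurrence : ∀ n i′ j′ → suc i′ < n → WZ.P i′ j′ * S n i′ (suc j′) ≈ WZ.Q i′ j′ * S n i′ j′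
  S-recurrence n i′ j′ i<n = difference (cancel-suc (y ℕ.+ (suc y ℕ.+ 0)) (trans (*-congʳ factor) (trans vanishing (sym (zeroʳ _)))))
    where
    open WZ i′ j′ using (i; j; I; J; P; Q; term; certificate; telescoping)
    y = suc i′ ℕ.+ suc j′

    factor : ι (+ (2 ℕ.* suc y)) ≈ ι (+ 2) * (I + J + 1#)
    factor = trans (ι-ℕ* 2 (suc y)) (*-congˡ (trans (ι-suc y) (trans (+-comm _ _) (+-congʳ (ι-+ i j)))))

    difference : P * S n i′ (suc j′) - Q * S n i′ j′ ≈ 0# → P * S n i′ (suc j′) ≈ Q * S n i′ j′
    difference e = trans (solve 2 (λ x y → x := (x :- y) :+ y) refl _ _) (trans (+-congʳ e) (+-identityˡ _))

    certificate-0 : certificate 0 ≈ 0#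
    certificate-0 = solve 4 (λ x f b y → x :* ((f :* (# 0 :* b)) :* y) := # 0) refl _ _ _ _

    certificate-n : certificate n ≈ 0#
    certificate-n = trans (*-congˡ (*-congʳ (*-congˡ (*-congˡ (*-congʳ (ρ-negative i<n))))))
      (solve 5 (λ x f a c y → x :* ((f :* (a :* (# 0 :* c))) :* y) := # 0) refl _ _ _ _ _)

    vanishing : ι (+ 2) * (I + J + 1#) * (P * S n i′ (suc j′) - Q * S n i′ j′) ≈ 0#
    vanishing = begin
      ι (+ 2) * (I + J + 1#) * (P * S n i′ (suc j′) - Q * S n i′ j′)
        ≈⟨ *-congˡ (trans (∑-+ n _ _) (+-cong (sym (∑-*ˡ n P (term (suc j′)))) (trans (∑-neg n _) (-‿cong (sym (∑-*ˡ n Q (term j′))))))) ⟨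
      ι (+ 2) * (I + J + 1#) * ∑ n (λ k → P * term (suc j′) k - Q * term j′ k)
        ≈⟨ trans (∑-*ˡ n _ _) (∑-cong n λ k _ → telescoping k) ⟩
      ∑ n (λ k → certificate k - certificate (suc k))
        ≈⟨ ∑-telescope n certificate ⟩
      certificate 0 - certificate n
        ≈⟨ trans (+-cong certificate-0 (-‿cong certificate-n)) (-‿inverseʳ 0#) ⟩
      0# ∎

  -- (i+j-1)! / ((2i-j)! (2j-i)!) times the central binomial coefficients of 2i and 2j.
  H : ℕ → ℕ → Carrier
  H i′ j′ = φ (suc (i′ ℕ.+ j′)) * (ρ (+ 2 ℤ.* + suc i′ ℤ.- + suc j′) * ρ (+ 2 ℤ.* + suc j′ ℤ.- + suc i′))
    * ((φ (2 ℕ.* suc i′) * φ (2 ℕ.* suc j′)) * ((ρ (+ suc i′) * ρ (+ suc i′)) * (ρ (+ suc j′) * ρ (+ suc j′))))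

  H-sym : ∀ i′ j′ → H i′ j′ ≈ H j′ i′
  H-sym i′ j′ = trans (*-congʳ (*-congʳ (reflexive (≡.cong (λ m → φ (suc m)) (ℕ.+-comm i′ j′)))))
    (solve 7 (λ f u v a b x y → f :* (u :* v) :* ((a :* b) :* (x :* y)) := f :* (v :* u) :* ((b :* a) :* (y :* x))) refl _ _ _ _ _ _ _)

  φ-2* : ∀ n → φ (2 ℕ.* suc n) ≈ (ι (+ 2) * ι (+ n) + ι (+ 2)) * ((ι (+ 2) * ι (+ n) + 1#) * φ (2 ℕ.* n))
  φ-2* n = trans (reflexive (≡.cong φ (ℕ.*-suc 2 n))) (trans (φ-suc (suc (2 ℕ.* n))) (*-cong
    (trans (ι-+ (+ 2) (+ (2 ℕ.* n))) (trans (+-comm _ _) (+-congʳ (ι-ℕ* 2 n))))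
    (trans (φ-suc (2 ℕ.* n)) (*-congʳ (trans (ι-suc (2 ℕ.* n)) (trans (+-comm _ _) (+-congʳ (ι-ℕ* 2 n))))))))

  H-recurrence : ∀ i′ j′ → WZ.P i′ j′ * H i′ (suc j′) ≈ WZ.Q i′ j′ * H i′ j′
  H-recurrence i′ j′ = begin
    P * (φ (suc (i′ ℕ.+ suc j′)) * (ρ (+ 2 ℤ.* i ℤ.- + suc (suc j′)) * v) * ((Φ * φ (2 ℕ.* suc (suc j′))) * (s * (r * r))))
      ≈⟨ *-congˡ (*-cong (*-cong φ-step (*-congʳ ρ-step₁)) (*-congʳ (*-congˡ (φ-2* (suc j′))))) ⟩
    P * (((I + J) * F) * (((ι (+ 2) * I - J) * u) * v) * ((Φ * ((ι (+ 2) * J + ι (+ 2)) * ((ι (+ 2) * J + 1#) * G))) * (s * (r * r))))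
      ≈⟨ solve 9 (λ I J F u v Φ G s r →
           ((J :+ # 1) :* ((# 2 :* J :+ # 2 :- I) :* (# 2 :* J :+ # 1 :- I)))
           :* (((I :+ J) :* F) :* (((# 2 :* I :- J) :* u) :* v) :* ((Φ :* ((# 2 :* J :+ # 2) :* ((# 2 :* J :+ # 1) :* G))) :* (s :* (r :* r))))
           := (# 2 :* (# 2 :* J :+ # 1) :* ((I :+ J) :* (# 2 :* I :- J)))
              :* (F :* (u :* (((# 1 :+ J) :* # 2 :- # 1 :- I) :* ((# 1 :+ J) :* # 2 :- I) :* v)) :* ((Φ :* G) :* (s :* (((# 1 :+ J) :* r) :* ((# 1 :+ J) :* r))))))
           refl I J F u v Φ G s r ⟩
    Q * (F * (u * (((1# + J) * ι (+ 2) - 1# - I) * ((1# + J) * ι (+ 2) - I) * v)) * ((Φ * G) * (s * (((1# + J) * r) * ((1# + J) * r)))))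
      ≈⟨ *-congˡ (*-cong (*-congˡ (*-congˡ ρ-step₂)) (*-congˡ (*-congˡ (*-cong ρ-step₃ ρ-step₃)))) ⟨
    Q * (F * (u * ρ (+ 2 ℤ.* j ℤ.- i)) * ((Φ * G) * (s * (ρ j * ρ j)))) ∎
    where
    open WZ i′ j′ using (i; j; I; J; P; Q; term; certificate; telescoping)
    F = φ (suc (i′ ℕ.+ j′))
    u = ρ (+ 2 ℤ.* i ℤ.- j)
    v = ρ (+ 2 ℤ.* + suc (suc j′) ℤ.- i)
    Φ = φ (2 ℕ.* suc i′)
    G = φ (2 ℕ.* suc j′)
    s = ρ i * ρ i
    r = ρ (+ suc (suc j′))

    φ-step : φ (suc (i′ ℕ.+ suc j′)) ≈ (I + J) * F
    φ-step = trans (reflexive (≡.cong (λ m → φ (suc m)) (ℕ.+-suc i′ j′))) (trans (φ-suc (suc (i′ ℕ.+ j′)))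
      (*-congʳ (trans (reflexive (≡.cong (λ m → ι (+ suc m)) (≡.sym (ℕ.+-suc i′ j′)))) (ι-+ i j))))

    ρ-step₁ : ρ (+ 2 ℤ.* i ℤ.- + suc (suc j′)) ≈ (ι (+ 2) * I - J) * u
    ρ-step₁ = trans (ρ-≡ (solveℤ 2 (λ i j → conℤ (+ 2) ⊠ i ⊟ (conℤ 1ℤ ⊞ j) ⊜ conℤ (+ 2) ⊠ i ⊟ conℤ 1ℤ ⊟ j) ≡.refl i j)) (ρ-2k-1 j i)

    ρ-step₂ : ρ (+ 2 ℤ.* j ℤ.- i) ≈ ((1# + J) * ι (+ 2) - 1# - I) * ((1# + J) * ι (+ 2) - I) * v
    ρ-step₂ = trans (ρ-≡ (solveℤ 2 (λ i j → conℤ (+ 2) ⊠ j ⊟ i ⊜ conℤ (+ 2) ⊠ (conℤ 1ℤ ⊞ j) ⊟ conℤ (+ 2) ⊟ i) ≡.refl i j))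
      (trans (ρ-2k-2 i (1ℤ ℤ.+ j)) (*-congʳ (*-cong (+-congʳ (+-congʳ e)) (+-congʳ e))))
      where
      e : ι (+ 2) * ι (1ℤ ℤ.+ j) ≈ (1# + J) * ι (+ 2)
      e = trans (*-congˡ (ι-suc (suc j′))) (*-comm _ _)

    ρ-step₃ : ρ j ≈ (1# + J) * r
    ρ-step₃ = sym (trans (*-congʳ (sym (ι-suc (suc j′)))) (ρ-step (+ suc (suc j′))))

  cancel-P : ∀ i′ j′ {x y} → i′ ≤ suc j′ → WZ.P i′ j′ * x ≈ WZ.P i′ j′ * y → x ≈ y
  cancel-P i′ j′ {x} {y} i≤ e with ℕ.m≤n⇒∃[o]m+o≡n i≤
  ... | d , i′+d = cancel-suc (suc j′) (cancel-suc (suc (j′ ℕ.+ d)) (cancel-suc (j′ ℕ.+ d) (trans (regroup x) (trans e (sym (regroup y))))))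
    where
    open WZ i′ j′ using (i; j; I; J; P; Q; term; certificate; telescoping)
    jd : ι (+ j′) + ι (+ d) ≈ ι (+ 2) * ι (+ j′) + 1# - ι (+ i′)
    jd = trans (solve 3 (λ j d i → j :+ d := j :+ (i :+ d) :- i) refl (ι (+ j′)) (ι (+ d)) (ι (+ i′)))
      (trans (+-congʳ (+-congˡ (trans (sym (ι-+ (+ i′) (+ d))) (trans (reflexive (≡.cong (λ m → ι (+ m)) i′+d)) (ι-suc j′)))))
        (solve 2 (λ j i → j :+ (# 1 :+ j) :- i := # 2 :* j :+ # 1 :- i) refl _ _))
    s₁ : ι (+ suc (j′ ℕ.+ d)) ≈ ι (+ 2) * J + 1# - I
    s₁ = trans (ι-suc (j′ ℕ.+ d)) (trans (+-congˡ (trans (ι-+ (+ j′) (+ d)) jd))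
      (trans (solve 2 (λ j i → # 1 :+ (# 2 :* j :+ # 1 :- i) := # 2 :* (# 1 :+ j) :+ # 1 :- (# 1 :+ i)) refl _ _)
        (sym (+-cong (+-congʳ (*-congˡ (ι-suc j′))) (-‿cong (ι-suc i′))))))
    s₂ : ι (+ suc (suc (j′ ℕ.+ d))) ≈ ι (+ 2) * J + ι (+ 2) - I
    s₂ = trans (ι-suc (suc (j′ ℕ.+ d))) (trans (+-congˡ s₁) (solve 2 (λ j i → # 1 :+ (# 2 :* j :+ # 1 :- i) := # 2 :* j :+ # 2 :- i) refl _ _))
    s₃ : ι (+ suc (suc j′)) ≈ J + 1#
    s₃ = trans (ι-suc (suc j′)) (+-comm _ _)
    regroup : ∀ x → ι (+ suc (j′ ℕ.+ d)) * (ι (+ suc (suc (j′ ℕ.+ d))) * (ι (+ suc (suc j′)) * x)) ≈ P * x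
    regroup x = trans (*-cong s₁ (*-cong s₂ (*-congʳ s₃))) (solve 4 (λ a b c x → a :* (b :* (c :* x)) := (c :* (b :* a)) :* x) refl _ _ _ _)

  ρ₁ : ρ (+ 1) ≈ 1#
  ρ₁ = trans (sym (*-identityˡ _)) (φ*ρ 1)

  module _ (n : ℕ) where
    Claim : ℕ → ℕ → Set
    Claim i′ j′ = ι (+ 4) * S n i′ j′ ≈ H i′ j′

    Claim-sym : ∀ i′ j′ → Claim i′ j′ → Claim j′ i′
    Claim-sym i′ j′ e = trans (*-congˡ (S-sym n j′ i′)) (trans e (H-sym i′ j′))

    Claim-suc : ∀ i′ j′ → suc i′ < n → i′ ≤ suc j′ → Claim i′ j′ → Claim i′ (suc j′)
    Claim-suc i′ j′ i<n i≤ e = cancel-P i′ j′ i≤ (begin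
      P * (ι (+ 4) * S n i′ (suc j′))   ≈⟨ solve 3 (λ p x y → p :* (x :* y) := x :* (p :* y)) refl _ _ _ ⟩
      ι (+ 4) * (P * S n i′ (suc j′))   ≈⟨ *-congˡ (S-recurrence n i′ j′ i<n) ⟩
      ι (+ 4) * (Q * S n i′ j′)         ≈⟨ solve 3 (λ p x y → x :* (p :* y) := p :* (x :* y)) refl _ _ _ ⟩
      Q * (ι (+ 4) * S n i′ j′)         ≈⟨ *-congˡ e ⟩
      Q * H i′ j′                       ≈⟨ H-recurrence i′ j′ ⟨
      P * H i′ (suc j′)                 ∎)
      where open WZ i′ j′ using (P; Q)

    -- The recurrence only raises j, and only from i ≤ j + 1. It leads from (i, i) to (i, i+1),
    -- symmetry leads to (i+1, i), and the recurrence leads on to (i+1, i+1).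
    Claim-diagonal : ∀ i′ → suc i′ < n → Claim 0 0 → Claim i′ i′
    Claim-diagonal zero     _   base = base
    Claim-diagonal (suc i′) i<n base = Claim-suc (suc i′) i′ i<n ℕ.≤-refl (Claim-sym i′ (suc i′)
      (Claim-suc i′ i′ i<n′ (ℕ.n≤1+n i′) (Claim-diagonal i′ i<n′ base)))
      where i<n′ = ℕ.<-trans (ℕ.n<1+n _) i<n

    Claim-above : ∀ i′ d → suc i′ < n → Claim 0 0 → Claim i′ (d ℕ.+ i′)
    Claim-above i′ zero    i<n base = Claim-diagonal i′ i<n base
    Claim-above i′ (suc d) i<n base = Claim-suc i′ (d ℕ.+ i′) i<n (ℕ.m≤n⇒m≤1+n (ℕ.m≤n+m i′ d)) (Claim-above i′ d i<n base)

  -- Only k = 1 contributes: the weight k removes k = 0, and 1/(1-k)! removes k ≥ 2.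
  Claim-base : ∀ n → 1 < n → Claim n 0 0
  Claim-base (suc zero) (s≤s ())
  Claim-base (suc (suc n)) _ = begin
    ι (+ 4) * S (suc (suc n)) 0 0
      ≈⟨ *-congˡ (trans (∑-head (suc n) _) (+-congˡ (∑-head n _))) ⟩
    ι (+ 4) * (0# * (β 0 0 * β 0 0) + (1# * (β 0 1 * β 0 1) + ∑ n (λ k → ι (+ suc (suc k)) * (β 0 (suc (suc k)) * β 0 (suc (suc k))))))
      ≈⟨ *-congˡ (+-congˡ (+-cong (*-congˡ (*-cong β₁ β₁)) (∑-0 n λ k _ → solve 5 (λ x f a c y → x :* ((f :* (a :* (# 0 :* c))) :* y) := # 0) refl _ _ _ _ _))) ⟩
    ι (+ 4) * (0# * (β 0 0 * β 0 0) + (1# * (1# * 1#) + 0#))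
      ≈⟨ solve 1 (λ x → # 4 :* (# 0 :* x :+ (# 1 :* (# 1 :* # 1) :+ # 0))
           := # 1 :* (# 1 :* # 1) :* ((# 2 :* # 2) :* ((# 1 :* # 1) :* (# 1 :* # 1)))) refl (β 0 0 * β 0 0) ⟩
    1# * (1# * 1#) * ((ι (+ 2) * ι (+ 2)) * ((1# * 1#) * (1# * 1#)))
      ≈⟨ *-cong (*-congˡ (*-cong ρ₁ ρ₁)) (*-congˡ (*-cong (*-cong ρ₁ ρ₁) (*-cong ρ₁ ρ₁))) ⟨
    H 0 0 ∎
    where
    β₁ : β 0 1 ≈ 1#
    β₁ = trans (*-congˡ (*-cong ρ₁ (*-identityˡ _))) (trans (*-congˡ (*-identityˡ _)) (φ*ρ 2))

  4S≈H : ∀ n i′ j′ → suc i′ < n → suc j′ < n → Claim n i′ j′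
  4S≈H n i′ j′ i<n j<n with ℕ.≤-total i′ j′
  ... | inj₁ i≤j with ℕ.m≤n⇒∃[o]m+o≡n i≤j
  ...   | d , ≡.refl = ≡.subst (Claim n i′) (ℕ.+-comm d i′) (Claim-above n i′ d i<n (Claim-base n (ℕ.≤-<-trans (s≤s z≤n) i<n)))
  4S≈H n i′ j′ i<n j<n | inj₂ j≤i with ℕ.m≤n⇒∃[o]m+o≡n j≤i
  ...   | d , ≡.refl = ≡.subst (λ i′ → Claim n i′ j′) (ℕ.+-comm d j′) (Claim-sym n j′ (d ℕ.+ j′) (Claim-above n j′ d j<n (Claim-base n (ℕ.≤-<-trans (s≤s z≤n) j<n))))

  p : ℕ → Carrier
  p n = ι (+ 4) ^ n

  -- Twice the entry m(z, j) for j = j′ + 1 and n = z + j - 1.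
  N : ℕ → ℤ → ℕ → Carrier
  N n z j′ = ι (+ 3) * ι (+ suc j′) * (p (suc n) * (φ n * (ρ (+ 2 ℤ.* z ℤ.- + suc j′) * ρ (+ 2 ℤ.* + suc j′ ℤ.- z))))

  -- This is the recurrence of `column`. All terms are polynomial multiples of 4^(n+1) n! u v, and a
  -- polynomial identity in z and j is left. z is an integer because the shift reaches z - 1 = -1; n
  -- is passed separately to keep the factorial on naturals.
  N-recurrence : ∀ n z j′ → + n ≡ z ℤ.+ + j′ → N (suc (suc (suc n))) (1ℤ ℤ.+ z) (suc (suc j′)) ≈
    ι (+ 64) * N n z j′ + (ι (+ 48) * N (suc n) z (suc j′) + ι (+ 64) * N n (z ℤ.- 1ℤ) (suc j′))
  N-recurrence n z j′ n≡ = begin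
    ι (+ 3) * ι (+ suc (suc (suc j′))) * (p (suc (suc (suc (suc n)))) * (φ (suc (suc (suc n))) * (ρ (+ 2 ℤ.* (1ℤ ℤ.+ z) ℤ.- + suc (suc (suc j′))) * ρ (+ 2 ℤ.* + suc (suc (suc j′)) ℤ.- (1ℤ ℤ.+ z)))))
      ≈⟨ *-cong (*-congˡ j₃) (*-congˡ (*-cong φ₃ (*-cong (ρ-≡ (solveℤ 2 (λ z j → conℤ (+ 2) ⊠ (conℤ 1ℤ ⊞ z) ⊟ (conℤ (+ 3) ⊞ j) ⊜ conℤ (+ 2) ⊠ z ⊟ conℤ 1ℤ ⊟ j) ≡.refl z (+ j′)))
           (ρ-≡ (solveℤ 2 (λ z j → conℤ (+ 2) ⊠ (conℤ (+ 3) ⊞ j) ⊟ (conℤ 1ℤ ⊞ z) ⊜ conℤ (+ 2) ⊠ j ⊟ z ⊞ conℤ (+ 5)) ≡.refl z (+ j′)))))) ⟩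
    ι (+ 3) * (ι (+ 3) + J) * ((ι (+ 4) * (ι (+ 4) * (ι (+ 4) * P))) * (((ι (+ 3) + (Z + J)) * ((ι (+ 2) + (Z + J)) * ((1# + (Z + J)) * F))) * (u * v)))
      ≈⟨ solve 6 (λ Z J P F u v →
           # 3 :* (# 3 :+ J) :* ((# 4 :* (# 4 :* (# 4 :* P))) :* (((# 3 :+ (Z :+ J)) :* ((# 2 :+ (Z :+ J)) :* ((# 1 :+ (Z :+ J)) :* F))) :* (u :* v)))
           := # 64 :* (# 3 :* (# 1 :+ J) :* (P :* (F :* (u :* ((# 2 :* J :- Z :+ # 3) :* ((# 2 :* J :- Z :+ # 4) :* ((# 2 :* J :- Z :+ # 5) :* v)))))))
              :+ (# 48 :* (# 3 :* (# 2 :+ J) :* ((# 4 :* P) :* (((# 1 :+ (Z :+ J)) :* F) :* (((# 2 :* Z :- # 1 :- J) :* u) :* ((# 2 :* J :- Z :+ # 5) :* v)))))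
                :+ # 64 :* (# 3 :* (# 2 :+ J) :* (P :* (F :* (((# 2 :* Z :- # 3 :- J) :* ((# 2 :* Z :- # 2 :- J) :* ((# 2 :* Z :- # 1 :- J) :* u))) :* v))))))
           refl Z J P F u v ⟩
    ι (+ 64) * (ι (+ 3) * (1# + J) * (P * (F * (u * (w₃ * (w₄ * (w₅ * v)))))))
      + (ι (+ 48) * (ι (+ 3) * (ι (+ 2) + J) * ((ι (+ 4) * P) * (((1# + (Z + J)) * F) * ((y₁ * u) * (w₅ * v)))))
        + ι (+ 64) * (ι (+ 3) * (ι (+ 2) + J) * (P * (F * ((y₃ * (y₂ * (y₁ * u))) * v)))))
      ≈⟨ +-cong (*-congˡ (*-cong (*-congˡ (ι-suc j′)) (*-congˡ (*-congˡ (*-cong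
             (ρ-≡ (solveℤ 2 (λ z j → conℤ (+ 2) ⊠ z ⊟ (conℤ 1ℤ ⊞ j) ⊜ conℤ (+ 2) ⊠ z ⊟ conℤ 1ℤ ⊟ j) ≡.refl z (+ j′)))
             (trans (ρ-≡ (solveℤ 2 (λ z j → conℤ (+ 2) ⊠ (conℤ 1ℤ ⊞ j) ⊟ z ⊜ conℤ (+ 2) ⊠ j ⊟ z ⊞ conℤ (+ 2)) ≡.refl z (+ j′))) v₂))))))
         (+-cong (*-congˡ (*-cong (*-congˡ j₂) (*-congˡ (*-cong (φn 0 refl) (*-cong
             (trans (ρ-≡ (solveℤ 2 (λ z j → conℤ (+ 2) ⊠ z ⊟ (conℤ (+ 2) ⊞ j) ⊜ conℤ (+ 2) ⊠ z ⊟ conℤ (+ 2) ⊟ j) ≡.refl z (+ j′))) u₂)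
             (trans (ρ-≡ (solveℤ 2 (λ z j → conℤ (+ 2) ⊠ (conℤ (+ 2) ⊞ j) ⊟ z ⊜ conℤ (+ 2) ⊠ j ⊟ z ⊞ conℤ (+ 4)) ≡.refl z (+ j′))) v₄))))))
           (*-congˡ (*-cong (*-congˡ j₂) (*-congˡ (*-congˡ (*-cong
             (trans (ρ-≡ (solveℤ 2 (λ z j → conℤ (+ 2) ⊠ (z ⊟ conℤ 1ℤ) ⊟ (conℤ (+ 2) ⊞ j) ⊜ conℤ (+ 2) ⊠ z ⊟ conℤ (+ 4) ⊟ j) ≡.refl z (+ j′))) u₄)
             (ρ-≡ (solveℤ 2 (λ z j → conℤ (+ 2) ⊠ (conℤ (+ 2) ⊞ j) ⊟ (z ⊟ conℤ 1ℤ) ⊜ conℤ (+ 2) ⊠ j ⊟ z ⊞ conℤ (+ 5)) ≡.refl z (+ j′)))))))))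
         ⟨
    ι (+ 64) * N n z j′ + (ι (+ 48) * N (suc n) z (suc j′) + ι (+ 64) * N n (z ℤ.- 1ℤ) (suc j′)) ∎
    where
    Z = ι z
    J = ι (+ j′)
    P = p (suc n)
    F = φ n
    u = ρ (+ 2 ℤ.* z ℤ.- 1ℤ ℤ.- + j′)
    v = ρ (+ 2 ℤ.* + j′ ℤ.- z ℤ.+ + 5)
    w₃ = ι (+ 2) * J - Z + ι (+ 3)
    w₄ = ι (+ 2) * J - Z + ι (+ 4)
    w₅ = ι (+ 2) * J - Z + ι (+ 5)
    y₁ = ι (+ 2) * Z - 1# - J
    y₂ = ι (+ 2) * Z - ι (+ 2) - J
    y₃ = ι (+ 2) * Z - ι (+ 3) - J

    j₂ : ι (+ suc (suc j′)) ≈ ι (+ 2) + J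
    j₂ = ι-+ (+ 2) (+ j′)
    j₃ : ι (+ suc (suc (suc j′))) ≈ ι (+ 3) + J
    j₃ = ι-+ (+ 3) (+ j′)

    ιn : ι (+ n) ≈ Z + J
    ιn = trans (reflexive (≡.cong ι n≡)) (ι-+ z (+ j′))

    φn : ∀ m {x} → φ (m ℕ.+ n) ≈ x → φ (suc m ℕ.+ n) ≈ (ι (+ suc m) + (Z + J)) * x
    φn m e = trans (φ-suc (m ℕ.+ n)) (*-cong (trans (ι-+ (+ suc m) (+ n)) (+-congˡ ιn)) e)

    φ₃ : φ (suc (suc (suc n))) ≈ (ι (+ 3) + (Z + J)) * ((ι (+ 2) + (Z + J)) * ((1# + (Z + J)) * F))
    φ₃ = φn 2 (φn 1 (φn 0 refl))

    u-pred : ∀ c → ρ (+ 2 ℤ.* z ℤ.- (1ℤ ℤ.+ c) ℤ.- + j′) ≈ (ι (+ 2) * Z - ι c - J) * ρ (+ 2 ℤ.* z ℤ.- c ℤ.- + j′)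
    u-pred c = ρ-pred (+ 2 ℤ.* z ℤ.- c ℤ.- + j′) (+ 2 ℤ.* z ℤ.- (1ℤ ℤ.+ c) ℤ.- + j′)
      (solveℤ 3 (λ z c j → conℤ 1ℤ ⊞ (conℤ (+ 2) ⊠ z ⊟ (conℤ 1ℤ ⊞ c) ⊟ j) ⊜ conℤ (+ 2) ⊠ z ⊟ c ⊟ j) ≡.refl z c (+ j′))
      (ι-−′ (+ 2 ℤ.* z ℤ.- c) (+ j′) (ι-−′ (+ 2 ℤ.* z) c (twice z) refl) refl)

    u₂ : ρ (+ 2 ℤ.* z ℤ.- + 2 ℤ.- + j′) ≈ y₁ * u
    u₂ = u-pred 1ℤ
    u₄ : ρ (+ 2 ℤ.* z ℤ.- + 4 ℤ.- + j′) ≈ y₃ * (y₂ * (y₁ * u))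
    u₄ = trans (u-pred (+ 3)) (*-congˡ (trans (u-pred (+ 2)) (*-congˡ u₂)))

    v-pred : ∀ c → ρ (+ 2 ℤ.* + j′ ℤ.- z ℤ.+ c) ≈ (ι (+ 2) * J - Z + ι (1ℤ ℤ.+ c)) * ρ (+ 2 ℤ.* + j′ ℤ.- z ℤ.+ (1ℤ ℤ.+ c))
    v-pred c = ρ-pred (+ 2 ℤ.* + j′ ℤ.- z ℤ.+ (1ℤ ℤ.+ c)) (+ 2 ℤ.* + j′ ℤ.- z ℤ.+ c)
      (solveℤ 3 (λ z c j → conℤ 1ℤ ⊞ (conℤ (+ 2) ⊠ j ⊟ z ⊞ c) ⊜ conℤ (+ 2) ⊠ j ⊟ z ⊞ (conℤ 1ℤ ⊞ c)) ≡.refl z c (+ j′))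
      (ι-+′ (+ 2 ℤ.* + j′ ℤ.- z) (1ℤ ℤ.+ c) (ι-−′ (+ 2 ℤ.* + j′) z (twice (+ j′)) refl) refl)

    v₄ : ρ (+ 2 ℤ.* + j′ ℤ.- z ℤ.+ + 4) ≈ w₅ * v
    v₄ = v-pred (+ 4)
    v₂ : ρ (+ 2 ℤ.* + j′ ℤ.- z ℤ.+ + 2) ≈ w₃ * (w₄ * (w₅ * v))
    v₂ = trans (v-pred (+ 2)) (*-congˡ (trans (v-pred (+ 3)) (*-congˡ v₄)))

-- Powers of 2 in factorials.

module Factorials where
  open import Data.Nat.Base
  open import Data.Nat.Properties
  open import Data.Nat.Tactic.RingSolver using (solve-∀)
  open import Data.Product.Base using (∃; ∃₂; _×_; _,_)
  open import Data.Sum.Base using (inj₁; inj₂)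
  open import Relation.Binary.PropositionalEquality
  open import Defs using (module ℚ-Valuation)
  open ≡-Reasoning

  Odd : ℕ → Set
  Odd n = ∃ λ m → n ≡ suc (2 * m)

  odd-1 : Odd 1
  odd-1 = 0 , refl

  odd-* : ∀ {m n} → Odd m → Odd n → Odd (m * n)
  odd-* (a , refl) (b , refl) = a + b + 2 * (a * b) , lemma a b
    where
    lemma : ∀ a b → suc (2 * a) * suc (2 * b) ≡ suc (2 * (a + b + 2 * (a * b)))
    lemma = solve-∀

  -- The double factorial (2n - 1)!!.
  odd-! : ℕ → ℕ
  odd-! zero    = 1
  odd-! (suc n) = suc (2 * n) * odd-! n

  odd-!-odd : ∀ n → Odd (odd-! n)
  odd-!-odd zero    = odd-1
  odd-!-odd (suc n) = odd-* (n , refl) (odd-!-odd n)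

  even-! : ∀ n → (2 * n) ! ≡ 2 ^ n * (n ! * odd-! n)
  even-! zero    = refl
  even-! (suc n) = begin
    (2 * suc n) !                                          ≡⟨ cong _! (*-suc 2 n) ⟩
    suc (suc (2 * n)) * (suc (2 * n) * (2 * n) !)          ≡⟨ cong (λ z → suc (suc (2 * n)) * (suc (2 * n) * z)) (even-! n) ⟩
    suc (suc (2 * n)) * (suc (2 * n) * (2 ^ n * (n ! * odd-! n))) ≡⟨ lemma n (2 ^ n) (n !) (odd-! n) ⟩
    2 ^ suc n * (suc n ! * odd-! (suc n))                  ∎
    where
    lemma : ∀ n p f o → suc (suc (2 * n)) * (suc (2 * n) * (p * (f * o))) ≡ (2 * p) * ((suc n * f) * (suc (2 * n) * o))
    lemma = solve-∀

  -- t is the integer part of (r + 1)/2, hence smaller than r + 1. The positive difference d + 1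
  -- supplies the factor 2 in `A-lower`.
  half-! : ∀ m r → ∃₂ λ t d → ∃ λ o → Odd o × t + suc d ≡ suc r × (2 * m + suc r) ! ≡ 2 ^ (m + t) * ((m + t) ! * o)
  half-! m r with ℚ-Valuation.halve (suc r)
  ... | suc t , inj₁ eq = suc t , t , odd-! (m + suc t) , odd-!-odd (m + suc t) , trans (lemma t) (sym eq) ,
    trans (cong _! (trans (cong (2 * m +_) eq) (sym (*-distribˡ-+ 2 m (suc t))))) (even-! (m + suc t))
    where
    lemma : ∀ t → suc t + suc t ≡ 2 * suc t
    lemma = solve-∀
  ... | t , inj₂ eq = t , t , odd-! (suc (m + t)) , odd-!-odd (suc (m + t)) , trans (lemma t) (sym eq) , (begin
    (2 * m + suc r) !                              ≡⟨ cong _! (trans (cong (2 * m +_) eq) (lemma₂ m t)) ⟩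
    suc (2 * (m + t)) * (2 * (m + t)) !            ≡⟨ cong (suc (2 * (m + t)) *_) (even-! (m + t)) ⟩
    suc (2 * (m + t)) * (2 ^ (m + t) * ((m + t) ! * odd-! (m + t)))  ≡⟨ lemma₃ (suc (2 * (m + t))) (2 ^ (m + t)) ((m + t) !) (odd-! (m + t)) ⟩
    2 ^ (m + t) * ((m + t) ! * odd-! (suc (m + t)))  ∎)
    where
    lemma : ∀ t → t + suc t ≡ suc (2 * t)
    lemma = solve-∀
    lemma₂ : ∀ m t → 2 * m + suc (2 * t) ≡ suc (2 * (m + t))
    lemma₂ = solve-∀
    lemma₃ : ∀ s p f o → s * (p * (f * o)) ≡ p * (f * (s * o))
    lemma₃ = solve-∀

  binomial : ∀ m n → ∃ λ c → (m + n) ! ≡ c * (m ! * n !)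
  binomial zero    n       = 1 , lemma (n !)
    where
    lemma : ∀ x → x ≡ 1 * (1 * x)
    lemma = solve-∀
  binomial (suc m) zero    = 1 , trans (cong _! (+-identityʳ (suc m))) (lemma (suc m !))
    where
    lemma : ∀ x → x ≡ 1 * (x * 1)
    lemma = solve-∀
  binomial (suc m) (suc n) with binomial m (suc n) | binomial (suc m) n
  ... | c₁ , e₁ | c₂ , e₂ = c₁ + c₂ , (begin
    (suc m + suc n) !                                   ≡⟨ cong (λ z → suc z * (m + suc n) !) (refl {x = m + suc n}) ⟩
    (suc m + suc n) * (m + suc n) !                     ≡⟨ *-distribʳ-+ ((m + suc n) !) (suc m) (suc n) ⟩
    suc m * (m + suc n) ! + suc n * (m + suc n) !       ≡⟨ cong₂ (λ x y → suc m * x + suc n * y) e₁ (trans (cong _! (+-suc m n)) e₂) ⟩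
    suc m * (c₁ * (m ! * suc n !)) + suc n * (c₂ * (suc m ! * n !))  ≡⟨ lemma m n c₁ c₂ (m !) (n !) ⟩
    (c₁ + c₂) * (suc m ! * suc n !)                     ∎)
    where
    lemma : ∀ m n c d x y → suc m * (c * (x * (suc n * y))) + suc n * (d * ((suc m * x) * y)) ≡ (c + d) * ((suc m * x) * (suc n * y))
    lemma = solve-∀

  -- (3k)! / k!, whose valuation determines the slopes.
  triple : ℕ → ℕ
  triple zero    = 1
  triple (suc k) = 3 * (suc (3 * k) * suc (suc (3 * k))) * triple k

  triple-! : ∀ k → (3 * k) ! ≡ triple k * k !
  triple-! zero    = refl
  triple-! (suc k) = begin
    (3 * suc k) !        ≡⟨ cong _! (*-suc 3 k) ⟩
    suc (suc (suc (3 * k))) * (suc (suc (3 * k)) * (suc (3 * k) * (3 * k) !))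
                         ≡⟨ cong (λ z → suc (suc (suc (3 * k))) * (suc (suc (3 * k)) * (suc (3 * k) * z))) (triple-! k) ⟩
    suc (suc (suc (3 * k))) * (suc (suc (3 * k)) * (suc (3 * k) * (triple k * k !)))
                         ≡⟨ lemma k (triple k) (k !) ⟩
    triple (suc k) * suc k !  ∎
    where
    lemma : ∀ k t f → suc (suc (suc (3 * k))) * (suc (suc (3 * k)) * (suc (3 * k) * (t * f))) ≡ 3 * (suc (3 * k) * suc (suc (3 * k))) * t * (suc k * f)
    lemma = solve-∀

-- The factorisation m = A D B and its 2-adic integrality.

module Factorisation (R : CommutativeRing 0ℓ 0ℓ) (reciprocals : RationalAlgebra.Reciprocals R) where
  open import Data.Integer.Base as ℤ using (ℤ; +_; 1ℤ)
  open import Data.Integer.Properties as ℤ using ()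
  open import Data.Integer.Solver using () renaming (module +-*-Solver to ℤ-Solver)
  open import Data.Nat.Base as ℕ using (ℕ; zero; suc; _<_; s≤s; _!)
  open import Data.Nat.Properties as ℕ using ()
  open import Data.Nat.Tactic.RingSolver using (solve-∀)
  open import Data.Product.Base using (∃₂; _×_; _,_)
  open import Data.Sum.Base using (inj₁; inj₂)
  open import Relation.Binary.PropositionalEquality as ≡ using (_≡_)
  open CommutativeRing R hiding (zero)
  open IntegerCoefficients R
  open FiniteSums R
  open Hypergeometric R reciprocals
  open ClosedForm R reciprocals
  open Factorials
  open RationalAlgebra.Reciprocals reciprocals
  open HauptmodulU using (shift; column)
  open import Algebra.Properties.Semiring.Exp semiring using (_^_; ^-homo-*; ^-congʳ)
  open import Relation.Binary.Reasoning.Setoid setoid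
  open ℤ-Solver using () renaming (solve to solveℤ; con to conℤ; _:+_ to _⊞_; _:*_ to _⊠_; _:-_ to _⊟_; _:=_ to _⊜_)

  zero-left : ∀ x p f b → 0# ≈ x * (p * (f * (0# * b)))
  zero-left = solve 4 (λ x p f b → # 0 := x :* (p :* (f :* (# 0 :* b)))) refl

  zero-right : ∀ x p f b → 0# ≈ x * (p * (f * (b * 0#)))
  zero-right = solve 4 (λ x p f b → # 0 := x :* (p :* (f :* (b :* # 0)))) refl

  -- The first two columns are compared entry by entry, the others by the common recurrence.
  2*column : ∀ j′ i → ι (+ 2) * ι (column (suc j′) i) ≈ N (i ℕ.+ j′) (+ i) j′
  2*column zero zero = trans (zeroʳ _) (zero-left _ _ _ _)
  2*column zero (suc zero) = trans
    (solve 0 (# 2 :* # 24 := # 3 :* # 1 :* (# 4 :^ 2 :* (# 1 :* (# 1 :* # 1)))) refl)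
    (*-congˡ (*-congˡ (*-congˡ (sym (*-cong ρ₁ ρ₁)))))
  2*column zero (suc (suc zero)) = trans
    (solve 0 (# 2 :* # 32 := # 64 :* # 1) refl)
    (trans (*-congˡ (sym (φ*ρ 3)))
      (solve 1 (λ r → # 64 :* (# 6 :* r) := # 3 :* # 1 :* (# 4 :^ 3 :* (# 2 :* (r :* # 1)))) refl (ρ (+ 3))))
  2*column zero (suc (suc (suc i))) = trans (zeroʳ _) (zero-right _ _ _ _)
  2*column (suc zero) zero = trans (zeroʳ _) (zero-left _ _ _ _)
  2*column (suc zero) (suc zero) = trans
    (solve 0 (# 2 :* # 64 := # 128 :* # 1) refl)
    (trans (*-congˡ (sym (φ*ρ 3)))
      (solve 1 (λ r → # 128 :* (# 6 :* r) := # 3 :* # 2 :* (# 4 :^ 3 :* (# 2 :* (# 1 :* r)))) refl (ρ (+ 3))))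
  2*column (suc zero) (suc (suc zero)) = trans
    (solve 0 (# 2 :* # 1152 := # 2304 :* (# 1 :* # 1)) refl)
    (trans (*-congˡ (sym (*-cong (φ*ρ 2) (φ*ρ 2))))
      (solve 1 (λ r → # 2304 :* ((# 2 :* r) :* (# 2 :* r)) := # 3 :* # 2 :* (# 4 :^ 4 :* (# 6 :* (r :* r)))) refl (ρ (+ 2))))
  2*column (suc zero) (suc (suc (suc zero))) = trans
    (solve 0 (# 2 :* # 3072 := # 6144 :* (# 1 :* # 1)) refl)
    (trans (*-congˡ (sym (*-cong (φ*ρ 4) ρ₁)))
      (solve 2 (λ r s → # 6144 :* ((# 24 :* r) :* s) := # 3 :* # 2 :* (# 4 :^ 5 :* (# 24 :* (r :* s)))) refl (ρ (+ 4)) (ρ (+ 1))))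
  2*column (suc zero) (suc (suc (suc (suc zero)))) = trans
    (solve 0 (# 2 :* # 2048 := # 4096 :* # 1) refl)
    (trans (*-congˡ (sym (φ*ρ 6)))
      (solve 1 (λ r → # 4096 :* (# 720 :* r) := # 3 :* # 2 :* (# 4 :^ 6 :* (# 120 :* (r :* # 1)))) refl (ρ (+ 6))))
  2*column (suc zero) (suc (suc (suc (suc (suc i))))) = trans (zeroʳ _) (zero-right _ _ _ _)
  2*column (suc (suc j′)) zero = trans (zeroʳ _) (zero-left _ _ _ _)
  2*column (suc (suc j′)) (suc i) = begin
    ι (+ 2) * ι (+ 64 ℤ.* x ℤ.+ (+ 48 ℤ.* y ℤ.+ + 64 ℤ.* z))
      ≈⟨ *-congˡ (trans (ι-+ (+ 64 ℤ.* x) _) (+-cong (ι-* (+ 64) x) (trans (ι-+ (+ 48 ℤ.* y) _) (+-cong (ι-* (+ 48) y) (ι-* (+ 64) z))))) ⟩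
    ι (+ 2) * (ι (+ 64) * ι x + (ι (+ 48) * ι y + ι (+ 64) * ι z))
      ≈⟨ solve 3 (λ x y z → # 2 :* (# 64 :* x :+ (# 48 :* y :+ # 64 :* z)) := # 64 :* (# 2 :* x) :+ (# 48 :* (# 2 :* y) :+ # 64 :* (# 2 :* z))) refl (ι x) (ι y) (ι z) ⟩
    ι (+ 64) * (ι (+ 2) * ι x) + (ι (+ 48) * (ι (+ 2) * ι y) + ι (+ 64) * (ι (+ 2) * ι z))
      ≈⟨ +-cong (*-congˡ (2*column j′ i)) (+-cong (*-congˡ (trans (2*column (suc j′) i) (index (+ i) (suc j′) (ℕ.+-suc i j′)))) (*-congˡ (shifted i (2*column (suc j′))))) ⟩
    ι (+ 64) * N (i ℕ.+ j′) (+ i) j′ + (ι (+ 48) * N (suc (i ℕ.+ j′)) (+ i) (suc j′) + ι (+ 64) * N (i ℕ.+ j′) (+ i ℤ.- 1ℤ) (suc j′))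
      ≈⟨ N-recurrence (i ℕ.+ j′) (+ i) j′ ≡.refl ⟨
    N (suc (suc (suc (i ℕ.+ j′)))) (+ suc i) (suc (suc j′))
      ≈⟨ index (+ suc i) (suc (suc j′)) (≡.cong suc (≡.trans (≡.cong suc (≡.sym (ℕ.+-suc i j′))) (≡.sym (ℕ.+-suc i (suc j′))))) ⟩
    N (suc i ℕ.+ suc (suc j′)) (+ suc i) (suc (suc j′)) ∎
    where
    x = column (suc j′) i
    y = column (suc (suc j′)) i
    z = shift (column (suc (suc j′))) i

    index : ∀ z j′ {m n} → m ≡ n → N m z j′ ≈ N n z j′
    index z j′ e = reflexive (≡.cong (λ m → N m z j′) e)

    shifted : ∀ i → (∀ i → ι (+ 2) * ι (column (suc (suc j′)) i) ≈ N (i ℕ.+ suc j′) (+ i) (suc j′)) →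
              ι (+ 2) * ι (shift (column (suc (suc j′))) i) ≈ N (i ℕ.+ j′) (+ i ℤ.- 1ℤ) (suc j′)
    shifted zero    h = trans (zeroʳ _) (zero-left _ _ _ _)
    shifted (suc i) h = trans (h i) (index (+ i) (suc j′) (ℕ.+-suc i j′))

  -- 4ⁱ divided by the central binomial coefficient of 2i. The factors c i and c j remove the two
  -- binomial coefficients from H(i, j) and supply the power of 4 in m.
  c : ℕ → Carrier
  c i′ = p (suc i′) * ((φ (suc i′) * φ (suc i′)) * ρ (+ (2 ℕ.* suc i′)))

  1*1 : ∀ {x y} → x ≈ 1# → y ≈ 1# → x * y ≈ 1#
  1*1 e e′ = trans (*-cong e e′) (*-identityˡ 1#)

  drop-1 : ∀ {x y} → x ≈ 1# → y * x ≈ y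
  drop-1 e = trans (*-congˡ e) (*-identityʳ _)

  column≈S : ∀ n i′ j′ → suc i′ < n → suc j′ < n → ι (column (suc j′) (suc i′)) ≈ ι (+ 6) * ι (+ suc j′) * (c i′ * c j′) * S n i′ j′
  column≈S n i′ j′ i<n j<n = cancel-suc 1 (trans (2*column j′ (suc i′)) (sym (begin
    ι (+ 2) * (ι (+ 6) * J * (c i′ * c j′) * S n i′ j′)
      ≈⟨ solve 3 (λ j c s → # 2 :* (# 6 :* j :* c :* s) := # 3 :* j :* (c :* (# 4 :* s))) refl J (c i′ * c j′) (S n i′ j′) ⟩
    ι (+ 3) * J * ((c i′ * c j′) * (ι (+ 4) * S n i′ j′))
      ≈⟨ *-congˡ (*-congˡ (4S≈H n i′ j′ i<n j<n)) ⟩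
    ι (+ 3) * J * ((c i′ * c j′) * H i′ j′)
      ≈⟨ *-congˡ (regroup (p (suc i′)) (p (suc j′)) _ _ _ _ _ _ _ _ _ _) ⟩
    ι (+ 3) * J * (((p (suc i′) * p (suc j′)) * (φ (suc i′ ℕ.+ j′) * (ρ (+ 2 ℤ.* + suc i′ ℤ.- + suc j′) * ρ (+ 2 ℤ.* + suc j′ ℤ.- + suc i′)))) *
      (((φ (suc i′) * ρ (+ suc i′)) * (φ (suc i′) * ρ (+ suc i′))) * ((φ (suc j′) * ρ (+ suc j′)) * (φ (suc j′) * ρ (+ suc j′))) *
       ((φ (2 ℕ.* suc i′) * ρ (+ (2 ℕ.* suc i′))) * (φ (2 ℕ.* suc j′) * ρ (+ (2 ℕ.* suc j′))))))
      ≈⟨ *-congˡ (drop-1 (1*1 (1*1 (1*1 (φ*ρ (suc i′)) (φ*ρ (suc i′))) (1*1 (φ*ρ (suc j′)) (φ*ρ (suc j′)))) (1*1 (φ*ρ (2 ℕ.* suc i′)) (φ*ρ (2 ℕ.* suc j′))))) ⟩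
    ι (+ 3) * J * ((p (suc i′) * p (suc j′)) * (φ (suc i′ ℕ.+ j′) * (ρ (+ 2 ℤ.* + suc i′ ℤ.- + suc j′) * ρ (+ 2 ℤ.* + suc j′ ℤ.- + suc i′))))
      ≈⟨ *-congˡ (*-congʳ (trans (sym (^-homo-* (ι (+ 4)) (suc i′) (suc j′))) (^-congʳ (ι (+ 4)) (≡.cong suc (ℕ.+-suc i′ j′))))) ⟩
    N (suc i′ ℕ.+ j′) (+ suc i′) j′ ∎)))
    where
    J = ι (+ suc j′)
    regroup : ∀ p₁ p₂ f₁ f₂ g₁ g₂ F uv Φ₁ Φ₂ r₁ r₂ →
      ((p₁ * ((f₁ * f₁) * g₁)) * (p₂ * ((f₂ * f₂) * g₂))) * (F * uv * ((Φ₁ * Φ₂) * ((r₁ * r₁) * (r₂ * r₂))))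
      ≈ ((p₁ * p₂) * (F * uv)) * (((f₁ * r₁) * (f₁ * r₁)) * ((f₂ * r₂) * (f₂ * r₂)) * ((Φ₁ * g₁) * (Φ₂ * g₂)))
    regroup = solve 12 (λ p₁ p₂ f₁ f₂ g₁ g₂ F uv Φ₁ Φ₂ r₁ r₂ →
      ((p₁ :* ((f₁ :* f₁) :* g₁)) :* (p₂ :* ((f₂ :* f₂) :* g₂))) :* (F :* uv :* ((Φ₁ :* Φ₂) :* ((r₁ :* r₁) :* (r₂ :* r₂))))
      := ((p₁ :* p₂) :* (F :* uv)) :* (((f₁ :* r₁) :* (f₁ :* r₁)) :* ((f₂ :* r₂) :* (f₂ :* r₂)) :* ((Φ₁ :* g₁) :* (Φ₂ :* g₂)))) refl

  p⁻¹ : ℕ → Carrier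
  p⁻¹ n = inv 3 ^ n

  p*p⁻¹ : ∀ n → p n * p⁻¹ n ≈ 1#
  p*p⁻¹ zero    = *-identityˡ 1#
  p*p⁻¹ (suc n) = trans (solve 4 (λ a b x y → (a :* x) :* (b :* y) := (a :* b) :* (x :* y)) refl _ _ _ _) (1*1 (ι*inv 3) (p*p⁻¹ n))

  -- The diagonal entries of the triangular matrix c i · β(i, k). Dividing its columns by them makes
  -- A unitriangular, and their squares go into D.
  pivot pivot⁻¹ : ℕ → Carrier
  pivot k′ = c k′ * β k′ (suc k′)
  pivot⁻¹ k′ = p⁻¹ (suc k′) * (ρ (+ (2 ℕ.* suc k′ ℕ.+ k′)) * (ρ (+ suc k′) * (φ (2 ℕ.* suc k′) * φ (2 ℕ.* suc k′))))
    * (φ (suc k′) * ρ (+ suc k′))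

  pivot≈ : ∀ k′ → pivot k′ ≈ (p (suc k′) * ((φ (suc k′) * φ (suc k′)) * ρ (+ (2 ℕ.* suc k′))))
                              * (φ (2 ℕ.* suc k′ ℕ.+ k′) * (ρ (+ suc k′) * ρ (+ (2 ℕ.* suc k′))))
  pivot≈ k′ = *-congˡ (*-congˡ (*-cong (ρ-≡ (solveℤ 1 (λ k → conℤ (+ 2) ⊠ k ⊟ k ⊜ k) ≡.refl (+ suc k′)))
    (trans (*-cong (ρ-≡ (ℤ.+-inverseʳ (+ suc k′))) (ρ-≡ (≡.cong (λ m → + (suc k′ ℕ.+ m)) (≡.sym (ℕ.+-identityʳ (suc k′)))))) (*-identityˡ _))))

  pivot*pivot⁻¹ : ∀ k′ → pivot k′ * pivot⁻¹ k′ ≈ 1#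
  pivot*pivot⁻¹ k′ = trans (*-congʳ (pivot≈ k′)) (trans (regroup _ _ _ _ _ _ _ _)
    (1*1 (1*1 (p*p⁻¹ (suc k′)) (φ*ρ (2 ℕ.* suc k′ ℕ.+ k′))) (1*1 (1*1 f (1*1 f f)) (1*1 (φ*ρ (2 ℕ.* suc k′)) (φ*ρ (2 ℕ.* suc k′))))))
    where
    f = φ*ρ (suc k′)
    regroup : ∀ p f g F r p′ ρF Φ → ((p * ((f * f) * g)) * (F * (r * g))) * (p′ * (ρF * (r * (Φ * Φ))) * (f * r))
      ≈ ((p * p′) * (F * ρF)) * (((f * r) * ((f * r) * (f * r))) * ((Φ * g) * (Φ * g)))
    regroup = solve 8 (λ p f g F r p′ ρF Φ → ((p :* ((f :* f) :* g)) :* (F :* (r :* g))) :* (p′ :* (ρF :* (r :* (Φ :* Φ))) :* (f :* r))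
      := ((p :* p′) :* (F :* ρF)) :* (((f :* r) :* ((f :* r) :* (f :* r))) :* ((Φ :* g) :* (Φ :* g)))) refl

  -- The matrix of U is the product of the lower unitriangular A, the diagonal D and the upper
  -- unitriangular B; indices are shifted by one.
  A B : ℕ → ℕ → Carrier
  A i′ k′ = c i′ * β i′ (suc k′) * pivot⁻¹ k′
  B k′ j′ = ι (+ suc j′) * inv k′ * A j′ k′

  D : ℕ → Carrier
  D k′ = ι (+ 6) * (ι (+ suc k′) * ι (+ suc k′)) * (pivot k′ * pivot k′)

  column≈ADB : ∀ n i′ j′ → i′ < n → j′ < n → ι (column (suc j′) (suc i′)) ≈ ∑ n (λ k′ → A i′ k′ * (D k′ * B k′ j′))
  column≈ADB n i′ j′ i<n j<n = begin
    ι (column (suc j′) (suc i′))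
      ≈⟨ column≈S (suc n) i′ j′ (s≤s i<n) (s≤s j<n) ⟩
    X * S (suc n) i′ j′
      ≈⟨ *-congˡ (trans (∑-head n _) (trans (+-congʳ (zeroˡ _)) (+-identityˡ _))) ⟩
    X * ∑ n (λ k′ → ι (+ suc k′) * (β i′ (suc k′) * β j′ (suc k′)))
      ≈⟨ trans (∑-*ˡ n _ _) (∑-cong n λ k′ _ → sym (trans (regroup _ _ _ _ _ _ _ _ _) (drop-1 (1*1 (1*1 (pivot*pivot⁻¹ k′) (pivot*pivot⁻¹ k′)) (ι*inv k′))))) ⟩
    ∑ n (λ k′ → A i′ k′ * (D k′ * B k′ j′)) ∎
    where
    X = ι (+ 6) * ι (+ suc j′) * (c i′ * c j′)
    regroup : ∀ c b e K x J n c′ b′ → (c * b * e) * ((ι (+ 6) * (K * K) * (x * x)) * (J * n * (c′ * b′ * e)))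
      ≈ (ι (+ 6) * J * (c * c′) * (K * (b * b′))) * (((x * e) * (x * e)) * (K * n))
    regroup = solve 9 (λ c b e K x J n c′ b′ → (c :* b :* e) :* ((# 6 :* (K :* K) :* (x :* x)) :* (J :* n :* (c′ :* b′ :* e)))
      := (# 6 :* J :* (c :* c′) :* (K :* (b :* b′))) :* (((x :* e) :* (x :* e)) :* (K :* n))) refl

  A-diagonal : ∀ k′ → A k′ k′ ≈ 1#
  A-diagonal = pivot*pivot⁻¹

  A-upper : ∀ {i′ k′} → i′ < k′ → A i′ k′ ≈ 0#
  A-upper i<k = trans (*-congʳ (*-congˡ (*-congˡ (*-congˡ (*-congʳ (ρ-negative (s≤s i<k)))))))
    (solve 5 (λ c f a b e → c :* (f :* (a :* (# 0 :* b))) :* e := # 0) refl _ _ _ _ _)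

  ι-! : ∀ {m} {x} → m ≡ x → ι (+ m) ≈ ι (+ x)
  ι-! e = reflexive (≡.cong (λ m → ι (+ m)) e)

  ι-product₃ : ∀ a b c → ι (+ (a ℕ.* (b ℕ.* c))) ≈ ι (+ a) * (ι (+ b) * ι (+ c))
  ι-product₃ a b c = trans (ι-ℕ* a (b ℕ.* c)) (*-congˡ (ι-ℕ* b c))

  p≈ : ∀ n → p n ≈ ι (+ (2 ℕ.^ n)) * ι (+ (2 ℕ.^ n))
  p≈ zero    = sym (*-identityˡ 1#)
  p≈ (suc n) = trans (*-congˡ (p≈ n)) (trans (solve 1 (λ t → # 4 :* (t :* t) := (# 2 :* t) :* (# 2 :* t)) refl _)
    (sym (*-cong (ι-ℕ* 2 (2 ℕ.^ n)) (ι-ℕ* 2 (2 ℕ.^ n)))))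

  -- The factor k beside the 2 compensates the denominator k in B. Put i = k + r, s = k - r and let
  -- t be the integer part of r/2. Up to odd factors the entry is C · 2ⁱ i! k! / (2^(k+t) (k+t)! s!)
  -- with a binomial coefficient C. The powers of 2 leave 2^(r-t) with r > t, the quotient i! /
  -- (k+t)! is integral, and k! / s! is a multiple of k because s < k. For r > k the entry is 0.
  A-lower : ∀ k′ r′ → ∃₂ λ o z → Odd o × A (k′ ℕ.+ suc r′) k′ * ι (+ o) ≈ ι (+ 2) * (ι (+ suc k′) * ι (+ z))
  A-lower k′ r′ with ℕ.≤-total (suc k′) r′
  ... | inj₁ k<r = 1 , 0 , odd-1 , trans (*-congʳ (*-congʳ (*-congˡ (*-congˡ (*-congʳ vanishing)))))
      (solve 5 (λ c f b e K → c :* (f :* (# 0 :* b)) :* e :* # 1 := # 2 :* (K :* # 0)) refl _ _ _ _ _)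
    where
    vanishing : ρ (+ 2 ℤ.* + suc k′ ℤ.- + suc (k′ ℕ.+ suc r′)) ≈ 0#
    vanishing = trans (ρ-≡ (≡.cong (ℤ._- + suc (k′ ℕ.+ suc r′)) (≡.sym (ℤ.pos-* 2 (suc k′))))) (ρ-negative (ℕ.<-≤-trans
      (ℕ.≤-reflexive (index k′)) (s≤s (ℕ.+-monoʳ-≤ k′ (s≤s k<r)))))
      where
      index : ∀ k′ → suc (2 ℕ.* suc k′) ≡ suc (k′ ℕ.+ suc (suc k′))
      index = solve-∀
  ... | inj₂ r≤k with ℕ.m≤n⇒∃[o]m+o≡n {r′} {suc k′} r≤k
  -- The boundary case r = k + 1: here 2k - i = -1, and the entry is still 0.
  ...   | zero , r′+0≡ = 1 , 0 , odd-1 , trans (*-congʳ (*-congʳ (*-congˡ (*-congˡ (*-congʳ vanishing)))))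
      (solve 5 (λ c f b e K → c :* (f :* (# 0 :* b)) :* e :* # 1 := # 2 :* (K :* # 0)) refl _ _ _ _ _)
    where
    vanishing : ρ (+ 2 ℤ.* + suc k′ ℤ.- + suc (k′ ℕ.+ suc r′)) ≈ 0#
    vanishing = trans (ρ-≡ (≡.cong (ℤ._- + suc (k′ ℕ.+ suc r′)) (≡.sym (ℤ.pos-* 2 (suc k′))))) (ρ-negative (ℕ.<-≤-trans
      (ℕ.≤-reflexive (index k′)) (s≤s (ℕ.+-monoʳ-≤ k′ (s≤s (ℕ.≤-reflexive (≡.trans (≡.sym r′+0≡) (ℕ.+-identityʳ r′))))))))
      where
      index : ∀ k′ → suc (2 ℕ.* suc k′) ≡ suc (k′ ℕ.+ suc (suc k′))
      index = solve-∀
  -- Now s = 2k - i and k - 1 = s + r′, so `binomial s r′` gives k! = k · Q₂ · s! · r′!.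
  ...   | suc s , r′+s≡ with half-! (suc k′) r′ | binomial (2 ℕ.* suc k′ ℕ.+ k′) (suc r′) | binomial s r′
  ...     | t , d , o , o-odd , t+d , half | C , C-eq | Q₂ , Q₂-eq with binomial (suc k′ ℕ.+ t) (suc d)
  ...       | Q₁′ , Q₁-eq = odd-! (suc i′) ℕ.* o , 2 ℕ.^ d ℕ.* ((C ℕ.* (Q₁′ ℕ.* suc d !)) ℕ.* ((Q₂ ℕ.* r′ !) ℕ.* (odd-! (suc k′) ℕ.* odd-! (suc k′)))) ,
      odd-* (odd-!-odd (suc i′)) o-odd , (begin
      A i′ k′ * ι (+ (odd-! (suc i′) ℕ.* o))
        ≈⟨ *-cong (*-cong (*-cong (*-congʳ (p≈ (suc i′))) (*-cong Fi (*-cong ρa (*-cong ρb ρc)))) (*-congʳ (*-congˡ (*-congˡ (*-congˡ (*-cong Φk Φk)))))) (ι-ℕ* (odd-! (suc i′)) o) ⟩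
      (((Ti * Ti) * ((fi * fi) * gi)) * ((ι (+ C) * (Fk * fr)) * (ra * (rr * rc))) * (qk * (ρFk * (rk * ((Tk * (fk * ok)) * (Tk * (fk * ok))))) * (fk * rk))) * (oi * ι (+ o))
        ≈⟨ regroup₁ Ti fi gi oi (ι (+ C)) Fk fr ra rr rc qk ρFk rk Tk fk ok (ι (+ o)) ⟩
      (((Ti * fi) * ι (+ C)) * ((fk * (ok * ok)) * (ra * (rc * ι (+ o))))) * (((Ti * (fi * oi)) * gi) * ((Fk * ρFk) * ((fr * rr) * (((Tk * Tk) * qk) * ((fk * rk) * (fk * rk))))))
        ≈⟨ drop-1 (1*1 (trans (*-congʳ (sym Φi)) (φ*ρ (2 ℕ.* suc i′))) (1*1 (φ*ρ (2 ℕ.* suc k′ ℕ.+ k′)) (1*1 (φ*ρ (suc r′))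
             (1*1 (trans (*-congʳ (sym (p≈ (suc k′)))) (p*p⁻¹ (suc k′))) (1*1 (φ*ρ (suc k′)) (φ*ρ (suc k′))))))) ⟩
      ((Ti * fi) * ι (+ C)) * ((fk * (ok * ok)) * (ra * (rc * ι (+ o))))
        ≈⟨ *-cong (*-congʳ (*-cong Ti≈ fi≈)) (*-congʳ (*-congʳ fk≈)) ⟩
      (((Tt * (ι (+ 2) * Td)) * ((ι (+ Q₁′) * (ft * fd))) * ι (+ C))) * (((K * (ι (+ Q₂) * (fs * fr′))) * (ok * ok)) * (ra * (rc * ι (+ o))))
        ≈⟨ regroup₂ Tt Td (ι (+ Q₁′)) ft fd (ι (+ C)) K (ι (+ Q₂)) fs fr′ ok ra rc (ι (+ o)) ⟩
      (ι (+ 2) * (K * (Td * ((ι (+ C) * (ι (+ Q₁′) * fd)) * ((ι (+ Q₂) * fr′) * (ok * ok)))))) * ((fs * ra) * ((Tt * (ft * ι (+ o))) * rc))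
        ≈⟨ drop-1 (1*1 (φ*ρ s) (trans (*-congʳ (sym φ-half)) (φ*ρ (2 ℕ.* suc k′ ℕ.+ suc r′)))) ⟩
      ι (+ 2) * (K * (Td * ((ι (+ C) * (ι (+ Q₁′) * fd)) * ((ι (+ Q₂) * fr′) * (ok * ok)))))
        ≈⟨ *-congˡ (*-congˡ (trans (ι-ℕ* (2 ℕ.^ d) (z₁ ℕ.* (z₂ ℕ.* z₃))) (*-congˡ (trans (ι-ℕ* z₁ (z₂ ℕ.* z₃)) (*-cong (ι-product₃ C Q₁′ (suc d !))
             (trans (ι-ℕ* z₂ z₃) (*-cong (ι-ℕ* Q₂ (r′ !)) (ι-ℕ* (odd-! (suc k′)) (odd-! (suc k′)))))))))) ⟨
      ι (+ 2) * (K * ι (+ (2 ℕ.^ d ℕ.* ((C ℕ.* (Q₁′ ℕ.* suc d !)) ℕ.* ((Q₂ ℕ.* r′ !) ℕ.* (odd-! (suc k′) ℕ.* odd-! (suc k′))))))) ∎)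
    where
    i′ = k′ ℕ.+ suc r′
    z₁ = C ℕ.* (Q₁′ ℕ.* suc d !)
    z₂ = Q₂ ℕ.* r′ !
    z₃ = odd-! (suc k′) ℕ.* odd-! (suc k′)
    K  = ι (+ suc k′)
    Ti = ι (+ (2 ℕ.^ suc i′))
    fi = φ (suc i′)
    gi = ρ (+ (2 ℕ.* suc i′))
    oi = ι (+ odd-! (suc i′))
    Fk = φ (2 ℕ.* suc k′ ℕ.+ k′)
    fr = φ (suc r′)
    ra = ρ (+ s)
    rr = ρ (+ suc r′)
    rc = ρ (+ (2 ℕ.* suc k′ ℕ.+ suc r′))
    qk = p⁻¹ (suc k′)
    ρFk = ρ (+ (2 ℕ.* suc k′ ℕ.+ k′))
    rk = ρ (+ suc k′)
    Tk = ι (+ (2 ℕ.^ suc k′))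
    fk = φ (suc k′)
    ok = ι (+ odd-! (suc k′))
    Tt = ι (+ (2 ℕ.^ (suc k′ ℕ.+ t)))
    Td = ι (+ (2 ℕ.^ d))
    ft = φ (suc k′ ℕ.+ t)
    fd = φ (suc d)
    fs = φ s
    fr′ = φ r′

    k′≡ : k′ ≡ s ℕ.+ r′
    k′≡ = ℕ.suc-injective (≡.trans (≡.sym r′+s≡) (≡.trans (ℕ.+-suc r′ s) (≡.cong suc (ℕ.+-comm r′ s))))

    Fi : φ (2 ℕ.* suc k′ ℕ.+ i′) ≈ ι (+ C) * (Fk * fr)
    Fi = trans (reflexive (≡.cong φ (≡.sym (ℕ.+-assoc (2 ℕ.* suc k′) k′ (suc r′))))) (trans (ι-! C-eq) (ι-product₃ C ((2 ℕ.* suc k′ ℕ.+ k′) !) (suc r′ !)))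

    ρa : ρ (+ 2 ℤ.* + suc k′ ℤ.- + suc i′) ≈ ra
    ρa = ρ-≡ (≡.trans (≡.cong₂ (λ x y → + 2 ℤ.* (1ℤ ℤ.+ x) ℤ.- (1ℤ ℤ.+ (y ℤ.+ (1ℤ ℤ.+ + r′)))) (≡.cong +_ k′≡) (≡.cong +_ k′≡))
      (solveℤ 2 (λ s r → conℤ (+ 2) ⊠ (conℤ 1ℤ ⊞ (s ⊞ r)) ⊟ (conℤ 1ℤ ⊞ (s ⊞ r ⊞ (conℤ 1ℤ ⊞ r))) ⊜ s) ≡.refl (+ s) (+ r′)))

    ρb : ρ (+ suc i′ ℤ.- + suc k′) ≈ rr
    ρb = ρ-≡ (solveℤ 2 (λ k r → conℤ 1ℤ ⊞ (k ⊞ r) ⊟ (conℤ 1ℤ ⊞ k) ⊜ r) ≡.refl (+ k′) (+ suc r′))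

    ρc : ρ (+ suc i′ ℤ.+ + suc k′) ≈ rc
    ρc = ρ-≡ (≡.cong +_ (index k′ r′))
      where
      index : ∀ k′ r′ → suc (k′ ℕ.+ suc r′) ℕ.+ suc k′ ≡ 2 ℕ.* suc k′ ℕ.+ suc r′
      index = solve-∀

    Φi : φ (2 ℕ.* suc i′) ≈ Ti * (fi * oi)
    Φi = trans (ι-! (even-! (suc i′))) (ι-product₃ (2 ℕ.^ suc i′) (suc i′ !) (odd-! (suc i′)))

    Φk : φ (2 ℕ.* suc k′) ≈ Tk * (fk * ok)
    Φk = trans (ι-! (even-! (suc k′))) (ι-product₃ (2 ℕ.^ suc k′) (suc k′ !) (odd-! (suc k′)))

    i≡ : suc i′ ≡ suc k′ ℕ.+ t ℕ.+ suc d
    i≡ = ≡.trans (≡.cong (suc k′ ℕ.+_) (≡.sym t+d)) (≡.sym (ℕ.+-assoc (suc k′) t (suc d)))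

    Ti≈ : Ti ≈ Tt * (ι (+ 2) * Td)
    Ti≈ = trans (ι-! (≡.trans (≡.cong (2 ℕ.^_) i≡) (ℕ.^-distribˡ-+-* 2 (suc k′ ℕ.+ t) (suc d)))) (ι-product₃ (2 ℕ.^ (suc k′ ℕ.+ t)) 2 (2 ℕ.^ d))

    fi≈ : fi ≈ ι (+ Q₁′) * (ft * fd)
    fi≈ = trans (ι-! (≡.trans (≡.cong _! i≡) Q₁-eq)) (ι-product₃ Q₁′ ((suc k′ ℕ.+ t) !) (suc d !))

    fk≈ : fk ≈ K * (ι (+ Q₂) * (fs * fr′))
    fk≈ = trans (φ-suc k′) (*-congˡ (trans (ι-! (≡.trans (≡.cong _! k′≡) Q₂-eq)) (ι-product₃ Q₂ (s !) (r′ !))))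

    φ-half : φ (2 ℕ.* suc k′ ℕ.+ suc r′) ≈ Tt * (ft * ι (+ o))
    φ-half = trans (ι-! half) (ι-product₃ (2 ℕ.^ (suc k′ ℕ.+ t)) ((suc k′ ℕ.+ t) !) o)

    regroup₁ : ∀ Ti fi gi oi C Fk fr ra rr rc qk ρFk rk Tk fk ok o →
      (((Ti * Ti) * ((fi * fi) * gi)) * ((C * (Fk * fr)) * (ra * (rr * rc))) * (qk * (ρFk * (rk * ((Tk * (fk * ok)) * (Tk * (fk * ok))))) * (fk * rk))) * (oi * o)
      ≈ (((Ti * fi) * C) * ((fk * (ok * ok)) * (ra * (rc * o)))) * (((Ti * (fi * oi)) * gi) * ((Fk * ρFk) * ((fr * rr) * (((Tk * Tk) * qk) * ((fk * rk) * (fk * rk))))))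
    regroup₁ = solve 17 (λ Ti fi gi oi C Fk fr ra rr rc qk ρFk rk Tk fk ok o →
      (((Ti :* Ti) :* ((fi :* fi) :* gi)) :* ((C :* (Fk :* fr)) :* (ra :* (rr :* rc))) :* (qk :* (ρFk :* (rk :* ((Tk :* (fk :* ok)) :* (Tk :* (fk :* ok))))) :* (fk :* rk))) :* (oi :* o)
      := (((Ti :* fi) :* C) :* ((fk :* (ok :* ok)) :* (ra :* (rc :* o)))) :* (((Ti :* (fi :* oi)) :* gi) :* ((Fk :* ρFk) :* ((fr :* rr) :* (((Tk :* Tk) :* qk) :* ((fk :* rk) :* (fk :* rk))))))) refl

    regroup₂ : ∀ Tt Td Q₁ ft fd C K Q₂ fs fr ok ra rc o →
      (((Tt * (ι (+ 2) * Td)) * ((Q₁ * (ft * fd))) * C)) * (((K * (Q₂ * (fs * fr))) * (ok * ok)) * (ra * (rc * o)))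
      ≈ (ι (+ 2) * (K * (Td * ((C * (Q₁ * fd)) * ((Q₂ * fr) * (ok * ok)))))) * ((fs * ra) * ((Tt * (ft * o)) * rc))
    regroup₂ = solve 14 (λ Tt Td Q₁ ft fd C K Q₂ fs fr ok ra rc o →
      (((Tt :* (# 2 :* Td)) :* ((Q₁ :* (ft :* fd))) :* C)) :* (((K :* (Q₂ :* (fs :* fr))) :* (ok :* ok)) :* (ra :* (rc :* o)))
      := (# 2 :* (K :* (Td :* ((C :* (Q₁ :* fd)) :* ((Q₂ :* fr) :* (ok :* ok)))))) :* ((fs :* ra) :* ((Tt :* (ft :* o)) :* rc))) refl

  -- As 3k · (3k-1)! = (3k)!, the number 3k · pivot k is `triple k` divided by the square of
  -- (2k-1)!!; and D k = 6 k² pivot² is two thirds of the square of 3k · pivot k.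
  D-valuation : ∀ k′ → D k′ * ι (+ (3 ℕ.* ((odd-! (suc k′) ℕ.* odd-! (suc k′)) ℕ.* (odd-! (suc k′) ℕ.* odd-! (suc k′))))) ≈
    ι (+ 2) * (ι (+ triple (suc k′)) * ι (+ triple (suc k′)))
  D-valuation k′ = cancel-suc 2 (begin
    ι (+ 3) * (D k′ * ι (+ (3 ℕ.* ((odd-! (suc k′) ℕ.* odd-! (suc k′)) ℕ.* (odd-! (suc k′) ℕ.* odd-! (suc k′))))))
      ≈⟨ *-congˡ (*-congˡ (trans (ι-ℕ* 3 (o² ℕ.* o²)) (*-congˡ (trans (ι-ℕ* o² o²) (*-cong (ι-ℕ* (odd-! (suc k′)) (odd-! (suc k′))) (ι-ℕ* (odd-! (suc k′)) (odd-! (suc k′)))))))) ⟩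
    ι (+ 3) * (ι (+ 6) * (K * K) * (x * x) * (ι (+ 3) * ((o * o) * (o * o))))
      ≈⟨ solve 3 (λ K x o → # 3 :* (# 6 :* (K :* K) :* (x :* x) :* (# 3 :* ((o :* o) :* (o :* o))))
           := # 3 :* (# 2 :* ((# 3 :* K :* x :* (o :* o)) :* (# 3 :* K :* x :* (o :* o))))) refl K x o ⟩
    ι (+ 3) * (ι (+ 2) * ((ι (+ 3) * K * x * (o * o)) * (ι (+ 3) * K * x * (o * o))))
      ≈⟨ *-congˡ (*-congˡ (*-cong root root)) ⟩
    ι (+ 3) * (ι (+ 2) * (ι (+ triple (suc k′)) * ι (+ triple (suc k′)))) ∎)
    where
    o² = odd-! (suc k′) ℕ.* odd-! (suc k′)
    K = ι (+ suc k′)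
    x = pivot k′
    o = ι (+ odd-! (suc k′))
    f = φ (suc k′)
    F = φ (2 ℕ.* suc k′ ℕ.+ k′)
    g = ρ (+ (2 ℕ.* suc k′))
    r = ρ (+ suc k′)
    T = ι (+ (2 ℕ.^ suc k′))

    3KF : ι (+ 3) * K * F ≈ ι (+ triple (suc k′)) * f
    3KF = begin
      ι (+ 3) * K * F                          ≈⟨ *-congʳ (trans (sym (ι-ℕ* 3 (suc k′))) (ι-! (index₁ k′))) ⟩
      ι (+ suc (2 ℕ.* suc k′ ℕ.+ k′)) * F      ≈⟨ φ-suc (2 ℕ.* suc k′ ℕ.+ k′) ⟨
      φ (suc (2 ℕ.* suc k′ ℕ.+ k′))            ≈⟨ ι-! (≡.cong _! (≡.sym (index₁ k′))) ⟩
      φ (3 ℕ.* suc k′)                         ≈⟨ trans (ι-! (triple-! (suc k′))) (ι-ℕ* (triple (suc k′)) (suc k′ !)) ⟩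
      ι (+ triple (suc k′)) * f                ∎
      where
      index₁ : ∀ k′ → 3 ℕ.* suc k′ ≡ suc (2 ℕ.* suc k′ ℕ.+ k′)
      index₁ = solve-∀

    Tfog : (T * (f * o)) * g ≈ 1#
    Tfog = trans (*-congʳ (sym (trans (ι-! (even-! (suc k′))) (ι-product₃ (2 ℕ.^ suc k′) (suc k′ !) (odd-! (suc k′)))))) (φ*ρ (2 ℕ.* suc k′))

    root : ι (+ 3) * K * x * (o * o) ≈ ι (+ triple (suc k′))
    root = begin
      ι (+ 3) * K * x * (o * o)
        ≈⟨ *-congʳ (*-congˡ (trans (pivot≈ k′) (*-congʳ (*-congʳ (p≈ (suc k′)))))) ⟩
      ι (+ 3) * K * (((T * T) * ((f * f) * g)) * (F * (r * g))) * (o * o)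
        ≈⟨ solve 8 (λ h K T f g F r o → h :* K :* (((T :* T) :* ((f :* f) :* g)) :* (F :* (r :* g))) :* (o :* o)
             := ((h :* K :* F) :* r) :* (((T :* (f :* o)) :* g) :* ((T :* (f :* o)) :* g))) refl (ι (+ 3)) K T f g F r o ⟩
      ((ι (+ 3) * K * F) * r) * (((T * (f * o)) * g) * ((T * (f * o)) * g))
        ≈⟨ drop-1 (1*1 Tfog Tfog) ⟩
      (ι (+ 3) * K * F) * r
        ≈⟨ *-congʳ 3KF ⟩
      (ι (+ triple (suc k′)) * f) * r
        ≈⟨ trans (*-assoc _ _ _) (drop-1 (φ*ρ (suc k′))) ⟩
      ι (+ triple (suc k′)) ∎

-- Determinants: row operations via the exterior algebra, estimates via a filtration.

module Determinants (R : CommutativeRing 0ℓ 0ℓ) where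
  open import Algebra.Properties.AbelianGroup (CommutativeRing.+-abelianGroup R) using (ε⁻¹≈ε)
  open import Algebra.Properties.Monoid.Sum (CommutativeRing.+-monoid R) using (sum; sum-init-last)
  open import Data.Bool.Base using (Bool; true; false)
  open import Data.Fin.Base using (Fin; zero; suc; toℕ; fromℕ; inject₁; punchIn)
  open import Data.Fin.Properties using (toℕ-inject₁; toℕ-fromℕ; toℕ<n)
  open import Data.Integer.Base as ℤ using (ℤ; +_; 0ℤ; 1ℤ)
  open import Data.Integer.Properties as ℤ using ()
  open import Data.Nat.Base as ℕ using (ℕ; zero; suc; _<_; s≤s)
  open import Data.Nat.Properties as ℕ using ()
  open import Data.Sum.Base using (inj₁; inj₂)
  open import Data.Vec.Base using (Vec; []; _∷_; insertAt; replicate)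
  open import Function.Base using (_∘_)
  open import Relation.Binary.PropositionalEquality as ≡ using (_≡_; _≢_)
  open import Defs using (det; signed)
  open CommutativeRing R hiding (zero)
  open IntegerCoefficients R
  open FiniteSums R
  open import Relation.Binary.Reasoning.Setoid setoid

  sum-cong : ∀ n {s t : Fin n → Carrier} → (∀ i → s i ≈ t i) → sum s ≈ sum t
  sum-cong zero    e = refl
  sum-cong (suc n) e = +-cong (e zero) (sum-cong n (e ∘ suc))

  sum-* : ∀ n x (t : Fin n → Carrier) → x * sum t ≈ sum (λ i → x * t i)
  sum-* zero    x t = zeroʳ x
  sum-* (suc n) x t = trans (distribˡ x _ _) (+-congˡ (sum-* n x (t ∘ suc)))

  signed-cong : ∀ m {x y} → x ≈ y → signed rawRing m x ≈ signed rawRing m y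
  signed-cong zero          e = e
  signed-cong (suc zero)    e = -‿cong e
  signed-cong (suc (suc m)) e = signed-cong m e

  signed-suc : ∀ m x → signed rawRing (suc m) x ≈ - signed rawRing m x
  signed-suc zero          x = refl
  signed-suc (suc zero)    x = solve 1 (λ x → x := :- (:- x)) refl x
  signed-suc (suc (suc m)) x = signed-suc m x

  sign : ℕ → Carrier
  sign m = signed rawRing m 1#

  signed≈ : ∀ m x → signed rawRing m x ≈ sign m * x
  signed≈ zero    x = sym (*-identityˡ x)
  signed≈ (suc m) x = trans (signed-suc m x) (trans (-‿cong (signed≈ m x))
    (trans (solve 2 (λ s x → :- (s :* x) := (:- s) :* x) refl _ _) (*-congʳ (sym (signed-suc m 1#)))))

  sign-+ : ∀ m n → sign (m ℕ.+ n) ≈ sign m * sign n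
  sign-+ zero    n = sym (*-identityˡ _)
  sign-+ (suc m) n = trans (signed-suc (m ℕ.+ n) 1#) (trans (-‿cong (sign-+ m n))
    (trans (solve 2 (λ s x → :- (s :* x) := (:- s) :* x) refl _ _) (*-congʳ (sym (signed-suc m 1#)))))

  sign-double : ∀ m → sign (m ℕ.+ m) ≈ 1#
  sign-double zero    = refl
  sign-double (suc m) = trans (reflexive (≡.cong (λ l → sign (suc l)) (ℕ.+-suc m m))) (sign-double m)

  det-cong : ∀ n {A B : Fin n → Fin n → Carrier} → (∀ i j → A i j ≈ B i j) → det rawRing A ≈ det rawRing B
  det-cong zero    e = refl
  det-cong (suc n) e = sum-cong (suc n) λ j → signed-cong (n ℕ.+ toℕ j)
    (*-cong (det-cong n λ i k → e (inject₁ i) (punchIn j k)) (e (fromℕ n) j))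

  -- Elements of the exterior algebra of Rⁿ, given by their coefficients in the standard basis;
  -- v ∧ x is computed from x = a + e₀ ∧ b.
  Λ : ℕ → Set
  Λ n = Vec Bool n → Carrier

  infixr 6 _∧_
  _∧_ : ∀ {n} → (Fin n → Carrier) → Λ n → Λ n
  (v ∧ x) []          = 0#
  (v ∧ x) (false ∷ S) = (v ∘ suc ∧ x ∘ (false ∷_)) S
  (v ∧ x) (true ∷ S)  = v zero * x (false ∷ S) - (v ∘ suc ∧ x ∘ (true ∷_)) S

  ∧-cong : ∀ {n} {v w : Fin n → Carrier} {x y : Λ n} → (∀ i → v i ≈ w i) → (∀ S → x S ≈ y S) → ∀ S → (v ∧ x) S ≈ (w ∧ y) S
  ∧-cong e f []          = refl
  ∧-cong e f (false ∷ S) = ∧-cong (e ∘ suc) (f ∘ (false ∷_)) S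
  ∧-cong e f (true ∷ S)  = +-cong (*-cong (e zero) (f (false ∷ S))) (-‿cong (∧-cong (e ∘ suc) (f ∘ (true ∷_)) S))

  ∧-linearʳ : ∀ {n} (v : Fin n → Carrier) c (x y : Λ n) S → (v ∧ (λ T → c * x T - y T)) S ≈ c * (v ∧ x) S - (v ∧ y) S
  ∧-linearʳ v c x y []          = solve 1 (λ c → # 0 := c :* # 0 :- # 0) refl c
  ∧-linearʳ v c x y (false ∷ S) = ∧-linearʳ (v ∘ suc) c (x ∘ (false ∷_)) (y ∘ (false ∷_)) S
  ∧-linearʳ v c x y (true ∷ S)  = trans (+-congˡ (-‿cong (∧-linearʳ (v ∘ suc) c (x ∘ (true ∷_)) (y ∘ (true ∷_)) S)))
    (solve 6 (λ v c a b p q → v :* (c :* a :- b) :- (c :* p :- q) := c :* (v :* a :- p) :- (v :* b :- q)) refl _ _ _ _ _ _)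

  ∧-linearˡ : ∀ {n} (v w : Fin n → Carrier) c (x : Λ n) S → ((λ i → v i + c * w i) ∧ x) S ≈ (v ∧ x) S + c * (w ∧ x) S
  ∧-linearˡ v w c x []          = solve 1 (λ c → # 0 := # 0 :+ c :* # 0) refl c
  ∧-linearˡ v w c x (false ∷ S) = ∧-linearˡ (v ∘ suc) (w ∘ suc) c (x ∘ (false ∷_)) S
  ∧-linearˡ v w c x (true ∷ S)  = trans (+-congˡ (-‿cong (∧-linearˡ (v ∘ suc) (w ∘ suc) c (x ∘ (true ∷_)) S)))
    (solve 6 (λ v w c a p q → (v :+ c :* w) :* a :- (p :+ c :* q) := (v :* a :- p) :+ c :* (w :* a :- q)) refl _ _ _ _ _ _)

  ∧-self : ∀ {n} (v : Fin n → Carrier) (x : Λ n) S → (v ∧ v ∧ x) S ≈ 0#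
  ∧-self v x []          = refl
  ∧-self v x (false ∷ S) = ∧-self (v ∘ suc) (x ∘ (false ∷_)) S
  ∧-self v x (true ∷ S)  = trans (+-congˡ (-‿cong (trans (∧-linearʳ (v ∘ suc) (v zero) (x ∘ (false ∷_)) (v ∘ suc ∧ x ∘ (true ∷_)) S)
      (+-congˡ (-‿cong (∧-self (v ∘ suc) (x ∘ (true ∷_)) S))))))
    (solve 1 (λ a → a :- (a :- # 0) := # 0) refl _)

  ∧-anti : ∀ {n} (v w : Fin n → Carrier) (x : Λ n) S → (v ∧ w ∧ x) S ≈ - (w ∧ v ∧ x) S
  ∧-anti v w x []          = sym ε⁻¹≈ε
  ∧-anti v w x (false ∷ S) = ∧-anti (v ∘ suc) (w ∘ suc) (x ∘ (false ∷_)) S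
  ∧-anti v w x (true ∷ S)  = begin
    v zero * p - (v ∘ suc ∧ (λ T → w zero * x (false ∷ T) - (w ∘ suc ∧ x ∘ (true ∷_)) T)) S
      ≈⟨ +-congˡ (-‿cong (trans (∧-linearʳ (v ∘ suc) (w zero) (x ∘ (false ∷_)) _ S) (+-congˡ (-‿cong (∧-anti (v ∘ suc) (w ∘ suc) (x ∘ (true ∷_)) S))))) ⟩
    v zero * p - (w zero * q - - r)
      ≈⟨ solve 5 (λ v w p q r → v :* p :- (w :* q :- (:- r)) := :- (w :* q :- (v :* p :- r))) refl _ _ _ _ _ ⟩
    - (w zero * q - (v zero * p - r))
      ≈⟨ -‿cong (+-congˡ (-‿cong (∧-linearʳ (w ∘ suc) (v zero) (x ∘ (false ∷_)) _ S))) ⟨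
    - (w ∧ v ∧ x) (true ∷ S) ∎
    where
    p = (w ∘ suc ∧ x ∘ (false ∷_)) S
    q = (v ∘ suc ∧ x ∘ (false ∷_)) S
    r = (w ∘ suc ∧ v ∘ suc ∧ x ∘ (true ∷_)) S

  unit : ∀ {n} → Λ n
  unit []          = 1#
  unit (false ∷ S) = unit S
  unit (true ∷ S)  = 0#

  ⋀ : ∀ {n} → ℕ → (ℕ → Fin n → Carrier) → Λ n
  ⋀ zero    r = unit
  ⋀ (suc m) r = r m ∧ ⋀ m r

  ∧-⋀ : ∀ {n} m (r : ℕ → Fin n → Carrier) {k} → k < m → ∀ S → (r k ∧ ⋀ m r) S ≈ 0#
  ∧-⋀ (suc m) r {k} (s≤s k≤m) S with ℕ.m≤n⇒m<n∨m≡n k≤m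
  ... | inj₂ ≡.refl = ∧-self (r m) (⋀ m r) S
  ... | inj₁ k<m    = trans (∧-anti (r k) (r m) (⋀ m r) S) (trans (-‿cong (trans (∧-cong (λ _ → refl) (∧-⋀ m r k<m) S) (∧-0 (r m) S))) ε⁻¹≈ε)
    where
    ∧-0 : ∀ {n} (v : Fin n → Carrier) S → (v ∧ (λ _ → 0#)) S ≈ 0#
    ∧-0 v []          = refl
    ∧-0 v (false ∷ S) = ∧-0 (v ∘ suc) S
    ∧-0 v (true ∷ S)  = trans (+-congˡ (-‿cong (∧-0 (v ∘ suc) S))) (solve 1 (λ v → v :* # 0 :- # 0 := # 0) refl _)

  -- Row m changes by multiples of earlier rows only, and each of these is already a factor of the
  -- product, so its wedge with the product vanishes.
  ⋀-row-operations : ∀ {n} m (r s : ℕ → Fin n → Carrier) (c : ℕ → ℕ → Carrier) →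
    (∀ i → i < m → ∀ j → r i j ≈ s i j + ∑ i (λ k → c i k * s k j)) → ∀ S → ⋀ m r S ≈ ⋀ m s S
  ⋀-row-operations zero    r s c e S = refl
  ⋀-row-operations (suc m) r s c e S = trans
    (∧-cong (e m ℕ.≤-refl) (⋀-row-operations m r s c λ i i<m → e i (ℕ.m<n⇒m<1+n i<m)) S) (absorb m ℕ.≤-refl)
    where
    absorb : ∀ l → l ℕ.≤ m → ((λ j → s m j + ∑ l (λ k → c m k * s k j)) ∧ ⋀ m s) S ≈ (s m ∧ ⋀ m s) S
    absorb zero    _   = ∧-cong (λ j → +-identityʳ (s m j)) (λ _ → refl) S
    absorb (suc l) l<m = trans (∧-cong (λ j → sym (+-assoc (s m j) _ _)) (λ _ → refl) S)
      (trans (∧-linearˡ (λ j → s m j + ∑ l (λ k → c m k * s k j)) (s l) (c m l) (⋀ m s) S)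
        (trans (+-cong (absorb l (ℕ.<⇒≤ l<m)) (trans (*-congˡ (∧-⋀ m s l<m S)) (zeroʳ _))) (+-identityʳ _)))

  -- Coefficients at sets without j do not see the component along eⱼ. This is the deletion of
  -- column j: `punchIn j` on vectors, `insertAt` with `false` on sets.
  ∧-insertAt : ∀ {n} (v : Fin (suc n) → Carrier) (x : Λ (suc n)) j S →
    (v ∧ x) (insertAt S j false) ≈ (v ∘ punchIn j ∧ (λ T → x (insertAt T j false))) S
  ∧-insertAt v x zero    S           = refl
  ∧-insertAt v x (suc j) (false ∷ S) = ∧-insertAt (v ∘ suc) (x ∘ (false ∷_)) j S
  ∧-insertAt v x (suc j) (true ∷ S)  = +-congˡ (-‿cong (∧-insertAt (v ∘ suc) (x ∘ (true ∷_)) j S))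

  unit-insertAt : ∀ {n} (j : Fin (suc n)) S → unit (insertAt S j false) ≈ unit S
  unit-insertAt zero    S           = refl
  unit-insertAt (suc j) (false ∷ S) = unit-insertAt j S
  unit-insertAt (suc j) (true ∷ S)  = refl

  ⋀-insertAt : ∀ {n} m (r : ℕ → Fin (suc n) → Carrier) j S → ⋀ m (λ i → r i ∘ punchIn j) S ≈ ⋀ m r (insertAt S j false)
  ⋀-insertAt zero    r j S = sym (unit-insertAt j S)
  ⋀-insertAt (suc m) r j S = trans (∧-cong (λ _ → refl) (⋀-insertAt m r j) S) (sym (∧-insertAt (r m) (⋀ m r) j S))

  top : ∀ n → Vec Bool n
  top n = replicate n true

  ∧-top : ∀ n (v : Fin (suc n) → Carrier) (x : Λ (suc n)) →
    (v ∧ x) (top (suc n)) ≈ sum (λ j → sign (toℕ j) * (v j * x (insertAt (top n) j false)))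
  ∧-top zero    v x = solve 2 (λ v x → v :* x :- # 0 := # 1 :* (v :* x) :+ # 0) refl _ _
  ∧-top (suc n) v x = +-cong (sym (*-identityˡ _)) (trans (-‿cong (∧-top n (v ∘ suc) (x ∘ (true ∷_))))
    (trans (solve 1 (λ x → :- x := (:- # 1) :* x) refl _) (trans (sum-* (suc n) (- 1#) (λ j → sign (toℕ j) * (v (suc j) * x (true ∷ insertAt (top n) j false)))) (sum-cong (suc n) λ j →
      trans (sym (*-assoc (- 1#) (sign (toℕ j)) (v (suc j) * x (true ∷ insertAt (top n) j false))))
        (*-congʳ (trans (solve 1 (λ s → (:- # 1) :* s := :- s) refl (sign (toℕ j))) (sym (signed-suc (toℕ j) 1#))))))))

  -- The sign of the reversal of n elements.
  reversal : ℕ → Carrier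
  reversal zero    = 1#
  reversal (suc n) = sign n * reversal n

  -- Expanding the top coefficient along the outermost vector is Laplace expansion along the last
  -- row, except that the signs start at (-1)ⁿ there and at 1 here; `reversal` accumulates the
  -- discrepancy. Invariance under row operations thus comes from the alternating wedge product.
  det≈⋀ : ∀ n (r : ℕ → Fin n → Carrier) → det rawRing (λ i j → r (toℕ i) j) ≈ reversal n * ⋀ n r (top n)
  det≈⋀ zero    r = sym (*-identityˡ 1#)
  det≈⋀ (suc n) r = begin
    sum (λ j → signed rawRing (n ℕ.+ toℕ j) (det rawRing (λ i k → r (toℕ (inject₁ i)) (punchIn j k)) * r (toℕ (fromℕ n)) j))
      ≈⟨ sum-cong (suc n) (λ j → begin
           signed rawRing (n ℕ.+ toℕ j) (det rawRing (λ i k → r (toℕ (inject₁ i)) (punchIn j k)) * r (toℕ (fromℕ n)) j)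
             ≈⟨ trans (signed≈ (n ℕ.+ toℕ j) _) (*-cong (sign-+ n (toℕ j)) (*-cong
                  (trans (det-cong n λ i k → reflexive (≡.cong (λ l → r l (punchIn j k)) (toℕ-inject₁ i))) (trans (det≈⋀ n (λ i → r i ∘ punchIn j)) (*-congˡ (⋀-insertAt n r j (top n)))))
                  (reflexive (≡.cong (λ l → r l j) (toℕ-fromℕ n))))) ⟩
           (sign n * sign (toℕ j)) * ((reversal n * ⋀ n r (insertAt (top n) j false)) * r n j)
             ≈⟨ solve 5 (λ a b c d e → (a :* b) :* ((c :* d) :* e) := (a :* c) :* (b :* (e :* d))) refl _ _ _ _ _ ⟩
           (sign n * reversal n) * (sign (toℕ j) * (r n j * ⋀ n r (insertAt (top n) j false))) ∎) ⟩
    sum (λ j → (sign n * reversal n) * (sign (toℕ j) * (r n j * ⋀ n r (insertAt (top n) j false))))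
      ≈⟨ sum-* (suc n) (sign n * reversal n) (λ j → sign (toℕ j) * (r n j * ⋀ n r (insertAt (top n) j false))) ⟨
    (sign n * reversal n) * sum (λ j → sign (toℕ j) * (r n j * ⋀ n r (insertAt (top n) j false)))
      ≈⟨ *-congˡ (∧-top n (r n) (⋀ n r)) ⟨
    reversal (suc n) * ⋀ (suc n) r (top (suc n)) ∎

  det-row-operations : ∀ n (r s : ℕ → ℕ → Carrier) (c : ℕ → ℕ → Carrier) →
    (∀ i j → i < n → j < n → r i j ≈ s i j + ∑ i (λ k → c i k * s k j)) →
    det rawRing {n} (λ i j → r (toℕ i) (toℕ j)) ≈ det rawRing {n} (λ i j → s (toℕ i) (toℕ j))
  det-row-operations n r s c e = trans (det≈⋀ n (λ i → r i ∘ toℕ)) (trans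
    (*-congˡ (⋀-row-operations n (λ i → r i ∘ toℕ) (λ i → s i ∘ toℕ) c (λ i i<n j → e i (toℕ j) i<n (toℕ<n j)) (top n)))
    (sym (det≈⋀ n (λ i → s i ∘ toℕ))))

  -- The properties of a Gauss norm on which the determinant estimate rests.
  record Filtration : Set₁ where
    field
      F      : ℤ → Carrier → Set
      F-resp : ∀ {k x y} → x ≈ y → F k x → F k y
      F-0    : ∀ k → F k 0#
      F-1    : F 0ℤ 1#
      F-+    : ∀ {k x y} → F k x → F k y → F k (x + y)
      F-neg  : ∀ {k x} → F k x → F k (- x)
      F-*    : ∀ {k l x y} → F k x → F l y → F (k ℤ.+ l) (x * y)
      F-mono : ∀ {k l x} → k ℤ.≤ l → F l x → F k x

    weight : ℕ → (ℕ → ℤ) → ℤ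
    weight = FiniteSums.∑ ℤ.+-*-commutativeRing

    F-signed : ∀ {k x} m → F k x → F k (signed rawRing m x)
    F-signed zero          f = f
    F-signed (suc zero)    f = F-neg f
    F-signed (suc (suc m)) f = F-signed m f

    F-sum : ∀ {k} n {t : Fin n → Carrier} → (∀ i → F k (t i)) → F k (sum t)
    F-sum zero    f = F-0 _
    F-sum (suc n) f = F-+ (f zero) (F-sum n (f ∘ suc))

    F-∏ : ∀ n (w : ℕ → ℤ) (t : ℕ → Carrier) → (∀ i → F (w i) (t i)) → F (weight n w) (∏ n t)
    F-∏ zero    w t f = F-1
    F-∏ (suc n) w t f = F-* (F-∏ n w t f) (f n)

    F-det : ∀ n (w : ℕ → ℤ) (a : Fin n → Fin n → Carrier) → (∀ i j → F (w (toℕ i)) (a i j)) → F (weight n w) (det rawRing a)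
    F-det zero    w a f = F-1
    F-det (suc n) w a f = F-sum (suc n) λ j → F-signed (n ℕ.+ toℕ j) (F-*
      (F-det n w _ λ i k → ≡.subst (λ l → F (w l) (a (inject₁ i) (punchIn j k))) (toℕ-inject₁ i) (f (inject₁ i) (punchIn j k)))
      (≡.subst (λ l → F (w l) (a (fromℕ n) j)) (toℕ-fromℕ n) (f (fromℕ n) j)))

    toℕ-punchIn-fromℕ : ∀ {n} (l : Fin n) → toℕ (punchIn (fromℕ n) l) ≡ toℕ l
    toℕ-punchIn-fromℕ zero    = ≡.refl
    toℕ-punchIn-fromℕ (suc l) = ≡.cong suc (toℕ-punchIn-fromℕ l)

    -- In the expansion along the last row every off-diagonal entry gains one level. For the
    -- remaining term, m x - p y = (m - p) x + p (x - y) combines the induction hypothesis for the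
    -- minor with the estimate for the last diagonal entry.
    F-det-diagonal : ∀ n (w : ℕ → ℤ) (a : ℕ → ℕ → Carrier) (d : ℕ → Carrier) →
      (∀ i j → F (w i) (a i j)) → (∀ i → F (w i) (d i)) →
      (∀ i j → i ≢ j → F (w i ℤ.+ 1ℤ) (a i j)) → (∀ i → F (w i ℤ.+ 1ℤ) (a i i - d i)) →
      F (weight n w ℤ.+ 1ℤ) (det rawRing {n} (λ i j → a (toℕ i) (toℕ j)) - ∏ n d)
    F-det-diagonal zero    w a d fa fd off diag = F-resp (sym (-‿inverseʳ 1#)) (F-0 _)
    F-det-diagonal (suc n) w a d fa fd off diag = F-resp split (F-+ (F-sum n others) last-term)
      where
      t : Fin (suc n) → Carrier
      t j = signed rawRing (n ℕ.+ toℕ j) (det rawRing (λ i k → a (toℕ (inject₁ i)) (toℕ (punchIn j k))) * a (toℕ (fromℕ n)) (toℕ j))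

      minor : Carrier
      minor = det rawRing {n} (λ i j → a (toℕ i) (toℕ j))

      others : ∀ j → F (weight n w ℤ.+ w n ℤ.+ 1ℤ) (t (inject₁ j))
      others j = ≡.subst (λ k → F k (t (inject₁ j))) (≡.sym (ℤ.+-assoc (weight n w) (w n) 1ℤ)) (F-signed (n ℕ.+ toℕ (inject₁ j)) (F-*
        (F-det n w _ λ i k → ≡.subst (λ l → F (w l) (a (toℕ (inject₁ i)) (toℕ (punchIn (inject₁ j) k)))) (toℕ-inject₁ i) (fa (toℕ (inject₁ i)) _))
        (≡.subst (λ l → F (w n ℤ.+ 1ℤ) (a l (toℕ (inject₁ j)))) (≡.sym (toℕ-fromℕ n))
          (off n (toℕ (inject₁ j)) λ n≡j → ℕ.<-irrefl (≡.trans (≡.sym (toℕ-inject₁ j)) (≡.sym n≡j)) (toℕ<n j)))))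

      last-≈ : t (fromℕ n) ≈ minor * a n n
      last-≈ = trans (signed≈ (n ℕ.+ toℕ (fromℕ n)) _) (trans (*-cong
        (trans (reflexive (≡.cong (λ l → sign (n ℕ.+ l)) (toℕ-fromℕ n))) (sign-double n))
        (*-cong (det-cong n λ i k → reflexive (≡.cong₂ a (toℕ-inject₁ i) (toℕ-punchIn-fromℕ k))) (reflexive (≡.cong₂ a (toℕ-fromℕ n) (toℕ-fromℕ n)))))
        (*-identityˡ _))

      last-term : F (weight n w ℤ.+ w n ℤ.+ 1ℤ) (t (fromℕ n) - ∏ n d * d n)
      last-term = F-resp (trans (solve 4 (λ m p x y → (m :- p) :* x :+ p :* (x :- y) := m :* x :- p :* y) refl minor (∏ n d) (a n n) (d n)) (+-congʳ (sym last-≈)))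
        (F-+ (≡.subst (λ k → F k ((minor - ∏ n d) * a n n)) (reorder (weight n w) (w n)) (F-* (F-det-diagonal n w a d fa fd off diag) (fa n n)))
             (≡.subst (λ k → F k (∏ n d * (a n n - d n))) (≡.sym (ℤ.+-assoc (weight n w) (w n) 1ℤ)) (F-* (F-∏ n w d fd) (diag n))))
        where
        reorder : ∀ x y → x ℤ.+ 1ℤ ℤ.+ y ≡ x ℤ.+ y ℤ.+ 1ℤ
        reorder x y = ≡.trans (ℤ.+-assoc x 1ℤ y) (≡.trans (≡.cong (λ z → x ℤ.+ z) (ℤ.+-comm 1ℤ y)) (≡.sym (ℤ.+-assoc x y 1ℤ)))

      split : sum (t ∘ inject₁) + (t (fromℕ n) - ∏ n d * d n) ≈ sum t - ∏ n d * d n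
      split = trans (sym (+-assoc _ _ _)) (+-congʳ (sym (sum-init-last t)))

-- Row reduction of 1 - X m and its dominant diagonal.

module RowReduction (K S : CommutativeRing 0ℓ 0ℓ) where
  open import Data.Nat.Base using (ℕ; zero; suc)
  open import Data.Integer.Base using (+_)
  private
    module K = CommutativeRing K
    module KSums = FiniteSums K
  open CommutativeRing S hiding (zero)
  open IntegerCoefficients S
  open FiniteSums S
  open import Relation.Binary.Reasoning.Setoid setoid

  module _ (κ : K.Carrier → Carrier)
    (κ-cong : ∀ {x y} → x K.≈ y → κ x ≈ κ y)
    (κ-0 : κ K.0# ≈ 0#)
    (κ-+ : ∀ x y → κ (x K.+ y) ≈ κ x + κ y)
    (κ-* : ∀ x y → κ (x K.* y) ≈ κ x * κ y)
    (X : Carrier) (u A P Q δ : ℕ → ℕ → K.Carrier) where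

    -- 1 - X m = A (A⁻¹ - X D B) read row by row, with P for A⁻¹ and Q for D B. The unit diagonal of
    -- A gives the first summand and its strictly lower part the sum, which is the shape of a row
    -- operation.
    reduce : ∀ i j → δ i j K.≈ P i j K.+ KSums.∑ i (λ k → A i k K.* P k j) →
      u i j K.≈ KSums.∑ i (λ k → A i k K.* Q k j) K.+ Q i j →
      κ (δ i j) + - (X * κ (u i j)) ≈ (κ (P i j) - X * κ (Q i j)) + ∑ i (λ k → κ (A i k) * (κ (P k j) - X * κ (Q k j)))
    reduce i j δ≈ u≈ = begin
      κ (δ i j) + - (X * κ (u i j))
        ≈⟨ +-cong (trans (κ-cong δ≈) (κ-+ _ _)) (-‿cong (*-congˡ (trans (κ-cong u≈) (κ-+ _ _)))) ⟩
      (κ (P i j) + κ (p i)) - X * (κ (q i) + κ (Q i j))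
        ≈⟨ solve 5 (λ a b X c d → (a :+ b) :- X :* (c :+ d) := (a :- X :* d) :+ (b :- X :* c)) refl _ _ _ _ _ ⟩
      (κ (P i j) - X * κ (Q i j)) + (κ (p i) - X * κ (q i))
        ≈⟨ +-congˡ (split i) ⟨
      (κ (P i j) - X * κ (Q i j)) + ∑ i (λ k → κ (A i k) * (κ (P k j) - X * κ (Q k j))) ∎
      where
      p q : ℕ → K.Carrier
      p l = KSums.∑ l λ k → A i k K.* P k j
      q l = KSums.∑ l λ k → A i k K.* Q k j

      split : ∀ l → ∑ l (λ k → κ (A i k) * (κ (P k j) - X * κ (Q k j))) ≈ κ (p l) - X * κ (q l)
      split zero    = sym (trans (+-cong κ-0 (-‿cong (*-congˡ κ-0))) (solve 1 (λ X → # 0 :- X :* # 0 := # 0) refl X))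
      split (suc l) = trans (+-congʳ (split l)) (trans
        (solve 6 (λ a X b c d e → (a :- X :* b) :+ c :* (d :- X :* e) := (a :+ c :* d) :- X :* (b :+ c :* e)) refl _ _ _ _ _ _)
        (sym (+-cong (trans (κ-+ _ _) (+-congˡ (κ-* _ _))) (-‿cong (*-congˡ (trans (κ-+ _ _) (+-congˡ (κ-* _ _))))))))

module CharacteristicSeries where
  open import Data.Bool.Base using (true; false; if_then_else_)
  open import Data.Fin.Base using (toℕ)
  open import Data.Integer.Base as ℤ using (ℤ; +_; 0ℤ; 1ℤ)
  open import Data.Integer.Properties as ℤ using ()
  open import Data.Integer.Solver using () renaming (module +-*-Solver to ℤ-Solver)
  open import Data.Nat.Base as ℕ using (ℕ; zero; suc; _<_; _≤_)
  open import Data.Nat.Properties as ℕ using ()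
  open import Data.Product.Base using (∃; _×_; _,_; proj₁; proj₂)
  open import Relation.Binary.PropositionalEquality as ≡ using (_≡_; _≢_)
  open import Relation.Nullary.Decidable using (yes; no; does; dec-true; dec-false)
  open import Defs using (ValuedRing; module Banach; constant; var)

  module _ (K : ValuedRing) (complete : ValuedRing.IsComplete K) where
    open ValuedRing K hiding (zero; sum)
    open Banach K complete using (1-X_; truncated)
    open FiniteSums commutativeRing
    open IntegerCoefficients commutativeRing using (solve; #_; _:+_; _:*_; _:-_; :-_; _:=_)
    open PowerSeries commutativeRing using (series; tail; *-tail; S-zero)
    private
      module S = CommutativeRing series
      module SSums = FiniteSums series
      module SSolver = IntegerCoefficients series
    open Determinants series using (Filtration; det-row-operations)

    κ : Carrier → S.Carrier
    κ = constant rawRing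

    X : S.Carrier
    X = var rawRing

    κ-cong : ∀ {x y} → x ≈ y → κ x S.≈ κ y
    κ-cong e zero    = e
    κ-cong e (suc n) = refl

    κ-0 : κ 0# S.≈ S.0#
    κ-0 zero    = refl
    κ-0 (suc n) = refl

    κ-+ : ∀ x y → κ (x + y) S.≈ κ x S.+ κ y
    κ-+ x y zero    = refl
    κ-+ x y (suc n) = sym (+-identityʳ 0#)

    *-κ : ∀ a x n → (a S.* κ x) n ≈ a n * x
    *-κ a x zero    = +-identityʳ _
    *-κ a x (suc n) = trans (+-congˡ (S-zero a n)) (+-identityʳ _)

    κ-* : ∀ x y → κ (x * y) S.≈ κ x S.* κ y
    κ-* x y zero    = sym (*-κ (κ x) y zero)
    κ-* x y (suc n) = sym (trans (*-κ (κ x) y (suc n)) (zeroˡ y))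

    X*-suc : ∀ a n → (X S.* a) (suc n) ≈ a n
    X*-suc a n = trans (*-tail X a n) (trans (+-cong (S.trans (S.*-congʳ {a} {tail X} {S.1#} tail-X) (S.*-identityˡ a) n) (zeroˡ _)) (+-identityʳ _))
      where
      tail-X : tail X S.≈ S.1#
      tail-X zero    = refl
      tail-X (suc n) = refl

    -- The Gauss norm that gives X the valuation - T: `level k n` is k + n T. The recursion follows
    -- the tails of a series, as the convolution does.
    module Gauss (T : ℤ) where
      level : ℤ → ℕ → ℤ
      level k zero    = k
      level k (suc n) = level (k ℤ.+ T) n

      level-+ : ∀ k l n → k ℤ.+ level l n ≡ level (k ℤ.+ l) n
      level-+ k l zero    = ≡.refl
      level-+ k l (suc n) = ≡.trans (level-+ k (l ℤ.+ T) n) (≡.cong (λ m → level m n) (≡.sym (ℤ.+-assoc k l T)))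

      level-mono : ∀ {k l} n → k ℤ.≤ l → level k n ℤ.≤ level l n
      level-mono zero    k≤l = k≤l
      level-mono (suc n) k≤l = level-mono n (ℤ.+-monoˡ-≤ T k≤l)

      infix 4 _≤G_
      _≤G_ : ℤ → S.Carrier → Set
      k ≤G a = ∀ n → level k n ≤v a n

      G-* : ∀ n {k l a b} → k ≤G a → l ≤G b → level (k ℤ.+ l) n ≤v (a S.* b) n
      G-* zero    v w = v-resp (sym (+-identityʳ _)) (v-* (v 0) (w 0))
      G-* (suc n) {k} {l} {a} {b} v w = v-resp (sym (*-tail a b n)) (v-+
        (≡.subst (λ m → level m n ≤v (tail a S.* b) n) (reorder k l T) (G-* n {k ℤ.+ T} {l} {tail a} {b} (λ m → v (suc m)) w))
        (≡.subst (_≤v a 0 * b (suc n)) (≡.trans (level-+ k (l ℤ.+ T) n) (≡.cong (λ m → level m n) (≡.sym (ℤ.+-assoc k l T)))) (v-* (v 0) (w (suc n)))))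
        where
        open ℤ-Solver using () renaming (solve to solveℤ; _:+_ to _⊞_; _:=_ to _⊜_)
        reorder : ∀ k l t → k ℤ.+ t ℤ.+ l ≡ k ℤ.+ l ℤ.+ t
        reorder = solveℤ 3 (λ k l t → k ⊞ t ⊞ l ⊜ k ⊞ l ⊞ t) ≡.refl

      G-κ : ∀ {k x} → k ≤v x → k ≤G κ x
      G-κ v zero    = v
      G-κ v (suc n) = v-0 _

      filtration : Filtration
      filtration = record
        { F = _≤G_
        ; F-resp = λ e v n → v-resp (e n) (v n)
        ; F-0 = λ k n → v-0 _
        ; F-1 = λ { zero → v-1 ; (suc n) → v-0 _ }
        ; F-+ = λ v w n → v-+ (v n) (w n)
        ; F-neg = λ v n → v-neg (v n)
        ; F-* = λ {k} {l} {a} {b} v w n → G-* n {k} {l} {a} {b} v w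
        ; F-mono = λ k≤l v n → v-mono (level-mono n k≤l) (v n)
        }

      G-X : ℤ.- T ≤G X
      G-X zero          = v-0 _
      G-X (suc zero)    = ≡.subst (_≤v 1#) (≡.sym (ℤ.+-inverseˡ T)) v-1
      G-X (suc (suc n)) = v-0 _

    δ : ℕ → ℕ → Carrier
    δ i j = if does (i ℕ.≟ j) then 1# else 0#

    v-∑ : ∀ {k} n {t : ℕ → Carrier} → (∀ i → i < n → k ≤v t i) → k ≤v ∑ n t
    v-∑ zero    v = v-0 _
    v-∑ (suc n) v = v-+ (v-∑ n λ i i<n → v i (ℕ.m<n⇒m<1+n i<n)) (v n ℕ.≤-refl)

    δ-integral : ∀ i j → 0ℤ ≤v δ i j
    δ-integral i j with does (i ℕ.≟ j)
    ... | true  = v-1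
    ... | false = v-0 0ℤ

    near-δ : ∀ {x} i j → Close 1ℤ x (δ i j) → 0ℤ ≤v x
    near-δ i j c = v-close (Close-mono (ℤ.+≤+ ℕ.z≤n) c) (δ-integral i j)

    -- Forward substitution.
    inverse-rows : (A : ℕ → ℕ → Carrier) → (∀ i k → k < i → 1ℤ ≤v A i k) → ∀ M → ∃ λ (P : ℕ → ℕ → Carrier) →
      (∀ i j → Close 1ℤ (P i j) (δ i j)) × (∀ i j → i < M → δ i j ≈ P i j + ∑ i (λ k → A i k * P k j))
    inverse-rows A even zero = δ , (λ i j → Close-refl (δ i j)) , λ _ _ ()
    inverse-rows A even (suc M) = P′ , close , equation
      where
      P = proj₁ (inverse-rows A even M)
      P-close = proj₁ (proj₂ (inverse-rows A even M))
      P-equation = proj₂ (proj₂ (inverse-rows A even M))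

      row : ℕ → Carrier
      row j = δ M j - ∑ M (λ k → A M k * P k j)

      P′ : ℕ → ℕ → Carrier
      P′ i j = if does (i ℕ.≟ M) then row j else P i j

      P′-old : ∀ {i} → i ≢ M → ∀ j → P′ i j ≡ P i j
      P′-old {i} i≢M j = ≡.cong (λ b → if b then row j else P i j) (dec-false (i ℕ.≟ M) i≢M)

      P′-new : ∀ j → P′ M j ≡ row j
      P′-new j = ≡.cong (λ b → if b then row j else P M j) (dec-true (M ℕ.≟ M) ≡.refl)

      close : ∀ i j → Close 1ℤ (P′ i j) (δ i j)
      close i j with i ℕ.≟ M
      ... | no  i≢M    = ≡.subst (λ x → Close 1ℤ x (δ i j)) (≡.sym (P′-old i≢M j)) (P-close i j)
      ... | yes ≡.refl = ≡.subst (λ x → Close 1ℤ x (δ M j)) (≡.sym (P′-new j)) (v-resp (solve 2 (λ d s → :- s := d :- s :- d) refl _ _)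
        (v-neg (v-∑ M λ k k<M → v-* (even M k k<M) (near-δ k j (P-close k j)))))

      equation : ∀ i j → i < suc M → δ i j ≈ P′ i j + ∑ i (λ k → A i k * P′ k j)
      equation i j i<1+M with i ℕ.≟ M
      ... | no i≢M = trans (P-equation i j i<M) (+-cong (reflexive (≡.sym (P′-old i≢M j))) (∑-cong i λ k k<i → *-congˡ (reflexive (≡.sym (P′-old (ℕ.<⇒≢ (ℕ.<-trans k<i i<M)) j)))))
        where i<M = ℕ.≤∧≢⇒< (ℕ.≤-pred i<1+M) i≢M
      ... | yes ≡.refl = trans (solve 2 (λ d s → d := d :- s :+ s) refl _ (∑ M (λ k → A M k * P k j)))
        (+-cong (reflexive (≡.sym (P′-new j))) (∑-cong M λ k k<M → *-congˡ (reflexive (≡.sym (P′-old (ℕ.<⇒≢ k<M) j)))))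

    weight : ℕ → (ℕ → ℤ) → ℤ
    weight = FiniteSums.∑ ℤ.+-*-commutativeRing

    -- T lies strictly between the first n slopes and the others. As all of them are integers, this
    -- requires a gap of at least 2 between slopes n - 1 and n, counted from 0.
    module _ (u A B : ℕ → ℕ → Carrier) (D : ℕ → Carrier) (s : ℕ → ℤ)
      (u≈ : ∀ i j → u i j ≈ ∑ i (λ k → A i k * (D k * B k j)) + D i * B i j)
      (A-even : ∀ i k → k < i → 1ℤ ≤v A i k)
      (B-close : ∀ i j → Close 1ℤ (B i j) (δ i j))
      (D-val : ∀ k → s k ≤v D k)
      (n : ℕ) (T : ℤ) (below : ∀ k → k < n → s k ℤ.+ 1ℤ ℤ.≤ T) (above : ∀ k → n ≤ k → T ℤ.+ 1ℤ ℤ.≤ s k) where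
      open Gauss T
      open Filtration filtration using (F-+; F-neg; F-*; F-mono; F-resp; F-1; F-det-diagonal)

      module _ (M : ℕ) where
        P = proj₁ (inverse-rows A A-even M)
        P-close = proj₁ (proj₂ (inverse-rows A A-even M))

        N : ℕ → ℕ → S.Carrier
        N i j = κ (P i j) S.- X S.* κ (D i * B i j)

        w : ℕ → ℤ
        w i = if does (i ℕ.<? n) then s i ℤ.- T else 0ℤ

        d : ℕ → S.Carrier
        d i = if does (i ℕ.<? n) then S.- (X S.* κ (D i)) else S.1#

        w-yes : ∀ {i} → i < n → w i ≡ s i ℤ.- T
        w-yes {i} i<n = ≡.cong (λ b → if b then s i ℤ.- T else 0ℤ) (dec-true (i ℕ.<? n) i<n)

        w-no : ∀ {i} → n ≤ i → w i ≡ 0ℤ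
        w-no {i} n≤i = ≡.cong (λ b → if b then s i ℤ.- T else 0ℤ) (dec-false (i ℕ.<? n) (ℕ.≤⇒≯ n≤i))

        d-yes : ∀ {i} → i < n → d i ≡ S.- (X S.* κ (D i))
        d-yes {i} i<n = ≡.cong (λ b → if b then S.- (X S.* κ (D i)) else S.1#) (dec-true (i ℕ.<? n) i<n)

        d-no : ∀ {i} → n ≤ i → d i ≡ S.1#
        d-no {i} n≤i = ≡.cong (λ b → if b then S.- (X S.* κ (D i)) else S.1#) (dec-false (i ℕ.<? n) (ℕ.≤⇒≯ n≤i))

        -- The pole of X raises row i < n above its constant part, so X D i dominates there; in the
        -- other rows X D i is small.
        w-low : ∀ i → i < n → s i ℤ.- T ℤ.+ 1ℤ ℤ.≤ 0ℤ
        w-low i i<n = ≡.subst₂ ℤ._≤_ (reorder (s i) T) (ℤ.+-inverseʳ T) (ℤ.+-monoˡ-≤ (ℤ.- T) (below i i<n))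
          where
          open ℤ-Solver using () renaming (solve to solveℤ; con to conℤ; _:+_ to _⊞_; _:-_ to _⊟_; _:=_ to _⊜_)
          reorder : ∀ s t → s ℤ.+ 1ℤ ℤ.- t ≡ s ℤ.- t ℤ.+ 1ℤ
          reorder = solveℤ 2 (λ s t → s ⊞ conℤ 1ℤ ⊟ t ⊜ s ⊟ t ⊞ conℤ 1ℤ) ≡.refl

        w-high : ∀ i → n ≤ i → 1ℤ ℤ.≤ s i ℤ.- T
        w-high i n≤i = ≡.subst (ℤ._≤ s i ℤ.- T) (cancel T) (ℤ.+-monoˡ-≤ (ℤ.- T) (above i n≤i))
          where
          open ℤ-Solver using () renaming (solve to solveℤ; con to conℤ; _:+_ to _⊞_; _:-_ to _⊟_; _:=_ to _⊜_)
          cancel : ∀ t → t ℤ.+ 1ℤ ℤ.- t ≡ 1ℤ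
          cancel = solveℤ 1 (λ t → t ⊞ conℤ 1ℤ ⊟ t ⊜ conℤ 1ℤ) ≡.refl

        w≤w+1 : ∀ k → k ℤ.≤ k ℤ.+ 1ℤ
        w≤w+1 k = ≡.subst (ℤ._≤ k ℤ.+ 1ℤ) (ℤ.+-identityʳ k) (ℤ.+-monoʳ-≤ k (ℤ.+≤+ ℕ.z≤n))

        G-XD : ∀ i k {x} → k ≤v x → s i ℤ.- T ℤ.+ k ≤G (X S.* κ (D i * x))
        G-XD i k {x} v = ≡.subst (_≤G (X S.* κ (D i * x))) (reorder (s i) T k) (F-* {ℤ.- T} {s i ℤ.+ k} {X} {κ (D i * x)} G-X (G-κ (v-* (D-val i) v)))
          where
          open ℤ-Solver using () renaming (solve to solveℤ; :-_ to ⊟_; _:+_ to _⊞_; _:-_ to _⊝_; _:=_ to _⊜_)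
          reorder : ∀ s t k → ℤ.- t ℤ.+ (s ℤ.+ k) ≡ s ℤ.- t ℤ.+ k
          reorder = solveℤ 3 (λ s t k → ⊟ t ⊞ (s ⊞ k) ⊜ s ⊝ t ⊞ k) ≡.refl

        G-XD₀ : ∀ i {x} → 0ℤ ≤v x → s i ℤ.- T ≤G (X S.* κ (D i * x))
        G-XD₀ i {x} v = ≡.subst (_≤G (X S.* κ (D i * x))) (ℤ.+-identityʳ (s i ℤ.- T)) (G-XD i 0ℤ v)

        P-integral : ∀ i j → 0ℤ ≤v P i j
        P-integral i j = near-δ i j (P-close i j)

        B-integral : ∀ i j → 0ℤ ≤v B i j
        B-integral i j = near-δ i j (B-close i j)

        off-close : ∀ {x} i j → i ≢ j → Close 1ℤ x (δ i j) → 1ℤ ≤v x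
        off-close {x} i j i≢j c = v-close c (≡.subst (λ b → 1ℤ ≤v (if b then 1# else 0#)) (≡.sym (dec-false (i ℕ.≟ j) i≢j)) (v-0 1ℤ))

        diagonal-close : ∀ {x} i → Close 1ℤ x (δ i i) → 1ℤ ≤v x - 1#
        diagonal-close {x} i = ≡.subst (λ b → Close 1ℤ x (if b then 1# else 0#)) (dec-true (i ℕ.≟ i) ≡.refl)

        G-N : ∀ i j → w i ≤G N i j
        G-N i j with i ℕ.<? n
        ... | yes i<n = ≡.subst (_≤G N i j) (≡.sym (w-yes i<n)) (F-+ {s i ℤ.- T} {κ (P i j)} (F-mono {x = κ (P i j)} (ℤ.≤-trans (w≤w+1 _) (w-low i i<n)) (G-κ (P-integral i j)))
                            (F-neg {x = X S.* κ (D i * B i j)} (G-XD₀ i (B-integral i j))))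
        ... | no i≮n  = ≡.subst (_≤G N i j) (≡.sym (w-no (ℕ.≮⇒≥ i≮n))) (F-+ {0ℤ} {κ (P i j)} (G-κ (P-integral i j))
                            (F-neg {x = X S.* κ (D i * B i j)} (F-mono {x = X S.* κ (D i * B i j)} (ℤ.≤-trans (ℤ.+≤+ ℕ.z≤n) (w-high i (ℕ.≮⇒≥ i≮n))) (G-XD₀ i (B-integral i j)))))

        κ-1 : ∀ x → X S.* κ (x * 1#) S.≈ X S.* κ x
        κ-1 x = S.*-congˡ {X} {κ (x * 1#)} {κ x} (κ-cong (*-identityʳ x))

        G-d : ∀ i → w i ≤G d i
        G-d i with i ℕ.<? n
        ... | yes i<n = ≡.subst₂ _≤G_ (≡.sym (w-yes i<n)) (≡.sym (d-yes i<n)) (F-neg {x = X S.* κ (D i)} (F-resp {x = X S.* κ (D i * 1#)} {X S.* κ (D i)} (κ-1 (D i)) (G-XD₀ i v-1)))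
        ... | no i≮n  = ≡.subst₂ _≤G_ (≡.sym (w-no (ℕ.≮⇒≥ i≮n))) (≡.sym (d-no (ℕ.≮⇒≥ i≮n))) (F-1)

        G-off : ∀ i j → i ≢ j → w i ℤ.+ 1ℤ ≤G N i j
        G-off i j i≢j with i ℕ.<? n
        ... | yes i<n = ≡.subst (λ k → k ℤ.+ 1ℤ ≤G N i j) (≡.sym (w-yes i<n)) (F-+ {s i ℤ.- T ℤ.+ 1ℤ} {κ (P i j)} (F-mono {x = κ (P i j)} (w-low i i<n) (G-κ (P-integral i j)))
                            (F-neg {x = X S.* κ (D i * B i j)} (G-XD i 1ℤ (off-close i j i≢j (B-close i j)))))
        ... | no i≮n  = ≡.subst (λ k → k ℤ.+ 1ℤ ≤G N i j) (≡.sym (w-no (ℕ.≮⇒≥ i≮n))) (F-+ {1ℤ} {κ (P i j)} (G-κ (off-close i j i≢j (P-close i j)))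
                            (F-neg {x = X S.* κ (D i * B i j)} (F-mono {x = X S.* κ (D i * B i j)} (w-high i (ℕ.≮⇒≥ i≮n)) (G-XD₀ i (B-integral i j)))))

        G-diagonal : ∀ i → w i ℤ.+ 1ℤ ≤G (N i i S.- d i)
        G-diagonal i with i ℕ.<? n
        ... | yes i<n = ≡.subst₂ (λ k e → k ℤ.+ 1ℤ ≤G (N i i S.- e)) (≡.sym (w-yes i<n)) (≡.sym (d-yes i<n)) (F-resp {x = κ (P i i) S.- X S.* κ (D i * (B i i - 1#))} {N i i S.- (S.- (X S.* κ (D i)))} (S.sym split)
            (F-+ {s i ℤ.- T ℤ.+ 1ℤ} {κ (P i i)} (F-mono {x = κ (P i i)} (w-low i i<n) (G-κ (P-integral i i)))
              (F-neg {x = X S.* κ (D i * (B i i - 1#))} (G-XD i 1ℤ (diagonal-close i (B-close i i))))))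
          where
          split : N i i S.- (S.- (X S.* κ (D i))) S.≈ κ (P i i) S.- X S.* κ (D i * (B i i - 1#))
          split = S.trans
            (SSolver.solve 4 (λ p x a b → (p SSolver.:- x SSolver.:* a) SSolver.:- (SSolver.:- (x SSolver.:* b)) SSolver.:= p SSolver.:- x SSolver.:* (a SSolver.:- b)) S.refl (κ (P i i)) X (κ (D i * B i i)) (κ (D i)))
            (S.+-congˡ {κ (P i i)} (S.-‿cong {X S.* (κ (D i * B i i) S.- κ (D i))} {X S.* κ (D i * (B i i - 1#))}
              (S.*-congˡ {X} {κ (D i * B i i) S.- κ (D i)} {κ (D i * (B i i - 1#))} κ-split)))
            where
            κ-split : κ (D i * B i i) S.- κ (D i) S.≈ κ (D i * (B i i - 1#))
            κ-split zero    = solve 2 (λ d b → d :* b :- d := d :* (b :- # 1)) refl _ _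
            κ-split (suc n) = -‿inverseʳ 0#
        ... | no i≮n  = ≡.subst₂ (λ k e → k ℤ.+ 1ℤ ≤G (N i i S.- e)) (≡.sym (w-no (ℕ.≮⇒≥ i≮n))) (≡.sym (d-no (ℕ.≮⇒≥ i≮n))) (F-resp {x = κ (P i i - 1#) S.- X S.* κ (D i * B i i)} {N i i S.- S.1#} split
            (F-+ {1ℤ} {κ (P i i - 1#)} (G-κ (diagonal-close i (P-close i i)))
              (F-neg {x = X S.* κ (D i * B i i)} (F-mono {x = X S.* κ (D i * B i i)} (w-high i (ℕ.≮⇒≥ i≮n)) (G-XD₀ i (B-integral i i))))))
          where
          split : κ (P i i - 1#) S.- X S.* κ (D i * B i i) S.≈ N i i S.- S.1#
          split zero    = solve 3 (λ p o x → (p :- o) :- x := (p :- x) :- o) refl _ _ _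
          split (suc n) = solve 1 (λ x → # 0 :- x := (# 0 :- x) :- # 0) refl ((X S.* κ (D i * B i i)) (suc n))

        truncated≈ : truncated u M S.≈ Defs.det S.rawRing {M} (λ i j → N (toℕ i) (toℕ j))
        truncated≈ = det-row-operations M (1-X u) N (λ i k → κ (A i k)) λ i j i<M j<M → S.trans (S.+-congʳ {S.- (X S.* κ (u i j))} (κ-δ i j))
          (RowReduction.reduce commutativeRing series κ κ-cong κ-0 κ-+ κ-* X u A P (λ k j → D k * B k j) δ i j
            (proj₂ (proj₂ (inverse-rows A A-even M)) i j i<M) (u≈ i j))
          where
          κ-1# : S.1# S.≈ κ 1#
          κ-1# zero    = refl
          κ-1# (suc n) = refl

          κ-δ : ∀ i j → (if does (i ℕ.≟ j) then S.1# else S.0#) S.≈ κ (δ i j)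
          κ-δ i j with does (i ℕ.≟ j)
          ... | true  = κ-1#
          ... | false = S.sym κ-0

        truncated-close : weight M w ℤ.+ 1ℤ ≤G (truncated u M S.- SSums.∏ M d)
        truncated-close m = v-resp (+-congʳ (sym (truncated≈ m))) (F-det-diagonal M w N d G-N G-d G-off G-diagonal m)

        ∏-high : ∀ m → SSums.∏ (m ℕ.+ n) d S.≈ SSums.∏ n d
        ∏-high zero    = S.refl
        ∏-high (suc m) = S.trans (S.*-cong {SSums.∏ (m ℕ.+ n) d} {SSums.∏ n d} {d (m ℕ.+ n)} {S.1#} (∏-high m) (S.reflexive (d-no (ℕ.m≤n+m n m)))) (S.*-identityʳ (SSums.∏ n d))

        weight-high : ∀ m → weight (m ℕ.+ n) w ≡ weight n w
        weight-high zero    = ≡.refl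
        weight-high (suc m) = ≡.trans (≡.cong₂ ℤ._+_ (weight-high m) (w-no (ℕ.m≤n+m n m))) (ℤ.+-identityʳ _)

        ∏-coeff : ∀ m → m ≤ n → SSums.∏ m d m ≈ ∏ m (λ k → - D k)
        ∏-coeff zero    _   = refl
        ∏-coeff (suc m) m<n = begin
          (SSums.∏ m d S.* d m) (suc m)
            ≈⟨ S.*-congˡ {SSums.∏ m d} {d m} {S.- (X S.* κ (D m))} (S.reflexive (d-yes m<n)) (suc m) ⟩
          (SSums.∏ m d S.* (S.- (X S.* κ (D m)))) (suc m)
            ≈⟨ SSolver.solve 3 (λ p x c → p SSolver.:* (SSolver.:- (x SSolver.:* c)) SSolver.:= x SSolver.:* (SSolver.:- (p SSolver.:* c))) S.refl (SSums.∏ m d) X (κ (D m)) (suc m) ⟩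
          (X S.* (S.- (SSums.∏ m d S.* κ (D m)))) (suc m)
            ≈⟨ X*-suc (S.- (SSums.∏ m d S.* κ (D m))) m ⟩
          - (SSums.∏ m d S.* κ (D m)) m
            ≈⟨ -‿cong (trans (*-κ (SSums.∏ m d) (D m) m) (*-congʳ (∏-coeff m (ℕ.<⇒≤ m<n)))) ⟩
          - (∏ m (λ k → - D k) * D m)
            ≈⟨ solve 2 (λ p d → :- (p :* d) := p :* (:- d)) refl _ _ ⟩
          ∏ m (λ k → - D k) * - D m ∎
          where open import Relation.Binary.Reasoning.Setoid setoid

        -- In degree m the m copies of T in `level` cancel the - T in each of the first m weights,
        -- and the sum of the slopes remains.
        level-weight : ∀ m k → m ≤ n → level (weight m w ℤ.+ k) m ≡ weight m s ℤ.+ k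
        level-weight zero    k _   = ≡.refl
        level-weight (suc m) k m<n = ≡.trans (≡.cong (λ l → level l m) (≡.trans (≡.cong (λ z → weight m w ℤ.+ z ℤ.+ k ℤ.+ T) (w-yes m<n)) (reorder (weight m w) (s m) T k)))
          (≡.trans (level-weight m (s m ℤ.+ k) (ℕ.<⇒≤ m<n)) (≡.sym (ℤ.+-assoc (weight m s) (s m) k)))
          where
          open ℤ-Solver using () renaming (solve to solveℤ; _:+_ to _⊞_; _:-_ to _⊟_; _:=_ to _⊜_)
          reorder : ∀ x s t k → x ℤ.+ (s ℤ.- t) ℤ.+ k ℤ.+ t ≡ x ℤ.+ (s ℤ.+ k)
          reorder = solveℤ 4 (λ x s t k → x ⊞ (s ⊟ t) ⊞ k ⊞ t ⊜ x ⊞ (s ⊞ k)) ≡.refl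

      -- Rows from n on have weight 0 and dominant entry 1, so neither the bound nor the product
      -- depends on m; this uniformity lets the estimate pass to the limit.
      truncated-leading : ∀ m → Close (weight n s ℤ.+ 1ℤ) (truncated u (m ℕ.+ n) n) (∏ n (λ k → - D k))
      truncated-leading m = Close-trans
        (≡.subst (λ l → Close l (truncated u M n) (SSums.∏ M (d M) n))
          (≡.trans (≡.cong (λ x → level (x ℤ.+ 1ℤ) n) (weight-high M m)) (level-weight M n 1ℤ ℕ.≤-refl)) (truncated-close M n))
        (Close-≈ (trans (∏-high M m n) (∏-coeff M n ℕ.≤-refl)))
        where M = m ℕ.+ n

-- The factorials in the explicit product.

module FactorIdentity where
  open import Data.Nat.Base
  open import Data.Product.Base using (∃₂; _×_; _,_)
  open import Relation.Binary.PropositionalEquality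
  open ≡-Reasoning
  open import Data.Nat.Properties
  open import Data.Nat.Solver using (module +-*-Solver)
  open +-*-Solver using (solve; con; _:*_; _:^_; _:=_)
  open import Data.Nat.Tactic.RingSolver using (solve-∀)
  open Factorials

  -- All factorials are expressed by 2ʲ, j!, `triple j` and double factorials. The powers 2^(14j+1)
  -- and the two j! balance. Writing (8j)! = 8j (8j-1) (8j-2)! against the denominator 12j leaves a
  -- single 2, so the j-th factor has valuation 1 + 2 v(`triple j`), just as the diagonal entry of D
  -- does.
  identity : ∀ j m → 8 * j ≡ suc (suc m) → ∃₂ λ oX oY → Odd oX × Odd oY ×
    (2 ^ (2 * j) * (12 * j + 2) ! * (6 * j) !) * (3 * oX) ≡ ((8 * j + 2) ! * m ! * (12 * j)) * (2 * (suc m * (oY * (triple j * triple j))))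
  identity j m 8j≡ = oX , oY ,
    odd-* (2 * j , cong suc (lemma₀ j)) (odd-* (odd-* (odd-!-odd j) (odd-!-odd j)) (odd-* (odd-* (odd-!-odd (2 * j)) (odd-!-odd (2 * j))) (odd-* (odd-!-odd (4 * j)) (odd-!-odd (suc (4 * j)))))) ,
    odd-* (3 * j , cong suc (lemma₁ j)) (odd-* (odd-* (odd-!-odd (3 * j)) (odd-!-odd (3 * j))) (odd-!-odd (suc (6 * j)))) ,
    (begin
    (2 ^ (2 * j) * (12 * j + 2) ! * (6 * j) !) * (3 * oX)
      ≡⟨ cong (_* (3 * oX)) (cong₂ _*_ (cong₂ _*_ (pow 2) 12j!) 6j!) ⟩
    (p 2 * (2 * p 6 * (suc (6 * j) * (p 3 * (W * f * o₃)) * o₆)) * (p 3 * (W * f * o₃))) * (3 * oX)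
      ≡⟨ left t (suc (6 * j)) W f o₃ o₆ oX ⟩
    (3 * (2 * p 7 * f) * (p 7 * f) * oX * (suc (6 * j) * ((o₃ * o₃) * o₆) * (W * W)))
      ≡⟨ right t (suc (4 * j)) W f o₁ o₂ o₄ o₄′ oY ⟩
    3 * ((2 * p 4 * (suc (4 * j) * (p 2 * (p 1 * (f * o₁) * o₂)) * o₄′)) * (p 4 * ((p 2 * (p 1 * (f * o₁) * o₂)) * o₄))) * (oY * (W * W))
      ≡⟨ cong (λ z → 3 * z * (oY * (W * W))) (cong₂ _*_ 8j+2! 8j!) ⟨
    3 * ((8 * j + 2) ! * (8 * j) !) * (oY * (W * W))
      ≡⟨ cong (λ z → 3 * ((8 * j + 2) ! * z) * (oY * (W * W))) (trans (cong _! 8j≡) (cong (λ z → z * (suc m * m !)) (sym 8j≡))) ⟩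
    3 * ((8 * j + 2) ! * (8 * j * (suc m * m !))) * (oY * (W * W))
      ≡⟨ last ((8 * j + 2) !) j (suc m) (m !) oY W ⟩
    ((8 * j + 2) ! * m ! * (12 * j)) * (2 * (suc m * (oY * (W * W)))) ∎)
    where
    t = 2 ^ j
    p : ℕ → ℕ
    p n = t ^ n
    f = j !
    W = triple j
    o₁ = odd-! j
    o₂ = odd-! (2 * j)
    o₃ = odd-! (3 * j)
    o₄ = odd-! (4 * j)
    o₄′ = odd-! (suc (4 * j))
    o₆ = odd-! (suc (6 * j))
    oX = suc (4 * j) * ((o₁ * o₁) * ((o₂ * o₂) * (o₄ * o₄′)))
    oY = suc (6 * j) * ((o₃ * o₃) * o₆)

    lemma₀ : ∀ j → 4 * j ≡ 2 * (2 * j)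
    lemma₀ = solve-∀
    lemma₁ : ∀ j → 6 * j ≡ 2 * (3 * j)
    lemma₁ = solve-∀

    pow : ∀ n → 2 ^ (n * j) ≡ p n
    pow n = trans (cong (2 ^_) (*-comm n j)) (sym (^-*-assoc 2 j n))

    2j! : (2 * j) ! ≡ p 1 * (f * o₁)
    2j! = trans (even-! j) (cong (_* (f * o₁)) (sym (*-identityʳ t)))

    4j! : (4 * j) ! ≡ p 2 * (p 1 * (f * o₁) * o₂)
    4j! = trans (cong _! (lemma₀ j)) (trans (even-! (2 * j)) (cong₂ _*_ (pow 2) (cong (_* o₂) 2j!)))

    8j! : (8 * j) ! ≡ p 4 * ((p 2 * (p 1 * (f * o₁) * o₂)) * o₄)
    8j! = trans (cong _! (lemma j)) (trans (even-! (4 * j)) (cong₂ _*_ (pow 4) (cong (_* o₄) 4j!)))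
      where
      lemma : ∀ j → 8 * j ≡ 2 * (4 * j)
      lemma = solve-∀

    8j+2! : (8 * j + 2) ! ≡ 2 * p 4 * (suc (4 * j) * (p 2 * (p 1 * (f * o₁) * o₂)) * o₄′)
    8j+2! = trans (cong _! (lemma j)) (trans (even-! (suc (4 * j))) (cong₂ _*_ (cong (2 *_) (pow 4)) (cong (λ z → suc (4 * j) * z * o₄′) 4j!)))
      where
      lemma : ∀ j → 8 * j + 2 ≡ 2 * suc (4 * j)
      lemma = solve-∀

    6j! : (6 * j) ! ≡ p 3 * (W * f * o₃)
    6j! = trans (cong _! (lemma₁ j)) (trans (even-! (3 * j)) (cong₂ _*_ (pow 3) (cong (_* o₃) (triple-! j))))

    12j! : (12 * j + 2) ! ≡ 2 * p 6 * (suc (6 * j) * (p 3 * (W * f * o₃)) * o₆)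
    12j! = trans (cong _! (lemma j)) (trans (even-! (suc (6 * j))) (cong₂ _*_ (cong (2 *_) (pow 6)) (cong (λ z → suc (6 * j) * z * o₆) 6j!)))
      where
      lemma : ∀ j → 12 * j + 2 ≡ 2 * suc (6 * j)
      lemma = solve-∀

    left : ∀ t s W f o₃ o₆ x → (t ^ 2 * (2 * t ^ 6 * (s * (t ^ 3 * (W * f * o₃)) * o₆)) * (t ^ 3 * (W * f * o₃))) * (3 * x)
      ≡ 3 * (2 * t ^ 7 * f) * (t ^ 7 * f) * x * (s * ((o₃ * o₃) * o₆) * (W * W))
    left = solve 7 (λ t s W f o₃ o₆ x → (t :^ 2 :* (con 2 :* t :^ 6 :* (s :* (t :^ 3 :* (W :* f :* o₃)) :* o₆)) :* (t :^ 3 :* (W :* f :* o₃))) :* (con 3 :* x)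
      := con 3 :* (con 2 :* t :^ 7 :* f) :* (t :^ 7 :* f) :* x :* (s :* ((o₃ :* o₃) :* o₆) :* (W :* W))) refl

    right : ∀ t s W f o₁ o₂ o₄ o₄′ y → 3 * (2 * t ^ 7 * f) * (t ^ 7 * f) * (s * ((o₁ * o₁) * ((o₂ * o₂) * (o₄ * o₄′)))) * (y * (W * W))
      ≡ 3 * ((2 * t ^ 4 * (s * (t ^ 2 * (t ^ 1 * (f * o₁) * o₂)) * o₄′)) * (t ^ 4 * ((t ^ 2 * (t ^ 1 * (f * o₁) * o₂)) * o₄))) * (y * (W * W))
    right = solve 9 (λ t s W f o₁ o₂ o₄ o₄′ y → con 3 :* (con 2 :* t :^ 7 :* f) :* (t :^ 7 :* f) :* (s :* ((o₁ :* o₁) :* ((o₂ :* o₂) :* (o₄ :* o₄′)))) :* (y :* (W :* W))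
      := con 3 :* ((con 2 :* t :^ 4 :* (s :* (t :^ 2 :* (t :^ 1 :* (f :* o₁) :* o₂)) :* o₄′)) :* (t :^ 4 :* ((t :^ 2 :* (t :^ 1 :* (f :* o₁) :* o₂)) :* o₄))) :* (y :* (W :* W))) refl

    last : ∀ A j s m y W → 3 * (A * (8 * j * (s * m))) * (y * (W * W)) ≡ (A * m * (12 * j)) * (2 * (s * (y * (W * W))))
    last = solve-∀

-- Exact 2-adic valuations of rational numbers.

module DyadicValuations where
  open import Data.Empty using (⊥-elim)
  open import Data.Integer.Base as ℤ using (ℤ; +_; 0ℤ; 1ℤ)
  open import Data.Integer.Properties as ℤ using ()
  open import Data.Integer.Solver using () renaming (module +-*-Solver to ℤ-Solver)
  open import Data.Nat.Base as ℕ using (ℕ; zero; suc; _!)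
  open import Data.Nat.Properties as ℕ using ()
  open import Data.Product.Base using (∃; _,_; proj₁; proj₂)
  open import Data.Rational.Base as ℚ using (ℚ; 1ℚ)
  open import Data.Rational.Literals using (fromℤ)
  open import Data.Rational.Properties as ℚ using ()
  open import Relation.Binary.PropositionalEquality
  open import Relation.Nullary.Negation.Core using (¬_)
  open import Defs using (module ℚ-Valuation; factor)
  open ℚ-Valuation hiding (odd-*)
  open IntegerCoefficients ℚ.+-*-commutativeRing
  open ≡-Reasoning

  ι⁺≡fromℤ : ∀ n → ι (+ n) ≡ fromℤ (+ n)
  ι⁺≡fromℤ zero          = refl
  ι⁺≡fromℤ (suc zero)    = refl
  ι⁺≡fromℤ (suc (suc n)) = trans (cong (ℚ._+ 1ℚ) (ι⁺≡fromℤ (suc n))) (trans (sym (fromℤ-+ (+ suc n) 1ℤ)) (cong (λ m → fromℤ (+ m)) (ℕ.+-comm (suc n) 1)))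

  ι≡fromℤ : ∀ z → ι z ≡ fromℤ z
  ι≡fromℤ (+ n)        = ι⁺≡fromℤ n
  ι≡fromℤ (ℤ.-[1+_] n) = cong ℚ.-_ (ι⁺≡fromℤ (suc n))

  reciprocals : RationalAlgebra.Reciprocals ℚ.+-*-commutativeRing
  reciprocals = record
    { inv   = λ n → ℚ.1/ fromℤ (+ suc n)
    ; ι*inv = λ n → trans (cong (ℚ._* (ℚ.1/ fromℤ (+ suc n))) (ι≡fromℤ (+ suc n))) (ℚ.*-inverseʳ (fromℤ (+ suc n)))
    }

  -- The valuation of x is exactly k.
  record Val (k : ℤ) (x : ℚ) : Set where
    constructor mkVal
    field
      a c : ℤ
      eq  : x ℚ.* fromℤ (odd c) ≡ 2^ k ℚ.* fromℤ (odd a)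

  exact : ∀ {k x} a → x ≡ 2^ k ℚ.* fromℤ (odd a) → Val k x
  exact {x = x} a e = mkVal a 0ℤ (trans (ℚ.*-identityʳ x) e)

  Val⇒≤v : ∀ {k x} → Val k x → k ≤vℚ x
  Val⇒≤v (mkVal a c eq) = mk≤vℚ (odd a) c eq

  2^-inverse : ∀ k → 2^ (ℤ.- k) ℚ.* 2^ k ≡ 1ℚ
  2^-inverse k = trans (sym (2^-+ (ℤ.- k) k)) (cong 2^ (ℤ.+-inverseˡ k))

  odd≢even : ∀ x y → odd x ≢ + 2 ℤ.* y
  odd≢even x y eq = go (ℤ.∣ y ℤ.- x ∣) (trans (cong ℤ.∣_∣ 1≡) (ℤ.abs-* (+ 2) (y ℤ.- x)))
    where
    open ℤ-Solver using () renaming (solve to solveℤ; con to conℤ; _:+_ to _⊞_; _:*_ to _⊠_; _:-_ to _⊟_; _:=_ to _⊜_)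
    1≡ : 1ℤ ≡ + 2 ℤ.* (y ℤ.- x)
    1≡ = trans (solveℤ 1 (λ x → conℤ 1ℤ ⊜ conℤ 1ℤ ⊞ conℤ (+ 2) ⊠ x ⊟ conℤ (+ 2) ⊠ x) refl x)
      (trans (cong (ℤ._- + 2 ℤ.* x) eq) (solveℤ 2 (λ x y → conℤ (+ 2) ⊠ y ⊟ conℤ (+ 2) ⊠ x ⊜ conℤ (+ 2) ⊠ (y ⊟ x)) refl x y))
    go : ∀ n → 1 ≢ 2 ℕ.* n
    go zero    ()
    go (suc n) e with trans (ℕ.suc-injective e) (ℕ.+-suc n (n ℕ.+ 0))
    ... | ()

  -- Both certificates multiplied out and divided by 2ᵏ would equate an odd and an even integer.
  Val⇒≰v : ∀ {k x} → Val k x → ¬ (ℤ.suc k ≤vℚ x)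
  Val⇒≰v {k} {x} (mkVal a c eq) (mk≤vℚ b d eq′) = odd≢even (a ℤ.+ d ℤ.+ + 2 ℤ.* (a ℤ.* d)) (b ℤ.* odd c) (cong ℚ.↥_ (begin
    fromℤ (odd (a ℤ.+ d ℤ.+ + 2 ℤ.* (a ℤ.* d)))          ≡⟨ fromℤ-odd-* a d ⟩
    α ℚ.* γ                                              ≡⟨ ℚ.*-identityˡ (α ℚ.* γ) ⟨
    1ℚ ℚ.* (α ℚ.* γ)                                     ≡⟨ cong (ℚ._* (α ℚ.* γ)) (2^-inverse k) ⟨
    (t ℚ.* 2^ k) ℚ.* (α ℚ.* γ)                           ≡⟨ solve 4 (λ t s a g → (t :* s) :* (a :* g) := t :* ((s :* a) :* g)) refl t (2^ k) α γ ⟩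
    t ℚ.* ((2^ k ℚ.* α) ℚ.* γ)                           ≡⟨ cong (λ z → t ℚ.* (z ℚ.* γ)) eq ⟨
    t ℚ.* ((x ℚ.* o) ℚ.* γ)                              ≡⟨ solve 4 (λ t x o g → t :* ((x :* o) :* g) := t :* ((x :* g) :* o)) refl t x o γ ⟩
    t ℚ.* ((x ℚ.* γ) ℚ.* o)                              ≡⟨ cong (λ z → t ℚ.* (z ℚ.* o)) (trans eq′ (cong (ℚ._* fromℤ b) (2^-suc k))) ⟩
    t ℚ.* (((fromℤ (+ 2) ℚ.* 2^ k) ℚ.* fromℤ b) ℚ.* o)   ≡⟨ solve 5 (λ t w s b o → t :* (((w :* s) :* b) :* o) := (t :* s) :* (w :* (b :* o))) refl t (fromℤ (+ 2)) (2^ k) (fromℤ b) o ⟩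
    (t ℚ.* 2^ k) ℚ.* (fromℤ (+ 2) ℚ.* (fromℤ b ℚ.* o))   ≡⟨ trans (cong (ℚ._* (fromℤ (+ 2) ℚ.* (fromℤ b ℚ.* o))) (2^-inverse k)) (ℚ.*-identityˡ (fromℤ (+ 2) ℚ.* (fromℤ b ℚ.* o))) ⟩
    fromℤ (+ 2) ℚ.* (fromℤ b ℚ.* o)                      ≡⟨ trans (fromℤ-* (+ 2) (b ℤ.* odd c)) (cong (fromℤ (+ 2) ℚ.*_) (fromℤ-* b (odd c))) ⟨
    fromℤ (+ 2 ℤ.* (b ℤ.* odd c))                        ∎))
    where
    t = 2^ (ℤ.- k)
    α = fromℤ (odd a)
    γ = fromℤ (odd d)
    o = fromℤ (odd c)

  Val-* : ∀ {k l x y} → Val k x → Val l y → Val (k ℤ.+ l) (x ℚ.* y)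
  Val-* {k} {l} {x} {y} (mkVal a c eq) (mkVal b d eq′) = mkVal (a ℤ.+ b ℤ.+ + 2 ℤ.* (a ℤ.* b)) (c ℤ.+ d ℤ.+ + 2 ℤ.* (c ℤ.* d)) (begin
    (x ℚ.* y) ℚ.* fromℤ (odd (c ℤ.+ d ℤ.+ + 2 ℤ.* (c ℤ.* d)))  ≡⟨ cong ((x ℚ.* y) ℚ.*_) (fromℤ-odd-* c d) ⟩
    (x ℚ.* y) ℚ.* (fromℤ (odd c) ℚ.* fromℤ (odd d))            ≡⟨ exchange x y (fromℤ (odd c)) (fromℤ (odd d)) ⟩
    (x ℚ.* fromℤ (odd c)) ℚ.* (y ℚ.* fromℤ (odd d))            ≡⟨ cong₂ ℚ._*_ eq eq′ ⟩
    (2^ k ℚ.* fromℤ (odd a)) ℚ.* (2^ l ℚ.* fromℤ (odd b))      ≡⟨ exchange (2^ k) (fromℤ (odd a)) (2^ l) (fromℤ (odd b)) ⟩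
    (2^ k ℚ.* 2^ l) ℚ.* (fromℤ (odd a) ℚ.* fromℤ (odd b))      ≡⟨ cong₂ ℚ._*_ (2^-+ k l) (fromℤ-odd-* a b) ⟨
    2^ (k ℤ.+ l) ℚ.* fromℤ (odd (a ℤ.+ b ℤ.+ + 2 ℤ.* (a ℤ.* b))) ∎)
    where
    exchange : ∀ a b c d → (a ℚ.* b) ℚ.* (c ℚ.* d) ≡ (a ℚ.* c) ℚ.* (b ℚ.* d)
    exchange = solve 4 (λ a b c d → (a :* b) :* (c :* d) := (a :* c) :* (b :* d)) refl

  Val-cancel : ∀ {l x y} → Val 0ℤ y → Val l (x ℚ.* y) → Val l x
  Val-cancel {l} {x} {y} (mkVal b d eq′) (mkVal a c eq) = mkVal (a ℤ.+ d ℤ.+ + 2 ℤ.* (a ℤ.* d)) (b ℤ.+ c ℤ.+ + 2 ℤ.* (b ℤ.* c)) (begin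
    x ℚ.* fromℤ (odd (b ℤ.+ c ℤ.+ + 2 ℤ.* (b ℤ.* c)))      ≡⟨ cong (x ℚ.*_) (fromℤ-odd-* b c) ⟩
    x ℚ.* (fromℤ (odd b) ℚ.* fromℤ (odd c))                ≡⟨ cong (λ z → x ℚ.* (z ℚ.* fromℤ (odd c))) (trans eq′ (ℚ.*-identityˡ (fromℤ (odd b)))) ⟨
    x ℚ.* ((y ℚ.* fromℤ (odd d)) ℚ.* fromℤ (odd c))        ≡⟨ solve 4 (λ x y d c → x :* ((y :* d) :* c) := ((x :* y) :* c) :* d) refl x y (fromℤ (odd d)) (fromℤ (odd c)) ⟩
    ((x ℚ.* y) ℚ.* fromℤ (odd c)) ℚ.* fromℤ (odd d)        ≡⟨ cong (ℚ._* fromℤ (odd d)) eq ⟩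
    (2^ l ℚ.* fromℤ (odd a)) ℚ.* fromℤ (odd d)             ≡⟨ trans (ℚ.*-assoc (2^ l) (fromℤ (odd a)) (fromℤ (odd d))) (cong (2^ l ℚ.*_) (sym (fromℤ-odd-* a d))) ⟩
    2^ l ℚ.* fromℤ (odd (a ℤ.+ d ℤ.+ + 2 ℤ.* (a ℤ.* d)))   ∎)

  Val-neg : ∀ {k x} → Val k x → Val k (ℚ.- x)
  Val-neg {k} {x} v = subst₂ Val (ℤ.+-identityˡ k) (solve 1 (λ x → (:- # 1) :* x := :- x) refl x) (Val-* {0ℤ} {k} {ℚ.- 1ℚ} {x} (mkVal ℤ.-1ℤ 0ℤ refl) v)

  Val-2 : Val 1ℤ (ι (+ 2))
  Val-2 = mkVal 0ℤ 0ℤ refl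

  +odd : ∀ m → + suc (2 ℕ.* m) ≡ odd (+ m)
  +odd m = cong (λ z → 1ℤ ℤ.+ z) (ℤ.pos-* 2 m)

  Val-odd : ∀ {n} → Factorials.Odd n → Val 0ℤ (ι (+ n))
  Val-odd (m , refl) = exact (+ m) (trans (ι≡fromℤ (+ suc (2 ℕ.* m))) (trans (cong fromℤ (+odd m)) (sym (ℚ.*-identityˡ (fromℤ (odd (+ m)))))))

  -- The half is returned as a successor, so that `positive-Val` applies to it.
  even-product : ∀ n → ∃ λ y → suc n ℕ.* suc (suc n) ≡ 2 ℕ.* suc y
  even-product zero    = 0 , refl
  even-product (suc n) with even-product n
  ... | y , eq = y ℕ.+ suc (suc n) , trans (lemma n) (trans (cong (ℕ._+ 2 ℕ.* suc (suc n)) eq) (lemma₂ y n))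
    where
    open import Data.Nat.Tactic.RingSolver using (solve-∀)
    lemma : ∀ n → suc (suc n) ℕ.* suc (suc (suc n)) ≡ suc n ℕ.* suc (suc n) ℕ.+ 2 ℕ.* suc (suc n)
    lemma = solve-∀
    lemma₂ : ∀ y n → 2 ℕ.* suc y ℕ.+ 2 ℕ.* suc (suc n) ≡ 2 ℕ.* suc (y ℕ.+ suc (suc n))
    lemma₂ = solve-∀

  open Hypergeometric ℚ.+-*-commutativeRing reciprocals using (ι-ℕ*; cancel-suc)
  open Factorials using (triple)

  positive-Val : ∀ y → ∃ λ u → Val (+ u) (ι (+ suc y))
  positive-Val y with oddPart (suc y) (ℕ.s≤s ℕ.z≤n)
  ... | u , c , eq = u , exact c (trans (ι≡fromℤ (+ suc y)) eq)

  -- One step multiplies by 3 (3k+1) (3k+2). The even one among the two consecutive numbers accounts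
  -- for the `suc` in the exponent; a slope counts the exponent twice, so successive slopes differ
  -- by at least 2.
  triple-Val : ∀ k → ∃ λ e → Val (+ e) (ι (+ triple k))
  triple-Val zero    = 0 , mkVal 0ℤ 0ℤ refl
  triple-Val (suc k) = suc u ℕ.+ e , subst (Val (+ (suc u ℕ.+ e))) (sym expand)
      (Val-* {+ suc u} {+ e} (Val-* {0ℤ} {+ suc u} (Val-odd {3} (1 , refl)) (Val-* {1ℤ} {+ u} Val-2 (proj₂ (positive-Val y)))) (proj₂ (triple-Val k)))
    where
    e = proj₁ (triple-Val k)
    y = proj₁ (even-product (3 ℕ.* k))
    u = proj₁ (positive-Val y)
    expand : ι (+ triple (suc k)) ≡ (ι (+ 3) ℚ.* (ι (+ 2) ℚ.* ι (+ suc y))) ℚ.* ι (+ triple k)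
    expand = trans (ι-ℕ* (3 ℕ.* (suc (3 ℕ.* k) ℕ.* suc (suc (3 ℕ.* k)))) (triple k)) (cong (ℚ._* ι (+ triple k))
      (trans (ι-ℕ* 3 (suc (3 ℕ.* k) ℕ.* suc (suc (3 ℕ.* k)))) (cong (ι (+ 3) ℚ.*_) (trans (cong (λ m → ι (+ m)) (proj₂ (even-product (3 ℕ.* k)))) (ι-ℕ* 2 (suc y))))))

  -- The k-th slope (counted from 0), 1 + 2 v((3j)! / j!) for j = k + 1.
  slope : ℕ → ℕ
  slope k = suc (proj₁ (triple-Val (suc k)) ℕ.+ proj₁ (triple-Val (suc k)))

  slope-gap : ∀ k → suc (suc (slope k)) ℕ.≤ slope (suc k)
  slope-gap k = ℕ.s≤s (ℕ.≤-trans (ℕ.≤-reflexive (cong suc (sym (ℕ.+-suc e e)))) (ℕ.+-mono-≤ (ℕ.s≤s (ℕ.m≤n+m e u)) (ℕ.s≤s (ℕ.m≤n+m e u))))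
    where
    e = proj₁ (triple-Val (suc k))
    u = proj₁ (positive-Val (proj₁ (even-product (3 ℕ.* suc k))))

  Val-slope : ∀ k → Val (+ slope k) (ι (+ 2) ℚ.* (ι (+ triple (suc k)) ℚ.* ι (+ triple (suc k))))
  Val-slope k = Val-* {1ℤ} {+ (e ℕ.+ e)} Val-2 (Val-* {+ e} {+ e} v v)
    where
    e = proj₁ (triple-Val (suc k))
    v = proj₂ (triple-Val (suc k))

  /-* : ∀ i n .{{_ : ℕ.NonZero n}} → (i ℚ./ n) ℚ.* fromℤ (+ n) ≡ fromℤ i
  /-* i n = begin
    x ℚ.* fromℤ (+ n)                              ≡⟨ cong (λ z → x ℚ.* fromℤ z) (ℚ.↧-/ i n) ⟨
    x ℚ.* fromℤ (ℚ.↧ x ℤ.* g)                      ≡⟨ cong (x ℚ.*_) (fromℤ-* (ℚ.↧ x) g) ⟩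
    x ℚ.* (fromℤ (ℚ.↧ x) ℚ.* fromℤ g)              ≡⟨ ℚ.*-assoc x (fromℤ (ℚ.↧ x)) (fromℤ g) ⟨
    (x ℚ.* fromℤ (ℚ.↧ x)) ℚ.* fromℤ g              ≡⟨ cong (ℚ._* fromℤ g) (*↧≡↥ x) ⟩
    fromℤ (ℚ.↥ x) ℚ.* fromℤ g                      ≡⟨ fromℤ-* (ℚ.↥ x) g ⟨
    fromℤ (ℚ.↥ x ℤ.* g)                            ≡⟨ cong fromℤ (ℚ.↥-/ i n) ⟩
    fromℤ i                                        ∎
    where
    open import Data.Integer.GCD using (gcd)
    x = i ℚ./ n
    g = gcd i (+ n)

  -- From x = - Y / X and Y a = X b c follows x a = - b c with a and b odd. X and Y are variables,
  -- so the factorials put in for them are not evaluated.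
  Val-quotient : ∀ {x X Y k} a b c → X ≢ 0 → x ℚ.* fromℤ (+ X) ≡ fromℤ (ℤ.- + Y) → Factorials.Odd a → Factorials.Odd b →
    Y ℕ.* a ≡ X ℕ.* (b ℕ.* c) → Val k (ι (+ c)) → Val k x
  Val-quotient {x} {zero}  {Y} {k} a b c X≢0 _  _     _     _   _  = ⊥-elim (X≢0 refl)
  Val-quotient {x} {suc X} {Y} {k} a b c X≢0 x≡ a-odd b-odd eq Vc = Val-cancel {k} {x} {ι (+ a)} (Val-odd a-odd)
      (subst (Val k) (sym xa≡) (Val-neg {k} {ι (+ b) ℚ.* ι (+ c)} (subst (λ l → Val l (ι (+ b) ℚ.* ι (+ c))) (ℤ.+-identityˡ k) (Val-* {0ℤ} {k} {ι (+ b)} {ι (+ c)} (Val-odd b-odd) Vc))))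
    where
    xa≡ : x ℚ.* ι (+ a) ≡ ℚ.- (ι (+ b) ℚ.* ι (+ c))
    xa≡ = cancel-suc X (begin
      ι (+ suc X) ℚ.* (x ℚ.* ι (+ a))               ≡⟨ solve 3 (λ s x a → s :* (x :* a) := (x :* s) :* a) refl (ι (+ suc X)) x (ι (+ a)) ⟩
      (x ℚ.* ι (+ suc X)) ℚ.* ι (+ a)               ≡⟨ cong (ℚ._* ι (+ a)) (trans (cong (x ℚ.*_) (ι≡fromℤ (+ suc X))) (trans x≡ (sym (ι≡fromℤ (ℤ.- + Y))))) ⟩
      ι (ℤ.- + Y) ℚ.* ι (+ a)                       ≡⟨ cong (ℚ._* ι (+ a)) (ι-neg (+ Y)) ⟩
      (ℚ.- ι (+ Y)) ℚ.* ι (+ a)                     ≡⟨ solve 2 (λ y a → (:- y) :* a := :- (y :* a)) refl (ι (+ Y)) (ι (+ a)) ⟩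
      ℚ.- (ι (+ Y) ℚ.* ι (+ a))                     ≡⟨ cong ℚ.-_ (trans (sym (ι-ℕ* Y a)) (trans (cong (λ m → ι (+ m)) eq) (trans (ι-ℕ* (suc X) (b ℕ.* c)) (cong (ι (+ suc X) ℚ.*_) (ι-ℕ* b c))))) ⟩
      ℚ.- (ι (+ suc X) ℚ.* (ι (+ b) ℚ.* ι (+ c)))   ≡⟨ solve 2 (λ s t → :- (s :* t) := s :* (:- t)) refl (ι (+ suc X)) (ι (+ b) ℚ.* ι (+ c)) ⟩
      ι (+ suc X) ℚ.* (ℚ.- (ι (+ b) ℚ.* ι (+ c)))   ∎)

  factor-Val′ : ∀ k j .{{_ : ℕ.NonZero j}} m → 8 ℕ.* j ≡ suc (suc m) → Factorials.Odd (suc m) →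
    Val k (ι (+ (2 ℕ.* (triple j ℕ.* triple j)))) → Val k (factor j)
  factor-Val′ k j m 8j≡ m-odd v =
    let oX , oY , oX-odd , oY-odd , eq = FactorIdentity.identity j m 8j≡ in
    Val-quotient {factor j} {X} {Y} (3 ℕ.* oX) (suc m ℕ.* oY) (2 ℕ.* (triple j ℕ.* triple j)) X≢0
      (/-* (ℤ.- + Y) X {{X-nonZero}}) (Factorials.odd-* {3} (1 , refl) oX-odd) (Factorials.odd-* m-odd oY-odd)
      (trans (subst (λ n → Y ℕ.* (3 ℕ.* oX) ≡ ((8 ℕ.* j ℕ.+ 2) ! ℕ.* n ! ℕ.* (12 ℕ.* j)) ℕ.* (2 ℕ.* (suc m ℕ.* (oY ℕ.* (triple j ℕ.* triple j))))) (sym (cong (ℕ._∸ 2) 8j≡)) eq)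
        (cong (X ℕ.*_) (regroup (suc m) oY (triple j))))
      v
    where
    open import Data.Nat.Tactic.RingSolver using (solve-∀)
    X = (8 ℕ.* j ℕ.+ 2) ! ℕ.* (8 ℕ.* j ℕ.∸ 2) ! ℕ.* (12 ℕ.* j)
    Y = 2 ℕ.^ (2 ℕ.* j) ℕ.* (12 ℕ.* j ℕ.+ 2) ! ℕ.* (6 ℕ.* j) !
    X-nonZero : ℕ.NonZero X
    X-nonZero = ℕ.m*n≢0 _ _ {{ℕ.m*n≢0 _ _ {{(8 ℕ.* j ℕ.+ 2) ℕ.!≢0}} {{(8 ℕ.* j ℕ.∸ 2) ℕ.!≢0}}}} {{ℕ.m*n≢0 12 j}}
    X≢0 : X ≢ 0
    X≢0 = ℕ.≢-nonZero⁻¹ X {{X-nonZero}}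
    regroup : ∀ m y W → 2 ℕ.* (m ℕ.* (y ℕ.* (W ℕ.* W))) ≡ m ℕ.* y ℕ.* (2 ℕ.* (W ℕ.* W))
    regroup = solve-∀

  factor-Val : ∀ k → Val (+ slope k) (factor (suc k))
  -- For j = k + 1 the number 8j - 1 is 2 (3 + 4k) + 1.
  factor-Val k = factor-Val′ (+ slope k) (suc k) (suc (2 ℕ.* (3 ℕ.+ 4 ℕ.* k)) ℕ.∸ 1) (lemma k) (3 ℕ.+ 4 ℕ.* k , refl)
    (subst (Val (+ slope k)) (sym (trans (ι-ℕ* 2 (triple (suc k) ℕ.* triple (suc k))) (cong (ι (+ 2) ℚ.*_) (ι-ℕ* (triple (suc k)) (triple (suc k)))))) (Val-slope k))
    where
    open import Data.Nat.Tactic.RingSolver using (solve-∀)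
    lemma : ∀ k → 8 ℕ.* suc k ≡ suc (suc (2 ℕ.* (3 ℕ.+ 4 ℕ.* k)))
    lemma = solve-∀

-- The factorisation in the form required by the determinant estimate.

module TriangularFactorisation (R : CommutativeRing 0ℓ 0ℓ) (reciprocals : RationalAlgebra.Reciprocals R) where
  open import Data.Integer.Base using (+_)
  open import Data.Nat.Base as ℕ using (ℕ; zero; suc; _<_; _≤_)
  open import Data.Nat.Properties as ℕ using ()
  open import Data.Product.Base using (∃₂; _×_; _,_)
  open import Relation.Binary.PropositionalEquality as ≡ using ()
  open CommutativeRing R hiding (zero)
  open IntegerCoefficients R
  open FiniteSums R
  open Factorials using (Odd)
  open Factorisation R reciprocals
  open Hypergeometric R reciprocals using (ι-ℕ*)
  open RationalAlgebra.Reciprocals reciprocals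
  open HauptmodulU using (column)
  open import Relation.Binary.Reasoning.Setoid setoid

  ∑-truncate : ∀ d m (t : ℕ → Carrier) → (∀ k → m ≤ k → t k ≈ 0#) → ∑ (d ℕ.+ m) t ≈ ∑ m t
  ∑-truncate zero    m t v = refl
  ∑-truncate (suc d) m t v = trans (+-cong (∑-truncate d m t v) (v (d ℕ.+ m) (ℕ.m≤n+m m d))) (+-identityʳ _)

  column≈ : ∀ i j → ι (column (suc j) (suc i)) ≈ ∑ i (λ k → A i k * (D k * B k j)) + D i * B i j
  column≈ i j = begin
    ι (column (suc j) (suc i))
      -- The range has to exceed both i and j. In the form `j + suc i` it can be cut at `suc i`,
      -- beyond which A i k = 0.
      ≈⟨ column≈ADB (j ℕ.+ suc i) i j (ℕ.m≤n+m (suc i) j) (ℕ.m<m+n j (ℕ.s≤s ℕ.z≤n)) ⟩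
    ∑ (j ℕ.+ suc i) (λ k → A i k * (D k * B k j))
      ≈⟨ ∑-truncate j (suc i) _ (λ k i<k → trans (*-congʳ (A-upper i<k)) (zeroˡ _)) ⟩
    ∑ i (λ k → A i k * (D k * B k j)) + A i i * (D i * B i j)
      ≈⟨ +-congˡ (trans (*-congʳ (A-diagonal i)) (*-identityˡ _)) ⟩
    ∑ i (λ k → A i k * (D k * B k j)) + D i * B i j ∎

  A-below : ∀ i k → k < i → ∃₂ λ o z → Odd o × A i k * ι (+ o) ≈ ι (+ 2) * ι (+ z)
  A-below i k k<i with ℕ.m≤n⇒∃[o]m+o≡n k<i
  ... | r , ≡.refl with A-lower k r
  ...   | o , z , o-odd , e = o , suc k ℕ.* z , o-odd ,
    trans (*-congʳ (reflexive (≡.cong (λ i → A i k) (≡.sym (ℕ.+-suc k r))))) (trans e (*-congˡ (sym (ι-ℕ* (suc k) z))))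

  B-diagonal : ∀ k → B k k ≈ 1#
  B-diagonal k = trans (*-congˡ (A-diagonal k)) (trans (*-identityʳ _) (ι*inv k))

  B-below : ∀ {k j} → j < k → B k j ≈ 0#
  B-below j<k = trans (*-congˡ (A-upper j<k)) (zeroʳ _)

  -- The factor k obtained in `A-lower` cancels the 1/k in B, and the factor j is an integer.
  B-above : ∀ k j → k < j → ∃₂ λ o z → Odd o × B k j * ι (+ o) ≈ ι (+ 2) * ι (+ z)
  B-above k j k<j with ℕ.m≤n⇒∃[o]m+o≡n k<j
  ... | r , ≡.refl with A-lower k r
  ...   | o , z , o-odd , e = o , suc (suc (k ℕ.+ r)) ℕ.* z , o-odd , (begin
    J * inv k * A (suc (k ℕ.+ r)) k * ι (+ o)
      ≈⟨ trans (*-assoc _ _ _) (*-congˡ (trans (*-congʳ (reflexive (≡.cong (λ i → A i k) (≡.sym (ℕ.+-suc k r))))) e)) ⟩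
    J * inv k * (ι (+ 2) * (ι (+ suc k) * ι (+ z)))
      ≈⟨ solve 5 (λ J n t K z → J :* n :* (t :* (K :* z)) := (K :* n) :* (t :* (J :* z))) refl J (inv k) (ι (+ 2)) (ι (+ suc k)) (ι (+ z)) ⟩
    (ι (+ suc k) * inv k) * (ι (+ 2) * (J * ι (+ z)))
      ≈⟨ trans (*-congʳ (ι*inv k)) (*-identityˡ _) ⟩
    ι (+ 2) * (J * ι (+ z))
      ≈⟨ *-congˡ (ι-ℕ* (suc (suc (k ℕ.+ r))) z) ⟨
    ι (+ 2) * ι (+ (suc (suc (k ℕ.+ r)) ℕ.* z)) ∎)
    where J = ι (+ suc (suc (k ℕ.+ r)))

-- Uniqueness of coefficients in a triangular system.

module TriangularUniqueness (R : CommutativeRing 0ℓ 0ℓ) where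
  open import Data.Bool.Base using (if_then_else_)
  open import Data.Nat.Base as ℕ using (ℕ; suc; _<_; _≤_)
  open import Data.Nat.Induction using (<-rec)
  open import Data.Nat.Properties as ℕ using ()
  open import Data.Product.Base using (∃; _,_)
  open import Relation.Binary.PropositionalEquality as ≡ using ()
  open import Relation.Nullary.Decidable using (does; yes; no; dec-true; dec-false)
  open CommutativeRing R hiding (zero)
  open FiniteSums R
  open Endomorphisms R using (cancel-unit)
  open IntegerCoefficients R using (solve; _:+_; _:*_; _:-_; :-_; _:=_)

  -- Equation n involves only unknowns of index below n. In equation i + 1 the unknown x i comes
  -- last and has an invertible coefficient, so strong induction applies.
  triangular-zero : (x : ℕ → Carrier) (G : ℕ → ℕ → Carrier) → (∀ i → ∃ λ y → y * G i (suc i) ≈ 1#) →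
    (∀ n → ∑ n (λ i → x i * G i n) ≈ 0#) → ∀ i → x i ≈ 0#
  triangular-zero x G unit h = <-rec _ λ i rec → let y , e = unit i in cancel-unit {y} {G i (suc i)} e (trans (*-comm _ _)
    (trans (sym (+-identityˡ _)) (trans (+-congʳ (sym (∑-0 i λ k k<i → trans (*-congʳ (rec k<i)) (zeroˡ _)))) (trans (h (suc i)) (sym (zeroʳ _))))))

  triangular-unique : (x y : ℕ → Carrier) (G : ℕ → ℕ → Carrier) → (∀ i → ∃ λ y → y * G i (suc i) ≈ 1#) →
    (∀ n → ∑ n (λ i → x i * G i n) ≈ ∑ n (λ i → y i * G i n)) → ∀ i → x i ≈ y i
  triangular-unique x y G unit h i = trans (solve 2 (λ x y → x := (x :- y) :+ y) refl (x i) (y i)) (trans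
    (+-congʳ (triangular-zero (λ i → x i - y i) G unit (λ n → trans
      (∑-cong n λ i _ → solve 3 (λ a b g → (a :- b) :* g := a :* g :+ (:- (b :* g))) refl (x i) (y i) (G i n))
      (trans (∑-+ n _ _) (trans (+-cong (h n) (∑-neg n _)) (-‿inverseʳ _)))) i)) (+-identityˡ _))

  ∑-basis-≥ : ∀ n j (t : ℕ → Carrier) → n ≤ j → ∑ n (λ i → (if does (i ℕ.≟ j) then 1# else 0#) * t i) ≈ 0#
  ∑-basis-≥ n j t n≤j = ∑-0 n λ i i<n → trans (*-congʳ (reflexive (≡.cong (λ b → if b then 1# else 0#) (dec-false (i ℕ.≟ j) (ℕ.<⇒≢ (ℕ.<-≤-trans i<n n≤j)))))) (zeroˡ _)

  ∑-basis-< : ∀ n j (t : ℕ → Carrier) → j < n → ∑ n (λ i → (if does (i ℕ.≟ j) then 1# else 0#) * t i) ≈ t j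
  ∑-basis-< (suc n) j t j<1+n with n ℕ.≟ j
  ... | yes ≡.refl = trans (+-cong (∑-basis-≥ n n t ℕ.≤-refl) (trans (*-congʳ (reflexive (≡.cong (λ b → if b then 1# else 0#) (dec-true (n ℕ.≟ n) ≡.refl)))) (*-identityˡ _))) (+-identityˡ _)
  ... | no n≢j     = trans (+-cong (∑-basis-< n j t (ℕ.≤∧≢⇒< (ℕ.≤-pred j<1+n) (λ j≡n → n≢j (≡.sym j≡n))))
      (trans (*-congʳ (reflexive (≡.cong (λ b → if b then 1# else 0#) (dec-false (n ℕ.≟ j) n≢j)))) (zeroˡ _))) (+-identityʳ _)

-- The Fredholm series and Newton polygons.

module FredholmSeries where
  open import Data.Integer.Base as ℤ using (ℤ; +_; 1ℤ)
  open import Data.Integer.Properties as ℤ using ()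
  open import Data.Nat.Base as ℕ using (ℕ; _<_; _≤_)
  open import Data.Nat.Properties as ℕ using ()
  open import Data.Product.Base using (_,_)
  open import Defs using (ValuedRing; module Banach; i≤+∣i∣; module NewtonPolygon)
  open CharacteristicSeries using (weight; δ; truncated-leading)
  open import Function.Bundles using (mk⇔)
  open import Relation.Binary.Definitions using (tri<; tri≈; tri>)
  open import Relation.Nullary.Negation.Core using (contradiction)
  open import Relation.Binary.PropositionalEquality as ≡ using (_≡_)

  module _ (K : ValuedRing) (complete : ValuedRing.IsComplete K) where
    open ValuedRing K hiding (zero; sum)
    open Banach K complete
    open FiniteSums commutativeRing using (∑; ∏)
    open NewtonPolygon K

    -- The estimate holds for every truncation of size at least n with one and the same bound, and
    -- far enough out a truncation agrees with the limit to that precision.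
    fredholm-leading : (U : CompactOperator) (A B : ℕ → ℕ → Carrier) (D : ℕ → Carrier) (s : ℕ → ℤ) →
      (∀ i j → CompactOperator.matrix U i j ≈ ∑ i (λ k → A i k * (D k * B k j)) + D i * B i j) →
      (∀ i k → k < i → 1ℤ ≤v A i k) → (∀ i j → Close 1ℤ (B i j) (δ K complete i j)) → (∀ k → s k ≤v D k) →
      ∀ n T → (∀ k → k < n → s k ℤ.+ 1ℤ ℤ.≤ T) → (∀ k → n ≤ k → T ℤ.+ 1ℤ ℤ.≤ s k) →
      Close (weight K complete n s ℤ.+ 1ℤ) (fredholm U n) (∏ n (λ k → - D k))
    fredholm-leading U A B D s u≈ A-even B-close D-val n T below above =
      -- Limits are available to natural precision only; the absolute value of k is such a precision
      -- and at least k.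
      let k = weight K complete n s ℤ.+ 1ℤ ; N , limit = fredholm-limit U n ℤ.∣ k ∣ in
      Close-trans (Close-sym (Close-mono (i≤+∣i∣ k) (limit (N ℕ.+ n) (ℕ.m≤m+n N n))))
        (truncated-leading K complete (CompactOperator.matrix U) A B D s u≈ A-even B-close D-val n T below above N)

    HasValuation-close : ∀ {k x y} → Close (k ℤ.+ 1ℤ) x y → HasValuation y k → HasValuation x k
    HasValuation-close {k} {x} {y} c (v , ¬v) =
      v-close (Close-mono (≡.subst (ℤ._≤ k ℤ.+ 1ℤ) (ℤ.+-identityʳ k) (ℤ.+-monoʳ-≤ k (ℤ.+≤+ ℕ.z≤n))) c) v ,
      λ w → ¬v (v-close (≡.subst (λ l → Close l y x) (ℤ.+-comm k 1ℤ) (Close-sym c)) w)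

    HasValuation-unique : ∀ {k l x} → HasValuation x k → HasValuation x l → k ≡ l
    HasValuation-unique {k} {l} (v , ¬v) (w , ¬w) with ℤ.<-cmp k l
    ... | tri< k<l _ _ = contradiction (v-mono (ℤ.i<j⇒suc[i]≤j k<l) w) ¬v
    ... | tri≈ _ k≡l _ = k≡l
    ... | tri> _ _ l<k = contradiction (v-mono (ℤ.i<j⇒suc[i]≤j l<k) v) ¬w

    OnOrAbove-map : ∀ {c d} → (∀ n k → HasValuation (c n) k → HasValuation (d n) k) → ∀ {x y} → OnOrAbove c x y → OnOrAbove d x y
    OnOrAbove-map h (ray {n} {k} v k≤y)     = ray (h n k v) k≤y
    OnOrAbove-map h (convex 0≤t t≤1 p p′)   = convex 0≤t t≤1 (OnOrAbove-map h p) (OnOrAbove-map h p′)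

    -- `OnOrAbove` depends on a series only through `HasValuation` of its coefficients, and
    -- valuations are unique.
    same-polygon : ∀ {c d} (S : ℕ → ℤ) → (∀ n → HasValuation (c n) (S n)) → (∀ n → HasValuation (d n) (S n)) → SameNewtonPolygon c d
    same-polygon S vc vd x y = mk⇔
      (OnOrAbove-map λ n k v → ≡.subst (HasValuation _) (HasValuation-unique (vc n) v) (vd n))
      (OnOrAbove-map λ n k v → ≡.subst (HasValuation _) (HasValuation-unique (vd n) v) (vc n))

-- Specialisation to U on weight zero forms over ℚ₂.

module WeightZeroSlopes where
  open import Data.Integer.Base as ℤ using (ℤ; +_; 0ℤ; 1ℤ)
  open import Data.Integer.Properties as ℤ using ()
  open import Data.Nat.Base as ℕ using (ℕ; zero; suc; _<_; _≤_)
  open import Data.Nat.Properties as ℕ using ()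
  open import Data.Product.Base using (∃; _,_)
  open import Data.Rational.Base as ℚ using (ℚ; 1ℚ)
  open import Data.Rational.Literals using (fromℤ)
  open import Data.Rational.Properties as ℚ using ()
  open import Data.Bool.Base using (if_then_else_)
  open import Data.Sum.Base using (inj₁; inj₂; [_,_]′)
  open import Relation.Nullary.Decidable using (dec-true; dec-false)
  open import Relation.Binary.Definitions using (tri<; tri≈; tri>)
  open import Relation.Binary.PropositionalEquality as ≡ using (_≡_)
  open import Defs hiding (factor)
  open Completion ℚ-valued using (≈⇒≈^)
  open ℚ-Valuation using (_≤vℚ_)
  open IntegerCoefficients ℚ.+-*-commutativeRing using (ι)
  open DyadicValuations
  open Factorials using (Odd; odd-!; odd-!-odd)
  open Factorisation ℚ.+-*-commutativeRing reciprocals using (A; B; D; D-valuation)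
  open TriangularFactorisation ℚ.+-*-commutativeRing reciprocals
  open HauptmodulU using (column; U-column; g^-leading; g^-vanishing)
  open ValuedRing ℚ₂-valued using (commutativeRing; _≈_; _+_; _*_; -_; _-_; 0#; 1#; Close; Close-≈; Close-0; v-resp; refl; sym; trans; +-cong; +-congʳ; *-cong; *-congˡ)
    renaming (_≤v_ to _≤v₂_)
  open FiniteSums commutativeRing
  open IntegerCoefficients commutativeRing using (_:*_; _:=_)
  private
    module ∑ℚ = FiniteSums ℚ.+-*-commutativeRing
    module ∑ℤ = FiniteSums ℤ.+-*-commutativeRing

  κ : ℚ → ℚ₂
  κ = ℚ⇒ℚ₂

  κ-+ : ∀ x y → κ (x ℚ.+ y) ≈ κ x + κ y
  κ-+ x y = ≈⇒≈^ λ _ → ≡.refl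

  κ-* : ∀ x y → κ (x ℚ.* y) ≈ κ x * κ y
  κ-* x y = ≈⇒≈^ λ _ → ≡.refl

  κ-neg : ∀ x → κ (ℚ.- x) ≈ - κ x
  κ-neg x = ≈⇒≈^ λ _ → ≡.refl

  κ-≡ : ∀ {x y} → x ≡ y → κ x ≈ κ y
  κ-≡ e = ≈⇒≈^ λ _ → e

  κ-∑ : ∀ n (t : ℕ → ℚ) → κ (∑ℚ.∑ n t) ≈ ∑ n (λ i → κ (t i))
  κ-∑ zero    t = refl
  κ-∑ (suc n) t = trans (κ-+ (∑ℚ.∑ n t) (t n)) (+-congʳ (κ-∑ n t))

  κ-∏-neg : ∀ n (t : ℕ → ℚ) → κ (∑ℚ.∏ n (λ i → ℚ.- t i)) ≈ ∏ n (λ i → - κ (t i))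
  κ-∏-neg zero    t = refl
  κ-∏-neg (suc n) t = trans (κ-* (∑ℚ.∏ n (λ i → ℚ.- t i)) (ℚ.- t n)) (*-cong (κ-∏-neg n t) (κ-neg (t n)))

  κ-≤v : ∀ {k x} → k ≤vℚ x → k ≤v₂ κ x
  κ-≤v v = 0 , λ _ _ → v

  -- A bound in the completion holds from some index on; for a constant sequence it can be inspected
  -- at that index and refuted in ℚ.
  HasValuation-κ : ∀ {k x} → Val k x → HasValuation (κ x) k
  HasValuation-κ v = κ-≤v (Val⇒≤v v) , λ { (N , h) → Val⇒≰v v (h N ℕ.≤-refl) }

  G : ℕ → ℕ → ℚ₂
  G i n = κ (fromℤ ((ℤ[[q]].g ℤ[[q]].^ suc i) n))

  fromℤ-∑ : ∀ n (t : ℕ → ℤ) → κ (fromℤ (∑ℤ.∑ n t)) ≈ ∑ n (λ i → κ (fromℤ (t i)))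
  fromℤ-∑ zero    t = refl
  fromℤ-∑ (suc n) t = trans (trans (κ-≡ (ℚ-Valuation.fromℤ-+ (∑ℤ.∑ n t) (t n))) (κ-+ (fromℤ (∑ℤ.∑ n t)) (fromℤ (t n)))) (+-congʳ (fromℤ-∑ n t))

  power-unit : ∀ n → ∃ λ y → y ℚ.* fromℤ ((+ 64) ℤ.^ n) ≡ 1ℚ
  power-unit zero    = 1ℚ , ≡.refl
  power-unit (suc n) = let y , e = power-unit n in inv₆₄ ℚ.* y , (begin
    (inv₆₄ ℚ.* y) ℚ.* fromℤ (+ 64 ℤ.* (+ 64) ℤ.^ n)           ≡⟨ ≡.cong ((inv₆₄ ℚ.* y) ℚ.*_) (ℚ-Valuation.fromℤ-* (+ 64) ((+ 64) ℤ.^ n)) ⟩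
    (inv₆₄ ℚ.* y) ℚ.* (fromℤ (+ 64) ℚ.* fromℤ ((+ 64) ℤ.^ n)) ≡⟨ S.solve 4 (λ a b c d → (a S.:* b) S.:* (c S.:* d) S.:= (a S.:* c) S.:* (b S.:* d)) ≡.refl inv₆₄ y (fromℤ (+ 64)) (fromℤ ((+ 64) ℤ.^ n)) ⟩
    (inv₆₄ ℚ.* fromℤ (+ 64)) ℚ.* (y ℚ.* fromℤ ((+ 64) ℤ.^ n)) ≡⟨ ≡.cong₂ ℚ._*_ (ℚ.*-inverseˡ (fromℤ (+ 64))) e ⟩
    1ℚ ∎)
    where
    open ≡.≡-Reasoning
    module S = IntegerCoefficients ℚ.+-*-commutativeRing
    inv₆₄ = ℚ.1/ fromℤ (+ 64)

  G-unit : ∀ i → ∃ λ y → y * G i (suc i) ≈ 1#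
  G-unit i = let y , e = power-unit (suc i) in κ y , trans (sym (κ-* y _)) (κ-≡ (≡.trans (≡.cong (λ z → y ℚ.* fromℤ z) (g^-leading (suc i))) e))

  qExpansion≈ : ∀ s n → qExpansion s n ≈ ∑ n (λ i → coef s i * G i n)
  qExpansion≈ s n = sum-∑ n (λ i → coef s i * G i n)

  U-g : ∀ j n → G j (2 ℕ.* n) ≈ ∑ n (λ i → κ (ι (column (suc j) (suc i))) * G i n)
  U-g j n = trans (κ-≡ (≡.cong fromℤ (U-column j n))) (trans (fromℤ-∑ n (λ i → column (suc j) (suc i) ℤ.* (ℤ[[q]].g ℤ[[q]].^ suc i) n))
    (∑-cong n λ i _ → entry (column (suc j) (suc i)) ((ℤ[[q]].g ℤ[[q]].^ suc i) n)))
    where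
    entry : ∀ c z → κ (fromℤ (c ℤ.* z)) ≈ κ (ι c) * κ (fromℤ z)
    entry c z = trans (κ-≡ (≡.trans (ℚ-Valuation.fromℤ-* c z) (≡.cong (ℚ._* fromℤ z) (≡.sym (ι≡fromℤ c))))) (κ-* (ι c) (fromℤ z))

  q-basis : ∀ j n → qExpansion (ℚ₂-Banach.basis j) n ≈ G j n
  q-basis j n = trans (qExpansion≈ (ℚ₂-Banach.basis j) n) ([ TriangularUniqueness.∑-basis-< commutativeRing n j (λ i → G i n) , beyond ]′ (ℕ.<-≤-connex j n))
    where
    beyond : n ≤ j → ∑ n (λ i → coef (ℚ₂-Banach.basis j) i * G i n) ≈ G j n
    beyond n≤j = trans (TriangularUniqueness.∑-basis-≥ commutativeRing n j (λ i → G i n) n≤j) (κ-≡ (≡.cong fromℤ (≡.sym (g^-vanishing (ℕ.s≤s n≤j)))))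

  -- `IsU` prescribes only q-expansions. Column j of the matrix lists the coordinates of U g^(j+1),
  -- and by triangularity these are determined by its q-expansion.
  matrix≈column : (U : CompactOperator) → IsU U → ∀ i j → ℚ₂-Banach.CompactOperator.matrix U i j ≈ κ (ι (column (suc j) (suc i)))
  matrix≈column U isU i j = TriangularUniqueness.triangular-unique commutativeRing
    (λ i → ℚ₂-Banach.CompactOperator.matrix U i j) (λ i → κ (ι (column (suc j) (suc i)))) G G-unit
    (λ n → trans (sym (qExpansion≈ (ℚ₂-Banach.CompactOperator.apply U (ℚ₂-Banach.basis j)) n))
      (trans (isU (ℚ₂-Banach.basis j) n) (trans (q-basis j (2 ℕ.* n)) (U-g j n)))) i

  even-from : ∀ {x o z} → Odd o → x ℚ.* ι (+ o) ≡ ι (+ 2) ℚ.* ι (+ z) → 1ℤ ≤vℚ x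
  even-from {x} {z = z} (m , ≡.refl) e = ℚ-Valuation.mk≤vℚ (+ z) (+ m) (≡.trans
    (≡.cong (x ℚ.*_) (≡.trans (≡.cong fromℤ (≡.sym (+odd m))) (≡.sym (ι≡fromℤ (+ suc (2 ℕ.* m))))))
    (≡.trans e (≡.cong (ι (+ 2) ℚ.*_) (ι≡fromℤ (+ z)))))

  A-even : ∀ i k → k < i → 1ℤ ≤v₂ κ (A i k)
  A-even i k k<i = let o , z , o-odd , e = A-below i k k<i in κ-≤v (even-from {A i k} {o} {z} o-odd e)

  B-close : ∀ i j → Close 1ℤ (κ (B i j)) (CharacteristicSeries.δ ℚ₂-valued ℚ₂-complete i j)
  B-close i j with ℕ.<-cmp i j
  ... | tri< i<j i≢j _ = ≡.subst (λ b → Close 1ℤ (κ (B i j)) (if b then 1# else 0#)) (≡.sym (dec-false (i ℕ.≟ j) i≢j))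
    (let o , z , o-odd , e = B-above i j i<j in Close-0 {1ℤ} {κ (B i j)} (κ-≤v (even-from {B i j} {o} {z} o-odd e)))
  ... | tri≈ _ ≡.refl _ = ≡.subst (λ b → Close 1ℤ (κ (B i i)) (if b then 1# else 0#)) (≡.sym (dec-true (i ℕ.≟ i) ≡.refl)) (Close-≈ {1ℤ} {κ (B i i)} {1#} (κ-≡ (B-diagonal i)))
  ... | tri> _ i≢j j<i = ≡.subst (λ b → Close 1ℤ (κ (B i j)) (if b then 1# else 0#)) (≡.sym (dec-false (i ℕ.≟ j) i≢j)) (Close-≈ {1ℤ} {κ (B i j)} {0#} (κ-≡ (B-below j<i)))

  D-Val : ∀ k → Val (+ slope k) (D k)
  D-Val k = Val-cancel (Val-odd (Factorials.odd-* {3} (1 , ≡.refl) (Factorials.odd-* oo oo))) (≡.subst (Val (+ slope k)) (≡.sym (D-valuation k)) (Val-slope k))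
    where
    oo : Odd (odd-! (suc k) ℕ.* odd-! (suc k))
    oo = Factorials.odd-* (odd-!-odd (suc k)) (odd-!-odd (suc k))

  slope-mono : ∀ {m n} → m ≤ n → slope m ≤ slope n
  slope-mono {m} {zero}  ℕ.z≤n = ℕ.≤-refl
  slope-mono {m} {suc n} m≤1+n with ℕ.m≤n⇒m<n∨m≡n m≤1+n
  ... | inj₂ ≡.refl      = ℕ.≤-refl
  ... | inj₁ (ℕ.s≤s m≤n) = ℕ.≤-trans (slope-mono m≤n) (ℕ.≤-trans (ℕ.m≤n⇒m≤1+n (ℕ.n≤1+n (slope n))) (slope-gap n))

  valuation : ℕ → ℤ
  valuation n = ∑ℤ.∑ n (λ k → + slope k)

  ∏D-Val : ∀ n → Val (valuation n) (∑ℚ.∏ n (λ k → ℚ.- D k))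
  ∏D-Val zero    = exact 0ℤ ≡.refl
  ∏D-Val (suc n) = Val-* (∏D-Val n) (Val-neg (D-Val n))

  explicit-Val : ∀ n → Val (valuation n) (explicitSeries n)
  explicit-Val zero    = exact 0ℤ ≡.refl
  explicit-Val (suc n) = Val-* (explicit-Val n) (factor-Val n)

  fredholm-valuation : (U : CompactOperator) → IsU U → ∀ n → HasValuation (fredholm U n) (valuation n)
  fredholm-valuation U isU n = FredholmSeries.HasValuation-close ℚ₂-valued ℚ₂-complete {valuation n} {fredholm U n} {∏ n (λ k → - κ (D k))}
      (FredholmSeries.fredholm-leading ℚ₂-valued ℚ₂-complete U (λ i k → κ (A i k)) (λ k j → κ (B k j)) (λ k → κ (D k)) (λ k → + slope k)
        -- T is one less than slope n: `slope-gap` keeps the earlier slopes at most T - 1, and T + 1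
        -- is slope n because every slope is a successor.
        matrix-split A-even B-close (λ k → κ-≤v (Val⇒≤v (D-Val k))) n (+ ℕ.pred (slope n)) below above)
      (resp (κ-∏-neg n D) (HasValuation-κ (∏D-Val n)))
    where
    resp : ∀ {k x y} → x ≈ y → HasValuation x k → HasValuation y k
    resp {k} {x} {y} e (v , ¬v) = v-resp {k} {x} {y} e v , λ w → ¬v (v-resp {ℤ.suc k} {y} {x} (sym e) w)

    matrix-split : ∀ i j → ℚ₂-Banach.CompactOperator.matrix U i j ≈ ∑ i (λ k → κ (A i k) * (κ (D k) * κ (B k j))) + κ (D i) * κ (B i j)
    matrix-split i j = trans (matrix≈column U isU i j) (trans (κ-≡ (column≈ i j)) (trans (κ-+ _ _) (+-cong
      (trans (κ-∑ i _) (∑-cong i λ k _ → trans (κ-* _ _) (*-congˡ (κ-* _ _)))) (κ-* _ _))))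

    below : ∀ k → k < n → + slope k ℤ.+ 1ℤ ℤ.≤ + ℕ.pred (slope n)
    below k k<n = ℤ.+≤+ (≡.subst (ℕ._≤ ℕ.pred (slope n)) (ℕ.+-comm 1 (slope k)) (ℕ.≤-pred (ℕ.≤-trans (slope-gap k) (slope-mono k<n))))

    above : ∀ k → n ≤ k → + ℕ.pred (slope n) ℤ.+ 1ℤ ℤ.≤ + slope k
    above k n≤k = ℤ.+≤+ (≡.subst (ℕ._≤ slope k) (ℕ.+-comm 1 (ℕ.pred (slope n))) (slope-mono n≤k))

open import Defs
open import Function.Base using (_∘_)

theorem1 : (U : CompactOperator) → IsU U → SameNewtonPolygon (fredholm U) (ℚ⇒ℚ₂ ∘ explicitSeries)
theorem1 U isU = FredholmSeries.same-polygon ℚ₂-valued ℚ₂-complete WeightZeroSlopes.valuation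
  (WeightZeroSlopes.fredholm-valuation U isU) (λ n → WeightZeroSlopes.HasValuation-κ (WeightZeroSlopes.explicit-Val n))
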